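{- Let $n$ be a positive integer and write $8n+15=3^{\beta}n_1$ with $n_1$ a positive integer and $3\nmid n_1$. Then $$t(1,1,1,12;n)=\frac 12\Big(3^{\beta+1}\Big(\frac 3{n_1}\Big)+1\Big)\sum_{d\mid n_1}d\Big(\frac 3d\Big)+3\sum_{\substack{a,b\in\mathbb N,\ 2\nmid a\\ 4(8n+15)=a^2+3b^2}}(-1)^{\frac{b-1}2}b,$$ where $d$ runs over positive divisors of $n_1$.
   Context: $\mathbb N$ is the set of positive integers and $\left(\frac{a}{m}\right)$ is the Legendre–Jacobi–Kronecker symbol. For positive integers $a,b,c,d$ and a nonnegative integer $n$, $t(a,b,c,d;n)$ denotes the number of $(x,y,z,w)\in\mathbb Z^4$ with $n=a\frac{x(x-1)}2+b\frac{y(y-1)}2+c\frac{z(z-1)}2+d\frac{w(w-1)}2$. -}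

module Defs where

open import Data.Nat as ℕ using (ℕ; zero; suc; _%_; _/_)
open import Data.Nat.Divisibility using (_∣?_)
open import Data.Integer as ℤ using (ℤ; +_; -1ℤ; 0ℤ; 1ℤ)
open import Data.Integer.DivMod using (_/ℕ_)
open import Data.Fin using (Fin; toℕ)
open import Data.Fin.Properties using (any?)
open import Data.List using (List; foldr; map; filter; applyUpTo; cartesianProduct)
open import Data.Product using (Σ-syntax; _×_; _,_)
open import Data.Bool using (if_then_else_)
open import Relation.Nullary using (does)
open import Relation.Nullary.Decidable using (_×-dec_)
open import Relation.Binary.PropositionalEquality using (_≡_)
open import Data.Nat.Primality.Factorisation using (factorise; factors)
open import Function.Bundles using (_↔_)

sumℤ : List ℤ → ℤ
sumℤ = foldr ℤ._+_ 0ℤ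

prodℤ : List ℤ → ℤ
prodℤ = foldr ℤ._*_ 1ℤ

-- triangular-type number x(x-1)/2 for x ∈ ℤ (exact: x(x-1) is even)
tri : ℤ → ℤ
tri x = (x ℤ.* (x ℤ.- 1ℤ)) /ℕ 2

Sol : ℕ → ℕ → ℕ → ℕ → ℕ → Set
Sol a b c d n =
  Σ[ v ∈ ℤ × ℤ × ℤ × ℤ ]
    (let (x , y , z , w) = v in
     + n ≡ + a ℤ.* tri x ℤ.+ + b ℤ.* tri y ℤ.+ + c ℤ.* tri z ℤ.+ + d ℤ.* tri w)

tIs : ℕ → ℕ → ℕ → ℕ → ℕ → ℕ → Set
tIs a b c d n k = Sol a b c d n ↔ Fin k

-- Legendre symbol (a/p) for a prime p (p odd: 0 if p ∣ a, 1 if a is a nonzero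
-- square mod p, -1 otherwise); for p = 2 the Kronecker convention
-- (a/2) = 0 (a even), 1 (a ≡ ±1 mod 8), -1 (a ≡ ±3 mod 8).
legendre : ℕ → ℕ → ℤ
legendre a zero = 0ℤ
legendre a (suc zero) = 1ℤ
legendre a (suc (suc zero)) =
  if does (a % 8 ℕ.≟ 1) then 1ℤ else
  if does (a % 8 ℕ.≟ 7) then 1ℤ else
  if does (a % 8 ℕ.≟ 3) then -1ℤ else
  if does (a % 8 ℕ.≟ 5) then -1ℤ else 0ℤ
legendre a p@(suc (suc (suc q))) =
  if does (a % p ℕ.≟ 0) then 0ℤ else
  if does (any? (λ (x : Fin p) → (toℕ x ℕ.* toℕ x) % p ℕ.≟ a % p)) then 1ℤ else -1ℤ

jacobi : ℕ → ℕ → ℤ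
jacobi a zero = if does (a ℕ.≟ 1) then 1ℤ else 0ℤ
jacobi a (suc m) = prodℤ (map (legendre a) (factors (factorise (suc m))))

divisorSum : ℕ → ℤ
divisorSum m = sumℤ (map (λ d → + d ℤ.* jacobi 3 d) (filter (_∣? m) (applyUpTo suc m)))

-- Σ_{a,b ∈ ℕ, 2 ∤ a, M = a² + 3 b²} (-1)^((b-1)/2) b ; any such a,b satisfy
-- 1 ≤ a,b ≤ M, so enumerating [1..M]² is exhaustive.
repSum : ℕ → ℤ
repSum M = sumℤ (map (λ { (a , b) → (-1ℤ ℤ.^ ((b ℕ.∸ 1) / 2)) ℤ.* + b })
  (filter (λ { (a , b) → (a % 2 ℕ.≟ 1) ×-dec (a ℕ.* a ℕ.+ 3 ℕ.* (b ℕ.* b) ℕ.≟ M) })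
    (cartesianProduct (applyUpTo suc M) (applyUpTo suc M))))

{-# OPTIONS --safe #-}

-- Put N = 8n + 15 and write θ_m, φ_m for the sums of q^(m x²) over the odd and over all integers x, φ⁻_m for the
-- alternating φ_m, and J_m for the sum of χ₄(x) x q^(m x²) over the odd x. Completing squares, t(1,1,1,12;n) is
-- the coefficient of q^N in θ₁³θ₁₂.
--
-- Lattice decompositions of products of two theta series relate a series identity to its own dilate under q ↦ q²;
-- the difference of the two sides then vanishes to arbitrarily high order. In this way θ₃θ₄(2φ₈² + φ⁻₈²) = θ₁³θ₁₂
-- + 3θ₄J₃. For exponents 7 modulo 8 the left-hand side plus θ₁³θ₁₂ equals φ₂²(θ₁φ₁₂ + φ₄θ₃), and both factors are
-- divisor sums, for χ₄ and χ₃, by the formulas for the representations by x² + y² and x² + xy + y². Since θ₄J₃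
-- contributes -2 times the sum over 4N = a² + 3b², what remains is s(N) + 4 S(N), where s(N) = Σ_{a|N} χ₃(a) and
-- S(N) = Σ_{ab+2ce=N} χ₃(a)χ₄(c).
--
-- Liouville's elementary identity for Σ_{ab+cd=N} F(a-d, b+c) - F(a+d, b-c), applied to F(x, y) = χ₁₂(x) g(y) for
-- two choices of g, supported on the even y and on the multiples of 6, gives two linear equations which determine
-- S(n₁) for n₁ prime to 6, and a recursion from S(N) to S(3N). Finally (3/m) = χ₁₂(m) for odd m: for a prime p the
-- representations by the two binary forms make -1 and -3 squares when χ₄(p) = 1 and χ₃(p) = 1, and Fermat's theorem
-- settles the remaining classes modulo 12.
--
-- In the theta identities all exponents carry an extra factor 8, and ab + 2ce appears as ab + cd with d even.

module Submission where

open import Defs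
open import Level using (0ℓ)
open import Data.Nat as ℕ using (ℕ; zero; suc; z≤n; s≤s)
import Data.Nat.Properties as ℕₚ
open import Data.Integer as ℤ using (ℤ; +_; -[1+_]; 0ℤ; 1ℤ; -1ℤ; _+_; _*_; -_; _-_; ∣_∣; _^_)
import Data.Integer.Properties as ℤₚ
open import Data.Integer.Tactic.RingSolver using (solve-∀)
open import Data.List as List using (List; []; _∷_; _++_; map; filter; concatMap; cartesianProduct; upTo; applyUpTo; length)
open import Data.List.Membership.Propositional using (_∈_; find)
open import Data.List.Membership.Propositional.Properties using (∈-map⁺; ∈-map⁻; ∈-++⁺ˡ; ∈-++⁺ʳ; ∈-++⁻; ∈-filter⁺; ∈-filter⁻; ∈-concatMap⁺; ∈-concatMap⁻; ∈-cartesianProduct⁺; ∈-cartesianProduct⁻; ∈-upTo⁺; ∈-upTo⁻; ∈-applyUpTo⁺; ∈-applyUpTo⁻; ∈-lookup)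
open import Data.List.Membership.Propositional.Properties.WithK using (unique∧set⇒bag)
open import Data.List.Relation.Binary.BagAndSetEquality using (∼bag⇒↭)
open import Data.List.Relation.Binary.Permutation.Propositional as Perm using (_↭_)
open import Data.List.Relation.Unary.Any as Any using (here; there)
open import Data.List.Relation.Unary.All as All using (All; []; _∷_)
open import Data.List.Relation.Unary.AllPairs as AllPairs using ([]; _∷_)
open import Data.List.Relation.Unary.Unique.Propositional using (Unique)
import Data.List.Relation.Unary.Unique.Propositional.Properties as Uniq
open import Data.Product using (Σ; ∃; ∃-syntax; _×_; _,_; proj₁; proj₂)
open import Data.Sum using (_⊎_; inj₁; inj₂; [_,_]′)
open import Data.Empty using (⊥; ⊥-elim)
open import Data.Unit using (⊤; tt)
open import Function using (_∘_; id)
open import Function.Bundles using (mk⇔; _↔_; mk↔ₛ′)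
open import Relation.Nullary using (¬_; Dec; yes; no; does)
open import Relation.Nullary.Decidable using (¬?; _×-dec_; dec-true; dec-false)
open import Relation.Unary using (Decidable)
open import Relation.Binary.PropositionalEquality hiding (J)
open import Algebra.Bundles using (CommutativeRing)
open import Data.Maybe using (Maybe; just; nothing)
open import Relation.Binary.Definitions using (tri<; tri≈; tri>)
open import Algebra.Structures using (IsCommutativeRing)
import Algebra.Solver.Ring as RingSolver
open import Algebra.Solver.Ring.AlmostCommutativeRing using (fromCommutativeRing; _-Raw-AlmostCommutative⟶_)
import Data.Nat.DivMod as ℕd
open import Data.Integer.DivMod using (_/ℕ_; _%ℕ_; a≡a%ℕn+[a/ℕn]*n; n%ℕd<d)
open import Data.Bool using (Bool; true; _∧_; if_then_else_)
open import Data.Fin using (Fin; zero; suc; toℕ; fromℕ<)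
open import Data.Vec as Vec using (Vec; []; _∷_; lookup)
open import Data.Product.Properties using (,-injectiveˡ; ,-injectiveʳ)
open import Data.Nat.Tactic.RingSolver using () renaming (solve-∀ to solveℕ)
open import Data.List.Properties as Listₚ using (length-applyUpTo)
open import Data.Nat.Divisibility as ℕ∣ using (_∣_; divides; _∣?_)
open import Data.Nat.Primality using (Prime; prime⇒irreducible; euclidsLemma; ¬prime[1])
open import Data.Nat.Coprimality using (prime⇒coprime; coprime-Bézout)
open import Data.Nat.GCD using (module Bézout)
open import Data.Nat.ListAction using (product)
open import Data.Nat.ListAction.Properties using (product-↭)
open import Data.Nat.Primality.Factorisation using (factorise; factors; PrimeFactorisation)
open import Data.Fin.Properties using (any?; toℕ-fromℕ<)
open import Data.List.Relation.Unary.Any.Properties using (lookup-index)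
open import Axiom.UniquenessOfIdentityProofs using (module Decidable⇒UIP)
open import Algebra.Properties.AbelianGroup ℤₚ.+-0-abelianGroup using (∙-cancelˡ; ∙-cancelʳ)

-- Sums over the fibres of an exponent function

-- The sum over a² + 3b² cannot be absorbed into the divisor sum: `θ 32 ⊛ J 24` is a cusp form, `J`
-- being a unary theta series of weight 3/2. Vanishing is proved formally throughout: a difference
-- that is tied to its own dilate and starts late enough has to be zero. The dilation is q ↦ q²,
-- except for 4 J(3m) = E(m)³, where it is q ↦ q³. The formulas for x² + y² and x² + xy + y² both
-- come from a cancellation among the indefinite forms a x² + B x y - c y². A sign-reversing
-- involution leaves only forms whose discriminant B² + 4ac is a square, and this yields J = θ (1 +
-- 4 R₄) = E (1 + 3 R₃) with divisor series R₄ and R₃. Comparison with the product J = θ φ⁻² settles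
-- the first form. The second needs J(m) E(m)² = 2 J(3m) b₂(m), a resummation over triples of odd
-- numbers, whose two sides are then separated by the residues of the exponents. The factor 8 in the
-- exponents arises there, because odd squares differ by multiples of 8.

private variable
  A B C I J′ I₁ I₂ : Set

∑ : List A → (A → ℤ) → ℤ
∑ [] w = 0ℤ
∑ (x ∷ xs) w = w x + ∑ xs w

∑-cong : (xs : List A) {w v : A → ℤ} → (∀ {x} → x ∈ xs → w x ≡ v x) → ∑ xs w ≡ ∑ xs v
∑-cong [] h = refl
∑-cong (x ∷ xs) h = cong₂ _+_ (h (here refl)) (∑-cong xs (h ∘ there))

∑-++ : (xs ys : List A) (w : A → ℤ) → ∑ (xs ++ ys) w ≡ ∑ xs w + ∑ ys w
∑-++ [] ys w = sym (ℤₚ.+-identityˡ _)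
∑-++ (x ∷ xs) ys w = trans (cong (_+_ (w x)) (∑-++ xs ys w)) (sym (ℤₚ.+-assoc (w x) _ _))

∑-map : (f : A → B) (xs : List A) (w : B → ℤ) → ∑ (map f xs) w ≡ ∑ xs (w ∘ f)
∑-map f [] w = refl
∑-map f (x ∷ xs) w = cong (_+_ (w (f x))) (∑-map f xs w)

∑-concatMap : (f : A → List B) (xs : List A) (w : B → ℤ) →
  ∑ (concatMap f xs) w ≡ ∑ xs (λ x → ∑ (f x) w)
∑-concatMap f [] w = refl
∑-concatMap f (x ∷ xs) w = trans (∑-++ (f x) _ w) (cong (_+_ (∑ (f x) w)) (∑-concatMap f xs w))

∑-+ : (xs : List A) (w v : A → ℤ) → ∑ xs (λ x → w x + v x) ≡ ∑ xs w + ∑ xs v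
∑-+ [] w v = refl
∑-+ (x ∷ xs) w v = trans (cong (_+_ (w x + v x)) (∑-+ xs w v)) (lem (w x) (v x) _ _)
  where
  lem : ∀ a b c d → (a + b) + (c + d) ≡ (a + c) + (b + d)
  lem = solve-∀

∑-*ˡ : (c : ℤ) (xs : List A) (w : A → ℤ) → ∑ xs (λ x → c * w x) ≡ c * ∑ xs w
∑-*ˡ c [] w = sym (ℤₚ.*-zeroʳ c)
∑-*ˡ c (x ∷ xs) w = trans (cong (_+_ (c * w x)) (∑-*ˡ c xs w)) (sym (ℤₚ.*-distribˡ-+ c (w x) _))

∑-*ʳ : (c : ℤ) (xs : List A) (w : A → ℤ) → ∑ xs (λ x → w x * c) ≡ ∑ xs w * c
∑-*ʳ c xs w = trans (∑-cong xs (λ {x} _ → ℤₚ.*-comm (w x) c)) (trans (∑-*ˡ c xs w) (ℤₚ.*-comm c _))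

∑-neg : (xs : List A) (w : A → ℤ) → ∑ xs (λ x → - w x) ≡ - ∑ xs w
∑-neg [] w = refl
∑-neg (x ∷ xs) w = trans (cong (_+_ (- w x)) (∑-neg xs w)) (sym (ℤₚ.neg-distrib-+ (w x) _))

∑-0 : (xs : List A) {w : A → ℤ} → (∀ {x} → x ∈ xs → w x ≡ 0ℤ) → ∑ xs w ≡ 0ℤ
∑-0 [] h = refl
∑-0 (x ∷ xs) h = cong₂ _+_ (h (here refl)) (∑-0 xs (h ∘ there))

∑-cartesian : (xs : List A) (ys : List B) (w : A × B → ℤ) →
  ∑ (cartesianProduct xs ys) w ≡ ∑ xs (λ x → ∑ ys (λ y → w (x , y)))
∑-cartesian [] ys w = refl
∑-cartesian (x ∷ xs) ys w =
  trans (∑-++ (map (x ,_) ys) _ w) (cong₂ _+_ (∑-map (x ,_) ys w) (∑-cartesian xs ys w))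

∑-↭ : {xs ys : List A} (w : A → ℤ) → xs ↭ ys → ∑ xs w ≡ ∑ ys w
∑-↭ w Perm.refl = refl
∑-↭ w (Perm.prep x p) = cong (_+_ (w x)) (∑-↭ w p)
∑-↭ w (Perm.swap x y p) = trans (cong (λ t → w x + (w y + t)) (∑-↭ w p)) (lem (w x) (w y) _)
  where
  lem : ∀ a b c → a + (b + c) ≡ b + (a + c)
  lem = solve-∀
∑-↭ w (Perm.trans p q) = trans (∑-↭ w p) (∑-↭ w q)

∑-filter : {P : A → Set} (P? : Decidable P) (xs : List A) (w : A → ℤ) →
  ∑ xs w ≡ ∑ (filter P? xs) w + ∑ (filter (¬? ∘ P?) xs) w
∑-filter P? [] w = refl
∑-filter P? (x ∷ xs) w with P? x
... | yes _ = trans (cong (_+_ (w x)) (∑-filter P? xs w)) (sym (ℤₚ.+-assoc (w x) _ _))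
... | no _ = trans (cong (_+_ (w x)) (∑-filter P? xs w)) (lem (w x) (∑ (filter P? xs) w) (∑ (filter (¬? ∘ P?) xs) w))
  where
  lem : ∀ a b c → a + (b + c) ≡ b + (a + c)
  lem = solve-∀

unique-map : (f : A → B) (xs : List A) →
  (∀ {x y} → x ∈ xs → y ∈ xs → f x ≡ f y → x ≡ y) → Unique xs → Unique (map f xs)
unique-map f [] inj u = []
unique-map f (x ∷ xs) inj (x∉ ∷ u) =
  All.tabulate (λ z∈ eq → case (∈-map⁻ f z∈) eq) ∷ unique-map f xs (λ p q → inj (there p) (there q)) u
  where
  case : ∀ {z} → ∃ (λ y → y ∈ xs × z ≡ f y) → f x ≡ z → ⊥
  case (y , y∈ , refl) eq = All.lookup x∉ y∈ (inj (here refl) (there y∈) eq)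

-- Without repetitions and with the same members, `map f xs` and `ys` are permutations of each
-- other.
∑-bij : {xs : List A} {ys : List B} {w : A → ℤ} {v : B → ℤ} → Unique xs → Unique ys → (f : A → B) →
  (∀ {x} → x ∈ xs → f x ∈ ys) →
  (∀ {x y} → x ∈ xs → y ∈ xs → f x ≡ f y → x ≡ y) →
  (∀ {y} → y ∈ ys → ∃[ x ] (x ∈ xs × f x ≡ y)) →
  (∀ {x} → x ∈ xs → w x ≡ v (f x)) → ∑ xs w ≡ ∑ ys v
∑-bij {xs = xs} {ys} {w} {v} ux uy f into inj surj eq =
  trans (∑-cong xs eq) (trans (sym (∑-map f xs v)) (∑-↭ v (∼bag⇒↭ (unique∧set⇒bag (unique-map f xs inj ux) uy (mk⇔ to from)))))
  where
  to : ∀ {z} → z ∈ map f xs → z ∈ ys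
  to z∈ with ∈-map⁻ f z∈
  ... | x , x∈ , refl = into x∈
  from : ∀ {z} → z ∈ ys → z ∈ map f xs
  from z∈ with surj z∈
  ... | x , x∈ , refl = ∈-map⁺ f x∈

unique-concatMap : (f : A → List B) (xs : List A) → Unique xs → (∀ x → Unique (f x)) →
  (∀ {x y z} → z ∈ f x → z ∈ f y → x ≡ y) → Unique (concatMap f xs)
unique-concatMap f [] u uf dis = []
unique-concatMap f (x ∷ xs) (x∉ ∷ u) uf dis =
  Uniq.++⁺ (uf x) (unique-concatMap f xs u uf dis) λ (p , q) →
    let (y , y∈ , z∈) = find (∈-concatMap⁻ f {xs = xs} q) in All.lookup x∉ y∈ (dis p z∈)

-- An exponent function e on the part R of I with finite fibres.
record Sys (I : Set) : Set₁ where
  field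
    R : I → Set
    e : I → ℤ
    fib : ℕ → List I
    unique : ∀ n → Unique (fib n)
    sound : ∀ {i n} → i ∈ fib n → R i × e i ≡ + n
    complete : ∀ {i n} → R i → e i ≡ + n → i ∈ fib n
    natural : ∀ {i} → R i → ∃[ n ] (e i ≡ + n)

open Sys public

Ser : Set
Ser = ℕ → ℤ

-- gen S w is the series Σ w(i) q^(e i), the sum extending over the i with R i.
opaque
  gen : Sys I → (I → ℤ) → Ser
  gen S w n = ∑ (fib S n) w

  gen-def : (S : Sys I) (w : I → ℤ) → ∀ n → gen S w n ≡ ∑ (fib S n) w
  gen-def S w n = refl

infix 4 _≈_
_≈_ : Ser → Ser → Set
f ≈ g = ∀ n → f n ≡ g n

opaque
  unfolding gen

  gen-cong : (S : Sys I) {w v : I → ℤ} → (∀ i → w i ≡ v i) → gen S w ≈ gen S v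
  gen-cong S h n = ∑-cong (fib S n) (λ {i} _ → h i)

  -- `f` keeps exponents, so it restricts to a bijection of each fibre. All conditions are asked for
  -- admissible indices only; this is what permits orders and parities to be imposed by `restrict`.
  gen-bij : (S : Sys I) (T : Sys J′) {w : I → ℤ} {v : J′ → ℤ} (f : I → J′) →
    (∀ {i} → R S i → R T (f i)) → (∀ {i} → R S i → e T (f i) ≡ e S i) →
    (∀ {i i'} → R S i → R S i' → f i ≡ f i' → i ≡ i') →
    (∀ {j} → R T j → ∃[ i ] (R S i × f i ≡ j)) →
    (∀ {i} → R S i → w i ≡ v (f i)) → gen S w ≈ gen T v
  gen-bij S T f into ef inj surj eq n = ∑-bij (unique S n) (unique T n) f
    (λ i∈ → let (r , q) = sound S i∈ in complete T (into r) (trans (ef r) q))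
    (λ p q → inj (proj₁ (sound S p)) (proj₁ (sound S q)))
    (λ j∈ → let (r , q) = sound T j∈; (i , ri , fi) = surj r in
       i , complete S ri (trans (sym (ef ri)) (trans (cong (e T) fi) q)) , fi)
    (λ i∈ → eq (proj₁ (sound S i∈)))

_⊕_ : Sys I → Sys J′ → Sys (I ⊎ J′)
S ⊕ T = record
  { R = [ R S , R T ]′
  ; e = [ e S , e T ]′
  ; fib = λ n → map inj₁ (fib S n) ++ map inj₂ (fib T n)
  ; unique = λ n → Uniq.++⁺ (Uniq.map⁺ inj₁-inj (unique S n)) (Uniq.map⁺ inj₂-inj (unique T n)) disj
  ; sound = λ {i} {n} p → snd (∈-++⁻ (map inj₁ (fib S n)) p)
  ; complete = λ { {inj₁ i} {n} r q → ∈-++⁺ˡ (∈-map⁺ inj₁ (complete S r q))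
                 ; {inj₂ j} {n} r q → ∈-++⁺ʳ (map inj₁ (fib S n)) (∈-map⁺ inj₂ (complete T r q)) }
  ; natural = λ { {inj₁ i} r → natural S r ; {inj₂ j} r → natural T r } }
  where
  inj₁-inj : ∀ {x y : A} → inj₁ {B = B} x ≡ inj₁ y → x ≡ y
  inj₁-inj refl = refl
  inj₂-inj : ∀ {x y : A} → inj₂ {A = B} x ≡ inj₂ y → x ≡ y
  inj₂-inj refl = refl
  disj : ∀ {n z} → ¬ (z ∈ map inj₁ (fib S n) × z ∈ map inj₂ (fib T n))
  disj (p , q) with ∈-map⁻ inj₁ p | ∈-map⁻ inj₂ q
  ... | _ , _ , refl | _ , _ , ()
  snd : ∀ {z n} → z ∈ map inj₁ (fib S n) ⊎ z ∈ map inj₂ (fib T n) → [ R S , R T ]′ z × [ e S , e T ]′ z ≡ + n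
  snd (inj₁ p) with ∈-map⁻ inj₁ p
  ... | _ , q , refl = sound S q
  snd (inj₂ p) with ∈-map⁻ inj₂ p
  ... | _ , q , refl = sound T q

opaque
  unfolding gen

  gen-⊕ : (S : Sys I) (T : Sys J′) (w : I ⊎ J′ → ℤ) → ∀ n → gen (S ⊕ T) w n ≡ gen S (w ∘ inj₁) n + gen T (w ∘ inj₂) n
  gen-⊕ S T w n = trans (∑-++ (map inj₁ (fib S n)) _ w) (cong₂ _+_ (∑-map inj₁ (fib S n) w) (∑-map inj₂ (fib T n) w))

splits : ℕ → List (ℕ × ℕ)
splits zero = (0 , 0) ∷ []
splits (suc n) = (0 , suc n) ∷ map (λ (i , j) → suc i , j) (splits n)

∈-splits : ∀ i j → (i , j) ∈ splits (i ℕ.+ j)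
∈-splits zero zero = here refl
∈-splits zero (suc j) = here refl
∈-splits (suc i) j = there (∈-map⁺ _ (∈-splits i j))

splits-∈ : ∀ n {i j} → (i , j) ∈ splits n → i ℕ.+ j ≡ n
splits-∈ zero (here refl) = refl
splits-∈ (suc n) (here refl) = refl
splits-∈ (suc n) (there p) with ∈-map⁻ _ p
... | (i , j) , q , refl = cong suc (splits-∈ n q)

splits-unique : ∀ n → Unique (splits n)
splits-unique zero = [] ∷ []
splits-unique (suc n) = All.tabulate (λ z∈ eq → lem (∈-map⁻ _ z∈) eq) ∷ Uniq.map⁺ (λ { refl → refl }) (splits-unique n)
  where
  lem : ∀ {z} → ∃ (λ y → y ∈ splits n × z ≡ (suc (proj₁ y) , proj₂ y)) → (0 , suc n) ≡ z → ⊥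
  lem (_ , _ , refl) ()

infixl 7 _⊛_
opaque
  _⊛_ : Ser → Ser → Ser
  (f ⊛ g) n = ∑ (splits n) (λ (i , j) → f i * g j)

  ⊛-def : ∀ f g n → (f ⊛ g) n ≡ ∑ (splits n) (λ (i , j) → f i * g j)
  ⊛-def f g n = refl

infixr 7 _⊗_
_⊗_ : Sys I → Sys J′ → Sys (I × J′)
S ⊗ T = record
  { R = λ (i , j) → R S i × R T j
  ; e = λ (i , j) → e S i + e T j
  ; fib = F
  ; unique = λ n → unique-concatMap G (splits n) (splits-unique n)
      (λ (a , b) → Uniq.cartesianProduct⁺ (unique S a) (unique T b)) dis
  ; sound = snd
  ; complete = cmp
  ; natural = λ (r , r') → let (m , p) = natural S r; (n , q) = natural T r' in m ℕ.+ n , cong₂ _+_ p q }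
  where
  G : ℕ × ℕ → List _
  G (a , b) = cartesianProduct (fib S a) (fib T b)
  F : ℕ → List _
  F n = concatMap G (splits n)
  -- The exponents of the two components determine the split, so the products for different splits
  -- are disjoint.
  dis : ∀ {x y z} → z ∈ G x → z ∈ G y → x ≡ y
  dis {a , b} {a' , b'} p q =
    let (p1 , p2) = ∈-cartesianProduct⁻ (fib S a) (fib T b) p
        (q1 , q2) = ∈-cartesianProduct⁻ (fib S a') (fib T b') q
    in cong₂ _,_ (ℤₚ.+-injective (trans (sym (proj₂ (sound S p1))) (proj₂ (sound S q1))))
                 (ℤₚ.+-injective (trans (sym (proj₂ (sound T p2))) (proj₂ (sound T q2))))
  snd : ∀ {z n} → z ∈ F n → (R S (proj₁ z) × R T (proj₂ z)) × e S (proj₁ z) + e T (proj₂ z) ≡ + n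
  snd {z} {n} p =
    let ((a , b) , ab∈ , z∈) = find (∈-concatMap⁻ G {xs = splits n} p)
        (p1 , p2) = ∈-cartesianProduct⁻ (fib S a) (fib T b) z∈
        (r1 , e1) = sound S p1
        (r2 , e2) = sound T p2
    in (r1 , r2) , trans (cong₂ _+_ e1 e2) (cong +_ (splits-∈ n ab∈))
  cmp : ∀ {z n} → R S (proj₁ z) × R T (proj₂ z) → e S (proj₁ z) + e T (proj₂ z) ≡ + n → z ∈ F n
  cmp {z} {n} (r , r') q =
    let (a , ea) = natural S r
        (b , eb) = natural T r'
        n≡ = ℤₚ.+-injective (trans (sym (cong₂ _+_ ea eb)) q)
    in subst (λ n → z ∈ F n) n≡
         (∈-concatMap⁺ G (Any.map (λ { refl → ∈-cartesianProduct⁺ (complete S r ea) (complete T r' eb) }) (∈-splits a b)))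

opaque
  unfolding gen

  gen-⊗ : (S : Sys I) (T : Sys J′) (w : I → ℤ) (v : J′ → ℤ) →
    gen (S ⊗ T) (λ (i , j) → w i * v j) ≈ gen S w ⊛ gen T v
  gen-⊗ S T w v n = trans (trans (∑-concatMap _ (splits n) _) (∑-cong (splits n) λ {(a , b)} _ →
    trans (∑-cartesian (fib S a) (fib T b) _)
      (trans (∑-cong (fib S a) (λ {i} _ → ∑-*ˡ (w i) (fib T b) v)) (∑-*ʳ (∑ (fib T b) v) (fib S a) w)))) (sym (⊛-def _ _ n))

-- Formal power series

infixl 6 _⊹_ _⊖_
infix 8 ⊝_
opaque
  _⊹_ : Ser → Ser → Ser
  (f ⊹ g) n = f n + g n

  ⊝_ : Ser → Ser
  (⊝ f) n = - f n

  ⊹-def : ∀ f g n → (f ⊹ g) n ≡ f n + g n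
  ⊹-def f g n = refl

  ⊝-def : ∀ f n → (⊝ f) n ≡ - f n
  ⊝-def f n = refl

_⊖_ : Ser → Ser → Ser
f ⊖ g = f ⊹ ⊝ g

K : ℤ → Ser
K c zero = c
K c (suc n) = 0ℤ

opaque
  unfolding _⊛_ _⊹_ ⊝_

  ⊛-suc : ∀ f g n → (f ⊛ g) (suc n) ≡ f 0 * g (suc n) + ((f ∘ suc) ⊛ g) n
  ⊛-suc f g n = cong (_+_ (f 0 * g (suc n))) (∑-map _ (splits n) _)

  ⊛-cong : ∀ {f f' g g'} → f ≈ f' → g ≈ g' → f ⊛ g ≈ f' ⊛ g'
  ⊛-cong p q n = ∑-cong (splits n) (λ {(i , j)} _ → cong₂ _*_ (p i) (q j))

  ⊛-sucʳ : ∀ f g n → (f ⊛ g) (suc n) ≡ (f ⊛ (g ∘ suc)) n + f (suc n) * g 0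
  ⊛-sucʳ f g zero = lem (f 0 * g 1) (f 1 * g 0)
    where
    lem : ∀ a b → a + (b + 0ℤ) ≡ (a + 0ℤ) + b
    lem = solve-∀
  ⊛-sucʳ f g (suc n) = trans (⊛-suc f g (suc n)) (trans (cong (_+_ (f 0 * g (suc (suc n)))) (⊛-sucʳ (f ∘ suc) g n))
    (trans (sym (ℤₚ.+-assoc (f 0 * g (suc (suc n))) _ _)) (cong (_+ f (suc (suc n)) * g 0) (sym (⊛-suc f (g ∘ suc) n)))))

  ⊛-comm : ∀ f g → f ⊛ g ≈ g ⊛ f
  ⊛-comm f g zero = cong (_+ 0ℤ) (ℤₚ.*-comm (f 0) (g 0))
  ⊛-comm f g (suc n) = trans (⊛-suc f g n) (trans (cong₂ _+_ (ℤₚ.*-comm (f 0) (g (suc n))) (⊛-comm (f ∘ suc) g n))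
    (trans (ℤₚ.+-comm (g (suc n) * f 0) _) (sym (⊛-sucʳ g f n))))

  ⊛-distribʳ : ∀ h f g → (f ⊹ g) ⊛ h ≈ f ⊛ h ⊹ g ⊛ h
  ⊛-distribʳ h f g n = trans (∑-cong (splits n) (λ {(i , j)} _ → ℤₚ.*-distribʳ-+ (h j) (f i) (g i))) (∑-+ (splits n) _ _)

  ⊛-distribˡ : ∀ h f g → h ⊛ (f ⊹ g) ≈ h ⊛ f ⊹ h ⊛ g
  ⊛-distribˡ h f g n = trans (∑-cong (splits n) (λ {(i , j)} _ → ℤₚ.*-distribˡ-+ (h i) (f j) (g j))) (∑-+ (splits n) _ _)

  scale-⊛ : ∀ c f g n → ((λ k → c * f k) ⊛ g) n ≡ c * (f ⊛ g) n
  scale-⊛ c f g n = trans (∑-cong (splits n) (λ {(i , j)} _ → ℤₚ.*-assoc c (f i) (g j))) (∑-*ˡ c (splits n) _)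

  ⊛-assoc : ∀ f g h → (f ⊛ g) ⊛ h ≈ f ⊛ (g ⊛ h)
  ⊛-assoc f g h zero = lem (f 0) (g 0) (h 0)
    where
    lem : ∀ a b c → (a * b + 0ℤ) * c + 0ℤ ≡ a * (b * c + 0ℤ) + 0ℤ
    lem = solve-∀
  ⊛-assoc f g h (suc n) = begin
    ((f ⊛ g) ⊛ h) (suc n)
      ≡⟨ ⊛-suc (f ⊛ g) h n ⟩
    (f 0 * g 0 + 0ℤ) * h (suc n) + (((f ⊛ g) ∘ suc) ⊛ h) n
      ≡⟨ cong (_+_ ((f 0 * g 0 + 0ℤ) * h (suc n))) (trans (⊛-cong {g = h} (⊛-suc f g) (λ _ → refl) n)
           (trans (⊛-distribʳ h (λ k → f 0 * g (suc k)) ((f ∘ suc) ⊛ g) n)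
             (cong₂ _+_ (scale-⊛ (f 0) (g ∘ suc) h n) (⊛-assoc (f ∘ suc) g h n)))) ⟩
    (f 0 * g 0 + 0ℤ) * h (suc n) + (f 0 * ((g ∘ suc) ⊛ h) n + ((f ∘ suc) ⊛ (g ⊛ h)) n)
      ≡⟨ lem (f 0) (g 0) (h (suc n)) _ _ ⟩
    f 0 * (g 0 * h (suc n) + ((g ∘ suc) ⊛ h) n) + ((f ∘ suc) ⊛ (g ⊛ h)) n
      ≡⟨ cong (λ t → f 0 * t + ((f ∘ suc) ⊛ (g ⊛ h)) n) (⊛-suc g h n) ⟨
    f 0 * (g ⊛ h) (suc n) + ((f ∘ suc) ⊛ (g ⊛ h)) n
      ≡⟨ ⊛-suc f (g ⊛ h) n ⟨
    (f ⊛ (g ⊛ h)) (suc n) ∎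
    where
    open ≡-Reasoning
    lem : ∀ a b c x y → (a * b + 0ℤ) * c + (a * x + y) ≡ a * (b * c + x) + y
    lem = solve-∀

  K-⊛ : ∀ c g n → (K c ⊛ g) n ≡ c * g n
  K-⊛ c g zero = ℤₚ.+-identityʳ _
  K-⊛ c g (suc n) = trans (⊛-suc (K c) g n)
    (trans (cong (_+_ (c * g (suc n))) (∑-0 (splits n) (λ _ → refl))) (ℤₚ.+-identityʳ _))

⊛-identityˡ : ∀ f → K 1ℤ ⊛ f ≈ f
⊛-identityˡ f n = trans (K-⊛ 1ℤ f n) (ℤₚ.*-identityˡ (f n))

-- Pointwise equality wrapped in a record, so that the series compared can be inferred.
infix 4 _≋_
record _≋_ (f g : Ser) : Set where
  constructor mk
  field un : f ≈ g

open _≋_ public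

opaque
  unfolding _⊹_ ⊝_

  serIsRing : IsCommutativeRing _≋_ _⊹_ _⊛_ ⊝_ (K 0ℤ) (K 1ℤ)
  serIsRing = record
      { isRing = record
        { +-isAbelianGroup = record
          { isGroup = record
            { isMonoid = record
              { isSemigroup = record
                { isMagma = record
                  { isEquivalence = record { refl = mk λ _ → refl ; sym = λ p → mk λ n → sym (un p n) ; trans = λ p q → mk λ n → trans (un p n) (un q n) }
                  ; ∙-cong = λ p q → mk λ n → cong₂ _+_ (un p n) (un q n) }
                ; assoc = λ f g h → mk λ n → ℤₚ.+-assoc (f n) (g n) (h n) }
              ; identity = (λ f → mk λ n → trans (cong (_+ f n) (K0 n)) (ℤₚ.+-identityˡ (f n)))
                         , (λ f → mk λ n → trans (cong (_+_ (f n)) (K0 n)) (ℤₚ.+-identityʳ (f n))) }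
            ; inverse = (λ f → mk λ n → trans (ℤₚ.+-inverseˡ (f n)) (sym (K0 n)))
                      , (λ f → mk λ n → trans (ℤₚ.+-inverseʳ (f n)) (sym (K0 n)))
            ; ⁻¹-cong = λ p → mk λ n → cong -_ (un p n) }
          ; comm = λ f g → mk λ n → ℤₚ.+-comm (f n) (g n) }
        ; *-cong = λ {f} {f'} {g} {g'} p q → mk (⊛-cong {f} {f'} {g} {g'} (un p) (un q))
        ; *-assoc = λ f g h → mk (⊛-assoc f g h)
        ; *-identity = (λ f → mk (⊛-identityˡ f)) , (λ f → mk λ n → trans (⊛-comm f (K 1ℤ) n) (⊛-identityˡ f n))
        ; distrib = (λ h f g → mk (⊛-distribˡ h f g)) , (λ h f g → mk (⊛-distribʳ h f g)) }
      ; *-comm = λ f g → mk (⊛-comm f g) }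
    where
    K0 : ∀ n → K 0ℤ n ≡ 0ℤ
    K0 zero = refl
    K0 (suc n) = refl

serRing : CommutativeRing 0ℓ 0ℓ
serRing = record { isCommutativeRing = serIsRing }

private
  K-* : ∀ x y n → x * K y n ≡ K (x * y) n
  K-* x y zero = refl
  K-* x y (suc n) = ℤₚ.*-zeroʳ x

  opaque
    unfolding _⊹_ ⊝_

    K-+ : ∀ x y → K (x + y) ≋ K x ⊹ K y
    K-+ x y = mk λ { zero → refl ; (suc n) → refl }

    K-neg : ∀ x → K (- x) ≋ ⊝ K x
    K-neg x = mk λ { zero → refl ; (suc n) → refl }

  K≟ : ∀ x y → Maybe (K x ≋ K y)
  K≟ x y with x ℤ.≟ y
  ... | yes refl = just (mk λ _ → refl)
  ... | no _ = nothing

-- Makes the integers the coefficient ring of the solver, so that numerical constants are computed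
-- with and not treated as unknown series.
K-homomorphism : CommutativeRing.rawRing ℤₚ.+-*-commutativeRing -Raw-AlmostCommutative⟶ fromCommutativeRing serRing
K-homomorphism = record
  { ⟦_⟧ = K
  ; +-homo = K-+
  ; *-homo = λ x y → mk λ n → sym (trans (K-⊛ x (K y) n) (K-* x y n))
  ; -‿homo = K-neg
  ; 0-homo = mk λ _ → refl
  ; 1-homo = mk λ _ → refl }

module SerSolver = RingSolver (CommutativeRing.rawRing ℤₚ.+-*-commutativeRing) (fromCommutativeRing serRing) K-homomorphism K≟

open CommutativeRing serRing public using ()
  renaming (refl to ≋-refl; sym to ≋-sym; trans to ≋-trans; +-cong to ⊹-cong; *-cong to ⊛-≋; setoid to serSetoid; -‿cong to ⊝-cong)

-- Orders of vanishing and the dilation principle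

∑-single : ∀ {A : Set} (xs : List A) {w : A → ℤ} {a} → Unique xs → a ∈ xs →
  (∀ {x} → x ∈ xs → x ≢ a → w x ≡ 0ℤ) → ∑ xs w ≡ w a
∑-single (x ∷ xs) {w} (x∉ ∷ u) (here refl) h =
  trans (cong (_+_ (w x)) (∑-0 xs (λ y∈ → h (there y∈) (λ eq → All.lookup x∉ y∈ (sym eq))))) (ℤₚ.+-identityʳ _)
∑-single (x ∷ xs) {w} (x∉ ∷ u) (there p) h =
  trans (cong₂ _+_ (h (here refl) (All.lookup x∉ p)) (∑-single xs u p (λ y∈ → h (there y∈)))) (ℤₚ.+-identityˡ _)

Vanish : Ser → ℕ → Set
Vanish f b = ∀ {n} → n ℕ.< b → f n ≡ 0ℤ

Leads : Ser → ℕ → Set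
Leads u r = Vanish u r × u r ≢ 0ℤ

opaque
  unfolding _⊛_ _⊹_ ⊝_

  vanish-⊛ : ∀ {f g a b} → Vanish f a → Vanish g b → Vanish (f ⊛ g) (a ℕ.+ b)
  vanish-⊛ {f} {g} {a} {b} vf vg {n} n< = ∑-0 (splits n) term
    where
    term : ∀ {x} → x ∈ splits n → f (proj₁ x) * g (proj₂ x) ≡ 0ℤ
    term {i , j} p with i ℕ.<? a | j ℕ.<? b
    ... | yes q | _ = cong (_* g j) (vf q)
    ... | no _ | yes q = trans (cong (f i *_) (vg q)) (ℤₚ.*-zeroʳ (f i))
    ... | no q | no r = ⊥-elim (ℕₚ.<-irrefl refl (ℕₚ.≤-<-trans (ℕₚ.+-mono-≤ (ℕₚ.≮⇒≥ q) (ℕₚ.≮⇒≥ r)) (subst (ℕ._< a ℕ.+ b) (sym (splits-∈ n p)) n<)))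

  -- The coefficient of the product at `r + n` is `u r * δ n` plus terms with a factor `u i`,
  -- `i < r`, or with an earlier coefficient of `δ`. As ℤ has no zero divisors, strong induction
  -- gives `δ n ≡ 0ℤ`.
  leads-cancel : ∀ {u δ r b} → Leads u r → Vanish (u ⊛ δ) (r ℕ.+ b) → Vanish δ b
  leads-cancel {u} {δ} {r} {b} (vu , ur) vp {n} n<b = below (suc n) ℕₚ.≤-refl n<b
    where
    next : ∀ n → (∀ {j} → j ℕ.< n → δ j ≡ 0ℤ) → n ℕ.< b → δ n ≡ 0ℤ
    next n lower n<b
      with ℤₚ.i*j≡0⇒i≡0∨j≡0 (u r) (trans (sym (∑-single (splits (r ℕ.+ n)) (splits-unique _) (∈-splits r n) others)) (vp (ℕₚ.+-monoʳ-< r n<b)))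
      where
      others : ∀ {x} → x ∈ splits (r ℕ.+ n) → x ≢ (r , n) → u (proj₁ x) * δ (proj₂ x) ≡ 0ℤ
      others {i , j} p ne with ℕₚ.<-cmp i r
      ... | tri< i<r _ _ = cong (_* δ j) (vu i<r)
      ... | tri≈ _ refl _ = ⊥-elim (ne (cong (i ,_) (ℕₚ.+-cancelˡ-≡ i j n (splits-∈ _ p))))
      ... | tri> _ _ r<i = trans (cong (u i *_) (lower (ℕₚ.+-cancelˡ-< r j n (ℕₚ.<-≤-trans (ℕₚ.+-monoˡ-< j r<i) (ℕₚ.≤-reflexive (splits-∈ _ p)))))) (ℤₚ.*-zeroʳ (u i))
    ... | inj₁ q = ⊥-elim (ur q)
    ... | inj₂ q = q
    below : ∀ k {j} → j ℕ.< k → j ℕ.< b → δ j ≡ 0ℤ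
    below (suc k) {j} j<k j<b = next j (λ {i} i<j → below k (ℕₚ.<-≤-trans i<j (ℕₚ.≤-pred j<k)) (ℕₚ.<-trans i<j j<b)) j<b

opaque
  unfolding _⊹_ ⊝_

  ⊛-cancelˡ : ∀ {u f g r} → Leads u r → u ⊛ f ≋ u ⊛ g → f ≋ g
  ⊛-cancelˡ {u} {f} {g} {r} lu eq = mk λ n → ℤₚ.i-j≡0⇒i≡j (f n) (g n)
    (leads-cancel {u} {f ⊖ g} {r} {suc n} lu (λ {k} _ → trans (un h k) (ℤₚ.i≡j⇒i-j≡0 (un eq k))) ℕₚ.≤-refl)
    where
    open SerSolver
    h : u ⊛ (f ⊖ g) ≋ u ⊛ f ⊖ u ⊛ g
    h = solve 3 (λ u f g → u :* (f :- g) := u :* f :- u :* g) ≋-refl u f g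

-- A family δ tied to its dilate δ (l m) by an equation u_m δ_m = v_m δ_{lm}
-- vanishes, because every use of the equation doubles its order of vanishing.
dilation-zero : ∀ (l a b c : ℕ) (δ u v : ℕ → Ser) → 2 ℕ.≤ l → b ℕ.+ c ℕ.* l ≡ a ℕ.+ c →
  (∀ m → 1 ℕ.≤ m → Leads (u m) (a ℕ.* m)) →
  (∀ m → 1 ℕ.≤ m → Vanish (v m) (b ℕ.* m)) →
  (∀ m → 1 ℕ.≤ m → Vanish (δ m) (c ℕ.* m ℕ.+ m)) →
  (∀ m → 1 ℕ.≤ m → u m ⊛ δ m ≋ v m ⊛ δ (l ℕ.* m)) →
  ∀ m → 1 ℕ.≤ m → δ m ≈ λ _ → 0ℤ
dilation-zero l a b c δ u v 2≤l arith lead van base step m 1≤m n =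
  all n m 1≤m (ℕₚ.≤-trans (ℕₚ.≤-trans (ℕₚ.n≤1+n _) (ℕₚ.m≤m*n (suc (suc n)) m {{ℕ.>-nonZero 1≤m}})) (ℕₚ.m≤n+m _ (c ℕ.* m)))
  where
  all : ∀ t m → 1 ℕ.≤ m → Vanish (δ m) (c ℕ.* m ℕ.+ (suc (suc t)) ℕ.* m)
  open import Data.Nat.Tactic.RingSolver using () renaming (solve-∀ to solveℕ)
  base' : ∀ m → 1 ℕ.≤ m → Vanish (δ m) (c ℕ.* m ℕ.+ 1 ℕ.* m)
  base' m h {n} n< = base m h (subst (λ z → n ℕ.< c ℕ.* m ℕ.+ z) (ℕₚ.*-identityˡ m) n<)
  stp : ∀ t → (∀ m → 1 ℕ.≤ m → Vanish (δ m) (c ℕ.* m ℕ.+ suc t ℕ.* m)) →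
        ∀ m → 1 ℕ.≤ m → Vanish (δ m) (c ℕ.* m ℕ.+ suc (suc t) ℕ.* m)
  -- By induction the right side vanishes to order bm + clm + (t+1)lm, which by `arith` is am + cm +
  -- (t+1)lm. Cancelling `u m`, of order am, leaves at least cm + (t+2)m, since (t+1)l ≥ 2(t+1) ≥
  -- t+2.
  stp t ih m 1≤m {n} n< = leads-cancel {u m} {δ m} {a ℕ.* m} {c ℕ.* m ℕ.+ (suc t ℕ.* l) ℕ.* m} (lead m 1≤m)
      (λ {k} k< → trans (un (step m 1≤m) k) (vanish-⊛ {v m} {δ (l ℕ.* m)} (van m 1≤m)
        (ih (l ℕ.* m) (ℕₚ.≤-trans 1≤m (ℕₚ.m≤n*m m l {{ℕ.>-nonZero (ℕₚ.≤-trans (s≤s z≤n) 2≤l)}})))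
        (subst (k ℕ.<_) (trans (sum1 a c m (suc t ℕ.* l)) (trans (cong (λ z → z ℕ.* m ℕ.+ (suc t ℕ.* l) ℕ.* m) (sym arith)) (sum2 b c l m t))) k<)))
      (ℕₚ.<-≤-trans n< (ℕₚ.+-monoʳ-≤ (c ℕ.* m) (ℕₚ.*-monoˡ-≤ m (ℕₚ.≤-trans (ine t) (ℕₚ.*-monoʳ-≤ (suc t) 2≤l)))))
    where
    sum1 : ∀ a c m x → a ℕ.* m ℕ.+ (c ℕ.* m ℕ.+ x ℕ.* m) ≡ (a ℕ.+ c) ℕ.* m ℕ.+ x ℕ.* m
    sum1 = solveℕ
    sum2 : ∀ b c l m t → (b ℕ.+ c ℕ.* l) ℕ.* m ℕ.+ ((1 ℕ.+ t) ℕ.* l) ℕ.* m ≡ b ℕ.* m ℕ.+ (c ℕ.* (l ℕ.* m) ℕ.+ (1 ℕ.+ t) ℕ.* (l ℕ.* m))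
    sum2 = solveℕ
    ine : ∀ t → suc (suc t) ℕ.≤ suc t ℕ.* 2
    ine zero = ℕₚ.≤-refl
    ine (suc t) = s≤s (ℕₚ.≤-trans (ine t) (ℕₚ.n≤1+n _))
  all zero m h = stp 0 base' m h
  all (suc t) m h = stp (suc t) (all t) m h

X : ℤ → ℕ → Ser
X c zero = K c
X c (suc r) zero = 0ℤ
X c (suc r) (suc n) = X c r n

X-below : ∀ c {r n} → n ℕ.< r → X c r n ≡ 0ℤ
X-below c {suc r} {zero} _ = refl
X-below c {suc r} {suc n} (s≤s h) = X-below c h

X-at : ∀ c r → X c r r ≡ c
X-at c zero = refl
X-at c (suc r) = X-at c r

X-0 : ∀ r n → X 0ℤ r n ≡ 0ℤ
X-0 zero zero = refl
X-0 zero (suc n) = refl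
X-0 (suc r) zero = refl
X-0 (suc r) (suc n) = X-0 r n

X-+ : ∀ c d r n → X c r n + X d r n ≡ X (c + d) r n
X-+ c d zero zero = refl
X-+ c d zero (suc n) = refl
X-+ c d (suc r) zero = refl
X-+ c d (suc r) (suc n) = X-+ c d r n

X-neg : ∀ c r n → - X c r n ≡ X (- c) r n
X-neg c zero zero = refl
X-neg c zero (suc n) = refl
X-neg c (suc r) zero = refl
X-neg c (suc r) (suc n) = X-neg c r n

opaque
  unfolding _⊛_ _⊹_ ⊝_

  X-⊛ : ∀ c d r s → X c r ⊛ X d s ≈ X (c * d) (r ℕ.+ s)
  X-⊛ c d zero s n = trans (K-⊛ c (X d s) n) (lem s n)
    where
    lem : ∀ s n → c * X d s n ≡ X (c * d) s n
    lem zero zero = refl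
    lem zero (suc n) = ℤₚ.*-zeroʳ c
    lem (suc s) zero = ℤₚ.*-zeroʳ c
    lem (suc s) (suc n) = lem s n
  X-⊛ c d (suc r) s zero = refl
  X-⊛ c d (suc r) s (suc n) = trans (⊛-suc (X c (suc r)) (X d s) n) (trans (ℤₚ.+-identityˡ _) (X-⊛ c d r s n))

-- f = c q^r + O(q^(r+m))
record Lead (m : ℕ) (f : Ser) (c : ℤ) (r : ℕ) : Set where
  constructor lead
  field approx : ∀ {n} → n ℕ.< r ℕ.+ m → f n ≡ X c r n
open Lead public

Lead-vanish : ∀ {m f c r} → Lead m f c r → Vanish f r
Lead-vanish {m} {f} {c} {r} l n< = trans (approx l (ℕₚ.<-≤-trans n< (ℕₚ.m≤m+n r m))) (X-below c n<)

Lead-leads : ∀ {m f c r} → 1 ℕ.≤ m → c ≢ 0ℤ → Lead m f c r → Leads f r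
Lead-leads {m} {f} {c} {r} h c≢0 l = Lead-vanish l , λ q → c≢0 (trans (sym (X-at c r)) (trans (sym (approx l (ℕₚ.m<m+n r h))) q))

Lead-0 : ∀ {m f r} → Vanish f (r ℕ.+ m) → Lead m f 0ℤ r
Lead-0 {r = r} v = lead λ {n} n< → trans (v n<) (sym (X-0 r n))

Lead-vanish⁺ : ∀ {m f r} → Lead m f 0ℤ r → Vanish f (r ℕ.+ m)
Lead-vanish⁺ {r = r} l {n} n< = trans (approx l n<) (X-0 r n)

opaque
  unfolding _⊹_ ⊝_

  Lead-+ : ∀ {m f g c d r} → Lead m f c r → Lead m g d r → Lead m (f ⊹ g) (c + d) r
  Lead-+ {c = c} {d} {r} l l' = lead λ {n} n< → trans (cong₂ _+_ (approx l n<) (approx l' n<)) (X-+ c d r n)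

  Lead-- : ∀ {m f g c d r} → Lead m f c r → Lead m g d r → Lead m (f ⊖ g) (c - d) r
  Lead-- {c = c} {d} {r} l l' = lead λ {n} n< → trans (cong₂ (λ a b → a + - b) (approx l n<) (approx l' n<)) (trans (cong (_+_ (X c r n)) (X-neg d r n)) (X-+ c (- d) r n))

Lead-K : ∀ {m} c → Lead m (K c) c 0
Lead-K c = lead λ _ → refl

opaque
  unfolding _⊛_ _⊹_ ⊝_

  -- If one exponent of a pair lies beyond its window, the other lies below its leading exponent;
  -- hence below `r + s + m` only the leading monomials meet.
  Lead-* : ∀ {m f g c d r s} → Lead m f c r → Lead m g d s → Lead m (f ⊛ g) (c * d) (r ℕ.+ s)
  Lead-* {m} {f} {g} {c} {d} {r} {s} l l' = lead λ {n} n< → trans (∑-cong (splits n) (term n<)) (X-⊛ c d r s n)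
    where
    term : ∀ {n} → n ℕ.< r ℕ.+ s ℕ.+ m → ∀ {x} → x ∈ splits n → f (proj₁ x) * g (proj₂ x) ≡ X c r (proj₁ x) * X d s (proj₂ x)
    term {n} n< {i , j} p with i ℕ.<? r ℕ.+ m | j ℕ.<? s ℕ.+ m
    ... | yes a | yes b = cong₂ _*_ (approx l a) (approx l' b)
    ... | yes a | no b = trans (cong (_* g j) (trans (approx l a) (X-below c i<r))) (cong (_* X d s j) (sym (X-below c i<r)))
      where
      i<r : i ℕ.< r
      i<r = ℕₚ.+-cancelʳ-< (s ℕ.+ m) i r (ℕₚ.≤-<-trans (ℕₚ.+-monoʳ-≤ i (ℕₚ.≮⇒≥ b)) (subst₂ ℕ._<_ (sym (splits-∈ n p)) (ℕₚ.+-assoc r s m) n<))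
    ... | no a | _ = trans (trans (cong (f i *_) (trans (approx l' (ℕₚ.<-≤-trans j<s (ℕₚ.m≤m+n s m))) (X-below d j<s))) (ℤₚ.*-zeroʳ (f i)))
                       (sym (trans (cong (X c r i *_) (X-below d j<s)) (ℤₚ.*-zeroʳ (X c r i))))
      where
      j<s : j ℕ.< s
      j<s = ℕₚ.+-cancelˡ-< (r ℕ.+ m) j s (ℕₚ.≤-<-trans (ℕₚ.+-monoˡ-≤ j (ℕₚ.≮⇒≥ a)) (subst₂ ℕ._<_ (sym (splits-∈ n p)) lem n<))
        where
        lem : r ℕ.+ s ℕ.+ m ≡ r ℕ.+ m ℕ.+ s
        lem = trans (ℕₚ.+-assoc r s m) (trans (cong (r ℕ.+_) (ℕₚ.+-comm s m)) (sym (ℕₚ.+-assoc r m s)))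

-- Theta systems and periodic weights

restrict : {P : I → Set} → Decidable P → Sys I → Sys I
restrict {P = P} P? S = record
  { R = λ i → R S i × P i
  ; e = e S
  ; fib = λ n → filter P? (fib S n)
  ; unique = λ n → Uniq.filter⁺ P? (unique S n)
  ; sound = λ i∈ → let (p , q) = ∈-filter⁻ P? i∈; (r , s) = sound S p in (r , q) , s
  ; complete = λ (r , p) q → ∈-filter⁺ P? (complete S r q) p
  ; natural = λ (r , _) → natural S r }

opaque
  unfolding gen _⊹_

  gen-restrict : {P : I → Set} (P? : Decidable P) (S : Sys I) (w : I → ℤ) → ∀ n →
    gen S w n ≡ gen (restrict P? S) w n + gen (restrict (¬? ∘ P?) S) w n
  gen-restrict P? S w n = ∑-filter P? (fib S n) w

  gen-cong-R : (S : Sys I) {w v : I → ℤ} → (∀ {i} → R S i → w i ≡ v i) → gen S w ≈ gen S v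
  gen-cong-R S h n = ∑-cong (fib S n) (λ i∈ → h (proj₁ (sound S i∈)))

  gen-+ : (S : Sys I) (w v : I → ℤ) → ∀ n → gen S (λ i → w i + v i) n ≡ gen S w n + gen S v n
  gen-+ S w v n = ∑-+ (fib S n) w v

  gen-* : (S : Sys I) (c : ℤ) (w : I → ℤ) → ∀ n → gen S (λ i → c * w i) n ≡ c * gen S w n
  gen-* S c w n = ∑-*ˡ c (fib S n) w

  gen-neg : (S : Sys I) (w : I → ℤ) → ∀ n → gen S (λ i → - w i) n ≡ - gen S w n
  gen-neg S w n = ∑-neg (fib S n) w

  gen-0 : (S : Sys I) {w : I → ℤ} → (∀ {i} → R S i → w i ≡ 0ℤ) → ∀ n → gen S w n ≡ 0ℤ
  gen-0 S h n = ∑-0 (fib S n) (λ i∈ → h (proj₁ (sound S i∈)))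

x≡-x⇒x≡0 : ∀ x → x ≡ - x → x ≡ 0ℤ
x≡-x⇒x≡0 (+ zero) _ = refl

opaque
  unfolding gen

  -- A sign-reversing involution on each fibre makes the coefficient equal to its own negative.
  -- Fixed points do no harm, since the weight is forced to vanish there.
  gen-anti : (S : Sys I) {w : I → ℤ} (f : I → I) → (∀ {i} → R S i → R S (f i)) →
    (∀ {i} → R S i → e S (f i) ≡ e S i) → (∀ {i} → R S i → f (f i) ≡ i) →
    (∀ {i} → R S i → w i ≡ - w (f i)) → ∀ n → gen S w n ≡ 0ℤ
  gen-anti S {w} f into ef inv anti n = x≡-x⇒x≡0 _
    (trans (gen-bij S S {w} {λ i → - w i} f into ef
      (λ r r' q → trans (sym (inv r)) (trans (cong f q) (inv r')))
      (λ {j} r → f j , into r , inv r) anti n) (∑-neg (fib S n) w))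

gen-decomp : (S : Sys J′) (T₁ : Sys I₁) (T₂ : Sys I₂) (w : J′ → ℤ) (f₁ : I₁ → J′) (f₂ : I₂ → J′) →
  (∀ {i} → R T₁ i → R S (f₁ i)) → (∀ {i} → R T₂ i → R S (f₂ i)) →
  (∀ {i} → R T₁ i → e S (f₁ i) ≡ e T₁ i) → (∀ {i} → R T₂ i → e S (f₂ i) ≡ e T₂ i) →
  (∀ {i i'} → f₁ i ≡ f₁ i' → i ≡ i') → (∀ {i i'} → f₂ i ≡ f₂ i' → i ≡ i') →
  (∀ {i i'} → f₁ i ≡ f₂ i' → ⊥) →
  (∀ {j} → R S j → (∃[ i ] (R T₁ i × f₁ i ≡ j)) ⊎ (∃[ i ] (R T₂ i × f₂ i ≡ j))) →
  ∀ n → gen S w n ≡ gen T₁ (w ∘ f₁) n + gen T₂ (w ∘ f₂) n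
gen-decomp S T₁ T₂ w f₁ f₂ into₁ into₂ e₁ e₂ inj¹ inj² disj surj n = trans
  (sym (gen-bij (T₁ ⊕ T₂) S {w = w ∘ f} {v = w} f (λ { {inj₁ i} → into₁ ; {inj₂ i} → into₂ })
    (λ { {inj₁ i} → e₁ ; {inj₂ i} → e₂ }) inj
    (λ r → [ (λ (i , r , q) → inj₁ i , r , q) , (λ (i , r , q) → inj₂ i , r , q) ]′ (surj r))
    (λ _ → refl) n))
  (gen-⊕ T₁ T₂ (w ∘ f) n)
  where
  f : _ ⊎ _ → _
  f = [ f₁ , f₂ ]′
  inj : ∀ {i i'} → R (T₁ ⊕ T₂) i → R (T₁ ⊕ T₂) i' → f i ≡ f i' → i ≡ i'
  inj {inj₁ i} {inj₁ i'} _ _ q = cong inj₁ (inj¹ q)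
  inj {inj₂ i} {inj₂ i'} _ _ q = cong inj₂ (inj² q)
  inj {inj₁ i} {inj₂ i'} _ _ q = ⊥-elim (disj q)
  inj {inj₂ i} {inj₁ i'} _ _ q = ⊥-elim (disj (sym q))

-- Squares, the hexagonal form and divisor pairs as systems

range : ℕ → List ℤ
range n = map +_ (upTo (suc n)) ++ map -[1+_] (upTo n)

range-unique : ∀ n → Unique (range n)
range-unique n = Uniq.++⁺ (Uniq.map⁺ ℤₚ.+-injective (Uniq.upTo⁺ (suc n))) (Uniq.map⁺ ℤₚ.-[1+-injective (Uniq.upTo⁺ n)) disj
  where
  disj : ∀ {z} → ¬ (z ∈ map +_ (upTo (suc n)) × z ∈ map -[1+_] (upTo n))
  disj (p , q) with ∈-map⁻ +_ p | ∈-map⁻ -[1+_] q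
  ... | _ , _ , refl | _ , _ , ()

∈-range : ∀ {x n} → ∣ x ∣ ℕ.≤ n → x ∈ range n
∈-range {+ k} {n} h = ∈-++⁺ˡ (∈-map⁺ +_ (∈-upTo⁺ (s≤s h)))
∈-range { -[1+ k ]} {n} h = ∈-++⁺ʳ (map +_ (upTo (suc n))) (∈-map⁺ -[1+_] (∈-upTo⁺ h))

range² : ℕ → List (ℤ × ℤ)
range² n = cartesianProduct (range n) (range n)

-- `box n` need only contain the admissible indices of exponent `n`; the fibre is found by filtering
-- it.
mkSys : {R : I → Set} → Decidable R → (e : I → ℤ) (box : ℕ → List I) → (∀ n → Unique (box n)) →
  (∀ {i} → R i → ∃[ n ] (e i ≡ + n × i ∈ box n)) → Sys I
mkSys {R = R} R? e box ub bound = record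
  { R = R ; e = e
  ; fib = λ n → filter (λ i → R? i ×-dec (e i ℤ.≟ + n)) (box n)
  ; unique = λ n → Uniq.filter⁺ _ (ub n)
  ; sound = λ i∈ → proj₂ (∈-filter⁻ _ {xs = box _} i∈)
  ; complete = λ {i} {n} r q → ∈-filter⁺ (λ i → R? i ×-dec (e i ℤ.≟ + n))
      (let (m , q' , i∈) = bound r in subst (λ n → i ∈ box n) (ℤₚ.+-injective (trans (sym q') q)) i∈) (r , q)
  ; natural = λ r → let (m , q' , _) = bound r in m , q' }

-- The dilation factor m, made positive: ⟪ 0 ⟫ = 1.
⟪_⟫ : ℕ → ℤ
⟪ m ⟫ = + suc (ℕ.pred m)

⟪⟫-pos : ∀ {m} → 1 ℕ.≤ m → ⟪ m ⟫ ≡ + m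
⟪⟫-pos (s≤s _) = refl

⟪⟫-* : ∀ k m → 1 ℕ.≤ m → ⟪ suc k ℕ.* m ⟫ ≡ + suc k * ⟪ m ⟫
⟪⟫-* k (suc m) _ = ℤₚ.pos-* (suc k) (suc m)

sq-abs : ∀ x → x * x ≡ + (∣ x ∣ ℕ.* ∣ x ∣)
sq-abs (+ n) = sym (ℤₚ.pos-* n n)
sq-abs -[1+ n ] = refl

n≤n*n : ∀ n → n ℕ.≤ n ℕ.* n
n≤n*n zero = z≤n
n≤n*n (suc n) = ℕₚ.m≤m*n (suc n) (suc n)

n≤sm*n*n : ∀ m n → n ℕ.≤ suc m ℕ.* (n ℕ.* n)
n≤sm*n*n m n = ℕₚ.≤-trans (n≤n*n n) (ℕₚ.m≤n*m (n ℕ.* n) (suc m))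

Sq : ℕ → Sys ℤ
Sq m = mkSys {R = λ _ → ⊤} (λ _ → yes tt) (λ x → ⟪ m ⟫ * (x * x)) range range-unique
  λ {x} _ → _ , trans (cong (⟪ m ⟫ *_) (sq-abs x)) (sym (ℤₚ.pos-* (suc (ℕ.pred m)) _)) , ∈-range (n≤sm*n*n (ℕ.pred m) ∣ x ∣)

odd : ℤ → ℤ
odd x = + 2 * x + 1ℤ

∣x∣≤∣odd∣ : ∀ x → ∣ x ∣ ℕ.≤ ∣ odd x ∣
∣x∣≤∣odd∣ (+ n) = subst (n ℕ.≤_) (cong ∣_∣ {x = + (n ℕ.+ (n ℕ.+ 0) ℕ.+ 1)} (cong (_+ 1ℤ) (ℤₚ.pos-* 2 n))) (ℕₚ.≤-trans (ℕₚ.m≤m+n n (n ℕ.+ 0)) (ℕₚ.m≤m+n _ 1))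
∣x∣≤∣odd∣ -[1+ n ] = subst (suc n ℕ.≤_) (cong ∣_∣ (sym (lem (+ n)))) (s≤s (ℕₚ.m≤m+n n n))
  where
  lem : ∀ a → + 2 * (- (1ℤ + a)) + 1ℤ ≡ - (1ℤ + (a + a))
  lem = solve-∀

Odd : ℕ → Sys ℤ
Odd m = mkSys {R = λ _ → ⊤} (λ _ → yes tt) (λ x → ⟪ m ⟫ * (odd x * odd x)) range range-unique
  λ {x} _ → _ , trans (cong (⟪ m ⟫ *_) (sq-abs (odd x))) (sym (ℤₚ.pos-* (suc (ℕ.pred m)) _)) ,
    ∈-range (ℕₚ.≤-trans (∣x∣≤∣odd∣ x) (n≤sm*n*n (ℕ.pred m) ∣ odd x ∣))

-- The norm form of the Eisenstein integers; the factor 8 is the one met in `Cube`. For the bound,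
-- 8(x² + xy + y²) = 2((2x + y)² + 3y²) controls y, and x by symmetry.
Hex : ℕ → Sys (ℤ × ℤ)
Hex m = mkSys {R = λ _ → ⊤} (λ _ → yes tt) (λ (x , y) → ⟪ m ⟫ * (+ 8 * (x * x + x * y + y * y))) range²
  (λ n → Uniq.cartesianProduct⁺ (range-unique n) (range-unique n))
  λ {(x , y)} _ → _ , form x y , ∈-cartesianProduct⁺ (∈-range (subst (∣ x ∣ ℕ.≤_) (ℤₚ.+-injective (trans (sym (form y x)) (trans (lem₁ ⟪ m ⟫ x y) (form x y)))) (bound y x))) (∈-range (bound x y))
  where
  val : ℤ → ℤ → ℕ
  val x y = suc (ℕ.pred m) ℕ.* (2 ℕ.* (∣ + 2 * x + y ∣ ℕ.* ∣ + 2 * x + y ∣ ℕ.+ 3 ℕ.* (∣ y ∣ ℕ.* ∣ y ∣)))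
  lem₁ : ∀ c x y → c * (+ 8 * (y * y + y * x + x * x)) ≡ c * (+ 8 * (x * x + x * y + y * y))
  lem₁ = solve-∀
  lem₂ : ∀ c x y → c * (+ 8 * (x * x + x * y + y * y)) ≡ c * (+ 2 * ((+ 2 * x + y) * (+ 2 * x + y) + + 3 * (y * y)))
  lem₂ = solve-∀
  form : ∀ x y → ⟪ m ⟫ * (+ 8 * (x * x + x * y + y * y)) ≡ + val x y
  form x y = trans (lem₂ ⟪ m ⟫ x y) (trans
    (cong₂ (λ a b → ⟪ m ⟫ * (+ 2 * (a + + 3 * b))) (sq-abs (+ 2 * x + y)) (sq-abs y))
    (sym (trans (ℤₚ.pos-* (suc (ℕ.pred m)) _) (cong (⟪ m ⟫ *_) (trans (ℤₚ.pos-* 2 (∣ + 2 * x + y ∣ ℕ.* ∣ + 2 * x + y ∣ ℕ.+ 3 ℕ.* (∣ y ∣ ℕ.* ∣ y ∣))) (cong (λ b → + 2 * (+ (∣ + 2 * x + y ∣ ℕ.* ∣ + 2 * x + y ∣) + b)) (ℤₚ.pos-* 3 (∣ y ∣ ℕ.* ∣ y ∣))))))))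
  bound : ∀ x y → ∣ y ∣ ℕ.≤ val x y
  bound x y = ℕₚ.≤-trans (n≤n*n ∣ y ∣) (ℕₚ.≤-trans (ℕₚ.m≤n*m (∣ y ∣ ℕ.* ∣ y ∣) 3) (ℕₚ.≤-trans (ℕₚ.m≤n+m (3 ℕ.* (∣ y ∣ ℕ.* ∣ y ∣)) (∣ + 2 * x + y ∣ ℕ.* ∣ + 2 * x + y ∣))
    (ℕₚ.≤-trans (ℕₚ.m≤n*m _ 2) (ℕₚ.m≤n*m _ (suc (ℕ.pred m))))))

Positive : ℤ → Set
Positive x = 0ℤ ℤ.< x

-- The series over `Dv m` are Lambert series: divisor sums in the variable q^m.
Dv : ℕ → Sys (ℤ × ℤ)
Dv m = mkSys {R = λ (c , d) → Positive c × Positive d} (λ (c , d) → (0ℤ ℤ.<? c) ×-dec (0ℤ ℤ.<? d))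
  (λ (c , d) → ⟪ m ⟫ * (c * d)) range² (λ n → Uniq.cartesianProduct⁺ (range-unique n) (range-unique n)) bnd
  where
  bnd : ∀ {z} → Positive (proj₁ z) × Positive (proj₂ z) → ∃[ n ] (⟪ m ⟫ * (proj₁ z * proj₂ z) ≡ + n × z ∈ range² n)
  bnd {+ suc c , + suc d} _ = suc (ℕ.pred m) ℕ.* (suc c ℕ.* suc d) ,
    trans (cong (⟪ m ⟫ *_) (sym (ℤₚ.pos-* (suc c) (suc d)))) (sym (ℤₚ.pos-* (suc (ℕ.pred m)) (suc c ℕ.* suc d))) ,
    ∈-cartesianProduct⁺ (∈-range (ℕₚ.≤-trans (ℕₚ.m≤m*n (suc c) (suc d)) (ℕₚ.m≤n*m (suc c ℕ.* suc d) (suc (ℕ.pred m)))))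
                        (∈-range (ℕₚ.≤-trans (ℕₚ.m≤n*m (suc d) (suc c)) (ℕₚ.m≤n*m (suc c ℕ.* suc d) (suc (ℕ.pred m)))))
  bnd {+ zero , d} (ℤ.+<+ () , _)
  bnd {+ suc c , + zero} (_ , ℤ.+<+ ())
  bnd {+ suc c , -[1+ d ]} (_ , ())
  bnd { -[1+ c ] , d} (() , _)

-- Functions of period 12 and their decision procedure

%-unique : ∀ n .{{_ : ℕ.NonZero n}} {r s} a b → r ℕ.< n → s ℕ.< n → + r + a * + n ≡ + s + b * + n → r ≡ s
%-unique n {r} {s} a b r<n s<n eq = ℤₚ.+-injective (trans (sym (mod r a r<n)) (trans (cong (λ z → + (z %ℕ n)) eq) (mod s b s<n)))
  where
  mod : ∀ r a → r ℕ.< n → + ((+ r + a * + n) %ℕ n) ≡ + r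
  mod r a r<n = go (a≡a%ℕn+[a/ℕn]*n (+ r + a * + n) n) (n%ℕd<d (+ r + a * + n) n)
    where
    lem : ∀ r a N r' b → r + a * N ≡ r' + b * N → r ≡ r' + (b - a) * N
    lem r a N r' b q = trans (l1 r a N) (trans (cong (_- a * N) q) (l2 r' b N a))
      where
      l1 : ∀ r a N → r ≡ r + a * N - a * N
      l1 = solve-∀
      l2 : ∀ r' b N a → r' + b * N - a * N ≡ r' + (b - a) * N
      l2 = solve-∀
    small : ∀ (r r' : ℕ) (c : ℤ) → r ℕ.< n → r' ℕ.< n → + r ≡ + r' + c * + n → r ≡ r'
    small r r' (+ zero) _ _ q = ℤₚ.+-injective (trans q (ℤₚ.+-identityʳ (+ r')))
    small r r' (+ suc c) r< _ q = ⊥-elim (ℕₚ.<-irrefl refl (ℕₚ.<-≤-trans r< (subst (n ℕ.≤_) (sym (ℤₚ.+-injective (trans q (cong (_+_ (+ r')) (sym (ℤₚ.pos-* (suc c) n)))))) (ℕₚ.≤-trans (ℕₚ.m≤n*m n (suc c)) (ℕₚ.m≤n+m _ r')))))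
    small r r' -[1+ c ] r< r'< q = sym (small r' r (+ suc c) r'< r< (sw (+ r) (+ r') (+ suc c) (+ n) q))
      where
      sw : ∀ r r' c N → r ≡ r' + (- c) * N → r' ≡ r + c * N
      sw r r' c N q = trans (l r' c N) (cong (_+ c * N) (sym q))
        where
        l : ∀ r' c N → r' ≡ r' + (- c) * N + c * N
        l = solve-∀
    go : + r + a * + n ≡ + ((+ r + a * + n) %ℕ n) + ((+ r + a * + n) /ℕ n) * + n → (+ r + a * + n) %ℕ n ℕ.< n → + ((+ r + a * + n) %ℕ n) ≡ + r
    go q r'< = cong +_ (sym (small r ((+ r + a * + n) %ℕ n) ((+ r + a * + n) /ℕ n - a) r<n r'< (lem (+ r) a (+ n) (+ ((+ r + a * + n) %ℕ n)) ((+ r + a * + n) /ℕ n) q)))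

%ℕ-periodic : ∀ n .{{_ : ℕ.NonZero n}} x k → (x + + n * k) %ℕ n ≡ x %ℕ n
%ℕ-periodic n x k = %-unique n ((x + + n * k) /ℕ n) (x /ℕ n + k) (n%ℕd<d (x + + n * k) n) (n%ℕd<d x n)
  (trans (sym (a≡a%ℕn+[a/ℕn]*n (x + + n * k) n)) (trans (cong (_+ + n * k) (a≡a%ℕn+[a/ℕn]*n x n)) (lem (+ (x %ℕ n)) (x /ℕ n) (+ n) k)))
  where
  lem : ∀ r q N k → r + q * N + N * k ≡ r + (q + k) * N
  lem = solve-∀

at : List ℤ → ℕ → ℤ
at [] n = 0ℤ
at (x ∷ xs) zero = x
at (x ∷ xs) (suc n) = at xs n

tab : List ℤ → ℤ → ℤ
tab t x = at t (x %ℕ 12)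

tab-per : ∀ t x k → tab t (x + + 12 * k) ≡ tab t x
tab-per t x k = cong (at t) (%ℕ-periodic 12 x k)

-- In order: the characters χ₃, χ₄, χ₁₂; the Ramanujan sum ω^x + ω^(-x) with a primitive cube root
-- of unity ω; the real part of i^x; the sign (-1)^x; the indicators of the even and of the odd
-- numbers.
t₃ t₄ t₁₂ tc te ts tev tod : List ℤ
t₃ = 0ℤ ∷ 1ℤ ∷ -1ℤ ∷ 0ℤ ∷ 1ℤ ∷ -1ℤ ∷ 0ℤ ∷ 1ℤ ∷ -1ℤ ∷ 0ℤ ∷ 1ℤ ∷ -1ℤ ∷ []
t₄ = 0ℤ ∷ 1ℤ ∷ 0ℤ ∷ -1ℤ ∷ 0ℤ ∷ 1ℤ ∷ 0ℤ ∷ -1ℤ ∷ 0ℤ ∷ 1ℤ ∷ 0ℤ ∷ -1ℤ ∷ []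
t₁₂ = 0ℤ ∷ 1ℤ ∷ 0ℤ ∷ 0ℤ ∷ 0ℤ ∷ -1ℤ ∷ 0ℤ ∷ -1ℤ ∷ 0ℤ ∷ 0ℤ ∷ 0ℤ ∷ 1ℤ ∷ []
tc = + 2 ∷ -1ℤ ∷ -1ℤ ∷ + 2 ∷ -1ℤ ∷ -1ℤ ∷ + 2 ∷ -1ℤ ∷ -1ℤ ∷ + 2 ∷ -1ℤ ∷ -1ℤ ∷ []
te = 1ℤ ∷ 0ℤ ∷ -1ℤ ∷ 0ℤ ∷ 1ℤ ∷ 0ℤ ∷ -1ℤ ∷ 0ℤ ∷ 1ℤ ∷ 0ℤ ∷ -1ℤ ∷ 0ℤ ∷ []
ts = 1ℤ ∷ -1ℤ ∷ 1ℤ ∷ -1ℤ ∷ 1ℤ ∷ -1ℤ ∷ 1ℤ ∷ -1ℤ ∷ 1ℤ ∷ -1ℤ ∷ 1ℤ ∷ -1ℤ ∷ []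
tev = 1ℤ ∷ 0ℤ ∷ 1ℤ ∷ 0ℤ ∷ 1ℤ ∷ 0ℤ ∷ 1ℤ ∷ 0ℤ ∷ 1ℤ ∷ 0ℤ ∷ 1ℤ ∷ 0ℤ ∷ []
tod = 0ℤ ∷ 1ℤ ∷ 0ℤ ∷ 1ℤ ∷ 0ℤ ∷ 1ℤ ∷ 0ℤ ∷ 1ℤ ∷ 0ℤ ∷ 1ℤ ∷ 0ℤ ∷ 1ℤ ∷ []

χ₃ χ₄ χ₁₂ c₃ e₂ sgn ev od : ℤ → ℤ
χ₃ = tab t₃
χ₄ = tab t₄
χ₁₂ = tab t₁₂
c₃ = tab tc
e₂ = tab te
sgn = tab ts
ev = tab tev
od = tab tod

below : ℕ → (ℕ → Bool) → Bool
below zero p = true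
below (suc n) p = p n ∧ below n p

below-sound : ∀ n p → below n p ≡ true → ∀ {i} → i ℕ.< n → p i ≡ true
below-sound (suc n) p h {i} i<n with p n in eq | ℕₚ.m≤n⇒m<n∨m≡n (ℕₚ.≤-pred i<n)
... | true | inj₁ i< = below-sound n p h i<
... | true | inj₂ refl = eq

does-sound : ∀ {x} → does (x ℤ.≟ 0ℤ) ≡ true → x ≡ 0ℤ
does-sound {x} h with x ℤ.≟ 0ℤ
... | yes p = p

-- Identities between 12-periodic functions of integral polynomials, decided by
-- running through the residues of the variables.
infixl 6 _⊞_ _⊟_ _:+:_ _:-:_

infixl 7 _·_ _⊠_ _:*:_
data Lin (n : ℕ) : Set where
  var : Fin n → Lin n
  lit : ℤ → Lin n
  _⊞_ _⊟_ _⊠_ : Lin n → Lin n → Lin n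
  _·_ : ℤ → Lin n → Lin n
  neg : Lin n → Lin n

data Exp (n : ℕ) : Set where
  cst : ℤ → Exp n
  ap : List ℤ → Lin n → Exp n
  _:+:_ _:-:_ _:*:_ : Exp n → Exp n → Exp n
  negᵉ : Exp n → Exp n

⟦_⟧ₗ : ∀ {n} → Lin n → Vec ℤ n → ℤ
⟦ var i ⟧ₗ ρ = lookup ρ i
⟦ lit c ⟧ₗ ρ = c
⟦ l ⊞ m ⟧ₗ ρ = ⟦ l ⟧ₗ ρ + ⟦ m ⟧ₗ ρ
⟦ l ⊟ m ⟧ₗ ρ = ⟦ l ⟧ₗ ρ - ⟦ m ⟧ₗ ρ
⟦ l ⊠ m ⟧ₗ ρ = ⟦ l ⟧ₗ ρ * ⟦ m ⟧ₗ ρ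
⟦ c · l ⟧ₗ ρ = c * ⟦ l ⟧ₗ ρ
⟦ neg l ⟧ₗ ρ = - ⟦ l ⟧ₗ ρ

⟦_⟧ : ∀ {n} → Exp n → Vec ℤ n → ℤ
⟦ cst c ⟧ ρ = c
⟦ ap t l ⟧ ρ = tab t (⟦ l ⟧ₗ ρ)
⟦ e :+: f ⟧ ρ = ⟦ e ⟧ ρ + ⟦ f ⟧ ρ
⟦ e :-: f ⟧ ρ = ⟦ e ⟧ ρ - ⟦ f ⟧ ρ
⟦ e :*: f ⟧ ρ = ⟦ e ⟧ ρ * ⟦ f ⟧ ρ
⟦ negᵉ e ⟧ ρ = - ⟦ e ⟧ ρ

residue : ℤ → ℤ
residue x = + (x %ℕ 12)

residues : ∀ {n} → Vec ℤ n → Vec ℤ n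
residues = Vec.map residue

lin-residues : ∀ {n} (l : Lin n) ρ → ∃[ k ] (⟦ l ⟧ₗ ρ ≡ ⟦ l ⟧ₗ (residues ρ) + + 12 * k)
lin-residues (var zero) (x ∷ ρ) = x /ℕ 12 , trans (a≡a%ℕn+[a/ℕn]*n x 12) (cong (_+_ (+ (x %ℕ 12))) (ℤₚ.*-comm (x /ℕ 12) (+ 12)))
lin-residues (var (suc i)) (x ∷ ρ) = lin-residues (var i) ρ
lin-residues (lit c) ρ = 0ℤ , sym (ℤₚ.+-identityʳ c)
lin-residues (l ⊞ m) ρ with lin-residues l ρ | lin-residues m ρ
... | k , p | k' , q = k + k' , trans (cong₂ _+_ p q) (lem (⟦ l ⟧ₗ (residues ρ)) k (⟦ m ⟧ₗ (residues ρ)) k')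
  where
  lem : ∀ a k b k' → (a + + 12 * k) + (b + + 12 * k') ≡ (a + b) + + 12 * (k + k')
  lem = solve-∀
lin-residues (l ⊟ m) ρ with lin-residues l ρ | lin-residues m ρ
... | k , p | k' , q = k - k' , trans (cong₂ _-_ p q) (lem (⟦ l ⟧ₗ (residues ρ)) k (⟦ m ⟧ₗ (residues ρ)) k')
  where
  lem : ∀ a k b k' → (a + + 12 * k) - (b + + 12 * k') ≡ (a - b) + + 12 * (k - k')
  lem = solve-∀
lin-residues (l ⊠ m) ρ with lin-residues l ρ | lin-residues m ρ
... | k , p | k' , q = ⟦ l ⟧ₗ (residues ρ) * k' + k * ⟦ m ⟧ₗ (residues ρ) + + 12 * (k * k') , trans (cong₂ _*_ p q) (lem (⟦ l ⟧ₗ (residues ρ)) k (⟦ m ⟧ₗ (residues ρ)) k')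
  where
  lem : ∀ a k b k' → (a + + 12 * k) * (b + + 12 * k') ≡ a * b + + 12 * (a * k' + k * b + + 12 * (k * k'))
  lem = solve-∀
lin-residues (c · l) ρ with lin-residues l ρ
... | k , p = c * k , trans (cong (c *_) p) (lem c (⟦ l ⟧ₗ (residues ρ)) k)
  where
  lem : ∀ c a k → c * (a + + 12 * k) ≡ c * a + + 12 * (c * k)
  lem = solve-∀
lin-residues (neg l) ρ with lin-residues l ρ
... | k , p = - k , trans (cong -_ p) (lem (⟦ l ⟧ₗ (residues ρ)) k)
  where
  lem : ∀ a k → - (a + + 12 * k) ≡ - a + + 12 * (- k)
  lem = solve-∀

exp-residues : ∀ {n} (e : Exp n) ρ → ⟦ e ⟧ ρ ≡ ⟦ e ⟧ (residues ρ)
exp-residues (cst c) ρ = refl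
exp-residues (ap t l) ρ = let (k , p) = lin-residues l ρ in trans (cong (tab t) p) (tab-per t (⟦ l ⟧ₗ (residues ρ)) k)
exp-residues (e :+: f) ρ = cong₂ _+_ (exp-residues e ρ) (exp-residues f ρ)
exp-residues (e :-: f) ρ = cong₂ _-_ (exp-residues e ρ) (exp-residues f ρ)
exp-residues (e :*: f) ρ = cong₂ _*_ (exp-residues e ρ) (exp-residues f ρ)
exp-residues (negᵉ e) ρ = cong -_ (exp-residues e ρ)

check : ∀ n → (Vec ℤ n → ℤ) → Bool
check zero f = does (f [] ℤ.≟ 0ℤ)
check (suc n) f = below 12 λ i → check n (λ ρ → f (+ i ∷ ρ))

check-sound : ∀ n f → check n f ≡ true → ∀ ρ → f (residues ρ) ≡ 0ℤ
check-sound zero f h [] = does-sound h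
check-sound (suc n) f h (x ∷ ρ) = check-sound n (λ ρ → f (residue x ∷ ρ)) (below-sound 12 (λ i → check n (λ ρ → f (+ i ∷ ρ))) h (n%ℕd<d x 12)) ρ

-- Both sides depend only on the residues modulo 12, so a proof `refl` of the premise evaluates them
-- at all 12^n residue vectors.
decide : ∀ {n} (e f : Exp n) → check n ⟦ e :-: f ⟧ ≡ true → ∀ ρ → ⟦ e ⟧ ρ ≡ ⟦ f ⟧ ρ
decide {n} e f h ρ = ℤₚ.i-j≡0⇒i≡j _ _ (trans (exp-residues (e :-: f) ρ) (check-sound n ⟦ e :-: f ⟧ h ρ))

pattern v₀ = var zero
pattern v₁ = var (suc zero)
pattern v₂ = var (suc (suc zero))
pattern v₃ = var (suc (suc (suc zero)))

χ₄-neg : ∀ b → χ₄ (- b) ≡ - χ₄ b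
χ₄-neg b = decide (ap t₄ (neg v₀)) (negᵉ (ap t₄ v₀)) refl (b ∷ [])

-- Identities between theta series

even∨odd : ∀ x → (∃[ k ] (+ 2 * k ≡ x)) ⊎ (∃[ k ] (odd k ≡ x))
even∨odd x with x %ℕ 2 | a≡a%ℕn+[a/ℕn]*n x 2 | n%ℕd<d x 2
... | 0 | q | _ = inj₁ (x /ℕ 2 , sym (trans q (lem (x /ℕ 2))))
  where
  lem : ∀ y → 0ℤ + y * + 2 ≡ + 2 * y
  lem = solve-∀
... | 1 | q | _ = inj₂ (x /ℕ 2 , sym (trans q (lem (x /ℕ 2))))
  where
  lem : ∀ y → 1ℤ + y * + 2 ≡ + 2 * y + 1ℤ
  lem = solve-∀
... | suc (suc _) | _ | s≤s (s≤s ())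

ev-2* : ∀ x → ev (+ 2 * x) ≡ 1ℤ
ev-2* x = decide (ap tev (+ 2 · v₀)) (cst 1ℤ) refl (x ∷ [])

ev-odd : ∀ x → ev (odd x) ≡ 0ℤ
ev-odd x = decide (ap tev (+ 2 · v₀ ⊞ lit 1ℤ)) (cst 0ℤ) refl (x ∷ [])

1≢0 : 1ℤ ≢ 0ℤ
1≢0 ()

even≢odd : ∀ x y → + 2 * x ≡ odd y → ⊥
even≢odd x y q = 1≢0 (trans (sym (ev-2* x)) (trans (cong ev q) (ev-odd y)))

2*-inj : ∀ x y → + 2 * x ≡ + 2 * y → x ≡ y
2*-inj x y = ℤₚ.*-cancelˡ-≡ (+ 2) x y

-- In terms of Dedekind's function, `J m` is 2η(8mτ)³ and `E m` is 2η(24mτ), because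
-- `sgn n * χ₃ (odd n)` is χ₁₂ at 2n + 1.
φ φ⁻ θ J E : ℕ → Ser
φ m = gen (Sq m) (λ _ → 1ℤ)
φ⁻ m = gen (Sq m) sgn
θ m = gen (Odd m) (λ _ → 1ℤ)
J m = gen (Odd m) (λ n → sgn n * odd n)
E m = gen (Odd m) (λ n → sgn n * χ₃ (odd n))

sq-decomp : ∀ m → 1 ℕ.≤ m → ∀ w n → gen (Sq m) w n ≡ gen (Sq (4 ℕ.* m)) (λ k → w (+ 2 * k)) n + gen (Odd m) (λ k → w (odd k)) n
sq-decomp m h w = gen-decomp (Sq m) (Sq (4 ℕ.* m)) (Odd m) w (λ k → + 2 * k) odd (λ _ → tt) (λ _ → tt)
  (λ {k} _ → trans (lem ⟪ m ⟫ k) (cong (_* (k * k)) (sym (⟪⟫-* 3 m h)))) (λ _ → refl)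
  (λ {x} {y} → 2*-inj x y) (λ {x} {y} q → 2*-inj x y (∙-cancelʳ 1ℤ (+ 2 * x) (+ 2 * y) q))
  (λ {x} {y} → even≢odd x y)
  λ {x} _ → [ (λ (k , q) → inj₁ (k , tt , q)) , (λ (k , q) → inj₂ (k , tt , q)) ]′ (even∨odd x)
  where
  lem : ∀ M k → M * ((+ 2 * k) * (+ 2 * k)) ≡ (+ 4 * M) * (k * k)
  lem = solve-∀

φ-split : ∀ m → 1 ℕ.≤ m → φ m ≈ φ (4 ℕ.* m) ⊹ θ m
φ-split m h n = trans (sq-decomp m h (λ _ → 1ℤ) n) (sym (⊹-def _ _ n))

φ⁻-split : ∀ m → 1 ℕ.≤ m → φ⁻ m ≈ φ (4 ℕ.* m) ⊖ θ m
φ⁻-split m h n = trans (trans (sq-decomp m h sgn n) (cong₂ _+_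
  (gen-cong (Sq (4 ℕ.* m)) (λ k → decide (ap ts (+ 2 · v₀)) (cst 1ℤ) refl (k ∷ [])) n)
  (trans (gen-cong (Odd m) (λ k → decide (ap ts (+ 2 · v₀ ⊞ lit 1ℤ)) (cst -1ℤ) refl (k ∷ [])) n)
    (trans (gen-neg (Odd m) (λ _ → 1ℤ) n) (sym (⊝-def _ n)))))) (sym (⊹-def _ _ n))

pair-inj : ∀ {x y x' y' u v u' v' : ℤ} d .{{_ : ℤ.NonZero d}} (a b : ℤ → ℤ → ℤ) →
  (u , v) ≡ (u' , v') → a u v ≡ d * x → a u' v' ≡ d * x' → b u v ≡ d * y → b u' v' ≡ d * y' → (x , y) ≡ (x' , y')
pair-inj {x} {y} {x'} {y'} d a b refl p p' q q' =
  cong₂ _,_ (ℤₚ.*-cancelˡ-≡ d x x' (trans (sym p) p')) (ℤₚ.*-cancelˡ-≡ d y y' (trans (sym q) q'))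

-- For odd x and y, x² + y² is twice the sum of the squares of (x + y)/2 and (x - y)/2, exactly one
-- of which is odd. The two branches tell which.
odd-odd-decomp : ∀ m → 1 ℕ.≤ m → ∀ w n → gen (Odd m ⊗ Odd m) w n ≡
  gen (Odd (2 ℕ.* m) ⊗ Sq (8 ℕ.* m)) (λ (i , j) → w (i + j , i - j)) n +
  gen (Odd (2 ℕ.* m) ⊗ Sq (8 ℕ.* m)) (λ (i , j) → w (i + j , j - i - 1ℤ)) n
odd-odd-decomp m h w = gen-decomp (Odd m ⊗ Odd m) T T w (λ (i , j) → i + j , i - j) (λ (i , j) → i + j , j - i - 1ℤ)
  (λ _ → tt , tt) (λ _ → tt , tt)
  (λ {(i , j)} _ → trans (lem₁ ⟪ m ⟫ i j) (e-eq i j)) (λ {(i , j)} _ → trans (lem₂ ⟪ m ⟫ i j) (e-eq i j))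
  (λ {(i , j)} {(i' , j')} q → pair-inj (+ 2) (λ u v → u + v) (λ u v → u - v) q (l₁ i j) (l₁ i' j') (l₂ i j) (l₂ i' j'))
  (λ {(i , j)} {(i' , j')} q → pair-inj (+ 2) (λ u v → u - v - 1ℤ) (λ u v → u + v + 1ℤ) q (l₃ i j) (l₃ i' j') (l₄ i j) (l₄ i' j'))
  (λ {(i , j)} {(i' , j')} q → even≢odd i (j' - 1ℤ) (trans (sym (l₁ i j)) (trans (cong₂ _+_ (,-injectiveˡ q) (,-injectiveʳ q)) (l₅ i' j'))))
  λ {(n , k)} _ → [ (λ (i , q) → inj₁ ((i , n - i) , (tt , tt) , cong₂ _,_ (l₆ n i) (trans (l₇ n i) (trans (cong (_- n) q) (l₈ n k)))))
                  , (λ (i , q) → inj₂ ((n - i - 1ℤ , i + 1ℤ) , (tt , tt) , cong₂ _,_ (l₉ n i) (trans (l₁₀ n i) (trans (cong (_- n) q) (l₈ n k))))) ]′ (even∨odd (n + k))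
  where
  T = Odd (2 ℕ.* m) ⊗ Sq (8 ℕ.* m)
  lem₁ : ∀ M i j → M * ((+ 2 * (i + j) + 1ℤ) * (+ 2 * (i + j) + 1ℤ)) + M * ((+ 2 * (i - j) + 1ℤ) * (+ 2 * (i - j) + 1ℤ))
    ≡ (+ 2 * M) * ((+ 2 * i + 1ℤ) * (+ 2 * i + 1ℤ)) + (+ 8 * M) * (j * j)
  lem₁ = solve-∀
  lem₂ : ∀ M i j → M * ((+ 2 * (i + j) + 1ℤ) * (+ 2 * (i + j) + 1ℤ)) + M * ((+ 2 * (j - i - 1ℤ) + 1ℤ) * (+ 2 * (j - i - 1ℤ) + 1ℤ))
    ≡ (+ 2 * M) * ((+ 2 * i + 1ℤ) * (+ 2 * i + 1ℤ)) + (+ 8 * M) * (j * j)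
  lem₂ = solve-∀
  e-eq : ∀ i j → (+ 2 * ⟪ m ⟫) * (odd i * odd i) + (+ 8 * ⟪ m ⟫) * (j * j) ≡ e T (i , j)
  e-eq i j = cong₂ (λ a b → a * (odd i * odd i) + b * (j * j)) (sym (⟪⟫-* 1 m h)) (sym (⟪⟫-* 7 m h))
  l₁ : ∀ i j → (i + j) + (i - j) ≡ + 2 * i
  l₁ = solve-∀
  l₂ : ∀ i j → (i + j) - (i - j) ≡ + 2 * j
  l₂ = solve-∀
  l₃ : ∀ i j → (i + j) - (j - i - 1ℤ) - 1ℤ ≡ + 2 * i
  l₃ = solve-∀
  l₄ : ∀ i j → (i + j) + (j - i - 1ℤ) + 1ℤ ≡ + 2 * j
  l₄ = solve-∀
  l₅ : ∀ i j → (i + j) + (j - i - 1ℤ) ≡ + 2 * (j - 1ℤ) + 1ℤ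
  l₅ = solve-∀
  l₆ : ∀ n i → i + (n - i) ≡ n
  l₆ = solve-∀
  l₇ : ∀ n i → i - (n - i) ≡ + 2 * i - n
  l₇ = solve-∀
  l₈ : ∀ n k → (n + k) - n ≡ k
  l₈ = solve-∀
  l₉ : ∀ n i → (n - i - 1ℤ) + (i + 1ℤ) ≡ n
  l₉ = solve-∀
  l₁₀ : ∀ n i → (i + 1ℤ) - (n - i - 1ℤ) - 1ℤ ≡ (+ 2 * i + 1ℤ) - n
  l₁₀ = solve-∀

θ² : ∀ m → 1 ℕ.≤ m → θ m ⊛ θ m ≈ θ (2 ℕ.* m) ⊛ φ (8 ℕ.* m) ⊹ θ (2 ℕ.* m) ⊛ φ (8 ℕ.* m)
θ² m h n = trans (sym (gen-⊗ (Odd m) (Odd m) one one n))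
  (trans (odd-odd-decomp m h (λ _ → 1ℤ) n) (trans (cong₂ _+_ (gen-⊗ (Odd (2 ℕ.* m)) (Sq (8 ℕ.* m)) one one n) (gen-⊗ (Odd (2 ℕ.* m)) (Sq (8 ℕ.* m)) one one n)) (sym (⊹-def _ _ n))))
  where
  one : ℤ → ℤ
  one _ = 1ℤ

Jθ : ∀ m → 1 ℕ.≤ m → J m ⊛ θ m ≈ J (2 ℕ.* m) ⊛ φ⁻ (8 ℕ.* m) ⊹ J (2 ℕ.* m) ⊛ φ⁻ (8 ℕ.* m)
Jθ m h n = trans (sym (gen-⊗ (Odd m) (Odd m) (λ n → sgn n * odd n) one n))
  (trans (odd-odd-decomp m h (λ (n , k) → (sgn n * odd n) * one k) n) (trans (cong₂ _+_ piece piece) (sym (⊹-def _ _ n))))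
  where
  one : ℤ → ℤ
  one _ = 1ℤ
  T = Odd (2 ℕ.* m) ⊗ Sq (8 ℕ.* m)
  expand : ∀ a b i j → (a * b) * (+ 2 * (i + j) + 1ℤ) * 1ℤ ≡ (a * (+ 2 * i + 1ℤ)) * b + (a * b) * (+ 2 * j)
  expand = solve-∀
  flip : ∀ a b j → (a * b) * (+ 2 * j) ≡ - ((a * b) * (+ 2 * (- j)))
  flip = solve-∀
  sq-neg : ∀ a M j → a + M * ((- j) * (- j)) ≡ a + M * (j * j)
  sq-neg = solve-∀
  piece : gen T (λ (i , j) → (sgn (i + j) * odd (i + j)) * 1ℤ) n ≡ (J (2 ℕ.* m) ⊛ φ⁻ (8 ℕ.* m)) n
  piece = trans (gen-cong T {v = λ (i , j) → (sgn i * odd i) * sgn j + (sgn i * sgn j) * (+ 2 * j)}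
      (λ (i , j) → trans (cong (λ s → s * odd (i + j) * 1ℤ) (decide (ap ts (v₀ ⊞ v₁)) (ap ts v₀ :*: ap ts v₁) refl (i ∷ j ∷ []))) (expand (sgn i) (sgn j) i j)) n)
    (trans (gen-+ T _ _ n) (trans (cong₂ _+_ (gen-⊗ (Odd (2 ℕ.* m)) (Sq (8 ℕ.* m)) (λ i → sgn i * odd i) sgn n)
      -- odd (i + j) is odd i plus 2j, and the part with 2j changes sign under j ↦ -j. The weight
      -- involves only the first coordinate i + j, so both branches of the decomposition equal
      -- `piece`.
      (gen-anti T {λ (i , j) → (sgn i * sgn j) * (+ 2 * j)} (λ (i , j) → i , - j) (λ _ → tt , tt) (λ {(i , j)} _ → sq-neg (⟪ 2 ℕ.* m ⟫ * (odd i * odd i)) ⟪ 8 ℕ.* m ⟫ j)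
        (λ {(i , j)} _ → cong (i ,_) (ℤₚ.neg-involutive j))
        (λ {(i , j)} _ → trans (flip (sgn i) (sgn j) j) (cong (λ s → - ((sgn i * s) * (+ 2 * (- j)))) (decide (ap ts v₀) (ap ts (neg v₀)) refl (j ∷ [])))) n))
      (ℤₚ.+-identityʳ _)))

φ² : ∀ m → 1 ℕ.≤ m → φ (2 ℕ.* m) ⊛ φ (2 ℕ.* m) ≈ φ (4 ℕ.* m) ⊛ φ (4 ℕ.* m) ⊹ θ m ⊛ θ m
φ² m h n = trans (sym (gen-⊗ (Sq (2 ℕ.* m)) (Sq (2 ℕ.* m)) one one n)) (trans
  (gen-decomp (Sq (2 ℕ.* m) ⊗ Sq (2 ℕ.* m)) (Sq (4 ℕ.* m) ⊗ Sq (4 ℕ.* m)) (Odd m ⊗ Odd m) (λ _ → 1ℤ)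
    (λ (p , q) → p + q , p - q) (λ (n , k) → n + k + 1ℤ , n - k) (λ _ → tt , tt) (λ _ → tt , tt)
    (λ {(i , j)} _ → trans (cong₂ (λ a b → a * ((i + j) * (i + j)) + b * ((i - j) * (i - j))) (⟪⟫-* 1 m h) (⟪⟫-* 1 m h))
      (trans (lem₁ ⟪ m ⟫ i j) (sym (cong₂ (λ a b → a * (i * i) + b * (j * j)) (⟪⟫-* 3 m h) (⟪⟫-* 3 m h)))))
    (λ {(i , j)} _ → trans (cong₂ (λ a b → a * ((i + j + 1ℤ) * (i + j + 1ℤ)) + b * ((i - j) * (i - j))) (⟪⟫-* 1 m h) (⟪⟫-* 1 m h)) (lem₂ ⟪ m ⟫ i j))
    (λ {(i , j)} {(i' , j')} q → pair-inj (+ 2) (λ u v → u + v) (λ u v → u - v) q (l₁ i j) (l₁ i' j') (l₂ i j) (l₂ i' j'))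
    (λ {(i , j)} {(i' , j')} q → pair-inj (+ 2) (λ u v → u + v - 1ℤ) (λ u v → u - v - 1ℤ) q (l₃ i j) (l₃ i' j') (l₄ i j) (l₄ i' j'))
    (λ {(i , j)} {(i' , j')} q → even≢odd i i' (trans (sym (l₁ i j)) (trans (cong₂ _+_ (,-injectiveˡ q) (,-injectiveʳ q)) (l₅ i' j'))))
    (λ {(n , k)} _ → [ (λ (i , q) → inj₁ ((i , n - i) , (tt , tt) , cong₂ _,_ (l₆ n i) (trans (l₇ n i) (trans (cong (_- n) q) (l₈ n k)))))
                    , (λ (i , q) → inj₂ ((i , n - i - 1ℤ) , (tt , tt) , cong₂ _,_ (l₉ n i) (trans (l₁₀ n i) (trans (cong (_- n) q) (l₈ n k))))) ]′ (even∨odd (n + k))) n)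
  (trans (cong₂ _+_ (gen-⊗ (Sq (4 ℕ.* m)) (Sq (4 ℕ.* m)) one one n) (gen-⊗ (Odd m) (Odd m) one one n)) (sym (⊹-def _ _ n))))
  where
  one : ℤ → ℤ
  one _ = 1ℤ
  lem₁ : ∀ M i j → (+ 2 * M) * ((i + j) * (i + j)) + (+ 2 * M) * ((i - j) * (i - j)) ≡ (+ 4 * M) * (i * i) + (+ 4 * M) * (j * j)
  lem₁ = solve-∀
  lem₂ : ∀ M i j → (+ 2 * M) * ((i + j + 1ℤ) * (i + j + 1ℤ)) + (+ 2 * M) * ((i - j) * (i - j)) ≡ M * ((+ 2 * i + 1ℤ) * (+ 2 * i + 1ℤ)) + M * ((+ 2 * j + 1ℤ) * (+ 2 * j + 1ℤ))
  lem₂ = solve-∀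
  l₁ : ∀ i j → (i + j) + (i - j) ≡ + 2 * i
  l₁ = solve-∀
  l₂ : ∀ i j → (i + j) - (i - j) ≡ + 2 * j
  l₂ = solve-∀
  l₃ : ∀ i j → (i + j + 1ℤ) + (i - j) - 1ℤ ≡ + 2 * i
  l₃ = solve-∀
  l₄ : ∀ i j → (i + j + 1ℤ) - (i - j) - 1ℤ ≡ + 2 * j
  l₄ = solve-∀
  l₅ : ∀ i j → (i + j + 1ℤ) + (i - j) ≡ + 2 * i + 1ℤ
  l₅ = solve-∀
  l₆ : ∀ n i → i + (n - i) ≡ n
  l₆ = solve-∀
  l₇ : ∀ n i → i - (n - i) ≡ + 2 * i - n
  l₇ = solve-∀
  l₈ : ∀ n k → (n + k) - n ≡ k
  l₈ = solve-∀
  l₉ : ∀ n i → i + (n - i - 1ℤ) + 1ℤ ≡ n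
  l₉ = solve-∀
  l₁₀ : ∀ n i → i - (n - i - 1ℤ) ≡ (+ 2 * i + 1ℤ) - n
  l₁₀ = solve-∀

-- For odd x and y exactly one of y, -y is congruent to x modulo 4, whence the outer doubling. If x
-- ≡ y modulo 4, then x² + 3y² = 4(A² + 3B²) with A = (x + 3y)/4 and B = (x - y)/4, of opposite
-- parity because A - B = y.
θθ₃ : ∀ m → 1 ℕ.≤ m → θ m ⊛ θ (3 ℕ.* m) ≈
  (θ (4 ℕ.* m) ⊛ φ (48 ℕ.* m) ⊹ φ (16 ℕ.* m) ⊛ θ (12 ℕ.* m)) ⊹ (θ (4 ℕ.* m) ⊛ φ (48 ℕ.* m) ⊹ φ (16 ℕ.* m) ⊛ θ (12 ℕ.* m))
θθ₃ m h n = trans (sym (gen-⊗ (Odd m) (Odd (3 ℕ.* m)) one one n)) (trans (gen-restrict P? S (λ _ → 1ℤ) n)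
  (trans (cong₂ _+_ half (trans (gen-bij (restrict (¬? ∘ P?) S) (restrict P? S) (λ (n , k) → n , -1ℤ - k)
    (λ {(n , k)} (_ , ¬p) → (tt , tt) , [ (λ p → ⊥-elim (¬p p)) , (λ p → trans (refl-ev n k) (cong (_-_ 1ℤ) p)) ]′ (ev01 (n - k)))
    (λ {(n , k)} _ → cong (_+_ (⟪ m ⟫ * (odd n * odd n))) (lem₀ ⟪ 3 ℕ.* m ⟫ k))
    (λ {(n , k)} {(n' , k')} _ _ q → cong₂ _,_ (,-injectiveˡ q) (ℤₚ.neg-injective (∙-cancelˡ -1ℤ (- k) (- k') (,-injectiveʳ q))))
    (λ {(n , k)} (_ , p) → (n , -1ℤ - k) , ((tt , tt) , λ p' → 1≢0 (trans (sym p') (trans (refl-ev n k) (cong (_-_ 1ℤ) p)))) , cong (n ,_) (l₀ k))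
    (λ _ → refl) n) half)) (sym (⊹-def _ _ n))))
  where
  one : ℤ → ℤ
  one _ = 1ℤ
  S = Odd m ⊗ Odd (3 ℕ.* m)
  T₁ = Odd (4 ℕ.* m) ⊗ Sq (48 ℕ.* m)
  T₂ = Sq (16 ℕ.* m) ⊗ Odd (12 ℕ.* m)
  P : ℤ × ℤ → Set
  P (n , k) = ev (n - k) ≡ 1ℤ
  P? : Decidable P
  P? (n , k) = ev (n - k) ℤ.≟ 1ℤ
  ev01 : ∀ x → ev x ≡ 1ℤ ⊎ ev x ≡ 0ℤ
  ev01 x with even∨odd x
  ... | inj₁ (k , refl) = inj₁ (ev-2* k)
  ... | inj₂ (k , refl) = inj₂ (ev-odd k)
  refl-ev : ∀ n k → ev (n - (-1ℤ - k)) ≡ 1ℤ - ev (n - k)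
  refl-ev n k = decide (ap tev (v₀ ⊟ (lit -1ℤ ⊟ v₁))) (cst 1ℤ :-: ap tev (v₀ ⊟ v₁)) refl (n ∷ k ∷ [])
  lem₀ : ∀ M k → M * ((+ 2 * (-1ℤ - k) + 1ℤ) * (+ 2 * (-1ℤ - k) + 1ℤ)) ≡ M * ((+ 2 * k + 1ℤ) * (+ 2 * k + 1ℤ))
  lem₀ = solve-∀
  l₀ : ∀ k → -1ℤ - (-1ℤ - k) ≡ k
  l₀ = solve-∀
  lem₁ : ∀ M i j → M * ((+ 2 * (i + + 3 * j) + 1ℤ) * (+ 2 * (i + + 3 * j) + 1ℤ)) + (+ 3 * M) * ((+ 2 * (i - j) + 1ℤ) * (+ 2 * (i - j) + 1ℤ))
    ≡ (+ 4 * M) * ((+ 2 * i + 1ℤ) * (+ 2 * i + 1ℤ)) + (+ 48 * M) * (j * j)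
  lem₁ = solve-∀
  lem₂ : ∀ M i j → M * ((+ 2 * (i + + 3 * j + 1ℤ) + 1ℤ) * (+ 2 * (i + + 3 * j + 1ℤ) + 1ℤ)) + (+ 3 * M) * ((+ 2 * (i - j - 1ℤ) + 1ℤ) * (+ 2 * (i - j - 1ℤ) + 1ℤ))
    ≡ (+ 16 * M) * (i * i) + (+ 12 * M) * ((+ 2 * j + 1ℤ) * (+ 2 * j + 1ℤ))
  lem₂ = solve-∀
  l₁ : ∀ i j → (i + + 3 * j) + + 3 * (i - j) ≡ + 4 * i
  l₁ = solve-∀
  l₂ : ∀ i j → (i + + 3 * j) - (i - j) ≡ + 4 * j
  l₂ = solve-∀
  l₃ : ∀ i j → (i + + 3 * j + 1ℤ) + + 3 * (i - j - 1ℤ) + + 2 ≡ + 4 * i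
  l₃ = solve-∀
  l₄ : ∀ i j → (i + + 3 * j + 1ℤ) - (i - j - 1ℤ) - + 2 ≡ + 4 * j
  l₄ = solve-∀
  l₅ : ∀ i j → (i + + 3 * j) - (i - j) ≡ + 2 * (+ 2 * j)
  l₅ = solve-∀
  l₆ : ∀ i j → (i + + 3 * j + 1ℤ) - (i - j - 1ℤ) ≡ + 2 * (+ 2 * j + 1ℤ)
  l₆ = solve-∀
  l₇ : ∀ k j → (k + j) + + 3 * j ≡ k + + 2 * (+ 2 * j)
  l₇ = solve-∀
  l₈ : ∀ k j → (k + j) - j ≡ k
  l₈ = solve-∀
  l₉ : ∀ k j → (k + j + 1ℤ) + + 3 * j + 1ℤ ≡ k + + 2 * (+ 2 * j + 1ℤ)
  l₉ = solve-∀
  l₁₀ : ∀ k j → (k + j + 1ℤ) - j - 1ℤ ≡ k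
  l₁₀ = solve-∀
  l₁₁ : ∀ k n → k + (n - k) ≡ n
  l₁₁ = solve-∀
  surj : ∀ {z} → R (restrict P? S) z → (∃[ i ] (R T₁ i × (proj₁ i + + 3 * proj₂ i , proj₁ i - proj₂ i) ≡ z)) ⊎ (∃[ i ] (R T₂ i × (proj₁ i + + 3 * proj₂ i + 1ℤ , proj₁ i - proj₂ i - 1ℤ) ≡ z))
  surj {n , k} (_ , p) with even∨odd (n - k)
  ... | inj₂ (t , q) = ⊥-elim (1≢0 (trans (sym p) (trans (cong ev (sym q)) (ev-odd t))))
  ... | inj₁ (t , q) with even∨odd t
  ... | inj₁ (j , refl) = inj₁ ((k + j , j) , (tt , tt) , cong₂ _,_ (trans (l₇ k j) (trans (cong (_+_ k) q) (l₁₁ k n))) (l₈ k j))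
  ... | inj₂ (j , refl) = inj₂ ((k + j + 1ℤ , j) , (tt , tt) , cong₂ _,_ (trans (l₉ k j) (trans (cong (_+_ k) q) (l₁₁ k n))) (l₁₀ k j))
  half : gen (restrict P? S) (λ _ → 1ℤ) n ≡ (θ (4 ℕ.* m) ⊛ φ (48 ℕ.* m) ⊹ φ (16 ℕ.* m) ⊛ θ (12 ℕ.* m)) n
  half = trans (gen-decomp (restrict P? S) T₁ T₂ (λ _ → 1ℤ) (λ (i , j) → i + + 3 * j , i - j) (λ (i , j) → i + + 3 * j + 1ℤ , i - j - 1ℤ)
      (λ {(i , j)} _ → (tt , tt) , trans (cong ev (l₅ i j)) (ev-2* (+ 2 * j)))
      (λ {(i , j)} _ → (tt , tt) , trans (cong ev (l₆ i j)) (ev-2* (+ 2 * j + 1ℤ)))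
      (λ {(i , j)} _ → trans (cong (λ c → ⟪ m ⟫ * (odd (i + + 3 * j) * odd (i + + 3 * j)) + c * (odd (i - j) * odd (i - j))) (⟪⟫-* 2 m h))
        (trans (lem₁ ⟪ m ⟫ i j) (cong₂ (λ a b → a * (odd i * odd i) + b * (j * j)) (sym (⟪⟫-* 3 m h)) (sym (⟪⟫-* 47 m h)))))
      (λ {(i , j)} _ → trans (cong (λ c → ⟪ m ⟫ * (odd (i + + 3 * j + 1ℤ) * odd (i + + 3 * j + 1ℤ)) + c * (odd (i - j - 1ℤ) * odd (i - j - 1ℤ))) (⟪⟫-* 2 m h))
        (trans (lem₂ ⟪ m ⟫ i j) (cong₂ (λ a b → a * (i * i) + b * (odd j * odd j)) (sym (⟪⟫-* 15 m h)) (sym (⟪⟫-* 11 m h)))))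
      (λ {(i , j)} {(i' , j')} q → pair-inj (+ 4) (λ u v → u + + 3 * v) (λ u v → u - v) q (l₁ i j) (l₁ i' j') (l₂ i j) (l₂ i' j'))
      (λ {(i , j)} {(i' , j')} q → pair-inj (+ 4) (λ u v → u + + 3 * v + + 2) (λ u v → u - v - + 2) q (l₃ i j) (l₃ i' j') (l₄ i j) (l₄ i' j'))
      (λ {(i , j)} {(i' , j')} q → even≢odd j j' (2*-inj (+ 2 * j) (odd j') (trans (sym (l₅ i j)) (trans (cong₂ _-_ (,-injectiveˡ q) (,-injectiveʳ q)) (l₆ i' j')))))
      surj n)
    (trans (cong₂ _+_ (gen-⊗ (Odd (4 ℕ.* m)) (Sq (48 ℕ.* m)) one one n) (gen-⊗ (Sq (16 ℕ.* m)) (Odd (12 ℕ.* m)) one one n)) (sym (⊹-def _ _ n)))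

-- Leading terms of the theta series

X-off : ∀ c {r n} → n ≢ r → X c r n ≡ 0ℤ
X-off c {zero} {zero} h = ⊥-elim (h refl)
X-off c {zero} {suc n} h = refl
X-off c {suc r} {zero} h = refl
X-off c {suc r} {suc n} h = X-off c (h ∘ cong suc)

Lead-weaken : ∀ {m m' f c r} → m' ℕ.≤ m → Lead m f c r → Lead m' f c r
Lead-weaken {r = r} h l = lead λ n< → approx l (ℕₚ.<-≤-trans n< (ℕₚ.+-monoʳ-≤ r h))

⟪⟫*-ℕ : ∀ {m n} k → 1 ℕ.≤ m → ⟪ m ⟫ * + k ≡ + n → m ℕ.* k ≡ n
⟪⟫*-ℕ {suc m} k (s≤s _) q = ℤₚ.+-injective (trans (ℤₚ.pos-* (suc m) k) q)

odd-small : ∀ {m n} → 1 ℕ.≤ m → ∀ i → ⟪ m ⟫ * (odd i * odd i) ≡ + n → n ℕ.< m ℕ.+ 8 ℕ.* m → i ≡ 0ℤ ⊎ i ≡ -1ℤ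
odd-small h (+ zero) q n< = inj₁ refl
odd-small h -[1+ zero ] q n< = inj₂ refl
odd-small {m} {n} h i@(+ suc k) q n< = ⊥-elim (ℕₚ.<-irrefl refl (ℕₚ.<-≤-trans n< (ℕₚ.≤-trans (big ∣ odd i ∣ three) (ℕₚ.≤-reflexive (⟪⟫*-ℕ _ h (trans (cong (⟪ m ⟫ *_) (sym (sq-abs (odd i)))) q))))))
  where
  big : ∀ a → 3 ℕ.≤ a → m ℕ.+ 8 ℕ.* m ℕ.≤ m ℕ.* (a ℕ.* a)
  big a h = subst (ℕ._≤ m ℕ.* (a ℕ.* a)) (ℕₚ.*-comm m 9) (ℕₚ.*-monoʳ-≤ m (ℕₚ.*-mono-≤ h h))
  lem : ∀ a → + 2 * (1ℤ + a) + 1ℤ ≡ + 3 + (a + a)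
  lem = solve-∀
  three : 3 ℕ.≤ ∣ odd i ∣
  three = subst (3 ℕ.≤_) (cong ∣_∣ (sym (lem (+ k)))) (ℕₚ.m≤m+n 3 (k ℕ.+ k))
odd-small {m} {n} h i@(-[1+ suc k ]) q n< = ⊥-elim (ℕₚ.<-irrefl refl (ℕₚ.<-≤-trans n< (ℕₚ.≤-trans (big ∣ odd i ∣ three) (ℕₚ.≤-reflexive (⟪⟫*-ℕ _ h (trans (cong (⟪ m ⟫ *_) (sym (sq-abs (odd i)))) q))))))
  where
  big : ∀ a → 3 ℕ.≤ a → m ℕ.+ 8 ℕ.* m ℕ.≤ m ℕ.* (a ℕ.* a)
  big a h = subst (ℕ._≤ m ℕ.* (a ℕ.* a)) (ℕₚ.*-comm m 9) (ℕₚ.*-monoʳ-≤ m (ℕₚ.*-mono-≤ h h))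
  lem : ∀ a → + 2 * (- (+ 2 + a)) + 1ℤ ≡ - (+ 3 + (a + a))
  lem = solve-∀
  three : 3 ℕ.≤ ∣ odd i ∣
  three = subst (3 ℕ.≤_) (trans refl (cong ∣_∣ (sym (lem (+ k))))) (ℕₚ.m≤m+n 3 (k ℕ.+ k))

opaque
  unfolding gen

  -- The least odd square 1 belongs to the indices 0 and -1, and the next one is 9; hence the window
  -- 8m.
  Odd-lead : ∀ m → 1 ℕ.≤ m → ∀ w → Lead (8 ℕ.* m) (gen (Odd m) w) (w 0ℤ + w -1ℤ) m
  Odd-lead m h w = lead λ {n} n< → go n n< (n ℕ.≟ m)
    where
    at-m : ∀ i {n} → i ≡ 0ℤ ⊎ i ≡ -1ℤ → ⟪ m ⟫ * (odd i * odd i) ≡ + n → m ≡ n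
    at-m i (inj₁ refl) q = trans (sym (ℕₚ.*-identityʳ m)) (⟪⟫*-ℕ 1 h q)
    at-m i (inj₂ refl) q = trans (sym (ℕₚ.*-identityʳ m)) (⟪⟫*-ℕ 1 h q)
    go : ∀ n → n ℕ.< m ℕ.+ 8 ℕ.* m → Dec (n ≡ m) → gen (Odd m) w n ≡ X (w 0ℤ + w -1ℤ) m n
    go n n< (no ne) = trans (∑-0 (fib (Odd m) n) (λ {i} i∈ → let (_ , q) = sound (Odd m) i∈ in ⊥-elim (ne (sym (at-m i (odd-small h i q n<) q))))) (sym (X-off _ ne))
    go n n< (yes refl) = trans (∑-bij {ys = 0ℤ ∷ -1ℤ ∷ []} {v = w} (unique (Odd m) m) (((λ ()) All.∷ All.[]) ∷ (All.[] ∷ [])) id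
        (λ {i} i∈ → into (odd-small h i (proj₂ (sound (Odd m) i∈)) n<)) (λ _ _ q → q)
        (λ { (here refl) → _ , complete (Odd m) tt m1 , refl ; (there (here refl)) → _ , complete (Odd m) tt m1 , refl })
        (λ _ → refl)) (trans (cong (_+_ (w 0ℤ)) (ℤₚ.+-identityʳ _)) (sym (X-at _ m)))
      where
      into : ∀ {i} → i ≡ 0ℤ ⊎ i ≡ -1ℤ → i ∈ 0ℤ ∷ -1ℤ ∷ []
      into (inj₁ refl) = here refl
      into (inj₂ refl) = there (here refl)
      m1 : ⟪ m ⟫ * 1ℤ ≡ + m
      m1 = trans (ℤₚ.*-identityʳ _) (⟪⟫-pos h)

  Sq-lead : ∀ m → 1 ℕ.≤ m → ∀ w → Lead m (gen (Sq m) w) (w 0ℤ) 0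
  Sq-lead m h w = lead λ {n} n< → go n n< (n ℕ.≟ 0)
    where
    zer : ∀ i {n} → n ℕ.< m → ⟪ m ⟫ * (i * i) ≡ + n → i ≡ 0ℤ
    zer i {n} n< q with ∣ i ∣ in eq | ⟪⟫*-ℕ (∣ i ∣ ℕ.* ∣ i ∣) h (trans (cong (⟪ m ⟫ *_) (sym (sq-abs i))) q)
    ... | zero | _ = ℤₚ.∣i∣≡0⇒i≡0 eq
    ... | suc k | q' = ⊥-elim (ℕₚ.<-irrefl refl (ℕₚ.<-≤-trans n< (ℕₚ.≤-trans (ℕₚ.m≤m*n m (suc k ℕ.* suc k)) (ℕₚ.≤-reflexive q'))))
    go : ∀ n → n ℕ.< m → Dec (n ≡ 0) → gen (Sq m) w n ≡ K (w 0ℤ) n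
    go n n< (no ne) = trans (∑-0 (fib (Sq m) n) (λ {i} i∈ → let (_ , q) = sound (Sq m) i∈ in ⊥-elim (ne (nz i (zer i n< q) q)))) (sym (X-off _ ne))
      where
      nz : ∀ i {n} → i ≡ 0ℤ → ⟪ m ⟫ * (i * i) ≡ + n → n ≡ 0
      nz i refl q = ℤₚ.+-injective (trans (sym q) (ℤₚ.*-zeroʳ ⟪ m ⟫))
    go n n< (yes refl) = trans (∑-bij {ys = 0ℤ ∷ []} {v = w} (unique (Sq m) 0) (All.[] ∷ []) id
        (λ {i} i∈ → here (zer i n< (proj₂ (sound (Sq m) i∈)))) (λ _ _ q → q)
        (λ { (here refl) → _ , complete (Sq m) tt (ℤₚ.*-zeroʳ ⟪ m ⟫) , refl })
        (λ _ → refl)) (ℤₚ.+-identityʳ _)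

m≤k*m : ∀ k m → m ℕ.≤ suc k ℕ.* m
m≤k*m k m = ℕₚ.m≤n*m m (suc k)

1≤k*m : ∀ k {m} → 1 ℕ.≤ m → 1 ℕ.≤ suc k ℕ.* m
1≤k*m k h = ℕₚ.≤-trans h (m≤k*m k _)

θ-lead : ∀ m → 1 ℕ.≤ m → Lead (8 ℕ.* m) (θ m) (+ 2) m
θ-lead m h = Odd-lead m h _
J-lead : ∀ m → 1 ℕ.≤ m → Lead (8 ℕ.* m) (J m) (+ 2) m
J-lead m h = Odd-lead m h _
E-lead : ∀ m → 1 ℕ.≤ m → Lead (8 ℕ.* m) (E m) (+ 2) m
E-lead m h = Odd-lead m h _
φ-lead : ∀ m → 1 ℕ.≤ m → Lead m (φ m) 1ℤ 0
φ-lead m h = Sq-lead m h _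
φ⁻-lead : ∀ m → 1 ℕ.≤ m → Lead m (φ⁻ m) 1ℤ 0
φ⁻-lead m h = Sq-lead m h _

-- Jacobi's cube identity, modular equations of degree three, the quaternary relation

open SerSolver using (solve; _:+_; _:*_; _:-_; _:=_; con)

two : Ser → Ser
two f = f ⊹ f

reindex : ∀ (F : ℕ → Ser) {a b} → a ≡ b → F a ≋ F b
reindex F refl = ≋-refl

*-assoc′ : ∀ a b m → a ℕ.* (b ℕ.* m) ≡ (a ℕ.* b) ℕ.* m
*-assoc′ a b m = sym (ℕₚ.*-assoc a b m)

-- The geometric step of the arithmetic-geometric mean for the squares of φ and φ⁻; `φ²-average` is
-- the arithmetic step.
φφ⁻ : ∀ m → 1 ℕ.≤ m → φ m ⊛ φ⁻ m ≋ φ⁻ (2 ℕ.* m) ⊛ φ⁻ (2 ℕ.* m)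
φφ⁻ m h = begin
  φ m ⊛ φ⁻ m ≈⟨ ⊛-≋ (mk (φ-split m h)) (mk (φ⁻-split m h)) ⟩
  (φ (4 ℕ.* m) ⊹ θ m) ⊛ (φ (4 ℕ.* m) ⊖ θ m) ≈⟨ solve 2 (λ a b → (a :+ b) :* (a :- b) := a :* a :- b :* b) ≋-refl (φ (4 ℕ.* m)) (θ m) ⟩
  φ (4 ℕ.* m) ⊛ φ (4 ℕ.* m) ⊖ θ m ⊛ θ m
    ≈⟨ ⊹-cong (≋-trans (⊛-≋ e₄ e₄) (≋-trans (mk (φ² (2 ℕ.* m) h₂)) (⊹-cong (⊛-≋ e₈ e₈) ≋-refl))) (⊝-cong (mk (θ² m h))) ⟩
  (φ (8 ℕ.* m) ⊛ φ (8 ℕ.* m) ⊹ θ (2 ℕ.* m) ⊛ θ (2 ℕ.* m)) ⊖ two (θ (2 ℕ.* m) ⊛ φ (8 ℕ.* m))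
    ≈⟨ solve 2 (λ a b → (a :* a :+ b :* b) :- (b :* a :+ b :* a) := (a :- b) :* (a :- b)) ≋-refl (φ (8 ℕ.* m)) (θ (2 ℕ.* m)) ⟩
  (φ (8 ℕ.* m) ⊖ θ (2 ℕ.* m)) ⊛ (φ (8 ℕ.* m) ⊖ θ (2 ℕ.* m)) ≈⟨ ⊛-≋ e⁻ e⁻ ⟩
  φ⁻ (2 ℕ.* m) ⊛ φ⁻ (2 ℕ.* m) ∎
  where
  open import Relation.Binary.Reasoning.Setoid serSetoid
  h₂ = 1≤k*m 1 h
  e₄ : φ (4 ℕ.* m) ≋ φ (2 ℕ.* (2 ℕ.* m))
  e₄ = reindex φ (sym (*-assoc′ 2 2 m))
  e₈ : φ (4 ℕ.* (2 ℕ.* m)) ≋ φ (8 ℕ.* m)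
  e₈ = reindex φ (*-assoc′ 4 2 m)
  e⁻ : φ (8 ℕ.* m) ⊖ θ (2 ℕ.* m) ≋ φ⁻ (2 ℕ.* m)
  e⁻ = ≋-sym (≋-trans (mk (φ⁻-split (2 ℕ.* m) h₂)) (⊹-cong e₈ ≋-refl))

opaque
  unfolding _⊹_ ⊝_

  ⊖-zero : ∀ {f g} → (f ⊖ g) ≈ (λ _ → 0ℤ) → f ≋ g
  ⊖-zero p = mk λ n → ℤₚ.i-j≡0⇒i≡j _ _ (p n)

-- Jacobi's cube identity: the quotient of the two sides is unchanged by q ↦ q².
J-product : ∀ m → 1 ℕ.≤ m → J m ≋ θ m ⊛ (φ⁻ (8 ℕ.* m) ⊛ φ⁻ (8 ℕ.* m))
J-product m h = ⊖-zero (dilation-zero 2 1 0 1 δ θ (λ m → two (φ⁻ (8 ℕ.* m))) (s≤s (s≤s z≤n)) refl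
  (λ m h → subst (Leads (θ m)) (sym (ℕₚ.*-identityˡ m)) (Lead-leads (1≤k*m 7 h) (λ ()) (θ-lead m h)))
  (λ m h {n} → λ ()) base step m h)
  where
  G δ : ℕ → Ser
  G m = θ m ⊛ (φ⁻ (8 ℕ.* m) ⊛ φ⁻ (8 ℕ.* m))
  δ m = J m ⊖ G m
  base : ∀ m → 1 ℕ.≤ m → Vanish (δ m) (1 ℕ.* m ℕ.+ m)
  base m h = subst (Vanish (δ m)) (cong (ℕ._+ m) (trans (ℕₚ.+-identityʳ m) (sym (ℕₚ.*-identityˡ m)))) (Lead-vanish⁺ {m} {δ m} {m ℕ.+ 0}
    (Lead-- (subst (Lead m (J m) (+ 2)) (sym (ℕₚ.+-identityʳ m)) (Lead-weaken (m≤k*m 7 m) (J-lead m h)))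
      (Lead-* (Lead-weaken (m≤k*m 7 m) (θ-lead m h)) (Lead-weaken (m≤k*m 7 m) (Lead-* (φ⁻-lead (8 ℕ.* m) (1≤k*m 7 h)) (φ⁻-lead (8 ℕ.* m) (1≤k*m 7 h)))))))
  step : ∀ m → 1 ℕ.≤ m → θ m ⊛ δ m ≋ two (φ⁻ (8 ℕ.* m)) ⊛ δ (2 ℕ.* m)
  step m h = begin
    θ m ⊛ δ m ≈⟨ solve 3 (λ t j f → t :* (j :- t :* (f :* f)) := j :* t :- (t :* t) :* (f :* f)) ≋-refl (θ m) (J m) (φ⁻ (8 ℕ.* m)) ⟩
    J m ⊛ θ m ⊖ (θ m ⊛ θ m) ⊛ (φ⁻ (8 ℕ.* m) ⊛ φ⁻ (8 ℕ.* m))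
      ≈⟨ ⊹-cong (mk (Jθ m h)) (⊝-cong (⊛-≋ (mk (θ² m h)) ≋-refl)) ⟩
    two (J (2 ℕ.* m) ⊛ φ⁻ (8 ℕ.* m)) ⊖ two (θ (2 ℕ.* m) ⊛ φ (8 ℕ.* m)) ⊛ (φ⁻ (8 ℕ.* m) ⊛ φ⁻ (8 ℕ.* m))
      ≈⟨ solve 4 (λ j f t g → (j :* f :+ j :* f) :- (t :* g :+ t :* g) :* (f :* f) := (f :+ f) :* (j :- t :* (g :* f))) ≋-refl (J (2 ℕ.* m)) (φ⁻ (8 ℕ.* m)) (θ (2 ℕ.* m)) (φ (8 ℕ.* m)) ⟩
    two (φ⁻ (8 ℕ.* m)) ⊛ (J (2 ℕ.* m) ⊖ θ (2 ℕ.* m) ⊛ (φ (8 ℕ.* m) ⊛ φ⁻ (8 ℕ.* m)))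
      ≈⟨ ⊛-≋ ≋-refl (⊹-cong ≋-refl (⊝-cong (⊛-≋ ≋-refl (≋-trans (φφ⁻ (8 ℕ.* m) (1≤k*m 7 h)) (⊛-≋ eq eq))))) ⟩
    two (φ⁻ (8 ℕ.* m)) ⊛ δ (2 ℕ.* m) ∎
    where
    open import Relation.Binary.Reasoning.Setoid serSetoid
    eq : φ⁻ (2 ℕ.* (8 ℕ.* m)) ≋ φ⁻ (8 ℕ.* (2 ℕ.* m))
    eq = reindex φ⁻ (trans (*-assoc′ 2 8 m) (sym (*-assoc′ 8 2 m)))

module Degree3 {x s y S a b c d : Ser}
  (xx : x ⊛ x ≋ a ⊛ a ⊹ b ⊛ b) (ss : s ⊛ s ≋ two (b ⊛ a))
  (yy : y ⊛ y ≋ c ⊛ c ⊹ d ⊛ d) (SS : S ⊛ S ≋ two (d ⊛ c))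
  (xsyS : (s ⊛ x) ⊛ (S ⊛ y) ≋ (b ⊛ c ⊹ a ⊛ d) ⊛ (b ⊛ c ⊹ a ⊛ d)) where
  open import Relation.Binary.Reasoning.Setoid serSetoid

  -- The multiplier `s ⊛ y` turns every monomial into a product of the four squares and of (sx)(Sy).
  -- The hypotheses express these by a, b, c, d, and the same expression in a, b, c, d can be split
  -- off. In `step₂` the multiplier is `S ⊛ x`.
  step₁ : (s ⊛ y) ⊛ (s ⊛ (y ⊛ y ⊛ y) ⊖ S ⊛ S ⊛ S ⊛ x ⊖ (s ⊛ x) ⊛ (x ⊛ y ⊖ s ⊛ S)) ≋
    two (a ⊛ c ⊖ b ⊛ d) ⊛ (b ⊛ (c ⊛ c ⊛ c) ⊖ d ⊛ d ⊛ d ⊛ a ⊖ (b ⊛ a) ⊛ (a ⊛ c ⊖ b ⊛ d))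
  step₁ = begin
    _ ≈⟨ solve 4 (λ x s y S → (s :* y) :* (s :* (y :* y :* y) :- S :* S :* S :* x :- (s :* x) :* (x :* y :- s :* S)) :=
           (s :* s) :* ((y :* y) :* (y :* y)) :- ((s :* x) :* (S :* y)) :* (S :* S) :- (s :* s) :* ((x :* x) :* (y :* y)) :+ (s :* s) :* ((s :* x) :* (S :* y))) ≋-refl x s y S ⟩
    (s ⊛ s) ⊛ ((y ⊛ y) ⊛ (y ⊛ y)) ⊖ ((s ⊛ x) ⊛ (S ⊛ y)) ⊛ (S ⊛ S) ⊖ (s ⊛ s) ⊛ ((x ⊛ x) ⊛ (y ⊛ y)) ⊹ (s ⊛ s) ⊛ ((s ⊛ x) ⊛ (S ⊛ y))
      ≈⟨ ⊹-cong (⊹-cong (⊹-cong (⊛-≋ ss (⊛-≋ yy yy)) (⊝-cong (⊛-≋ xsyS SS))) (⊝-cong (⊛-≋ ss (⊛-≋ xx yy)))) (⊛-≋ ss xsyS) ⟩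
    _ ≈⟨ solve 4 (λ a b c d → (b :* a :+ b :* a) :* ((c :* c :+ d :* d) :* (c :* c :+ d :* d)) :- ((b :* c :+ a :* d) :* (b :* c :+ a :* d)) :* (d :* c :+ d :* c)
             :- (b :* a :+ b :* a) :* ((a :* a :+ b :* b) :* (c :* c :+ d :* d)) :+ (b :* a :+ b :* a) :* ((b :* c :+ a :* d) :* (b :* c :+ a :* d)) :=
           ((a :* c :- b :* d) :+ (a :* c :- b :* d)) :* (b :* (c :* c :* c) :- d :* d :* d :* a :- (b :* a) :* (a :* c :- b :* d))) ≋-refl a b c d ⟩
    _ ∎

  step₂ : (S ⊛ x) ⊛ (s ⊛ s ⊛ s ⊛ y ⊖ S ⊛ (x ⊛ x ⊛ x) ⊖ K (+ 3) ⊛ ((S ⊛ y) ⊛ (x ⊛ y ⊖ s ⊛ S))) ≋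
    two (a ⊛ c ⊖ b ⊛ d) ⊛ (b ⊛ b ⊛ b ⊛ c ⊖ d ⊛ (a ⊛ a ⊛ a) ⊖ K (+ 3) ⊛ ((d ⊛ c) ⊛ (a ⊛ c ⊖ b ⊛ d)))
  step₂ = begin
    _ ≈⟨ solve 4 (λ x s y S → (S :* x) :* (s :* s :* s :* y :- S :* (x :* x :* x) :- con (+ 3) :* ((S :* y) :* (x :* y :- s :* S))) :=
           ((s :* x) :* (S :* y)) :* (s :* s) :- ((x :* x) :* (x :* x)) :* (S :* S) :- con (+ 3) :* ((S :* S) :* ((x :* x) :* (y :* y)) :- (S :* S) :* ((s :* x) :* (S :* y)))) ≋-refl x s y S ⟩
    ((s ⊛ x) ⊛ (S ⊛ y)) ⊛ (s ⊛ s) ⊖ ((x ⊛ x) ⊛ (x ⊛ x)) ⊛ (S ⊛ S) ⊖ K (+ 3) ⊛ ((S ⊛ S) ⊛ ((x ⊛ x) ⊛ (y ⊛ y)) ⊖ (S ⊛ S) ⊛ ((s ⊛ x) ⊛ (S ⊛ y)))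
      ≈⟨ ⊹-cong (⊹-cong (⊛-≋ xsyS ss) (⊝-cong (⊛-≋ (⊛-≋ xx xx) SS))) (⊝-cong (⊛-≋ ≋-refl (⊹-cong (⊛-≋ SS (⊛-≋ xx yy)) (⊝-cong (⊛-≋ SS xsyS))))) ⟩
    _ ≈⟨ solve 4 (λ a b c d → ((b :* c :+ a :* d) :* (b :* c :+ a :* d)) :* (b :* a :+ b :* a) :- ((a :* a :+ b :* b) :* (a :* a :+ b :* b)) :* (d :* c :+ d :* c)
             :- con (+ 3) :* ((d :* c :+ d :* c) :* ((a :* a :+ b :* b) :* (c :* c :+ d :* d)) :- (d :* c :+ d :* c) :* ((b :* c :+ a :* d) :* (b :* c :+ a :* d))) :=
           ((a :* c :- b :* d) :+ (a :* c :- b :* d)) :* (b :* b :* b :* c :- d :* (a :* a :* a) :- con (+ 3) :* ((d :* c) :* (a :* c :- b :* d)))) ≋-refl a b c d ⟩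
    _ ∎

module Landen (m : ℕ) (h : 1 ℕ.≤ m) where
  private
    x = φ (8 ℕ.* m)
    s = θ (2 ℕ.* m)
    y = φ (24 ℕ.* m)
    S = θ (6 ℕ.* m)
    a = φ (8 ℕ.* (2 ℕ.* m))
    b = θ (2 ℕ.* (2 ℕ.* m))
    c = φ (24 ℕ.* (2 ℕ.* m))
    d = θ (6 ℕ.* (2 ℕ.* m))
    r : ∀ (F : ℕ → Ser) k l k' l' → k ℕ.* l ≡ k' ℕ.* l' → F (k ℕ.* (l ℕ.* m)) ≋ F (k' ℕ.* (l' ℕ.* m))
    r F k l k' l' q = reindex F (trans (*-assoc′ k l m) (trans (cong (ℕ._* m) q) (sym (*-assoc′ k' l' m))))
    r₁ : ∀ (F : ℕ → Ser) k l k' → k ℕ.* l ≡ k' → F (k' ℕ.* m) ≋ F (k ℕ.* (l ℕ.* m))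
    r₁ F k l k' q = reindex F (trans (cong (ℕ._* m) (sym q)) (sym (*-assoc′ k l m)))

  xx : x ⊛ x ≋ a ⊛ a ⊹ b ⊛ b
  xx = ≋-trans (⊛-≋ (r₁ φ 2 4 8 refl) (r₁ φ 2 4 8 refl)) (≋-trans (mk (φ² (4 ℕ.* m) (1≤k*m 3 h)))
    (⊹-cong (⊛-≋ (r φ 4 4 8 2 refl) (r φ 4 4 8 2 refl)) (⊛-≋ (r₁ θ 2 2 4 refl) (r₁ θ 2 2 4 refl))))
  yy : y ⊛ y ≋ c ⊛ c ⊹ d ⊛ d
  yy = ≋-trans (⊛-≋ (r₁ φ 2 12 24 refl) (r₁ φ 2 12 24 refl)) (≋-trans (mk (φ² (12 ℕ.* m) (1≤k*m 11 h)))
    (⊹-cong (⊛-≋ (r φ 4 12 24 2 refl) (r φ 4 12 24 2 refl)) (⊛-≋ (r₁ θ 6 2 12 refl) (r₁ θ 6 2 12 refl))))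
  ss : s ⊛ s ≋ two (b ⊛ a)
  ss = mk (θ² (2 ℕ.* m) (1≤k*m 1 h))
  SS : S ⊛ S ≋ two (d ⊛ c)
  SS = ≋-trans (mk (θ² (6 ℕ.* m) (1≤k*m 5 h))) (⊹-cong eq eq)
    where eq = ⊛-≋ (r θ 2 6 6 2 refl) (r φ 8 6 24 2 refl)
  -- Four times either side is the square of θ(m) θ(3m): evaluated by `θ²` for each factor, and by
  -- `θθ₃` for the product.
  xsyS : (s ⊛ x) ⊛ (S ⊛ y) ≋ (b ⊛ c ⊹ a ⊛ d) ⊛ (b ⊛ c ⊹ a ⊛ d)
  xsyS = ⊛-cancelˡ {r = 0} (Lead-leads {1} ℕₚ.≤-refl (λ ()) (Lead-K (+ 4))) (begin
    K (+ 4) ⊛ ((s ⊛ x) ⊛ (S ⊛ y)) ≈⟨ solve 2 (λ p q → con (+ 4) :* (p :* q) := (p :+ p) :* (q :+ q)) ≋-refl (s ⊛ x) (S ⊛ y) ⟩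
    two (s ⊛ x) ⊛ two (S ⊛ y) ≈⟨ ⊛-≋ (mk (θ² m h)) (≋-trans (mk (θ² (3 ℕ.* m) (1≤k*m 2 h))) (⊹-cong eq eq)) ⟨
    (θ m ⊛ θ m) ⊛ (θ (3 ℕ.* m) ⊛ θ (3 ℕ.* m)) ≈⟨ solve 2 (λ p q → (p :* p) :* (q :* q) := (p :* q) :* (p :* q)) ≋-refl (θ m) (θ (3 ℕ.* m)) ⟩
    (θ m ⊛ θ (3 ℕ.* m)) ⊛ (θ m ⊛ θ (3 ℕ.* m)) ≈⟨ ⊛-≋ q q ⟩
    two (b ⊛ c ⊹ a ⊛ d) ⊛ two (b ⊛ c ⊹ a ⊛ d) ≈⟨ solve 1 (λ p → (p :+ p) :* (p :+ p) := con (+ 4) :* (p :* p)) ≋-refl (b ⊛ c ⊹ a ⊛ d) ⟩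
    K (+ 4) ⊛ ((b ⊛ c ⊹ a ⊛ d) ⊛ (b ⊛ c ⊹ a ⊛ d)) ∎)
    where
    open import Relation.Binary.Reasoning.Setoid serSetoid
    eq : θ (2 ℕ.* (3 ℕ.* m)) ⊛ φ (8 ℕ.* (3 ℕ.* m)) ≋ S ⊛ y
    eq = ⊛-≋ (≋-sym (r₁ θ 2 3 6 refl)) (≋-sym (r₁ φ 8 3 24 refl))
    q : θ m ⊛ θ (3 ℕ.* m) ≋ two (b ⊛ c ⊹ a ⊛ d)
    q = ≋-trans (mk (θθ₃ m h)) (⊹-cong q' q')
      where q' = ⊹-cong (⊛-≋ (r₁ θ 2 2 4 refl) (r₁ φ 24 2 48 refl)) (⊛-≋ (r₁ φ 8 2 16 refl) (r₁ θ 6 2 12 refl))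

  open Degree3 xx ss yy SS xsyS public

-- With nome Q = q^(8m) the four series are the theta constants θ₃(Q), θ₂(Q), θ₃(Q³), θ₂(Q³), so
-- that the vanishing of `δ₁` and `δ₂` expresses modular equations of degree three. Classically x y
-- - s S is the product of θ₄(Q) and θ₄(Q³).
δ₁ δ₂ : ℕ → Ser
δ₁ m = let x = φ (8 ℕ.* m); s = θ (2 ℕ.* m); y = φ (24 ℕ.* m); S = θ (6 ℕ.* m) in
  s ⊛ (y ⊛ y ⊛ y) ⊖ S ⊛ S ⊛ S ⊛ x ⊖ (s ⊛ x) ⊛ (x ⊛ y ⊖ s ⊛ S)
δ₂ m = let x = φ (8 ℕ.* m); s = θ (2 ℕ.* m); y = φ (24 ℕ.* m); S = θ (6 ℕ.* m) in
  s ⊛ s ⊛ s ⊛ y ⊖ S ⊛ (x ⊛ x ⊛ x) ⊖ K (+ 3) ⊛ ((S ⊛ y) ⊛ (x ⊛ y ⊖ s ⊛ S))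

module Leading (m : ℕ) (h : 1 ℕ.≤ m) where
  X₀ : Lead m (φ (8 ℕ.* m)) 1ℤ 0
  X₀ = Lead-weaken (m≤k*m 7 m) (φ-lead (8 ℕ.* m) (1≤k*m 7 h))
  Y₀ : Lead m (φ (24 ℕ.* m)) 1ℤ 0
  Y₀ = Lead-weaken (m≤k*m 23 m) (φ-lead (24 ℕ.* m) (1≤k*m 23 h))
  S₂ : Lead m (θ (2 ℕ.* m)) (+ 2) (2 ℕ.* m)
  S₂ = Lead-weaken (ℕₚ.≤-trans (m≤k*m 1 m) (m≤k*m 7 (2 ℕ.* m))) (θ-lead (2 ℕ.* m) (1≤k*m 1 h))
  S₆ : Lead m (θ (6 ℕ.* m)) (+ 2) (6 ℕ.* m)
  S₆ = Lead-weaken (ℕₚ.≤-trans (m≤k*m 5 m) (m≤k*m 7 (6 ℕ.* m))) (θ-lead (6 ℕ.* m) (1≤k*m 5 h))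

  conv : ∀ {f c r r'} → r ≡ r' → Lead m f c r → Lead m f c r'
  conv refl l = l
  high : ∀ {f c r r'} → r' ℕ.+ m ℕ.≤ r → Lead m f c r → Lead m f 0ℤ r'
  high le l = Lead-0 λ n< → Lead-vanish l (ℕₚ.<-≤-trans n< le)

  -- At exponent 2m the first and the last term contribute 2 and -2, while the middle one starts at
  -- 18m.
  lead₁ : Lead m (δ₁ m) 0ℤ (2 ℕ.* m)
  lead₁ = Lead-- (Lead-- (conv (n₁ m) (Lead-* S₂ (Lead-* (Lead-* Y₀ Y₀) Y₀)))
      (high (i₁ m) (Lead-* (Lead-* (Lead-* S₆ S₆) S₆) X₀)))
    (conv (n₁' m) (Lead-* (Lead-* S₂ X₀) (Lead-- (Lead-* X₀ Y₀) (high (i₂ m) (Lead-* S₂ S₆)))))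
    where
    n₁ : ∀ m → 2 ℕ.* m ℕ.+ 0 ≡ 2 ℕ.* m
    n₁ m = ℕₚ.+-identityʳ _
    n₁' : ∀ m → 2 ℕ.* m ℕ.+ 0 ℕ.+ 0 ≡ 2 ℕ.* m
    n₁' = solveℕ
    i₁ : ∀ m → 2 ℕ.* m ℕ.+ m ℕ.≤ 6 ℕ.* m ℕ.+ 6 ℕ.* m ℕ.+ 6 ℕ.* m ℕ.+ 0
    i₁ m = subst (2 ℕ.* m ℕ.+ m ℕ.≤_) (l m) (ℕₚ.m≤m+n _ (15 ℕ.* m))
      where
      l : ∀ m → 2 ℕ.* m ℕ.+ m ℕ.+ 15 ℕ.* m ≡ 6 ℕ.* m ℕ.+ 6 ℕ.* m ℕ.+ 6 ℕ.* m ℕ.+ 0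
      l = solveℕ
    i₂ : ∀ m → m ℕ.≤ 2 ℕ.* m ℕ.+ 6 ℕ.* m
    i₂ m = ℕₚ.≤-trans (m≤k*m 1 m) (ℕₚ.m≤m+n _ _)

  -- At exponent 6m the three terms contribute 8, -2 and -3 · 2.
  lead₂ : Lead m (δ₂ m) 0ℤ (6 ℕ.* m)
  lead₂ = Lead-- (Lead-- (conv (n₁ m) (Lead-* (Lead-* (Lead-* S₂ S₂) S₂) Y₀)) (conv (n₂ m) (Lead-* S₆ (Lead-* (Lead-* X₀ X₀) X₀))))
    (conv (n₃ m) (Lead-* (Lead-K (+ 3)) (Lead-* (Lead-* S₆ Y₀) (Lead-- (Lead-* X₀ Y₀) (high (i₂ m) (Lead-* S₂ S₆))))))
    where
    n₁ : ∀ m → 2 ℕ.* m ℕ.+ 2 ℕ.* m ℕ.+ 2 ℕ.* m ℕ.+ 0 ≡ 6 ℕ.* m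
    n₁ = solveℕ
    n₂ : ∀ m → 6 ℕ.* m ℕ.+ 0 ≡ 6 ℕ.* m
    n₂ = solveℕ
    n₃ : ∀ m → 6 ℕ.* m ℕ.+ 0 ℕ.+ 0 ≡ 6 ℕ.* m
    n₃ = solveℕ
    i₂ : ∀ m → m ℕ.≤ 2 ℕ.* m ℕ.+ 6 ℕ.* m
    i₂ m = ℕₚ.≤-trans (m≤k*m 1 m) (ℕₚ.m≤m+n _ _)

δ₁-zero : ∀ m → 1 ℕ.≤ m → δ₁ m ≈ λ _ → 0ℤ
δ₁-zero = dilation-zero 2 2 0 2 δ₁ (λ m → θ (2 ℕ.* m) ⊛ φ (24 ℕ.* m))
  (λ m → two (φ (8 ℕ.* (2 ℕ.* m)) ⊛ φ (24 ℕ.* (2 ℕ.* m)) ⊖ θ (2 ℕ.* (2 ℕ.* m)) ⊛ θ (6 ℕ.* (2 ℕ.* m)))) (s≤s (s≤s z≤n)) refl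
  (λ m h → let open Leading m h in Lead-leads h (λ ()) (conv (ℕₚ.+-identityʳ (2 ℕ.* m)) (Lead-* S₂ Y₀)))
  (λ m h → λ ())
  (λ m h → Lead-vanish⁺ (Leading.lead₁ m h))
  (λ m h → Landen.step₁ m h)

δ₂-zero : ∀ m → 1 ℕ.≤ m → δ₂ m ≈ λ _ → 0ℤ
δ₂-zero = dilation-zero 2 6 0 6 δ₂ (λ m → θ (6 ℕ.* m) ⊛ φ (8 ℕ.* m))
  (λ m → two (φ (8 ℕ.* (2 ℕ.* m)) ⊛ φ (24 ℕ.* (2 ℕ.* m)) ⊖ θ (2 ℕ.* (2 ℕ.* m)) ⊛ θ (6 ℕ.* (2 ℕ.* m)))) (s≤s (s≤s z≤n)) refl
  (λ m h → let open Leading m h in Lead-leads h (λ ()) (conv (ℕₚ.+-identityʳ (6 ℕ.* m)) (Lead-* S₆ X₀)))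
  (λ m h → λ ())
  (λ m h → Lead-vanish⁺ (Leading.lead₂ m h))
  (λ m h → Landen.step₂ m h)

φ⁻² : ∀ m → 1 ℕ.≤ m → φ⁻ (2 ℕ.* m) ⊛ φ⁻ (2 ℕ.* m) ≋ φ (4 ℕ.* m) ⊛ φ (4 ℕ.* m) ⊖ θ m ⊛ θ m
φ⁻² m h = ≋-trans (≋-sym (φφ⁻ m h)) (≋-trans (⊛-≋ (mk (φ-split m h)) (mk (φ⁻-split m h)))
  (solve 2 (λ a b → (a :+ b) :* (a :- b) := a :* a :- b :* b) ≋-refl (φ (4 ℕ.* m)) (θ m)))

-- The multiplier 2θ(8) is introduced so that all other series can be eliminated: θ(8)θ(24) by
-- `θθ₃`, θ(8)⁴ by `θ²` applied twice, the squares of φ(64), φ⁻(64) and φ⁻(192) by `φ²` and `φ⁻²`.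
-- What remains are polynomials in x, s, y, S.
quaternary-relation : θ 24 ⊛ θ 32 ⊛ (two (φ 64 ⊛ φ 64) ⊹ φ⁻ 64 ⊛ φ⁻ 64) ≋ θ 8 ⊛ θ 8 ⊛ θ 8 ⊛ θ 96 ⊹ K (+ 3) ⊛ (θ 32 ⊛ J 24)
quaternary-relation = ⊛-cancelˡ {θ 8 ⊛ K (+ 2)} {r = 8} (Lead-leads {64} (s≤s z≤n) (λ ()) (Lead-* (θ-lead 8 (s≤s z≤n)) (Lead-K (+ 2)))) (begin
  (θ 8 ⊛ K (+ 2)) ⊛ (θ 24 ⊛ θ 32 ⊛ (two (φ 64 ⊛ φ 64) ⊹ φ⁻ 64 ⊛ φ⁻ 64))
    ≈⟨ solve 5 (λ t R s f g → (t :* con (+ 2)) :* (R :* s :* ((f :* f :+ f :* f) :+ g :* g)) := (con (+ 2) :* s) :* ((t :* R) :* ((f :* f :+ f :* f) :+ g :* g))) ≋-refl (θ 8) (θ 24) (θ 32) (φ 64) (φ⁻ 64) ⟩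
  (K (+ 2) ⊛ s) ⊛ ((θ 8 ⊛ θ 24) ⊛ (two (φ 64 ⊛ φ 64) ⊹ φ⁻ 64 ⊛ φ⁻ 64))
    ≈⟨ ⊛-≋ ≋-refl (⊛-≋ (mk (θθ₃ 8 (s≤s z≤n))) (⊹-cong (⊹-cong (mk (φ² 32 (s≤s z≤n))) (mk (φ² 32 (s≤s z≤n)))) (φ⁻² 32 (s≤s z≤n)))) ⟩
  (K (+ 2) ⊛ s) ⊛ (two (s ⊛ y ⊹ x ⊛ S) ⊛ (two (x ⊛ x ⊹ s ⊛ s) ⊹ (x ⊛ x ⊖ s ⊛ s)))
    -- The two polynomials differ by 4 s (δ₂ - 3 δ₁) at m = 16.
    ≈⟨ solve 4 (λ x s y S → (con (+ 2) :* s) :* (((s :* y :+ x :* S) :+ (s :* y :+ x :* S)) :* (((x :* x :+ s :* s) :+ (x :* x :+ s :* s)) :+ (x :* x :- s :* s))) :=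
         (con (+ 2) :* ((con (+ 2) :* (s :* x :+ s :* x) :* (x :* x :+ s :* s :+ (x :* x :+ s :* s))) :* S) :+ con (+ 2) :* (con (+ 3) :* s :* ((s :* y :+ x :* S :+ (s :* y :+ x :* S)) :* (y :* y :- S :* S))))
         :+ con (+ 4) :* s :* ((s :* s :* s :* y :- S :* (x :* x :* x) :- con (+ 3) :* ((S :* y) :* (x :* y :- s :* S))) :- con (+ 3) :* (s :* (y :* y :* y) :- S :* S :* S :* x :- (s :* x) :* (x :* y :- s :* S)))) ≋-refl x s y S ⟩
  (K (+ 2) ⊛ ((K (+ 2) ⊛ two (s ⊛ x) ⊛ (x ⊛ x ⊹ s ⊛ s ⊹ (x ⊛ x ⊹ s ⊛ s))) ⊛ S) ⊹ K (+ 2) ⊛ (K (+ 3) ⊛ s ⊛ (two (s ⊛ y ⊹ x ⊛ S) ⊛ (y ⊛ y ⊖ S ⊛ S)))) ⊹ K (+ 4) ⊛ s ⊛ (δ₂ 16 ⊖ K (+ 3) ⊛ δ₁ 16)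
    ≈⟨ ⊹-cong (⊹-cong (⊛-≋ ≋-refl (⊛-≋ (≋-trans (⊛-≋ (⊛-≋ ≋-refl (≋-sym (mk (θ² 16 (s≤s z≤n))))) (⊹-cong (≋-sym (mk (φ² 32 (s≤s z≤n)))) (≋-sym (mk (φ² 32 (s≤s z≤n))))))
           (solve 2 (λ t f → con (+ 2) :* (t :* t) :* (f :* f :+ f :* f) := (t :* f :+ t :* f) :* (t :* f :+ t :* f)) ≋-refl (θ 16) (φ 64))) ≋-refl))
         (⊛-≋ ≋-refl (⊛-≋ ≋-refl (⊛-≋ (≋-sym (mk (θθ₃ 8 (s≤s z≤n)))) (≋-sym (φ⁻² 96 (s≤s z≤n)))))))
       (⊛-≋ ≋-refl (≋-trans (⊹-cong z₂ (⊝-cong (⊛-≋ ≋-refl z₁))) (solve 0 (con 0ℤ :- con (+ 3) :* con 0ℤ := con 0ℤ) ≋-refl))) ⟩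
  (K (+ 2) ⊛ ((two (θ 16 ⊛ φ 64) ⊛ two (θ 16 ⊛ φ 64)) ⊛ S) ⊹ K (+ 2) ⊛ (K (+ 3) ⊛ s ⊛ ((θ 8 ⊛ θ 24) ⊛ (φ⁻ 192 ⊛ φ⁻ 192)))) ⊹ K (+ 4) ⊛ s ⊛ K 0ℤ
    ≈⟨ ⊹-cong (⊹-cong (⊛-≋ ≋-refl (⊛-≋ (⊛-≋ (≋-sym (mk (θ² 8 (s≤s z≤n)))) (≋-sym (mk (θ² 8 (s≤s z≤n))))) ≋-refl)) ≋-refl) ≋-refl ⟩
  (K (+ 2) ⊛ ((θ 8 ⊛ θ 8) ⊛ (θ 8 ⊛ θ 8) ⊛ S) ⊹ K (+ 2) ⊛ (K (+ 3) ⊛ s ⊛ ((θ 8 ⊛ θ 24) ⊛ (φ⁻ 192 ⊛ φ⁻ 192)))) ⊹ K (+ 4) ⊛ s ⊛ K 0ℤ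
    ≈⟨ solve 5 (λ t S s R f → (con (+ 2) :* ((t :* t) :* (t :* t) :* S) :+ con (+ 2) :* (con (+ 3) :* s :* ((t :* R) :* (f :* f)))) :+ con (+ 4) :* s :* con 0ℤ :=
         (t :* con (+ 2)) :* (t :* t :* t :* S :+ con (+ 3) :* (s :* (R :* (f :* f))))) ≋-refl (θ 8) S s (θ 24) (φ⁻ 192) ⟩
  (θ 8 ⊛ K (+ 2)) ⊛ (θ 8 ⊛ θ 8 ⊛ θ 8 ⊛ θ 96 ⊹ K (+ 3) ⊛ (θ 32 ⊛ (θ 24 ⊛ (φ⁻ 192 ⊛ φ⁻ 192))))
    ≈⟨ ⊛-≋ ≋-refl (⊹-cong ≋-refl (⊛-≋ ≋-refl (⊛-≋ ≋-refl (≋-sym (J-product 24 (s≤s z≤n)))))) ⟩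
  (θ 8 ⊛ K (+ 2)) ⊛ (θ 8 ⊛ θ 8 ⊛ θ 8 ⊛ θ 96 ⊹ K (+ 3) ⊛ (θ 32 ⊛ J 24)) ∎)
  where
  open import Relation.Binary.Reasoning.Setoid serSetoid
  x = φ 128
  s = θ 32
  y = φ 384
  S = θ 96
  z₁ : δ₁ 16 ≋ K 0ℤ
  z₁ = mk λ n → trans (δ₁-zero 16 (s≤s z≤n) n) (sym (X-0 0 n))
  z₂ : δ₂ 16 ≋ K 0ℤ
  z₂ = mk λ n → trans (δ₂-zero 16 (s≤s z≤n) n) (sym (X-0 0 n))

-- Divisor sums from cancelling binary forms

sumTo : ℕ → (ℕ → ℤ) → ℤ
sumTo zero f = 0ℤ
sumTo (suc k) f = sumTo k f + f k

sumTo-cong : ∀ k {f g : ℕ → ℤ} → (∀ i → f i ≡ g i) → sumTo k f ≡ sumTo k g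
sumTo-cong zero h = refl
sumTo-cong (suc k) h = cong₂ _+_ (sumTo-cong k h) (h k)

∑-upTo : ∀ k (w : ℕ → ℤ) → ∑ (upTo k) w ≡ sumTo k w
∑-upTo zero w = refl
∑-upTo (suc k) w = trans (cong (λ l → ∑ l w) (sym (Listₚ.upTo-∷ʳ k))) (trans (∑-++ (upTo k) _ w) (cong₂ _+_ (∑-upTo k w) (ℤₚ.+-identityʳ (w k))))

sum₁₂ : (ℕ → ℤ) → ℤ
sum₁₂ f = f 0 + f 1 + f 2 + f 3 + f 4 + f 5 + f 6 + f 7 + f 8 + f 9 + f 10 + f 11

-- The second argument of `f` is the length plus one, so the summand changes with the length.
-- Lengthening by 12 leaves the old terms alone by periodicity and adds one block, which `G`
-- accounts for; lengths below 12 are computed.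
periodic-sum : (f : ℤ → ℤ → ℤ) (G : ℤ → ℤ) → (∀ a b → f a (+ 12 + b) ≡ f a b) →
  (∀ b → sum₁₂ (λ j → f (+ j + b) b) ≡ G (+ 12 + b) - G b) →
  below 12 (λ k → does (sumTo k (λ i → f (+ suc i) (+ suc k)) - G (+ suc k) ℤ.≟ 0ℤ)) ≡ true →
  ∀ k → sumTo k (λ i → f (+ suc i) (+ suc k)) ≡ G (+ suc k)
periodic-sum f G per block base k = subst P (sym (trans (ℕd.m≡m%n+[m/n]*n k 12) (ℕₚ.+-comm (k ℕ.% 12) _))) (go (k ℕ./ 12) (k ℕ.% 12) (ℕd.m%n<n k 12))
  where
  P : ℕ → Set
  P k = sumTo k (λ i → f (+ suc i) (+ suc k)) ≡ G (+ suc k)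
  step : ∀ k → P k → P (12 ℕ.+ k)
  step k p = trans (sumTo-cong (12 ℕ.+ k) (λ i → per (+ suc i) (+ suc k)))
    (trans (regroup (sumTo k F) (F k) (F (1 ℕ.+ k)) (F (2 ℕ.+ k)) (F (3 ℕ.+ k)) (F (4 ℕ.+ k)) (F (5 ℕ.+ k)) (F (6 ℕ.+ k)) (F (7 ℕ.+ k)) (F (8 ℕ.+ k)) (F (9 ℕ.+ k)) (F (10 ℕ.+ k)) (F (11 ℕ.+ k)))
    (trans (cong₂ _+_ p (block (+ suc k))) (add-sub (G (+ suc k)) (G (+ 12 + + suc k)))))
    where
    F : ℕ → ℤ
    F i = f (+ suc i) (+ suc k)
    regroup : ∀ s a b c d e g h i j l m n → s + a + b + c + d + e + g + h + i + j + l + m + n ≡ s + (a + b + c + d + e + g + h + i + j + l + m + n)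
    regroup = solve-∀
    add-sub : ∀ a b → a + (b - a) ≡ b
    add-sub = solve-∀
  go : ∀ q r → r ℕ.< 12 → P (q ℕ.* 12 ℕ.+ r)
  go zero r r< = ℤₚ.i-j≡0⇒i≡j _ _ (does-sound (below-sound 12 (λ k → does (sumTo k (λ i → f (+ suc i) (+ suc k)) - G (+ suc k) ℤ.≟ 0ℤ)) base r<))
  go (suc q) r r< = step (q ℕ.* 12 ℕ.+ r) (go q r r<)

-- The exponent of (B , a , c) is m times B² + 4ac, the discriminant of a x² + B x y - c y².
Forms : ℕ → Sys (ℤ × (ℤ × ℤ))
Forms m = Sq m ⊗ Dv (4 ℕ.* m)

-- For the form a x² + B x y - c y², with a, c > 0, the substitution x ↦ x + y either
-- keeps its roots separated (a + B > c) or is undone by exchanging the variables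
-- (a + B < c); only the isotropic forms with a + B = c survive the cancellation.
module River (m : ℕ) (1≤m : 1 ℕ.≤ m) (F : ℤ × (ℤ × ℤ) → ℤ)
  (swap : ∀ B a c → F (- B , c , a) ≡ F (B , a , c))
  (shift : ∀ B a c → F (B , a , c) ≡ - F (+ 2 * c - B , a + B - c , c)) where

  S = Forms m
  M = ⟪ m ⟫

  e-form : ∀ B a c → e S (B , a , c) ≡ M * (B * B) + (+ 4 * M) * (a * c)
  e-form B a c = cong (λ t → M * (B * B) + t * (a * c)) (⟪⟫-* 3 m 1≤m)

  >? : Decidable {A = ℤ × (ℤ × ℤ)} (λ (B , a , c) → c ℤ.< a + B)
  >? (B , a , c) = c ℤ.<? a + B
  ≡? : Decidable {A = ℤ × (ℤ × ℤ)} (λ (B , a , c) → a + B ≡ c)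
  ≡? (B , a , c) = a + B ℤ.≟ c

  pos-diff : ∀ {x y} → x ℤ.< y → Positive (y - x)
  pos-diff {x} {y} h = subst (ℤ._< y - x) (ℤₚ.+-inverseʳ x) (ℤₚ.+-monoˡ-< (- x) h)

  <-by : ∀ {x y z} → Positive z → x + z ≡ y → x ℤ.< y
  <-by {x} {y} {z} h q = subst₂ ℤ._<_ (ℤₚ.+-identityʳ x) q (ℤₚ.+-monoʳ-< x h)

  -- The involution substitutes x - y for y, which makes the first coefficient a + B - c. It is
  -- positive exactly in the region c < a + B, and `shift` says that the weight changes sign.
  larger-zero : ∀ n → gen (restrict >? S) F n ≡ 0ℤ
  larger-zero = gen-anti (restrict >? S) (λ (B , a , c) → + 2 * c - B , a + B - c , c)
    (λ {(B , a , c)} ((_ , a>0 , c>0) , h) → (tt , pos-diff h , c>0) , <-by a>0 (l₁ B a c))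
    (λ {(B , a , c)} _ → trans (e-form (+ 2 * c - B) (a + B - c) c) (trans (l₂ M B a c) (sym (e-form B a c))))
    (λ {(B , a , c)} _ → cong₂ (λ x y → x , y , c) (l₃ B c) (l₄ B a c))
    (λ {(B , a , c)} _ → shift B a c)
    where
    l₁ : ∀ B a c → c + a ≡ (a + B - c) + (+ 2 * c - B)
    l₁ = solve-∀
    l₂ : ∀ M B a c → M * ((+ 2 * c - B) * (+ 2 * c - B)) + (+ 4 * M) * ((a + B - c) * c) ≡ M * (B * B) + (+ 4 * M) * (a * c)
    l₂ = solve-∀
    l₃ : ∀ B c → + 2 * c - (+ 2 * c - B) ≡ B
    l₃ = solve-∀
    l₄ : ∀ B a c → (a + B - c) + (+ 2 * c - B) - c ≡ a
    l₄ = solve-∀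

  -- Exchanging the variables and negating the form carries a + B < c to the region of
  -- `larger-zero`, with the same weight by `swap`.
  smaller-zero : ∀ n → gen (restrict (¬? ∘ ≡?) (restrict (¬? ∘ >?) S)) F n ≡ 0ℤ
  smaller-zero n = trans (gen-bij (restrict (¬? ∘ ≡?) (restrict (¬? ∘ >?) S)) (restrict >? S) {v = F} (λ (B , a , c) → - B , c , a)
    (λ {(B , a , c)} (((_ , a>0 , c>0) , ≯) , ≢) → (tt , c>0 , a>0) , less B a c ≯ ≢)
    (λ {(B , a , c)} _ → sw B a c)
    (λ {(B , a , c)} {(B' , a' , c')} _ _ q → trans (sym (inv B a c)) (trans (cong (λ (B , c , a) → - B , a , c) q) (inv B' a' c')))
    (λ {(B , a , c)} ((_ , a>0 , c>0) , >) → (- B , c , a) , (((tt , c>0 , a>0) , λ a<c-B → ℤₚ.<-asym > (bk B a c a<c-B)) ,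
        λ q → ℤₚ.<-irrefl (sym (trans (cong (_+ B) (sym q)) (l₅ B c))) >) , inv B a c)
    (λ {(B , a , c)} _ → sym (swap B a c)) n) (larger-zero n)
    where
    l₁ : ∀ B c → c ≡ (c + - B) + B
    l₁ = solve-∀
    l₅ : ∀ B c → (c + - B) + B ≡ c
    l₅ = solve-∀
    l₆ : ∀ M B a c → M * ((- B) * (- B)) + (+ 4 * M) * (c * a) ≡ M * (B * B) + (+ 4 * M) * (a * c)
    l₆ = solve-∀
    inv : ∀ B a c → (- (- B) , a , c) ≡ (B , a , c)
    inv B a c = cong (λ x → x , a , c) (ℤₚ.neg-involutive B)
    sw : ∀ B a c → e S (- B , c , a) ≡ e S (B , a , c)
    sw B a c = trans (e-form (- B) c a) (trans (l₆ M B a c) (sym (e-form B a c)))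
    bk : ∀ B a c → a ℤ.< c + - B → a + B ℤ.< c
    bk B a c h = subst (a + B ℤ.<_) (l₅ B c) (ℤₚ.+-monoˡ-< B h)
    l₇ : ∀ B a → (a + B) + - B ≡ a
    l₇ = solve-∀
    less : ∀ B a c → ¬ (c ℤ.< a + B) → ¬ (a + B ≡ c) → a ℤ.< c + - B
    less B a c ≯ ≢ with ℤₚ.<-cmp (a + B) c
    ... | tri< lt _ _ = subst (ℤ._< c + - B) (l₇ B a) (ℤₚ.+-monoˡ-< (- B) lt)
    ... | tri≈ _ eq _ = ⊥-elim (≢ eq)
    ... | tri> _ _ gt = ⊥-elim (≯ gt)

  boundary : ∀ n → gen S F n ≡ gen (restrict ≡? S) F n
  boundary n = trans (gen-restrict >? S F n) (trans (cong₂ _+_ (larger-zero n) (trans (gen-restrict ≡? (restrict (¬? ∘ >?) S) F n) (cong₂ _+_ eqs (smaller-zero n))))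
    (trans (ℤₚ.+-identityˡ _) (ℤₚ.+-identityʳ _)))
    where
    eqs : gen (restrict ≡? (restrict (¬? ∘ >?) S)) F n ≡ gen (restrict ≡? S) F n
    eqs = gen-bij (restrict ≡? (restrict (¬? ∘ >?) S)) (restrict ≡? S) id (λ ((r , _) , q) → r , q) (λ _ → refl) (λ _ _ q → q)
      (λ {z} (r , q) → z , ((r , λ lt → ℤₚ.<-irrefl (sym q) lt) , q) , refl) (λ _ → refl) n

  Pos? : Decidable {A = ℤ} Positive
  Pos? = 0ℤ ℤ.<?_

  slice : ℤ → List (ℤ × (ℤ × ℤ))
  slice (+ suc k) = map (λ i → (+ suc k - + 2 * + suc i , + suc i , + suc k - + suc i)) (upTo k)
  slice _ = []

  unique-slice : ∀ b → Unique (slice b)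
  unique-slice (+ zero) = AllPairs.[]
  unique-slice (+ suc k) = Uniq.map⁺ (λ q → ℕₚ.suc-injective (ℤₚ.+-injective (cong (λ z → proj₁ (proj₂ z)) q))) (Uniq.upTo⁺ k)
  unique-slice -[1+ k ] = AllPairs.[]

  slice-∈ : ∀ b {z} → z ∈ slice b → Positive (proj₁ (proj₂ z)) × Positive (proj₂ (proj₂ z)) × proj₁ (proj₂ z) + proj₁ z ≡ proj₂ (proj₂ z) × proj₁ (proj₂ z) + proj₂ (proj₂ z) ≡ b
  slice-∈ (+ suc k) z∈ with ∈-map⁻ _ z∈
  ... | i , i∈ , refl = ℤ.+<+ (s≤s z≤n) , pos-diff {+ suc i} {+ suc k} (ℤ.+<+ (s≤s (∈-upTo⁻ i∈))) , l₁ (+ suc i) (+ suc k) , l₂ (+ suc i) (+ suc k)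
    where
    l₁ : ∀ a b → a + (b - + 2 * a) ≡ b - a
    l₁ = solve-∀
    l₂ : ∀ a b → a + (b - a) ≡ b
    l₂ = solve-∀

  ∈-slice : ∀ B a c → Positive a → Positive c → a + B ≡ c → (B , a , c) ∈ slice (a + c)
  ∈-slice B (+ suc i) (+ suc j) _ _ q = subst (_∈ slice (+ suc i + + suc j)) (cong₂ (λ x y → x , + suc i , y) (trans (l₁ (+ suc i) (+ suc j)) (trans (cong (_- + suc i) (sym q)) (l₃ (+ suc i) B))) (l₂ (+ suc i) (+ suc j)))
    (∈-map⁺ (λ i' → (+ suc (i ℕ.+ suc j) - + 2 * + suc i' , + suc i' , + suc (i ℕ.+ suc j) - + suc i')) (∈-upTo⁺ (ℕₚ.m<m+n i (s≤s z≤n))))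
    where
    l₁ : ∀ a c → (a + c) - + 2 * a ≡ c - a
    l₁ = solve-∀
    l₂ : ∀ a c → (a + c) - a ≡ c
    l₂ = solve-∀
    l₃ : ∀ a B → (a + B) - a ≡ B
    l₃ = solve-∀
  ∈-slice B (+ zero) c (ℤ.+<+ ()) _ q
  ∈-slice B (+ suc i) (+ zero) _ (ℤ.+<+ ()) q

  -- If a + B = c, the discriminant is (a + c)². The surviving triples are grouped by b = a + c, and
  -- in each group a runs from 1 to b - 1.
  boundary-slices : ∀ n → gen (restrict ≡? S) F n ≡ gen (restrict Pos? (Sq m)) (λ b → ∑ (slice b) F) n
  boundary-slices n = trans (gen-def (restrict ≡? S) F n) (trans (∑-bij {ys = concatMap slice (fib T n)} {v = F} (unique (restrict ≡? S) n)
      (unique-concatMap slice (fib T n) (unique T n) unique-slice (λ {b} {b'} p q → trans (sym (proj₂ (proj₂ (proj₂ (slice-∈ b p))))) (proj₂ (proj₂ (proj₂ (slice-∈ b' q))))))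
      id into (λ _ _ q → q) (λ {z} z∈ → z , out z∈ , refl) (λ _ → refl)) (trans (∑-concatMap slice (fib T n) F) (sym (gen-def T _ n))))
    where
    T = restrict Pos? (Sq m)
    l : ∀ M a B → M * (B * B) + (+ 4 * M) * (a * (a + B)) ≡ M * ((a + (a + B)) * (a + (a + B)))
    l = solve-∀
    e-eq : ∀ B a c → a + B ≡ c → e S (B , a , c) ≡ M * ((a + c) * (a + c))
    e-eq B a c refl = trans (e-form B a (a + B)) (l M a B)
    into : ∀ {z} → z ∈ fib (restrict ≡? S) n → z ∈ concatMap slice (fib T n)
    into {B , a , c} z∈ = let (((_ , a>0 , c>0) , q) , en) = sound (restrict ≡? S) z∈ in
      ∈-concatMap⁺ slice (Any.map (λ { refl → ∈-slice B a c a>0 c>0 q })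
        (complete T {a + c} {n} (tt , ℤₚ.+-mono-< a>0 c>0) (trans (sym (e-eq B a c q)) en)))
    out : ∀ {z} → z ∈ concatMap slice (fib T n) → z ∈ fib (restrict ≡? S) n
    out {B , a , c} z∈ = let (b , b∈ , zb) = find (∈-concatMap⁻ slice {xs = fib T n} z∈); (a>0 , c>0 , q , s) = slice-∈ b zb; (_ , en) = sound T b∈ in
      complete (restrict ≡? S) ((tt , a>0 , c>0) , q) (trans (e-eq B a c q) (trans (cong (λ t → M * (t * t)) s) en))

  even-positive : (G : ℤ → ℤ) → G 0ℤ ≡ 0ℤ → (∀ b → G (- b) ≡ G b) → ∀ n → gen (Sq m) G n ≡ + 2 * gen (restrict Pos? (Sq m)) G n
  even-positive G G0 Gev n = trans (gen-restrict Pos? (Sq m) G n) (trans (cong (_+_ (gen (restrict Pos? (Sq m)) G n))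
      (trans (gen-restrict Zero? (restrict (¬? ∘ Pos?) (Sq m)) G n) (trans (cong₂ _+_ (gen-0 (restrict Zero? (restrict (¬? ∘ Pos?) (Sq m))) (λ {(_ , refl) → G0}) n) negs) (ℤₚ.+-identityˡ _))))
      (dbl (gen (restrict Pos? (Sq m)) G n)))
    where
    dbl : ∀ x → x + x ≡ + 2 * x
    dbl = solve-∀
    Zero? : Decidable {A = ℤ} (_≡ 0ℤ)
    Zero? b = b ℤ.≟ 0ℤ
    sqn : ∀ M b → M * ((- b) * (- b)) ≡ M * (b * b)
    sqn = solve-∀
    neg-pos : ∀ {b} → ¬ Positive b → b ≢ 0ℤ → Positive (- b)
    neg-pos {+ zero} _ h = ⊥-elim (h refl)
    neg-pos {+ suc k} h _ = ⊥-elim (h (ℤ.+<+ (s≤s z≤n)))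
    neg-pos { -[1+ k ]} _ _ = ℤ.+<+ (s≤s z≤n)
    pos-neg : ∀ {b} → Positive b → ¬ Positive (- b) × - b ≢ 0ℤ
    pos-neg {+ suc k} _ = (λ ()) , λ ()
    pos-neg {+ zero} (ℤ.+<+ ())
    negs : gen (restrict (¬? ∘ Zero?) (restrict (¬? ∘ Pos?) (Sq m))) G n ≡ gen (restrict Pos? (Sq m)) G n
    negs = gen-bij (restrict (¬? ∘ Zero?) (restrict (¬? ∘ Pos?) (Sq m))) (restrict Pos? (Sq m)) -_
      (λ ((_ , p) , z) → tt , neg-pos p z) (λ {b} _ → sqn M b) (λ {b} {b'} _ _ q → ℤₚ.neg-injective q)
      (λ {b} (_ , p) → - b , ((tt , proj₁ (pos-neg p)) , proj₂ (pos-neg p)) , ℤₚ.neg-involutive b) (λ {b} _ → sym (Gev b)) n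

  -- The square roots b of the discriminant are positive in the slices; the factor 2 extends the sum
  -- to all integers b, as `G` is even and vanishes at 0.
  river : (G : ℤ → ℤ) → G 0ℤ ≡ 0ℤ → (∀ b → G (- b) ≡ G b) →
    (∀ j → sumTo j (λ i → F (+ suc j - + 2 * + suc i , + suc i , + suc j - + suc i)) ≡ G (+ suc j)) →
    ∀ n → + 2 * gen S F n ≡ gen (Sq m) G n
  river G G0 Gev h n = trans (cong (+ 2 *_) (trans (boundary n) (trans (boundary-slices n)
      (gen-cong-R T (λ {b} (_ , p) → val b p) n))))
    (sym (even-positive G G0 Gev n))
    where
    T = restrict Pos? (Sq m)
    val : ∀ b → Positive b → ∑ (slice b) F ≡ G b
    val (+ suc j) _ = trans (∑-map _ (upTo j) F) (trans (∑-upTo j _) (h j))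
    val (+ zero) (ℤ.+<+ ())

sq-odd : ∀ m → 1 ℕ.≤ m → (w w' : ℤ → ℤ) → (∀ k → w (+ 2 * k) ≡ 0ℤ) → (∀ k → w (odd k) ≡ w' k) → gen (Sq m) w ≈ gen (Odd m) w'
sq-odd m h w w' p q n = trans (sq-decomp m h w n) (trans (cong₂ _+_ (gen-0 (Sq (4 ℕ.* m)) (λ {k} _ → p k) n) (gen-cong (Odd m) q n)) (ℤₚ.+-identityˡ _))

θ-sq : ∀ m → 1 ℕ.≤ m → gen (Sq m) od ≈ θ m
θ-sq m h = sq-odd m h od (λ _ → 1ℤ) (λ k → decide (ap tod (+ 2 · v₀)) (cst 0ℤ) refl (k ∷ [])) (λ k → decide (ap tod (+ 2 · v₀ ⊞ lit 1ℤ)) (cst 1ℤ) refl (k ∷ []))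

J-sq : ∀ m → 1 ℕ.≤ m → gen (Sq m) (λ b → χ₄ b * b) ≈ J m
J-sq m h = sq-odd m h (λ b → χ₄ b * b) (λ n → sgn n * odd n)
  (λ k → cong (_* (+ 2 * k)) (decide (ap t₄ (+ 2 · v₀)) (cst 0ℤ) refl (k ∷ [])))
  (λ k → cong (_* odd k) (decide (ap t₄ (+ 2 · v₀ ⊞ lit 1ℤ)) (ap ts v₀) refl (k ∷ [])))

E-sq : ∀ m → 1 ℕ.≤ m → gen (Sq m) χ₁₂ ≈ E m
E-sq m h = sq-odd m h χ₁₂ (λ n → sgn n * χ₃ (odd n)) (λ k → decide (ap t₁₂ (+ 2 · v₀)) (cst 0ℤ) refl (k ∷ []))
  (λ k → decide (ap t₁₂ (+ 2 · v₀ ⊞ lit 1ℤ)) (ap ts v₀ :*: ap t₃ (+ 2 · v₀ ⊞ lit 1ℤ)) refl (k ∷ []))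

Fun : Set
Fun = ∀ {n} → Lin n → Lin n → Lin n → Exp n

fun : Fun → ℤ × (ℤ × ℤ) → ℤ
fun f (B , a , c) = ⟦ f v₀ v₁ v₂ ⟧ (B ∷ a ∷ c ∷ [])

-- `W` is the weight that is wanted, even in B: a theta series times a divisor series. `U` is odd in
-- B, hence sums to zero; it is chosen so that `F`, which also contains `W` with a and c exchanged,
-- satisfies `swap` and `shift`.
W₁ U₁ F₁ W₂ U₂ F₂ : Fun
W₁ B a c = ap tod B :*: (ap t₄ a :*: ap te c)
U₁ B a c = ap t₄ B :*: (ap te c :-: ap te a)
F₁ B a c = W₁ B a c :+: W₁ B c a :+: U₁ B a c
W₂ B a c = ap t₁₂ B :*: (ap t₃ a :*: (ap tc c :*: ap tev c))
U₂ B a c = ap t₄ B :*: (ap tev c :*: Y a c :-: ap tev a :*: Y c a)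
  where
  Y : _ → _ → _
  Y a c = ap tc c :*: (ap t₃ a :*: ap t₃ a) :-: cst (+ 3) :*: ((cst 1ℤ :-: ap t₃ B :*: ap t₃ B) :*: (ap t₃ a :*: ap t₃ c))
F₂ B a c = cst (+ 3) :*: (W₂ B a c :+: W₂ B c a :+: U₂ B a c)

module Split (m : ℕ) (1≤m : 1 ℕ.≤ m) where
  S = Forms m

  swap-sum : (w : ℤ × (ℤ × ℤ) → ℤ) → ∀ n → gen S (λ (B , a , c) → w (B , c , a)) n ≡ gen S w n
  swap-sum w = gen-bij S S (λ (B , a , c) → B , c , a) (λ (t , p , q) → t , q , p)
    (λ {(B , a , c)} _ → cong (λ t → ⟪ m ⟫ * (B * B) + ⟪ 4 ℕ.* m ⟫ * t) (ℤₚ.*-comm c a))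
    (λ { _ _ refl → refl }) (λ {(B , a , c)} (t , p , q) → (B , c , a) , (t , q , p) , refl) (λ _ → refl)

  anti-sum : (u : ℤ × (ℤ × ℤ) → ℤ) → (∀ B a c → u (B , a , c) ≡ - u (- B , a , c)) → ∀ n → gen S u n ≡ 0ℤ
  anti-sum u h = gen-anti S (λ (B , a , c) → - B , a , c) id (λ {(B , a , c)} _ → l ⟪ m ⟫ B (⟪ 4 ℕ.* m ⟫ * (a * c)))
    (λ {(B , a , c)} _ → cong (λ x → x , a , c) (ℤₚ.neg-involutive B)) (λ {(B , a , c)} _ → h B a c)
    where
    l : ∀ M B x → M * ((- B) * (- B)) + x ≡ M * (B * B) + x
    l = solve-∀

  split-sum : (w u : ℤ × (ℤ × ℤ) → ℤ) → (∀ B a c → u (B , a , c) ≡ - u (- B , a , c)) →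
    ∀ n → gen S (λ (B , a , c) → w (B , a , c) + w (B , c , a) + u (B , a , c)) n ≡ + 2 * gen S w n
  split-sum w u h n = trans (gen-+ S (λ (B , a , c) → w (B , a , c) + w (B , c , a)) u n)
    (trans (cong₂ _+_ (trans (gen-+ S w (λ (B , a , c) → w (B , c , a)) n) (cong (_+_ (gen S w n)) (swap-sum w n))) (anti-sum u h n)) (l (gen S w n)))
    where
    l : ∀ x → x + x + 0ℤ ≡ + 2 * x
    l = solve-∀

-- By `φ⁻²-divisors`, 1 + 4 R₄ is the square of φ⁻(8m). The counterpart of 2(1 + 3 R₃) is `b₂`:
-- compare `two-b` with `b₂-split`.
R₄ R₃ : ℕ → Ser
R₄ m = gen (Dv (4 ℕ.* m)) (λ (a , c) → χ₄ a * e₂ c)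
R₃ m = gen (Dv (4 ℕ.* m)) (λ (a , c) → χ₃ a * (c₃ c * ev c))

sumExp : ∀ {n} → (ℤ → Exp n) → Exp n
sumExp f = f 0ℤ :+: f 1ℤ :+: f (+ 2) :+: f (+ 3) :+: f (+ 4) :+: f (+ 5) :+: f (+ 6) :+: f (+ 7) :+: f (+ 8) :+: f (+ 9) :+: f (+ 10) :+: f (+ 11)

12+ : ∀ t b → tab t (+ 12 + b) ≡ tab t b
12+ t b = trans (cong (tab t) (ℤₚ.+-comm (+ 12) b)) (tab-per t b 1ℤ)

-- Twelve consecutive terms of a slice contribute 12 χ₄(b) for odd b, so the slice sum grows
-- linearly in b; this produces the weight χ₄(b) b of `J`.
θR₄ : ∀ m → 1 ℕ.≤ m → ∀ n → + 4 * (θ m ⊛ R₄ m) n ≡ J m n - θ m n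
θR₄ m h n = begin
  + 4 * (θ m ⊛ R₄ m) n ≡⟨ cong (+ 4 *_) (⊛-cong {g = R₄ m} (θ-sq m h) (λ _ → refl) n) ⟨
  + 4 * (gen (Sq m) od ⊛ R₄ m) n ≡⟨ cong (+ 4 *_) (gen-⊗ (Sq m) (Dv (4 ℕ.* m)) od (λ (a , c) → χ₄ a * e₂ c) n) ⟨
  + 4 * gen S (fun W₁) n ≡⟨ l (gen S (fun W₁) n) ⟩
  + 2 * (+ 2 * gen S (fun W₁) n)
    ≡⟨ cong (+ 2 *_) (split-sum (fun W₁) (fun U₁) (λ B a c → decide (U₁ v₀ v₁ v₂) (negᵉ (U₁ (neg v₀) v₁ v₂)) refl (B ∷ a ∷ c ∷ [])) n) ⟨
  + 2 * gen S (fun F₁) n ≡⟨ riv n ⟩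
  gen (Sq m) G n ≡⟨ gen-cong (Sq m) (λ b → trans (l₂ (od b) (χ₄ b) b) (cong (λ t → t * b + - od b) (decide (ap tod v₀ :*: ap t₄ v₀) (ap t₄ v₀) refl (b ∷ [])))) n ⟩
  gen (Sq m) (λ b → χ₄ b * b + - od b) n ≡⟨ gen-+ (Sq m) _ _ n ⟩
  gen (Sq m) (λ b → χ₄ b * b) n + gen (Sq m) (λ b → - od b) n ≡⟨ cong₂ _+_ (J-sq m h n) (trans (gen-neg (Sq m) od n) (cong -_ (θ-sq m h n))) ⟩
  J m n - θ m n ∎
  where
  open ≡-Reasoning
  open Split m h
  G : ℤ → ℤ
  G b = od b * (χ₄ b * b - 1ℤ)
  l : ∀ x → + 4 * x ≡ + 2 * (+ 2 * x)
  l = solve-∀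
  l₂ : ∀ o x b → o * (x * b - 1ℤ) ≡ (o * x) * b + - o
  l₂ = solve-∀
  l₃ : ∀ o x b → o * (- x * - b - 1ℤ) ≡ o * (x * b - 1ℤ)
  l₃ = solve-∀
  l₄ : ∀ o x b → + 12 * (o * x) ≡ o * (x * (+ 12 + b) - 1ℤ) - o * (x * b - 1ℤ)
  l₄ = solve-∀
  f : ∀ {n} → Lin n → Lin n → Exp n
  f a b = F₁ (b ⊟ + 2 · a) a (b ⊟ a)
  riv : ∀ n → + 2 * gen S (fun F₁) n ≡ gen (Sq m) G n
  riv = River.river m h (fun F₁)
    (λ B a c → decide (F₁ (neg v₀) v₂ v₁) (F₁ v₀ v₁ v₂) refl (B ∷ a ∷ c ∷ []))
    (λ B a c → decide (F₁ v₀ v₁ v₂) (negᵉ (F₁ (+ 2 · v₂ ⊟ v₀) (v₁ ⊞ v₀ ⊟ v₂) v₂)) refl (B ∷ a ∷ c ∷ []))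
    G refl (λ b → trans (cong₂ (λ o x → o * (x * - b - 1ℤ)) (decide (ap tod (neg v₀)) (ap tod v₀) refl (b ∷ [])) (χ₄-neg b)) (l₃ (od b) (χ₄ b) b))
    (periodic-sum (λ a b → fun F₁ (b - + 2 * a , a , b - a)) G
      (λ a b → decide (f v₀ (lit (+ 12) ⊞ v₁)) (f v₀ v₁) refl (a ∷ b ∷ []))
      (λ b → trans (decide (sumExp (λ j → f (lit j ⊞ v₀) v₀)) (cst (+ 12) :*: (ap tod v₀ :*: ap t₄ v₀)) refl (b ∷ []))
        (trans (l₄ (od b) (χ₄ b) b) (cong₂ (λ o x → o * (x * (+ 12 + b) - 1ℤ) - od b * (χ₄ b * b - 1ℤ)) (sym (12+ tod b)) (sym (12+ t₄ b)))))
      refl)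

-- As for `θR₄`, the slice sums now being 4(χ₄(b) b - χ₁₂(b)). The common factor 4 is removed in
-- `J-ER₃`.
ER₃ : ∀ m → 1 ℕ.≤ m → ∀ n → + 12 * (E m ⊛ R₃ m) n ≡ + 4 * (J m n - E m n)
ER₃ m h n = begin
  + 12 * (E m ⊛ R₃ m) n ≡⟨ cong (+ 12 *_) (⊛-cong {g = R₃ m} (E-sq m h) (λ _ → refl) n) ⟨
  + 12 * (gen (Sq m) χ₁₂ ⊛ R₃ m) n ≡⟨ cong (+ 12 *_) (gen-⊗ (Sq m) (Dv (4 ℕ.* m)) χ₁₂ (λ (a , c) → χ₃ a * (c₃ c * ev c)) n) ⟨
  + 12 * gen S (fun W₂) n ≡⟨ l (gen S (fun W₂) n) ⟩
  + 2 * (+ 3 * (+ 2 * gen S (fun W₂) n))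
    ≡⟨ cong (λ t → + 2 * (+ 3 * t)) (split-sum (fun W₂) (fun U₂) (λ B a c → decide (U₂ v₀ v₁ v₂) (negᵉ (U₂ (neg v₀) v₁ v₂)) refl (B ∷ a ∷ c ∷ [])) n) ⟨
  + 2 * (+ 3 * gen S (λ (B , a , c) → fun W₂ (B , a , c) + fun W₂ (B , c , a) + fun U₂ (B , a , c)) n) ≡⟨ cong (+ 2 *_) (gen-* S (+ 3) _ n) ⟨
  + 2 * gen S (fun F₂) n ≡⟨ riv n ⟩
  gen (Sq m) G n ≡⟨ gen-* (Sq m) (+ 4) (λ b → χ₄ b * b + - χ₁₂ b) n ⟩
  + 4 * gen (Sq m) (λ b → χ₄ b * b + - χ₁₂ b) n ≡⟨ cong (+ 4 *_) (gen-+ (Sq m) (λ b → χ₄ b * b) (λ b → - χ₁₂ b) n) ⟩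
  + 4 * (gen (Sq m) (λ b → χ₄ b * b) n + gen (Sq m) (λ b → - χ₁₂ b) n) ≡⟨ cong (+ 4 *_) (cong₂ _+_ (J-sq m h n) (trans (gen-neg (Sq m) χ₁₂ n) (cong -_ (E-sq m h n)))) ⟩
  + 4 * (J m n - E m n) ∎
  where
  open ≡-Reasoning
  open Split m h
  G : ℤ → ℤ
  G b = + 4 * (χ₄ b * b + - χ₁₂ b)
  l : ∀ x → + 12 * x ≡ + 2 * (+ 3 * (+ 2 * x))
  l = solve-∀
  l₃ : ∀ x y b → + 4 * (- x * - b + - y) ≡ + 4 * (x * b + - y)
  l₃ = solve-∀
  l₄ : ∀ x y b → + 48 * x ≡ + 4 * (x * (+ 12 + b) + - y) - + 4 * (x * b + - y)
  l₄ = solve-∀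
  f : ∀ {n} → Lin n → Lin n → Exp n
  f a b = F₂ (b ⊟ + 2 · a) a (b ⊟ a)
  riv : ∀ n → + 2 * gen S (fun F₂) n ≡ gen (Sq m) G n
  riv = River.river m h (fun F₂)
    (λ B a c → decide (F₂ (neg v₀) v₂ v₁) (F₂ v₀ v₁ v₂) refl (B ∷ a ∷ c ∷ []))
    (λ B a c → decide (F₂ v₀ v₁ v₂) (negᵉ (F₂ (+ 2 · v₂ ⊟ v₀) (v₁ ⊞ v₀ ⊟ v₂) v₂)) refl (B ∷ a ∷ c ∷ []))
    G refl (λ b → trans (cong₂ (λ x y → + 4 * (x * - b + - y)) (χ₄-neg b) (decide (ap t₁₂ (neg v₀)) (ap t₁₂ v₀) refl (b ∷ []))) (l₃ (χ₄ b) (χ₁₂ b) b))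
    (periodic-sum (λ a b → fun F₂ (b - + 2 * a , a , b - a)) G
      (λ a b → decide (f v₀ (lit (+ 12) ⊞ v₁)) (f v₀ v₁) refl (a ∷ b ∷ []))
      (λ b → trans (decide (sumExp (λ j → f (lit j ⊞ v₀) v₀)) (cst (+ 48) :*: ap t₄ v₀) refl (b ∷ []))
        (trans (l₄ (χ₄ b) (χ₁₂ b) b) (cong₂ (λ x y → + 4 * (x * (+ 12 + b) + - y) - + 4 * (χ₄ b * b + - χ₁₂ b)) (sym (12+ t₄ b)) (sym (12+ t₁₂ b)))))
      refl)

opaque
  unfolding _⊹_ ⊝_

  J-θR₄ : ∀ m → 1 ℕ.≤ m → θ m ⊛ (K 1ℤ ⊹ K (+ 4) ⊛ R₄ m) ≋ J m
  J-θR₄ m h = ≋-trans (solve 2 (λ t r → t :* (con 1ℤ :+ con (+ 4) :* r) := t :+ con (+ 4) :* (t :* r)) ≋-refl (θ m) (R₄ m))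
    (mk λ n → trans (cong (_+_ (θ m n)) (trans (K-⊛ (+ 4) (θ m ⊛ R₄ m) n) (θR₄ m h n))) (l (θ m n) (J m n)))
    where
    l : ∀ a b → a + (b - a) ≡ b
    l = solve-∀

  J-ER₃ : ∀ m → 1 ℕ.≤ m → E m ⊛ (K 1ℤ ⊹ K (+ 3) ⊛ R₃ m) ≋ J m
  J-ER₃ m h = ≋-trans (solve 2 (λ t r → t :* (con 1ℤ :+ con (+ 3) :* r) := t :+ con (+ 3) :* (t :* r)) ≋-refl (E m) (R₃ m))
    (mk λ n → trans (cong (_+_ (E m n)) (trans (K-⊛ (+ 3) (E m ⊛ R₃ m) n) (ℤₚ.*-cancelˡ-≡ (+ 4) _ _ (trans (l' ((E m ⊛ R₃ m) n)) (ER₃ m h n))))) (l (E m n) (J m n)))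
    where
    l : ∀ a b → a + (b - a) ≡ b
    l = solve-∀
    l' : ∀ x → + 4 * (+ 3 * x) ≡ + 12 * x
    l' = solve-∀

φ⁻²-divisors : ∀ m → 1 ℕ.≤ m → φ⁻ (8 ℕ.* m) ⊛ φ⁻ (8 ℕ.* m) ≋ K 1ℤ ⊹ K (+ 4) ⊛ R₄ m
φ⁻²-divisors m h = ⊛-cancelˡ (Lead-leads (1≤k*m 7 h) (λ ()) (θ-lead m h)) (≋-trans (≋-sym (J-product m h)) (≋-sym (J-θR₄ m h)))

-- The hexagonal form

td : List ℤ
td = 1ℤ ∷ 0ℤ ∷ 0ℤ ∷ 1ℤ ∷ 0ℤ ∷ 0ℤ ∷ 1ℤ ∷ 0ℤ ∷ 0ℤ ∷ 1ℤ ∷ 0ℤ ∷ 0ℤ ∷ []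

d₃ : ℤ → ℤ
d₃ = tab td

mod3 : ∀ x → (∃[ k ] (+ 3 * k ≡ x)) ⊎ d₃ x ≡ 0ℤ
mod3 x with x %ℕ 3 | a≡a%ℕn+[a/ℕn]*n x 3 | n%ℕd<d x 3
... | 0 | q | _ = inj₁ (x /ℕ 3 , sym (trans q (lem (x /ℕ 3))))
  where
  lem : ∀ y → 0ℤ + y * + 3 ≡ + 3 * y
  lem = solve-∀
... | 1 | q | _ = inj₂ (trans (cong d₃ (trans q (lem (x /ℕ 3)))) (decide (ap td (+ 3 · v₀ ⊞ lit 1ℤ)) (cst 0ℤ) refl (x /ℕ 3 ∷ [])))
  where
  lem : ∀ y → 1ℤ + y * + 3 ≡ + 3 * y + 1ℤ
  lem = solve-∀
... | 2 | q | _ = inj₂ (trans (cong d₃ (trans q (lem (x /ℕ 3)))) (decide (ap td (+ 3 · v₀ ⊞ lit (+ 2))) (cst 0ℤ) refl (x /ℕ 3 ∷ [])))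
  where
  lem : ∀ y → + 2 + y * + 3 ≡ + 3 * y + + 2
  lem = solve-∀
... | suc (suc (suc _)) | _ | s≤s (s≤s (s≤s ()))

d₃-3* : ∀ k → d₃ (+ 3 * k) ≡ 1ℤ
d₃-3* k = decide (ap td (+ 3 · v₀)) (cst 1ℤ) refl (k ∷ [])

3∣? : ∀ {A : Set} (f : A → ℤ) → Decidable {A = A} (λ i → d₃ (f i) ≡ 1ℤ)
3∣? f i = d₃ (f i) ℤ.≟ 1ℤ

3∣-witness : ∀ x → d₃ x ≡ 1ℤ → ∃[ k ] (+ 3 * k ≡ x)
3∣-witness x p = [ id , (λ q → ⊥-elim (1≢0 (trans (sym p) q))) ]′ (mod3 x)

3∤-zero : ∀ x → ¬ d₃ x ≡ 1ℤ → d₃ x ≡ 0ℤ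
3∤-zero x np = [ (λ (k , q) → ⊥-elim (np (trans (cong d₃ (sym q)) (d₃-3* k)))) , id ]′ (mod3 x)

gen-param : ∀ {I J : Set} (S : Sys J) (T : Sys I) {P : J → Set} (P? : Decidable P) (w : J → ℤ) (f : I → J) →
  (∀ {i} → R T i → R S (f i)) → (∀ {i} → R T i → P (f i)) → (∀ {i} → R T i → e S (f i) ≡ e T i) → (∀ {i i'} → f i ≡ f i' → i ≡ i') →
  (∀ {j} → R S j → P j → ∃[ i ] (R T i × f i ≡ j)) → (∀ {j} → R S j → ¬ P j → w j ≡ 0ℤ) →
  ∀ n → gen S w n ≡ gen T (w ∘ f) n
gen-param S T P? w f into inP ef inj surj vanish n = trans (gen-restrict P? S w n) (trans (cong₂ _+_
    (sym (gen-bij T (restrict P? S) {w ∘ f} {w} f (λ r → into r , inP r) ef (λ _ _ → inj) (λ (r , p) → surj r p) (λ _ → refl) n))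
    (gen-0 (restrict (¬? ∘ P?) S) (λ (r , np) → vanish r np) n)) (ℤₚ.+-identityʳ _))

-- With nome q^(8m), `H` is the cubic theta function a(q) of the Borweins and `b₂` is twice their
-- b(q), because c₃(x) = ω^x + ω^(-x).
H b₂ : ℕ → Ser
H m = gen (Hex m) (λ _ → 1ℤ)
b₂ m = gen (Hex m) (λ (p , q) → c₃ (p - q))

module Cube (m : ℕ) (1≤m : 1 ℕ.≤ m) where
  O = Odd m
  O³ = O ⊗ (O ⊗ O)

  flip : ℤ → ℤ
  flip n = -1ℤ - n

  flip² : ∀ n → flip (flip n) ≡ n
  flip² = lem
    where
    lem : ∀ n → -1ℤ - (-1ℤ - n) ≡ n
    lem = solve-∀

  odd-flip² : ∀ n → odd (flip n) * odd (flip n) ≡ odd n * odd n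
  odd-flip² = lem
    where
    lem : ∀ n → (+ 2 * (-1ℤ - n) + 1ℤ) * (+ 2 * (-1ℤ - n) + 1ℤ) ≡ (+ 2 * n + 1ℤ) * (+ 2 * n + 1ℤ)
    lem = solve-∀

  sgn-flip : ∀ n → sgn n ≡ - sgn (flip n)
  sgn-flip n = decide (ap ts v₀) (negᵉ (ap ts (lit -1ℤ ⊟ v₀))) refl (n ∷ [])

  χ : ℤ × (ℤ × ℤ) → ℤ
  χ (a , b , c) = sgn a * (sgn b * sgn c)

  flip-b-zero : (w : ℤ × (ℤ × ℤ) → ℤ) → (∀ a b c → w (a , flip b , c) ≡ w (a , b , c)) → ∀ n → gen O³ (λ i → χ i * w i) n ≡ 0ℤ
  flip-b-zero w h = gen-anti O³ (λ (a , b , c) → a , flip b , c) id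
    (λ {(a , b , c)} _ → cong (λ t → ⟪ m ⟫ * (odd a * odd a) + (⟪ m ⟫ * t + ⟪ m ⟫ * (odd c * odd c))) (odd-flip² b))
    (λ {(a , b , c)} _ → cong (λ t → a , t , c) (flip² b))
    (λ {(a , b , c)} _ → trans (cong₂ (λ s t → (sgn a * (s * sgn c)) * t) (sgn-flip b) (sym (h a b c))) (l (sgn a) (sgn (flip b)) (sgn c) (w (a , flip b , c))))
    where
    l : ∀ a b c w → (a * (- b * c)) * w ≡ - ((a * (b * c)) * w)
    l = solve-∀

  flip-c-zero : (w : ℤ × (ℤ × ℤ) → ℤ) → (∀ a b c → w (a , b , flip c) ≡ w (a , b , c)) → ∀ n → gen O³ (λ i → χ i * w i) n ≡ 0ℤ
  flip-c-zero w h = gen-anti O³ (λ (a , b , c) → a , b , flip c) id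
    (λ {(a , b , c)} _ → cong (λ t → ⟪ m ⟫ * (odd a * odd a) + (⟪ m ⟫ * (odd b * odd b) + ⟪ m ⟫ * t)) (odd-flip² c))
    (λ {(a , b , c)} _ → cong (λ t → a , b , t) (flip² c))
    (λ {(a , b , c)} _ → trans (cong₂ (λ s t → (sgn a * (sgn b * s)) * t) (sgn-flip c) (sym (h a b c))) (l (sgn a) (sgn b) (sgn (flip c)) (w (a , b , flip c))))
    where
    l : ∀ a b c w → (a * (b * - c)) * w ≡ - ((a * (b * c)) * w)
    l = solve-∀

  swap-ab : (w : ℤ × (ℤ × ℤ) → ℤ) → ∀ n → gen O³ (λ i → χ i * w i) n ≡ gen O³ (λ i → χ i * w (proj₁ (proj₂ i) , proj₁ i , proj₂ (proj₂ i))) n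
  swap-ab w = gen-bij O³ O³ (λ (a , b , c) → b , a , c) id
    (λ {(a , b , c)} _ → l (⟪ m ⟫ * (odd b * odd b)) (⟪ m ⟫ * (odd a * odd a)) (⟪ m ⟫ * (odd c * odd c)))
    (λ { _ _ refl → refl }) (λ {(a , b , c)} _ → (b , a , c) , (tt , tt , tt) , refl)
    (λ {(a , b , c)} _ → cong (_* w (a , b , c)) (l' (sgn a) (sgn b) (sgn c)))
    where
    l : ∀ a b c → a + (b + c) ≡ b + (a + c)
    l = solve-∀
    l' : ∀ a b c → a * (b * c) ≡ b * (a * c)
    l' = solve-∀

  swap-ac : (w : ℤ × (ℤ × ℤ) → ℤ) → ∀ n → gen O³ (λ i → χ i * w i) n ≡ gen O³ (λ i → χ i * w (proj₂ (proj₂ i) , proj₁ (proj₂ i) , proj₁ i)) n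
  swap-ac w = gen-bij O³ O³ (λ (a , b , c) → c , b , a) id
    (λ {(a , b , c)} _ → l (⟪ m ⟫ * (odd c * odd c)) (⟪ m ⟫ * (odd b * odd b)) (⟪ m ⟫ * (odd a * odd a)))
    (λ { _ _ refl → refl }) (λ {(a , b , c)} _ → (c , b , a) , (tt , tt , tt) , refl)
    (λ {(a , b , c)} _ → cong (_* w (a , b , c)) (l' (sgn a) (sgn b) (sgn c)))
    where
    l : ∀ a b c → a + (b + c) ≡ c + (b + a)
    l = solve-∀
    l' : ∀ a b c → a * (b * c) ≡ c * (b * a)
    l' = solve-∀

  oddᵉ : ∀ {n} → Lin n → Lin n
  oddᵉ l = + 2 · l ⊞ lit 1ℤ

  Δ : ℤ → ℤ → ℤ
  Δ x y = c₃ (odd x - odd y)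

  -- symmetric in the three residues, and supported on triples with sum divisible by 3
  Γ : ℤ × (ℤ × ℤ) → ℤ
  Γ (a , b , c) = Δ b c + Δ a b + Δ a c

  prod : ∀ n → gen O³ (λ (a , b , c) → (sgn a * odd a) * ((sgn b * χ₃ (odd b)) * (sgn c * χ₃ (odd c)))) n ≡ (J m ⊛ (E m ⊛ E m)) n
  prod n = trans (gen-⊗ O (O ⊗ O) (λ a → sgn a * odd a) (λ (b , c) → (sgn b * χ₃ (odd b)) * (sgn c * χ₃ (odd c))) n)
    (⊛-cong {f = J m} (λ _ → refl) (gen-⊗ O O (λ b → sgn b * χ₃ (odd b)) (λ c → sgn c * χ₃ (odd c))) n)

  -- By the addition theorem 2 c₃(x - y) = c₃(x) c₃(y) + 3 χ₃(x) χ₃(y). The first product is even in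
  -- x, so it cancels against the sign of `flip`; the second gives `E` twice.
  step₁ : ∀ n → + 2 * gen O³ (λ i → χ i * (odd (proj₁ i) * Δ (proj₁ (proj₂ i)) (proj₂ (proj₂ i)))) n ≡ + 3 * (J m ⊛ (E m ⊛ E m)) n
  step₁ n = trans (sym (gen-* O³ (+ 2) _ n)) (trans
    (gen-cong O³ {v = λ (a , b , c) → χ (a , b , c) * ((odd a * c₃ (odd c)) * c₃ (odd b)) + + 3 * ((sgn a * odd a) * ((sgn b * χ₃ (odd b)) * (sgn c * χ₃ (odd c))))}
      (λ (a , b , c) → trans (l₁ (sgn a) (sgn b) (sgn c) (odd a) (Δ b c))
        (trans (cong ((sgn a * (sgn b * sgn c) * odd a) *_) (decide (cst (+ 2) :*: ap tc (oddᵉ v₀ ⊟ oddᵉ v₁)) (ap tc (oddᵉ v₀) :*: ap tc (oddᵉ v₁) :+: cst (+ 3) :*: (ap t₃ (oddᵉ v₀) :*: ap t₃ (oddᵉ v₁))) refl (b ∷ c ∷ [])))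
          (l₂ (sgn a) (sgn b) (sgn c) (odd a) (c₃ (odd b)) (c₃ (odd c)) (χ₃ (odd b)) (χ₃ (odd c))))) n)
    (trans (gen-+ O³ _ _ n) (trans (cong₂ _+_
        (flip-b-zero (λ (a , b , c) → (odd a * c₃ (odd c)) * c₃ (odd b)) (λ a b c → cong ((odd a * c₃ (odd c)) *_) (decide (ap tc (oddᵉ (lit -1ℤ ⊟ v₀))) (ap tc (oddᵉ v₀)) refl (b ∷ []))) n)
        (trans (gen-* O³ (+ 3) _ n) (cong (+ 3 *_) (prod n)))) (ℤₚ.+-identityˡ _))))
    where
    l₁ : ∀ s t u x d → + 2 * ((s * (t * u)) * (x * d)) ≡ (s * (t * u) * x) * (+ 2 * d)
    l₁ = solve-∀
    l₂ : ∀ s t u x a b c d → (s * (t * u) * x) * (a * b + + 3 * (c * d)) ≡ (s * (t * u)) * ((x * b) * a) + + 3 * ((s * x) * ((t * c) * (u * d)))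
    l₂ = solve-∀

  -- The two terms added by `Γ` do not contain c and b, respectively, and cancel by flipping the
  -- missing variable.
  step₂ : ∀ n → gen O³ (λ i → χ i * (odd (proj₁ i) * Γ i)) n ≡ gen O³ (λ i → χ i * (odd (proj₁ i) * Δ (proj₁ (proj₂ i)) (proj₂ (proj₂ i)))) n
  step₂ n = trans (gen-cong O³ {v = λ i → (w₀ i + w₁ i) + w₂ i} (λ (a , b , c) → l (χ (a , b , c)) (odd a) (Δ b c) (Δ a b) (Δ a c)) n)
    (trans (gen-+ O³ (λ i → w₀ i + w₁ i) w₂ n) (trans (cong₂ _+_ (trans (gen-+ O³ w₀ w₁ n) (trans (cong (_+_ (gen O³ w₀ n))
      (flip-c-zero (λ (a , b , c) → odd a * Δ a b) (λ _ _ _ → refl) n)) (ℤₚ.+-identityʳ (gen O³ w₀ n))))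
      (flip-b-zero (λ (a , b , c) → odd a * Δ a c) (λ _ _ _ → refl) n)) (ℤₚ.+-identityʳ (gen O³ w₀ n))))
    where
    w₀ w₁ w₂ : ℤ × (ℤ × ℤ) → ℤ
    w₀ (a , b , c) = χ (a , b , c) * (odd a * Δ b c)
    w₁ (a , b , c) = χ (a , b , c) * (odd a * Δ a b)
    w₂ (a , b , c) = χ (a , b , c) * (odd a * Δ a c)
    l : ∀ s x a b c → s * (x * (a + b + c)) ≡ (s * (x * a) + s * (x * b)) + s * (x * c)
    l = solve-∀

  total : ℤ × (ℤ × ℤ) → ℤ
  total (a , b , c) = odd a + odd b + odd c

  -- `Γ` and `χ` are symmetric, so each of the three odd numbers may take the place of the first.
  step₃ : ∀ n → + 3 * gen O³ (λ i → χ i * (odd (proj₁ i) * Γ i)) n ≡ gen O³ (λ i → χ i * (total i * Γ i)) n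
  step₃ n = trans (l (gen O³ (λ i → χ i * (odd (proj₁ i) * Γ i)) n)) (trans (cong₂ (λ x y → gen O³ (λ i → χ i * (odd (proj₁ i) * Γ i)) n + x + y)
      (trans (swap-ab (λ i → odd (proj₁ i) * Γ i) n) (gen-cong O³ (λ (a , b , c) → cong (λ t → χ (a , b , c) * (odd b * t)) (sym₁ a b c)) n))
      (trans (swap-ac (λ i → odd (proj₁ i) * Γ i) n) (gen-cong O³ (λ (a , b , c) → cong (λ t → χ (a , b , c) * (odd c * t)) (sym₂ a b c)) n)))
    (trans (cong (_+ gen O³ (λ i → χ i * (odd (proj₂ (proj₂ i)) * Γ i)) n) (sym (gen-+ O³ _ _ n))) (trans (sym (gen-+ O³ _ _ n))
      (gen-cong O³ (λ (a , b , c) → l' (χ (a , b , c)) (odd a) (odd b) (odd c) (Γ (a , b , c))) n))))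
    where
    l : ∀ x → + 3 * x ≡ x + x + x
    l = solve-∀
    l' : ∀ s x y z c → s * (x * c) + s * (y * c) + s * (z * c) ≡ s * ((x + y + z) * c)
    l' = solve-∀
    Cᵉ : ∀ {n} → Lin n → Lin n → Lin n → Exp n
    Cᵉ a b c = ap tc (oddᵉ b ⊟ oddᵉ c) :+: ap tc (oddᵉ a ⊟ oddᵉ b) :+: ap tc (oddᵉ a ⊟ oddᵉ c)
    sym₁ : ∀ a b c → Γ (b , a , c) ≡ Γ (a , b , c)
    sym₁ a b c = decide (Cᵉ v₁ v₀ v₂) (Cᵉ v₀ v₁ v₂) refl (a ∷ b ∷ c ∷ [])
    sym₂ : ∀ a b c → Γ (c , b , a) ≡ Γ (a , b , c)
    sym₂ a b c = decide (Cᵉ v₂ v₁ v₀) (Cᵉ v₀ v₁ v₂) refl (a ∷ b ∷ c ∷ [])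

  T = Odd (3 ℕ.* m) ⊗ Hex m

  -- Three residues modulo 3 with sum 0 are all equal or all distinct; otherwise exactly two agree
  -- and `Γ` is 2 - 1 - 1 = 0. On the support the mean is 2t + 1, and the three squares add up to
  -- 3(2t + 1)² + 8(p² + pq + q²).
  step₄ : ∀ n → gen O³ (λ i → χ i * (total i * Γ i)) n ≡ + 9 * (J (3 ℕ.* m) ⊛ b₂ m) n
  step₄ n = trans (gen-param O³ T (3∣? total) (λ i → χ i * (total i * Γ i)) (λ (t , p , q) → t - p - q , t + p , t + q)
      (λ _ → tt , tt , tt)
      (λ {(t , p , q)} _ → decide (ap td (oddᵉ (v₀ ⊟ v₁ ⊟ v₂) ⊞ oddᵉ (v₀ ⊞ v₁) ⊞ oddᵉ (v₀ ⊞ v₂))) (cst 1ℤ) refl (t ∷ p ∷ q ∷ []))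
      (λ {(t , p , q)} _ → trans (l₁ ⟪ m ⟫ t p q) (cong (λ c → c * (odd t * odd t) + ⟪ m ⟫ * (+ 8 * (p * p + p * q + q * q))) (sym (⟪⟫-* 2 m 1≤m))))
      (λ {(t , p , q)} {(t' , p' , q')} eq → inj t p q t' p' q' (cong proj₁ eq) (cong (proj₁ ∘ proj₂) eq) (cong (proj₂ ∘ proj₂) eq))
      (λ {(a , b , c)} _ h → let (k , q) = 3∣-witness (total (a , b , c)) h in surj a b c k q)
      (λ {(a , b , c)} _ nh → trans (cong (λ t → χ (a , b , c) * (total (a , b , c) * t)) (trans (supp a b c) (cong (λ t → + 3 * (t * Δ b c)) (3∤-zero (total (a , b , c)) nh)))) (l₂ (χ (a , b , c)) (total (a , b , c)) (Δ b c)))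
      n)
    (trans (gen-cong T {v = λ (t , p , q) → + 9 * ((sgn t * odd t) * c₃ (p - q))} (λ (t , p , q) →
        trans (cong₂ (λ s c → s * (total (t - p - q , t + p , t + q) * c))
          (decide (ap ts (v₀ ⊟ v₁ ⊟ v₂) :*: (ap ts (v₀ ⊞ v₁) :*: ap ts (v₀ ⊞ v₂))) (ap ts v₀) refl (t ∷ p ∷ q ∷ []))
          (decide (ap tc (oddᵉ (v₀ ⊞ v₁) ⊟ oddᵉ (v₀ ⊞ v₂)) :+: ap tc (oddᵉ (v₀ ⊟ v₁ ⊟ v₂) ⊟ oddᵉ (v₀ ⊞ v₁)) :+: ap tc (oddᵉ (v₀ ⊟ v₁ ⊟ v₂) ⊟ oddᵉ (v₀ ⊞ v₂)))
            (cst (+ 3) :*: ap tc (v₁ ⊟ v₂)) refl (t ∷ p ∷ q ∷ [])))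
        (l₃ (sgn t) t p q (c₃ (p - q)))) n)
      (trans (gen-* T (+ 9) _ n) (cong (+ 9 *_) (gen-⊗ (Odd (3 ℕ.* m)) (Hex m) (λ t → sgn t * odd t) (λ (p , q) → c₃ (p - q)) n))))
    where
    l₁ : ∀ M t p q → M * ((+ 2 * (t - p - q) + 1ℤ) * (+ 2 * (t - p - q) + 1ℤ)) + (M * ((+ 2 * (t + p) + 1ℤ) * (+ 2 * (t + p) + 1ℤ)) + M * ((+ 2 * (t + q) + 1ℤ) * (+ 2 * (t + q) + 1ℤ)))
      ≡ (+ 3 * M) * ((+ 2 * t + 1ℤ) * (+ 2 * t + 1ℤ)) + M * (+ 8 * (p * p + p * q + q * q))
    l₁ = solve-∀
    l₂ : ∀ s t d → s * (t * (+ 3 * (0ℤ * d))) ≡ 0ℤ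
    l₂ = solve-∀
    l₃ : ∀ s t p q c → s * (((+ 2 * (t - p - q) + 1ℤ) + (+ 2 * (t + p) + 1ℤ) + (+ 2 * (t + q) + 1ℤ)) * (+ 3 * c)) ≡ + 9 * ((s * (+ 2 * t + 1ℤ)) * c)
    l₃ = solve-∀
    supp : ∀ a b c → Γ (a , b , c) ≡ + 3 * (d₃ (total (a , b , c)) * Δ b c)
    supp a b c = decide (ap tc (oddᵉ v₁ ⊟ oddᵉ v₂) :+: ap tc (oddᵉ v₀ ⊟ oddᵉ v₁) :+: ap tc (oddᵉ v₀ ⊟ oddᵉ v₂))
      (cst (+ 3) :*: (ap td (oddᵉ v₀ ⊞ oddᵉ v₁ ⊞ oddᵉ v₂) :*: ap tc (oddᵉ v₁ ⊟ oddᵉ v₂))) refl (a ∷ b ∷ c ∷ [])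
    s₁ : ∀ t p q → (t - p - q) + (t + p) + (t + q) ≡ + 3 * t
    s₁ = solve-∀
    inj : ∀ t p q t' p' q' → t - p - q ≡ t' - p' - q' → t + p ≡ t' + p' → t + q ≡ t' + q' → (t , p , q) ≡ (t' , p' , q')
    inj t p q t' p' q' x y z = cong₂ _,_ t≡ (cong₂ _,_ (cancel p p' y) (cancel q q' z))
      where
      t≡ : t ≡ t'
      t≡ = ℤₚ.*-cancelˡ-≡ (+ 3) t t' (trans (sym (s₁ t p q)) (trans (cong₂ _+_ (cong₂ _+_ x y) z) (s₁ t' p' q')))
      s₂ : ∀ t p → (t + p) - t ≡ p
      s₂ = solve-∀
      cancel : ∀ p p' → t + p ≡ t' + p' → p ≡ p'
      cancel p p' y = trans (sym (s₂ t p)) (trans (cong₂ _-_ y t≡) (s₂ t' p'))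
    surj : ∀ a b c k → + 3 * k ≡ total (a , b , c) → ∃[ i ] (R T i × (proj₁ i - proj₁ (proj₂ i) - proj₂ (proj₂ i) , proj₁ i + proj₁ (proj₂ i) , proj₁ i + proj₂ (proj₂ i)) ≡ (a , b , c))
    surj a b c k q = (t , b - t , c - t) , (tt , tt) , cong₂ _,_ (trans (s₃ t b c) (trans (cong (λ z → z - b - c) 3t) (s₄ a b c))) (cong₂ _,_ (s₅ t b) (s₅ t c))
      where
      t = a + b + c + 1ℤ - k
      s₃ : ∀ t b c → t - (b - t) - (c - t) ≡ + 3 * t - b - c
      s₃ = solve-∀
      s₄ : ∀ a b c → (a + b + c) - b - c ≡ a
      s₄ = solve-∀
      s₅ : ∀ t b → t + (b - t) ≡ b
      s₅ = solve-∀
      s₆ : ∀ a b c k → + 3 * (a + b + c + 1ℤ - k) ≡ + 3 * (a + b + c) + + 3 - + 3 * k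
      s₆ = solve-∀
      s₇ : ∀ a b c → + 3 * (a + b + c) + + 3 - ((+ 2 * a + 1ℤ) + (+ 2 * b + 1ℤ) + (+ 2 * c + 1ℤ)) ≡ a + b + c
      s₇ = solve-∀
      3t : + 3 * t ≡ a + b + c
      3t = trans (s₆ a b c k) (trans (cong (λ z → + 3 * (a + b + c) + + 3 - z) q) (s₇ a b c))

  cube : ∀ n → (J m ⊛ (E m ⊛ E m)) n ≡ + 2 * (J (3 ℕ.* m) ⊛ b₂ m) n
  cube n = ℤₚ.*-cancelˡ-≡ (+ 9) _ _ (begin
    + 9 * JE ≡⟨ l₁ JE ⟩
    + 3 * (+ 3 * JE) ≡⟨ cong (+ 3 *_) (step₁ n) ⟨
    + 3 * (+ 2 * X₁) ≡⟨ l₂ X₁ ⟩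
    + 2 * (+ 3 * X₁) ≡⟨ cong (λ t → + 2 * (+ 3 * t)) (step₂ n) ⟨
    + 2 * (+ 3 * gen O³ (λ i → χ i * (odd (proj₁ i) * Γ i)) n) ≡⟨ cong (+ 2 *_) (trans (step₃ n) (step₄ n)) ⟩
    + 2 * (+ 9 * JB) ≡⟨ l₃ JB ⟩
    + 9 * (+ 2 * JB) ∎)
    where
    open ≡-Reasoning
    JE = (J m ⊛ (E m ⊛ E m)) n
    JB = (J (3 ℕ.* m) ⊛ b₂ m) n
    X₁ = gen O³ (λ i → χ i * (odd (proj₁ i) * Δ (proj₁ (proj₂ i)) (proj₂ (proj₂ i)))) n
    l₁ : ∀ x → + 9 * x ≡ + 3 * (+ 3 * x)
    l₁ = solve-∀
    l₂ : ∀ x → + 3 * (+ 2 * x) ≡ + 2 * (+ 3 * x)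
    l₂ = solve-∀
    l₃ : ∀ x → + 2 * (+ 9 * x) ≡ + 9 * (+ 2 * x)
    l₃ = solve-∀

-- Support in a residue class, put as a disjunction: products and sums then inherit it without any
-- congruence having to be decided.
record Cls (L r : ℤ) (f : Ser) : Set where
  constructor cls
  field on : ∀ n → (∃[ k ] (+ n ≡ r + L * k)) ⊎ f n ≡ 0ℤ
open Cls

∑-⊎ : {A Q : Set} (xs : List A) {w : A → ℤ} → (∀ {x} → x ∈ xs → Q ⊎ w x ≡ 0ℤ) → Q ⊎ ∑ xs w ≡ 0ℤ
∑-⊎ [] h = inj₂ refl
∑-⊎ (x ∷ xs) h = [ inj₁ , (λ p → [ inj₁ , (λ q → inj₂ (cong₂ _+_ p q)) ]′ (∑-⊎ xs (h ∘ there))) ]′ (h (here refl))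

opaque
  unfolding _⊛_ gen _⊹_

  Cls-⊛ : ∀ {L r s f g} → Cls L r f → Cls L s g → Cls L (r + s) (f ⊛ g)
  Cls-⊛ {L} {r} {s} {f} {g} cf cg = cls λ n → ∑-⊎ (splits n) λ {(i , j)} p →
    [ (λ (k , q) → [ (λ (k' , q') → inj₁ (k + k' , trans (cong +_ (sym (splits-∈ n p))) (trans (cong₂ _+_ q q') (l r s L k k'))))
                   , (λ z → inj₂ (trans (cong (f i *_) z) (ℤₚ.*-zeroʳ (f i)))) ]′ (on cg j))
    , (λ z → inj₂ (cong (_* g j) z)) ]′ (on cf i)
    where
    l : ∀ r s L k k' → (r + L * k) + (s + L * k') ≡ (r + s) + L * (k + k')
    l = solve-∀

  Cls-gen : ∀ {L r} (S : Sys I) (w : I → ℤ) → (∀ {i} → R S i → (∃[ k ] (e S i ≡ r + L * k)) ⊎ w i ≡ 0ℤ) → Cls L r (gen S w)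
  Cls-gen S w h = cls λ n → ∑-⊎ (fib S n) λ i∈ → let (ri , q) = sound S i∈ in
    [ (λ (k , p) → inj₁ (k , trans (sym q) p)) , inj₂ ]′ (h ri)

  Cls-⊹ : ∀ {L r f g} → Cls L r f → Cls L r g → Cls L r (f ⊹ g)
  Cls-⊹ cf cg = cls λ n → [ inj₁ , (λ p → [ inj₁ , (λ q → inj₂ (cong₂ _+_ p q)) ]′ (on cg n)) ]′ (on cf n)

  Cls-split : ∀ {L r s f g f' g'} → (∀ k k' → r + L * k ≡ s + L * k' → ⊥) →
    Cls L r f → Cls L r f' → Cls L s g → Cls L s g' → f ⊹ g ≋ f' ⊹ g' → f ≋ f' × g ≋ g'
  Cls-split {L} {r} {s} {f} {g} {f'} {g'} dis cf cf' cg cg' eq = mk (λ n → proj₁ (both n)) , mk (λ n → proj₂ (both n))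
    where
    left : ∀ n → g n ≡ 0ℤ → g' n ≡ 0ℤ → f n ≡ f' n
    left n z z' = trans (sym (ℤₚ.+-identityʳ (f n))) (trans (cong (_+_ (f n)) (sym z)) (trans (un eq n) (trans (cong (_+_ (f' n)) z') (ℤₚ.+-identityʳ (f' n)))))
    right : ∀ n → f n ≡ 0ℤ → f' n ≡ 0ℤ → g n ≡ g' n
    right n z z' = trans (sym (ℤₚ.+-identityˡ (g n))) (trans (cong (_+ g n) (sym z)) (trans (un eq n) (trans (cong (_+ g' n) z') (ℤₚ.+-identityˡ (g' n)))))
    notBoth : ∀ n {h} → Cls L s h → ∃[ k ] (+ n ≡ r + L * k) → h n ≡ 0ℤ
    notBoth n c (k , p) = [ (λ (k' , q) → ⊥-elim (dis k k' (trans (sym p) q))) , id ]′ (on c n)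
    in-r : ∀ n → ∃[ k ] (+ n ≡ r + L * k) → f n ≡ f' n × g n ≡ g' n
    in-r n w = let z = notBoth n cg w; z' = notBoth n cg' w in left n z z' , trans z (sym z')
    both : ∀ n → f n ≡ f' n × g n ≡ g' n
    both n = [ in-r n , (λ z → [ in-r n , (λ z' → trans z (sym z') , right n z z') ]′ (on cf' n)) ]′ (on cf n)

Cls-K : ∀ {L} c → Cls L 0ℤ (K c)
Cls-K {L} c = cls λ
  { zero → inj₁ (0ℤ , sym (trans (ℤₚ.+-identityˡ (L * 0ℤ)) (ℤₚ.*-zeroʳ L)))
  ; (suc n) → inj₂ refl }

Mod3 : ℤ → Set
Mod3 x = (∃[ k ] (+ 3 * k ≡ x)) ⊎ (∃[ k ] (+ 3 * k + 1ℤ ≡ x)) ⊎ (∃[ k ] (+ 3 * k + + 2 ≡ x))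

trichotomy : ∀ x → Mod3 x
trichotomy x with x %ℕ 3 | a≡a%ℕn+[a/ℕn]*n x 3 | n%ℕd<d x 3
... | 0 | q | _ = inj₁ (x /ℕ 3 , sym (trans q (lem (x /ℕ 3))))
  where
  lem : ∀ y → 0ℤ + y * + 3 ≡ + 3 * y
  lem = solve-∀
... | 1 | q | _ = inj₂ (inj₁ (x /ℕ 3 , sym (trans q (lem (x /ℕ 3)))))
  where
  lem : ∀ y → 1ℤ + y * + 3 ≡ + 3 * y + 1ℤ
  lem = solve-∀
... | 2 | q | _ = inj₂ (inj₂ (x /ℕ 3 , sym (trans q (lem (x /ℕ 3)))))
  where
  lem : ∀ y → + 2 + y * + 3 ≡ + 3 * y + + 2
  lem = solve-∀
... | suc (suc (suc _)) | _ | s≤s (s≤s (s≤s ()))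

-- The sublattice where 3 divides p - q is √-3 times the Eisenstein lattice; the map (u + 2v , u -
-- v) multiplies the norm by 3.
Hex-3∣ : ∀ m → 1 ℕ.≤ m → ∀ n → gen (Hex m) (λ (p , q) → d₃ (p - q)) n ≡ H (3 ℕ.* m) n
Hex-3∣ m h n = trans (gen-param (Hex m) (Hex (3 ℕ.* m)) (3∣? (λ (p , q) → p - q)) (λ (p , q) → d₃ (p - q)) (λ (u , v) → u + + 2 * v , u - v)
    (λ _ → tt) (λ {(u , v)} _ → three u v)
    (λ {(u , v)} _ → trans (l₁ ⟪ m ⟫ u v) (cong (_* (+ 8 * (u * u + u * v + v * v))) (sym (⟪⟫-* 2 m h))))
    (λ {(u , v)} {(u' , v')} q → pair-inj (+ 3) (λ x y → x + + 2 * y) (λ x y → x - y) q (l₂ u v) (l₂ u' v') (l₃ u v) (l₃ u' v'))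
    (λ {(p , q)} _ r → let (k , s) = 3∣-witness (p - q) r in (q + k , k) , tt , cong₂ _,_ (trans (l₄ q k) (trans (cong (_+_ q) s) (l₅ p q))) (l₆ q k))
    (λ {(p , q)} _ → 3∤-zero (p - q)) n)
  (gen-cong (Hex (3 ℕ.* m)) (λ (u , v) → three u v) n)
  where
  three : ∀ u v → d₃ ((u + + 2 * v) - (u - v)) ≡ 1ℤ
  three u v = decide (ap td ((v₀ ⊞ + 2 · v₁) ⊟ (v₀ ⊟ v₁))) (cst 1ℤ) refl (u ∷ v ∷ [])
  l₁ : ∀ M u v → M * (+ 8 * ((u + + 2 * v) * (u + + 2 * v) + (u + + 2 * v) * (u - v) + (u - v) * (u - v))) ≡ (+ 3 * M) * (+ 8 * (u * u + u * v + v * v))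
  l₁ = solve-∀
  l₂ : ∀ u v → (u + + 2 * v) + + 2 * (u - v) ≡ + 3 * u
  l₂ = solve-∀
  l₃ : ∀ u v → (u + + 2 * v) - (u - v) ≡ + 3 * v
  l₃ = solve-∀
  l₄ : ∀ q k → (q + k) + + 2 * k ≡ q + + 3 * k
  l₄ = solve-∀
  l₅ : ∀ p q → q + (p - q) ≡ p
  l₅ = solve-∀
  l₆ : ∀ q k → (q + k) - k ≡ q
  l₆ = solve-∀

-- the part of H m with exponents prime to 3, up to the factor 8m
H' : ℕ → Ser
H' m = gen (Hex m) (λ (p , q) → 1ℤ + - d₃ (p - q))

H-split : ∀ m → 1 ℕ.≤ m → ∀ n → H m n ≡ H (3 ℕ.* m) n + H' m n
H-split m h n = trans (gen-cong (Hex m) {v = λ (p , q) → d₃ (p - q) + (1ℤ + - d₃ (p - q))} (λ (p , q) → l (d₃ (p - q))) n)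
  (trans (gen-+ (Hex m) (λ (p , q) → d₃ (p - q)) (λ (p , q) → 1ℤ + - d₃ (p - q)) n) (cong (_+ H' m n) (Hex-3∣ m h n)))
  where
  l : ∀ x → 1ℤ ≡ x + (1ℤ + - x)
  l = solve-∀

b₂-split : ∀ m → 1 ℕ.≤ m → ∀ n → b₂ m n ≡ + 2 * H (3 ℕ.* m) n + - H' m n
b₂-split m h n = trans (gen-cong (Hex m) {v = λ (p , q) → + 2 * d₃ (p - q) + - (1ℤ + - d₃ (p - q))} (λ (p , q) →
      decide (ap tc (v₀ ⊟ v₁)) (cst (+ 2) :*: ap td (v₀ ⊟ v₁) :+: negᵉ (cst 1ℤ :+: negᵉ (ap td (v₀ ⊟ v₁)))) refl (p ∷ q ∷ [])) n)
  (trans (gen-+ (Hex m) (λ (p , q) → + 2 * d₃ (p - q)) (λ (p , q) → - (1ℤ + - d₃ (p - q))) n)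
    (cong₂ _+_ (trans (gen-* (Hex m) (+ 2) (λ (p , q) → d₃ (p - q)) n) (cong (+ 2 *_) (Hex-3∣ m h n))) (gen-neg (Hex m) (λ (p , q) → 1ℤ + - d₃ (p - q)) n)))

positive-factor : ∀ k {d} → Positive (+ suc k * d) → Positive d
positive-factor k {d} p = ℤₚ.*-cancelˡ-<-nonNeg (+ suc k) (subst (ℤ._< + suc k * d) (sym (ℤₚ.*-zeroʳ (+ suc k))) p)

positive-multiple : ∀ k {d} → Positive d → Positive (+ suc k * d)
positive-multiple k {+ suc d} _ = ℤ.+<+ (s≤s z≤n)
positive-multiple k {+ zero} (ℤ.+<+ ())

Dv-multiples : ∀ k m → 1 ℕ.≤ m → {P : ℤ → Set} (P? : Decidable P) (w : ℤ × ℤ → ℤ) → (∀ d → P (+ suc k * d)) →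
  (∀ d → P d → ∃[ d' ] (+ suc k * d' ≡ d)) → (∀ a d → ¬ P d → w (a , d) ≡ 0ℤ) →
  ∀ n → gen (Dv m) w n ≡ gen (Dv (suc k ℕ.* m)) (λ (a , d) → w (a , + suc k * d)) n
Dv-multiples k m h P? w inP wit van = gen-param (Dv m) (Dv (suc k ℕ.* m)) (P? ∘ proj₂) w (λ (a , d) → a , + suc k * d)
  (λ (p , q) → p , positive-multiple k q) (λ {(a , d)} _ → inP d)
  (λ {(a , d)} _ → trans (l ⟪ m ⟫ (+ suc k) a d) (cong (_* (a * d)) (sym (⟪⟫-* k m h))))
  (λ {(a , d)} {(a' , d')} q → cong₂ _,_ (,-injectiveˡ q) (ℤₚ.*-cancelˡ-≡ (+ suc k) d d' (,-injectiveʳ q)))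
  (λ {(a , d)} (p , q) r → let (d' , s) = wit d r in (a , d') , (p , positive-factor k (subst Positive (sym s) q)) , cong (a ,_) s)
  (λ {(a , d)} _ → van a d)
  where
  l : ∀ M k a d → M * (a * (k * d)) ≡ (k * M) * (a * d)
  l = solve-∀

2∣? : Decidable {A = ℤ} (λ d → ev d ≡ 1ℤ)
2∣? d = ev d ℤ.≟ 1ℤ

ev-witness : ∀ d → ev d ≡ 1ℤ → ∃[ k ] (+ 2 * k ≡ d)
ev-witness d p = [ id , (λ (k , q) → ⊥-elim (1≢0 (trans (sym p) (trans (cong ev (sym q)) (ev-odd k))))) ]′ (even∨odd d)

ev-zero : ∀ d → ¬ ev d ≡ 1ℤ → ev d ≡ 0ℤ
ev-zero d np = [ (λ (k , q) → ⊥-elim (np (trans (cong ev (sym q)) (ev-2* k)))) , (λ (k , q) → trans (cong ev (sym q)) (ev-odd k)) ]′ (even∨odd d)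

-- `X₃′` is twice the part of `X₃` with a d prime to 3, symmetrised in a and d. Its weight vanishes
-- unless a d ≡ 1 modulo 3, so its exponents fill a single class, that of `H'`.
X₃ X₃′ : ℕ → Ser
X₃ m = gen (Dv (8 ℕ.* m)) (λ (a , d) → χ₃ a)
X₃′ m = gen (Dv (8 ℕ.* m)) (λ (a , d) → χ₃ a * χ₃ d * (χ₃ a + χ₃ d))

D-3∣ : ∀ m → 1 ℕ.≤ m → ∀ n → gen (Dv (8 ℕ.* m)) (λ (a , d) → χ₃ a * d₃ d) n ≡ X₃ (3 ℕ.* m) n
D-3∣ m h n = trans (Dv-multiples 2 (8 ℕ.* m) (1≤k*m 7 h) (3∣? id) (λ (a , d) → χ₃ a * d₃ d) d₃-3* 3∣-witness
    (λ a d np → trans (cong (χ₃ a *_) (3∤-zero d np)) (ℤₚ.*-zeroʳ (χ₃ a))) n)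
  (trans (gen-cong (Dv (3 ℕ.* (8 ℕ.* m))) (λ (a , d) → trans (cong (χ₃ a *_) (d₃-3* d)) (ℤₚ.*-identityʳ (χ₃ a))) n)
    (cong (λ k → gen (Dv k) (λ (a , d) → χ₃ a) n) (trans (*-assoc′ 3 8 m) (sym (*-assoc′ 8 3 m)))))

Dv-swap : ∀ m (w : ℤ × ℤ → ℤ) → ∀ n → gen (Dv m) w n ≡ gen (Dv m) (λ (a , d) → w (d , a)) n
Dv-swap m w = gen-bij (Dv m) (Dv m) (λ (a , d) → d , a) (λ (p , q) → q , p) (λ {(a , d)} _ → cong (⟪ m ⟫ *_) (ℤₚ.*-comm d a))
  (λ { _ _ refl → refl }) (λ {(a , d)} (p , q) → (d , a) , (q , p) , refl) (λ _ → refl)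

D-split : ∀ m → 1 ℕ.≤ m → ∀ n → + 2 * X₃ m n ≡ + 2 * X₃ (3 ℕ.* m) n + X₃′ m n
D-split m h n = trans (sym (gen-* S (+ 2) (λ (a , d) → χ₃ a) n)) (trans
  (gen-cong S {v = λ (a , d) → (+ 2 * (χ₃ a * d₃ d) + χ₃ a * χ₃ d * (χ₃ a + χ₃ d)) + u (a , d)} (λ (a , d) →
    decide (cst (+ 2) :*: ap t₃ v₀) (cst (+ 2) :*: (ap t₃ v₀ :*: ap td v₁) :+: ap t₃ v₀ :*: ap t₃ v₁ :*: (ap t₃ v₀ :+: ap t₃ v₁) :+: ap t₃ v₀ :*: ap t₃ v₁ :*: (ap t₃ v₁ :-: ap t₃ v₀)) refl (a ∷ d ∷ [])) n)
  (trans (gen-+ S (λ (a , d) → + 2 * (χ₃ a * d₃ d) + χ₃ a * χ₃ d * (χ₃ a + χ₃ d)) u n) (trans (cong₂ _+_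
    (trans (gen-+ S (λ (a , d) → + 2 * (χ₃ a * d₃ d)) (λ (a , d) → χ₃ a * χ₃ d * (χ₃ a + χ₃ d)) n)
      (cong (_+ X₃′ m n) (trans (gen-* S (+ 2) (λ (a , d) → χ₃ a * d₃ d) n) (cong (+ 2 *_) (D-3∣ m h n)))))
    (gen-anti S {u} (λ (a , d) → d , a) (λ (p , q) → q , p) (λ {(a , d)} _ → cong (⟪ 8 ℕ.* m ⟫ *_) (ℤₚ.*-comm d a)) (λ _ → refl) (λ {(a , d)} _ → l (χ₃ a) (χ₃ d)) n)) (ℤₚ.+-identityʳ _))))
  where
  S = Dv (8 ℕ.* m)
  u : ℤ × ℤ → ℤ
  u (a , d) = χ₃ a * χ₃ d * (χ₃ d - χ₃ a)
  l : ∀ a d → a * d * (d - a) ≡ - (d * a * (a - d))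
  l = solve-∀

-- Only even c = 2d count, and there c₃(2d) = c₃(d) = 3 d₃(d) - 1.
R₃-split : ∀ m → 1 ℕ.≤ m → ∀ n → R₃ m n ≡ + 3 * X₃ (3 ℕ.* m) n + - X₃ m n
R₃-split m h n = trans (Dv-multiples 1 (4 ℕ.* m) (1≤k*m 3 h) 2∣? (λ (a , c) → χ₃ a * (c₃ c * ev c)) ev-2* ev-witness
    (λ a d np → trans (cong (λ t → χ₃ a * (c₃ d * t)) (ev-zero d np)) (l (χ₃ a) (c₃ d))) n)
  (trans (cong (λ k → gen (Dv k) (λ (a , d) → χ₃ a * (c₃ (+ 2 * d) * ev (+ 2 * d))) n) (*-assoc′ 2 4 m))
  (trans (gen-cong S {v = λ (a , d) → + 3 * (χ₃ a * d₃ d) + - χ₃ a} (λ (a , d) →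
      decide (ap t₃ v₀ :*: (ap tc (+ 2 · v₁) :*: ap tev (+ 2 · v₁))) (cst (+ 3) :*: (ap t₃ v₀ :*: ap td v₁) :+: negᵉ (ap t₃ v₀)) refl (a ∷ d ∷ [])) n)
    (trans (gen-+ S (λ (a , d) → + 3 * (χ₃ a * d₃ d)) (λ (a , d) → - χ₃ a) n)
      (cong₂ _+_ (trans (gen-* S (+ 3) (λ (a , d) → χ₃ a * d₃ d) n) (cong (+ 3 *_) (D-3∣ m h n))) (gen-neg S (λ (a , d) → χ₃ a) n)))))
  where
  S = Dv (8 ℕ.* m)
  l : ∀ a c → a * (c * 0ℤ) ≡ 0ℤ
  l = solve-∀

-- The Lambert series which `Hex-divisors` identifies with `H`.
HL : ℕ → Ser
HL m = K 1ℤ ⊹ K (+ 6) ⊛ X₃ m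

opaque
  unfolding _⊹_ ⊝_

  R₃-split≋ : ∀ m → 1 ℕ.≤ m → R₃ m ≋ K (+ 3) ⊛ X₃ (3 ℕ.* m) ⊖ X₃ m
  R₃-split≋ m h = mk λ n → trans (R₃-split m h n) (cong (_+ - X₃ m n) (sym (K-⊛ (+ 3) (X₃ (3 ℕ.* m)) n)))

  D-split≋ : ∀ m → 1 ℕ.≤ m → K (+ 2) ⊛ X₃ m ≋ K (+ 2) ⊛ X₃ (3 ℕ.* m) ⊹ X₃′ m
  D-split≋ m h = mk λ n → trans (K-⊛ (+ 2) (X₃ m) n) (trans (D-split m h n) (cong (_+ X₃′ m n) (sym (K-⊛ (+ 2) (X₃ (3 ℕ.* m)) n))))

  H-split≋ : ∀ m → 1 ℕ.≤ m → H m ≋ H (3 ℕ.* m) ⊹ H' m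
  H-split≋ m h = mk (H-split m h)

  b₂-split≋ : ∀ m → 1 ℕ.≤ m → b₂ m ≋ K (+ 2) ⊛ H (3 ℕ.* m) ⊹ K -1ℤ ⊛ H' m
  b₂-split≋ m h = mk λ n → trans (b₂-split m h n) (cong₂ _+_ (sym (K-⊛ (+ 2) (H (3 ℕ.* m)) n)) (trans (sym (ℤₚ.-1*i≡-i (H' m n))) (sym (K-⊛ -1ℤ (H' m) n))))

  cube≋ : ∀ m → 1 ℕ.≤ m → J m ⊛ (E m ⊛ E m) ≋ K (+ 2) ⊛ (J (3 ℕ.* m) ⊛ b₂ m)
  cube≋ m h = mk λ n → trans (Cube.cube m h n) (sym (K-⊛ (+ 2) (J (3 ℕ.* m) ⊛ b₂ m) n))

two-b : ∀ m → 1 ℕ.≤ m → K (+ 2) ⊛ (K 1ℤ ⊹ K (+ 3) ⊛ R₃ m) ≋ K (+ 2) ⊛ HL (3 ℕ.* m) ⊹ K (-[1+ 2 ]) ⊛ X₃′ m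
two-b m h = begin
  K (+ 2) ⊛ (K 1ℤ ⊹ K (+ 3) ⊛ R₃ m) ≈⟨ ⊛-≋ ≋-refl (⊹-cong ≋-refl (⊛-≋ ≋-refl (R₃-split≋ m h))) ⟩
  K (+ 2) ⊛ (K 1ℤ ⊹ K (+ 3) ⊛ (K (+ 3) ⊛ X₃ (3 ℕ.* m) ⊖ X₃ m))
    ≈⟨ solve 2 (λ d d' → con (+ 2) :* (con 1ℤ :+ con (+ 3) :* (con (+ 3) :* d :- d')) := con (+ 2) :+ con (+ 18) :* d :- con (+ 3) :* (con (+ 2) :* d')) ≋-refl (X₃ (3 ℕ.* m)) (X₃ m) ⟩
  K (+ 2) ⊹ K (+ 18) ⊛ X₃ (3 ℕ.* m) ⊖ K (+ 3) ⊛ (K (+ 2) ⊛ X₃ m) ≈⟨ ⊹-cong ≋-refl (⊝-cong (⊛-≋ ≋-refl (D-split≋ m h))) ⟩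
  K (+ 2) ⊹ K (+ 18) ⊛ X₃ (3 ℕ.* m) ⊖ K (+ 3) ⊛ (K (+ 2) ⊛ X₃ (3 ℕ.* m) ⊹ X₃′ m)
    ≈⟨ solve 2 (λ d d' → con (+ 2) :+ con (+ 18) :* d :- con (+ 3) :* (con (+ 2) :* d :+ d') := con (+ 2) :* (con 1ℤ :+ con (+ 6) :* d) :+ con (-[1+ 2 ]) :* d') ≋-refl (X₃ (3 ℕ.* m)) (X₃′ m) ⟩
  K (+ 2) ⊛ HL (3 ℕ.* m) ⊹ K (-[1+ 2 ]) ⊛ X₃′ m ∎
  where open import Relation.Binary.Reasoning.Setoid serSetoid

HL-split : ∀ m → 1 ℕ.≤ m → HL m ≋ HL (3 ℕ.* m) ⊹ K (+ 3) ⊛ X₃′ m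
HL-split m h = begin
  K 1ℤ ⊹ K (+ 6) ⊛ X₃ m ≈⟨ solve 1 (λ d → con 1ℤ :+ con (+ 6) :* d := con 1ℤ :+ con (+ 3) :* (con (+ 2) :* d)) ≋-refl (X₃ m) ⟩
  K 1ℤ ⊹ K (+ 3) ⊛ (K (+ 2) ⊛ X₃ m) ≈⟨ ⊹-cong ≋-refl (⊛-≋ ≋-refl (D-split≋ m h)) ⟩
  K 1ℤ ⊹ K (+ 3) ⊛ (K (+ 2) ⊛ X₃ (3 ℕ.* m) ⊹ X₃′ m)
    ≈⟨ solve 2 (λ d d' → con 1ℤ :+ con (+ 3) :* (con (+ 2) :* d :+ d') := con 1ℤ :+ con (+ 6) :* d :+ con (+ 3) :* d') ≋-refl (X₃ (3 ℕ.* m)) (X₃′ m) ⟩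
  HL (3 ℕ.* m) ⊹ K (+ 3) ⊛ X₃′ m ∎
  where open import Relation.Binary.Reasoning.Setoid serSetoid

-- Both are 8η(24mτ)³, but their equality only becomes available with `J-cube`.
E³ G₃ : ℕ → Ser
E³ m = E m ⊛ (E m ⊛ E m)
G₃ m = K (+ 4) ⊛ J (3 ℕ.* m)

-- The identity of `cube`, separated into exponents 3m and 11m modulo 12m.
module Separate (m : ℕ) (h : 1 ℕ.≤ m) where
  M L : ℤ
  M = ⟪ m ⟫
  L = + 12 * M

  Hit : ℤ → ℤ → ℤ → Set
  Hit r x w = (∃[ k ] (x ≡ r + L * k)) ⊎ w ≡ 0ℤ

  at-class : ∀ {r r' f} → r ≡ r' → Cls L r f → Cls L r' f
  at-class refl c = c

  E-cls : Cls L M (E m)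
  E-cls = Cls-gen (Odd m) (λ n → sgn n * χ₃ (odd n)) λ {n} _ → go n (trichotomy n)
    where
    go : ∀ n → Mod3 n → Hit M (M * (odd n * odd n)) (sgn n * χ₃ (odd n))
    go _ (inj₁ (j , refl)) = inj₁ (j * (+ 3 * j + 1ℤ) , l M j)
      where
      l : ∀ M j → M * ((+ 2 * (+ 3 * j) + 1ℤ) * (+ 2 * (+ 3 * j) + 1ℤ)) ≡ M + (+ 12 * M) * (j * (+ 3 * j + 1ℤ))
      l = solve-∀
    go _ (inj₂ (inj₁ (j , refl))) = inj₂ (decide (ap ts (+ 3 · v₀ ⊞ lit 1ℤ) :*: ap t₃ (+ 2 · (+ 3 · v₀ ⊞ lit 1ℤ) ⊞ lit 1ℤ)) (cst 0ℤ) refl (j ∷ []))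
    go _ (inj₂ (inj₂ (j , refl))) = inj₁ ((j + 1ℤ) * (+ 3 * j + + 2) , l M j)
      where
      l : ∀ M j → M * ((+ 2 * (+ 3 * j + + 2) + 1ℤ) * (+ 2 * (+ 3 * j + + 2) + 1ℤ)) ≡ M + (+ 12 * M) * ((j + 1ℤ) * (+ 3 * j + + 2))
      l = solve-∀

  E³-cls : Cls L (+ 3 * M) (E³ m)
  E³-cls = at-class (l M) (Cls-⊛ E-cls (Cls-⊛ E-cls E-cls))
    where
    l : ∀ M → M + (M + M) ≡ + 3 * M
    l = solve-∀

  G-cls : Cls L (+ 3 * M) (G₃ m)
  G-cls = at-class (ℤₚ.+-identityˡ _) (Cls-⊛ (Cls-K (+ 4)) (Cls-gen {L = L} {r = + 3 * M} (Odd (3 ℕ.* m)) (λ n → sgn n * odd n) λ {n} _ →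
    inj₁ (n * (n + 1ℤ) , trans (cong (_* (odd n * odd n)) (⟪⟫-* 2 m h)) (l M n))))
    where
    l : ∀ M n → (+ 3 * M) * ((+ 2 * n + 1ℤ) * (+ 2 * n + 1ℤ)) ≡ + 3 * M + (+ 12 * M) * (n * (n + 1ℤ))
    l = solve-∀

  H₃-cls : Cls L 0ℤ (H (3 ℕ.* m))
  H₃-cls = Cls-gen {L = L} {r = 0ℤ} (Hex (3 ℕ.* m)) (λ _ → 1ℤ) λ {(p , q)} _ → inj₁ (+ 2 * (p * p + p * q + q * q) , trans (cong (_* (+ 8 * (p * p + p * q + q * q))) (⟪⟫-* 2 m h)) (l M (p * p + p * q + q * q)))
    where
    l : ∀ M x → (+ 3 * M) * (+ 8 * x) ≡ 0ℤ + (+ 12 * M) * (+ 2 * x)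
    l = solve-∀

  HL₃-cls : Cls L 0ℤ (HL (3 ℕ.* m))
  HL₃-cls = Cls-⊹ (Cls-K 1ℤ) (Cls-⊛ (Cls-K (+ 6)) (Cls-gen {L = L} {r = 0ℤ} (Dv (8 ℕ.* (3 ℕ.* m))) (λ (a , d) → χ₃ a) λ {(a , d)} _ →
    inj₁ (+ 2 * (a * d) , trans (cong (_* (a * d)) (trans (⟪⟫-* 7 (3 ℕ.* m) (1≤k*m 2 h)) (cong (+ 8 *_) (⟪⟫-* 2 m h)))) (l M (a * d)))))
    where
    l : ∀ M x → (+ 8 * (+ 3 * M)) * x ≡ 0ℤ + (+ 12 * M) * (+ 2 * x)
    l = solve-∀

  H'-cls : Cls L (+ 8 * M) (H' m)
  H'-cls = Cls-gen (Hex m) (λ (p , q) → 1ℤ + - d₃ (p - q)) λ {(p , q)} _ → go p q (trichotomy (p - q))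
    where
    go : ∀ p q → Mod3 (p - q) → Hit (+ 8 * M) (M * (+ 8 * (p * p + p * q + q * q))) (1ℤ + - d₃ (p - q))
    go p q (inj₁ (k , s)) = inj₂ (trans (cong (λ t → 1ℤ + - d₃ t) (sym s)) (cong (λ t → 1ℤ + - t) (d₃-3* k)))
    go p q (inj₂ (inj₁ (k , s))) = inj₁ (+ 2 * (+ 3 * k * k + + 2 * k + p * q) , trans (l₁ M p q) (trans (cong (λ t → M * (+ 8 * (t * t + + 3 * (p * q)))) (sym s)) (l₂ M k (p * q))))
      where
      l₁ : ∀ M p q → M * (+ 8 * (p * p + p * q + q * q)) ≡ M * (+ 8 * ((p - q) * (p - q) + + 3 * (p * q)))
      l₁ = solve-∀
      l₂ : ∀ M k x → M * (+ 8 * ((+ 3 * k + 1ℤ) * (+ 3 * k + 1ℤ) + + 3 * x)) ≡ + 8 * M + (+ 12 * M) * (+ 2 * (+ 3 * k * k + + 2 * k + x))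
      l₂ = solve-∀
    go p q (inj₂ (inj₂ (k , s))) = inj₁ (+ 2 * (+ 3 * k * k + + 4 * k + 1ℤ + p * q) , trans (l₁ M p q) (trans (cong (λ t → M * (+ 8 * (t * t + + 3 * (p * q)))) (sym s)) (l₂ M k (p * q))))
      where
      l₁ : ∀ M p q → M * (+ 8 * (p * p + p * q + q * q)) ≡ M * (+ 8 * ((p - q) * (p - q) + + 3 * (p * q)))
      l₁ = solve-∀
      l₂ : ∀ M k x → M * (+ 8 * ((+ 3 * k + + 2) * (+ 3 * k + + 2) + + 3 * x)) ≡ + 8 * M + (+ 12 * M) * (+ 2 * (+ 3 * k * k + + 4 * k + 1ℤ + x))
      l₂ = solve-∀

  D'-cls : Cls L (+ 8 * M) (X₃′ m)
  D'-cls = Cls-gen (Dv (8 ℕ.* m)) (λ (a , d) → χ₃ a * χ₃ d * (χ₃ a + χ₃ d)) λ {(a , d)} _ → go (trichotomy a) (trichotomy d)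
    where
    8m : ∀ x → ⟪ 8 ℕ.* m ⟫ * x ≡ (+ 8 * M) * x
    8m x = cong (_* x) (⟪⟫-* 7 m h)
    dec : ∀ {n} (a d : Lin n) → Exp n
    dec a d = ap t₃ a :*: ap t₃ d :*: (ap t₃ a :+: ap t₃ d)
    go : ∀ {a d} → Mod3 a → Mod3 d → Hit (+ 8 * M) (⟪ 8 ℕ.* m ⟫ * (a * d)) (χ₃ a * χ₃ d * (χ₃ a + χ₃ d))
    go {a} {d} (inj₁ (i , refl)) _ = inj₂ (decide (dec (+ 3 · v₀) v₁) (cst 0ℤ) refl (i ∷ d ∷ []))
    go {a} {d} (inj₂ _) (inj₁ (j , refl)) = inj₂ (decide (dec v₀ (+ 3 · v₁)) (cst 0ℤ) refl (a ∷ j ∷ []))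
    go (inj₂ (inj₁ (i , refl))) (inj₂ (inj₁ (j , refl))) = inj₁ (+ 2 * (+ 3 * i * j + i + j) , trans (8m ((+ 3 * i + 1ℤ) * (+ 3 * j + 1ℤ))) (l M i j))
      where
      l : ∀ M i j → (+ 8 * M) * ((+ 3 * i + 1ℤ) * (+ 3 * j + 1ℤ)) ≡ + 8 * M + (+ 12 * M) * (+ 2 * (+ 3 * i * j + i + j))
      l = solve-∀
    go (inj₂ (inj₂ (i , refl))) (inj₂ (inj₂ (j , refl))) = inj₁ (+ 2 * (+ 3 * i * j + + 2 * i + + 2 * j + 1ℤ) , trans (8m ((+ 3 * i + + 2) * (+ 3 * j + + 2))) (l M i j))
      where
      l : ∀ M i j → (+ 8 * M) * ((+ 3 * i + + 2) * (+ 3 * j + + 2)) ≡ + 8 * M + (+ 12 * M) * (+ 2 * (+ 3 * i * j + + 2 * i + + 2 * j + 1ℤ))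
      l = solve-∀
    go (inj₂ (inj₁ (i , refl))) (inj₂ (inj₂ (j , refl))) = inj₂ (decide (dec (+ 3 · v₀ ⊞ lit 1ℤ) (+ 3 · v₁ ⊞ lit (+ 2))) (cst 0ℤ) refl (i ∷ j ∷ []))
    go (inj₂ (inj₂ (i , refl))) (inj₂ (inj₁ (j , refl))) = inj₂ (decide (dec (+ 3 · v₀ ⊞ lit (+ 2)) (+ 3 · v₁ ⊞ lit 1ℤ)) (cst 0ℤ) refl (i ∷ j ∷ []))

  -- The factor E (1 + 3 R₃) is `J`, so the left side is 2 J E², which `cube` turns into 4 J(3m) b₂.
  combined : E³ m ⊛ (K (+ 2) ⊛ HL (3 ℕ.* m)) ⊹ E³ m ⊛ (K (-[1+ 2 ]) ⊛ X₃′ m) ≋ G₃ m ⊛ (K (+ 2) ⊛ H (3 ℕ.* m)) ⊹ G₃ m ⊛ (K -1ℤ ⊛ H' m)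
  combined = begin
    E³ m ⊛ (K (+ 2) ⊛ HL (3 ℕ.* m)) ⊹ E³ m ⊛ (K (-[1+ 2 ]) ⊛ X₃′ m) ≈⟨ solve 3 (λ f x y → f :* x :+ f :* y := f :* (x :+ y)) ≋-refl (E³ m) (K (+ 2) ⊛ HL (3 ℕ.* m)) (K (-[1+ 2 ]) ⊛ X₃′ m) ⟩
    E³ m ⊛ (K (+ 2) ⊛ HL (3 ℕ.* m) ⊹ K (-[1+ 2 ]) ⊛ X₃′ m) ≈⟨ ⊛-≋ ≋-refl (two-b m h) ⟨
    E³ m ⊛ (K (+ 2) ⊛ (K 1ℤ ⊹ K (+ 3) ⊛ R₃ m)) ≈⟨ solve 2 (λ x b → (x :* (x :* x)) :* (con (+ 2) :* b) := con (+ 2) :* ((x :* b) :* (x :* x))) ≋-refl (E m) (K 1ℤ ⊹ K (+ 3) ⊛ R₃ m) ⟩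
    K (+ 2) ⊛ ((E m ⊛ (K 1ℤ ⊹ K (+ 3) ⊛ R₃ m)) ⊛ (E m ⊛ E m)) ≈⟨ ⊛-≋ ≋-refl (≋-trans (⊛-≋ (J-ER₃ m h) ≋-refl) (cube≋ m h)) ⟩
    K (+ 2) ⊛ (K (+ 2) ⊛ (J (3 ℕ.* m) ⊛ b₂ m)) ≈⟨ ⊛-≋ ≋-refl (⊛-≋ ≋-refl (⊛-≋ ≋-refl (b₂-split≋ m h))) ⟩
    K (+ 2) ⊛ (K (+ 2) ⊛ (J (3 ℕ.* m) ⊛ (K (+ 2) ⊛ H (3 ℕ.* m) ⊹ K -1ℤ ⊛ H' m)))
      ≈⟨ solve 3 (λ j x y → con (+ 2) :* (con (+ 2) :* (j :* (x :+ y))) := (con (+ 4) :* j) :* x :+ (con (+ 4) :* j) :* y) ≋-refl (J (3 ℕ.* m)) (K (+ 2) ⊛ H (3 ℕ.* m)) (K -1ℤ ⊛ H' m) ⟩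
    G₃ m ⊛ (K (+ 2) ⊛ H (3 ℕ.* m)) ⊹ G₃ m ⊛ (K -1ℤ ⊛ H' m) ∎
    where open import Relation.Binary.Reasoning.Setoid serSetoid

  separated : E³ m ⊛ (K (+ 2) ⊛ HL (3 ℕ.* m)) ≋ G₃ m ⊛ (K (+ 2) ⊛ H (3 ℕ.* m)) × E³ m ⊛ (K (-[1+ 2 ]) ⊛ X₃′ m) ≋ G₃ m ⊛ (K -1ℤ ⊛ H' m)
  separated = Cls-split {L} {+ 3 * M} {+ 11 * M} dis (c₀ E³-cls HL₃-cls) (c₀ G-cls H₃-cls) (c₁ E³-cls D'-cls) (c₁ G-cls H'-cls) combined
    where
    c₀ : ∀ {f g c} → Cls L (+ 3 * M) f → Cls L 0ℤ g → Cls L (+ 3 * M) (f ⊛ (K c ⊛ g))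
    c₀ {c = c} p q = at-class (ℤₚ.+-identityʳ _) (Cls-⊛ p (Cls-⊛ (Cls-K c) q))
    l₁ : ∀ M → + 3 * M + (0ℤ + + 8 * M) ≡ + 11 * M
    l₁ = solve-∀
    c₁ : ∀ {f g c} → Cls L (+ 3 * M) f → Cls L (+ 8 * M) g → Cls L (+ 11 * M) (f ⊛ (K c ⊛ g))
    c₁ {c = c} p q = at-class (l₁ M) (Cls-⊛ p (Cls-⊛ (Cls-K c) q))
    l₂ : ∀ M k → + 3 * M + (+ 12 * M) * k ≡ M * (+ 3 + + 12 * k)
    l₂ = solve-∀
    l₃ : ∀ M k → + 11 * M + (+ 12 * M) * k ≡ M * (+ 11 + + 12 * k)
    l₃ = solve-∀
    dis : ∀ k k' → + 3 * M + L * k ≡ + 11 * M + L * k' → ⊥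
    dis k k' q = 1≢0 (trans (sym (decide (ap td (lit (+ 3) ⊞ + 12 · v₀)) (cst 1ℤ) refl (k ∷ []))) (trans (cong d₃ (ℤₚ.*-cancelˡ-≡ M (+ 3 + + 12 * k) (+ 11 + + 12 * k') (trans (sym (l₂ M k)) (trans q (l₃ M k')))))
      (decide (ap td (lit (+ 11) ⊞ + 12 · v₀)) (cst 0ℤ) refl (k' ∷ []))))

  eq₃ : E³ m ⊛ HL (3 ℕ.* m) ≋ G₃ m ⊛ H (3 ℕ.* m)
  eq₃ = ⊛-cancelˡ {K (+ 2)} {r = 0} (Lead-leads {1} ℕₚ.≤-refl (λ ()) (Lead-K (+ 2))) (≋-trans (sw (E³ m) (HL (3 ℕ.* m))) (≋-trans (proj₁ separated) (≋-sym (sw (G₃ m) (H (3 ℕ.* m))))))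
    where
    sw : ∀ f g → K (+ 2) ⊛ (f ⊛ g) ≋ f ⊛ (K (+ 2) ⊛ g)
    sw = solve 2 (λ f g → con (+ 2) :* (f :* g) := f :* (con (+ 2) :* g)) ≋-refl

  -- The parts enter `b₂` as 2 H(3m) - H' but `H` as H(3m) + H'. This is why `combined` had to be
  -- separated: the two parts can now be recombined with other coefficients.
  eq₁ : E³ m ⊛ HL m ≋ G₃ m ⊛ H m
  eq₁ = begin
    E³ m ⊛ HL m ≈⟨ ⊛-≋ ≋-refl (HL-split m h) ⟩
    E³ m ⊛ (HL (3 ℕ.* m) ⊹ K (+ 3) ⊛ X₃′ m) ≈⟨ solve 3 (λ f x y → f :* (x :+ con (+ 3) :* y) := f :* x :- f :* (con (-[1+ 2 ]) :* y)) ≋-refl (E³ m) (HL (3 ℕ.* m)) (X₃′ m) ⟩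
    E³ m ⊛ HL (3 ℕ.* m) ⊖ E³ m ⊛ (K (-[1+ 2 ]) ⊛ X₃′ m) ≈⟨ ⊹-cong eq₃ (⊝-cong (proj₂ separated)) ⟩
    G₃ m ⊛ H (3 ℕ.* m) ⊖ G₃ m ⊛ (K -1ℤ ⊛ H' m) ≈⟨ solve 3 (λ f x y → f :* x :- f :* (con -1ℤ :* y) := f :* (x :+ y)) ≋-refl (G₃ m) (H (3 ℕ.* m)) (H' m) ⟩
    G₃ m ⊛ (H (3 ℕ.* m) ⊹ H' m) ≈⟨ ⊛-≋ ≋-refl (H-split≋ m h) ⟨
    G₃ m ⊛ H m ∎
    where open import Relation.Binary.Reasoning.Setoid serSetoid

Dv-vanish : ∀ m → 1 ℕ.≤ m → ∀ w → Vanish (gen (Dv m) w) m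
Dv-vanish m h w {n} n<m = trans (gen-def (Dv m) w n) (∑-0 (fib (Dv m) n) λ {i} i∈ → let (r , q) = sound (Dv m) {i} {n} i∈ in ⊥-elim (absurd i r q))
  where
  absurd : ∀ i → R (Dv m) i → ⟪ m ⟫ * (proj₁ i * proj₂ i) ≡ + n → ⊥
  absurd (+ suc a , + suc d) _ q = ℕₚ.<-irrefl refl (ℕₚ.<-≤-trans n<m (ℕₚ.≤-trans (ℕₚ.m≤m*n m (suc a ℕ.* suc d)) (ℕₚ.≤-reflexive (⟪⟫*-ℕ (suc a ℕ.* suc d) h (trans (cong (⟪ m ⟫ *_) (ℤₚ.pos-* (suc a) (suc d))) q)))))
  absurd (+ zero , _) (ℤ.+<+ () , _) q
  absurd (+ suc a , + zero) (_ , ℤ.+<+ ()) q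

HL-lead : ∀ m → 1 ℕ.≤ m → Lead m (HL m) 1ℤ 0
HL-lead m h = Lead-+ (Lead-K 1ℤ) (Lead-* (Lead-K (+ 6)) (Lead-0 λ n< → Dv-vanish (8 ℕ.* m) (1≤k*m 7 h) _ (ℕₚ.<-≤-trans n< (m≤k*m 7 m))))

E³-lead : ∀ m → 1 ℕ.≤ m → Lead m (E³ m) (+ 8) (m ℕ.+ (m ℕ.+ m))
E³-lead m h = Lead-* l (Lead-* l l)
  where l = Lead-weaken (m≤k*m 7 m) (E-lead m h)

-- By `eq₃` at m and `eq₁` at 3m the quotient of the two sides is HL(3m)/H(3m), for m and for 3m
-- alike. So it is invariant under q ↦ q³, and both sides start with 8 q^(3m). The orders 9m of
-- `E³ (3 ℕ.* m)` and 3m of `E³ m` are the parameters 9 and 3.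
J-cube : ∀ m → 1 ℕ.≤ m → G₃ m ≋ E³ m
J-cube m h = ⊖-zero (dilation-zero 3 9 3 3 δ (λ m → E³ (3 ℕ.* m)) E³ (s≤s (s≤s z≤n)) refl
  (λ m h → subst (Leads (E³ (3 ℕ.* m))) (l₁ m) (Lead-leads (1≤k*m 2 h) (λ ()) (E³-lead (3 ℕ.* m) (1≤k*m 2 h))))
  (λ m h → subst (Vanish (E³ m)) (l₂ m) (Lead-vanish (E³-lead m h)))
  (λ m h → Lead-vanish⁺ (Lead-- (Lead-* (Lead-K (+ 4)) (Lead-weaken (ℕₚ.≤-trans (m≤k*m 2 m) (m≤k*m 7 (3 ℕ.* m))) (J-lead (3 ℕ.* m) (1≤k*m 2 h))))
                                  (subst (Lead m (E³ m) (+ 8)) (l₂ m) (E³-lead m h))))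
  step m h)
  where
  δ : ℕ → Ser
  δ m = G₃ m ⊖ E³ m
  l₁ : ∀ m → 3 ℕ.* m ℕ.+ (3 ℕ.* m ℕ.+ 3 ℕ.* m) ≡ 9 ℕ.* m
  l₁ = solveℕ
  l₂ : ∀ m → m ℕ.+ (m ℕ.+ m) ≡ 3 ℕ.* m
  l₂ = solveℕ
  step : ∀ m → 1 ℕ.≤ m → E³ (3 ℕ.* m) ⊛ δ m ≋ E³ m ⊛ δ (3 ℕ.* m)
  step m h = begin
    E³ (3 ℕ.* m) ⊛ (G₃ m ⊖ E³ m) ≈⟨ solve 3 (λ f' g f → f' :* (g :- f) := g :* f' :- f :* f') ≋-refl (E³ (3 ℕ.* m)) (G₃ m) (E³ m) ⟩
    G₃ m ⊛ E³ (3 ℕ.* m) ⊖ E³ m ⊛ E³ (3 ℕ.* m) ≈⟨ ⊹-cong cross ≋-refl ⟩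
    E³ m ⊛ G₃ (3 ℕ.* m) ⊖ E³ m ⊛ E³ (3 ℕ.* m) ≈⟨ solve 3 (λ f x y → f :* x :- f :* y := f :* (x :- y)) ≋-refl (E³ m) (G₃ (3 ℕ.* m)) (E³ (3 ℕ.* m)) ⟩
    E³ m ⊛ δ (3 ℕ.* m) ∎
    where
    open import Relation.Binary.Reasoning.Setoid serSetoid
    h₃ = 1≤k*m 2 h
    cross : G₃ m ⊛ E³ (3 ℕ.* m) ≋ E³ m ⊛ G₃ (3 ℕ.* m)
    cross = ⊛-cancelˡ {HL (3 ℕ.* m)} {r = 0} (Lead-leads (1≤k*m 2 h) (λ ()) (HL-lead (3 ℕ.* m) h₃)) (begin
      HL (3 ℕ.* m) ⊛ (G₃ m ⊛ E³ (3 ℕ.* m)) ≈⟨ solve 3 (λ x g f → x :* (g :* f) := g :* (f :* x)) ≋-refl (HL (3 ℕ.* m)) (G₃ m) (E³ (3 ℕ.* m)) ⟩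
      G₃ m ⊛ (E³ (3 ℕ.* m) ⊛ HL (3 ℕ.* m)) ≈⟨ ⊛-≋ ≋-refl (Separate.eq₁ (3 ℕ.* m) h₃) ⟩
      G₃ m ⊛ (G₃ (3 ℕ.* m) ⊛ H (3 ℕ.* m)) ≈⟨ solve 3 (λ g g' x → g :* (g' :* x) := g' :* (g :* x)) ≋-refl (G₃ m) (G₃ (3 ℕ.* m)) (H (3 ℕ.* m)) ⟩
      G₃ (3 ℕ.* m) ⊛ (G₃ m ⊛ H (3 ℕ.* m)) ≈⟨ ⊛-≋ ≋-refl (Separate.eq₃ m h) ⟨
      G₃ (3 ℕ.* m) ⊛ (E³ m ⊛ HL (3 ℕ.* m)) ≈⟨ solve 3 (λ g f x → g :* (f :* x) := x :* (f :* g)) ≋-refl (G₃ (3 ℕ.* m)) (E³ m) (HL (3 ℕ.* m)) ⟩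
      HL (3 ℕ.* m) ⊛ (E³ m ⊛ G₃ (3 ℕ.* m)) ∎)

Hex-divisors : ∀ m → 1 ℕ.≤ m → H m ≋ HL m
Hex-divisors m h = ⊛-cancelˡ (Lead-leads h (λ ()) (E³-lead m h)) (≋-trans (⊛-≋ (≋-sym (J-cube m h)) ≋-refl) (≋-sym (Separate.eq₁ m h)))

-- Sums of two squares

X₄ : ℕ → Ser
X₄ m = gen (Dv (8 ℕ.* m)) (λ (a , d) → χ₄ a)

-- 1 = 2 ev(d) - (-1)^d. The even d give X₄(2m); the signs give `R₄`, where only even c = 2d count
-- and e₂(2d) = (-1)^d.
X₄-halve : ∀ m → 1 ℕ.≤ m → ∀ n → X₄ m n ≡ + 2 * X₄ (2 ℕ.* m) n + - R₄ m n
X₄-halve m h n = trans (gen-cong S {v = λ (a , d) → + 2 * (χ₄ a * ev d) + - (χ₄ a * e₂ (+ 2 * d))} (λ (a , d) →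
    decide (ap t₄ v₀) (cst (+ 2) :*: (ap t₄ v₀ :*: ap tev v₁) :+: negᵉ (ap t₄ v₀ :*: ap te (+ 2 · v₁))) refl (a ∷ d ∷ [])) n)
  (trans (gen-+ S (λ (a , d) → + 2 * (χ₄ a * ev d)) (λ (a , d) → - (χ₄ a * e₂ (+ 2 * d))) n) (cong₂ _+_
    (trans (gen-* S (+ 2) (λ (a , d) → χ₄ a * ev d) n) (cong (+ 2 *_) even-part))
    (trans (gen-neg S (λ (a , d) → χ₄ a * e₂ (+ 2 * d)) n) (cong -_ (sym odd-part)))))
  where
  S = Dv (8 ℕ.* m)
  even-part : gen S (λ (a , d) → χ₄ a * ev d) n ≡ X₄ (2 ℕ.* m) n
  even-part = trans (Dv-multiples 1 (8 ℕ.* m) (1≤k*m 7 h) 2∣? (λ (a , d) → χ₄ a * ev d) ev-2* ev-witness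
      (λ a d np → trans (cong (χ₄ a *_) (ev-zero d np)) (ℤₚ.*-zeroʳ (χ₄ a))) n)
    (trans (gen-cong (Dv (2 ℕ.* (8 ℕ.* m))) (λ (a , d) → trans (cong (χ₄ a *_) (ev-2* d)) (ℤₚ.*-identityʳ (χ₄ a))) n)
      (cong (λ k → gen (Dv k) (λ (a , d) → χ₄ a) n) (trans (*-assoc′ 2 8 m) (sym (*-assoc′ 8 2 m)))))
  odd-part : R₄ m n ≡ gen S (λ (a , d) → χ₄ a * e₂ (+ 2 * d)) n
  odd-part = trans (Dv-multiples 1 (4 ℕ.* m) (1≤k*m 3 h) 2∣? (λ (a , c) → χ₄ a * e₂ c) ev-2* ev-witness
      (λ a d np → trans (cong (χ₄ a *_) (trans (decide (ap te v₀) (ap tev v₀ :*: ap te v₀) refl (d ∷ [])) (cong (_* e₂ d) (ev-zero d np)))) (ℤₚ.*-zeroʳ (χ₄ a))) n)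
    (cong (λ k → gen (Dv k) (λ (a , d) → χ₄ a * e₂ (+ 2 * d)) n) (*-assoc′ 2 4 m))

opaque
  unfolding _⊹_ ⊝_

  X₄-halve≋ : ∀ m → 1 ℕ.≤ m → X₄ m ≋ K (+ 2) ⊛ X₄ (2 ℕ.* m) ⊖ R₄ m
  X₄-halve≋ m h = mk λ n → trans (X₄-halve m h n) (cong (_+ - R₄ m n) (sym (K-⊛ (+ 2) (X₄ (2 ℕ.* m)) n)))

φ²-average : ∀ m → 1 ℕ.≤ m → φ m ⊛ φ m ≋ K (+ 2) ⊛ (φ (2 ℕ.* m) ⊛ φ (2 ℕ.* m)) ⊖ φ⁻ m ⊛ φ⁻ m
φ²-average m h = begin
  φ m ⊛ φ m ≈⟨ ⊛-≋ (mk (φ-split m h)) (mk (φ-split m h)) ⟩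
  (φ (4 ℕ.* m) ⊹ θ m) ⊛ (φ (4 ℕ.* m) ⊹ θ m)
    ≈⟨ solve 2 (λ a b → (a :+ b) :* (a :+ b) := con (+ 2) :* (a :* a :+ b :* b) :- (a :- b) :* (a :- b)) ≋-refl (φ (4 ℕ.* m)) (θ m) ⟩
  K (+ 2) ⊛ (φ (4 ℕ.* m) ⊛ φ (4 ℕ.* m) ⊹ θ m ⊛ θ m) ⊖ (φ (4 ℕ.* m) ⊖ θ m) ⊛ (φ (4 ℕ.* m) ⊖ θ m)
    ≈⟨ ⊹-cong (⊛-≋ ≋-refl (mk (φ² m h))) (⊝-cong (⊛-≋ (mk (φ⁻-split m h)) (mk (φ⁻-split m h)))) ⟨
  K (+ 2) ⊛ (φ (2 ℕ.* m) ⊛ φ (2 ℕ.* m)) ⊖ φ⁻ m ⊛ φ⁻ m ∎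
  where open import Relation.Binary.Reasoning.Setoid serSetoid

-- Both sides satisfy f(m) = 2 f(2m) - φ⁻(8m)², by `φ²-average` and by `X₄-halve` with
-- `φ⁻²-divisors`. Hence δ(m) = 2 δ(2m), and the constant terms agree.
φ²-divisors : ∀ m → 1 ℕ.≤ m → φ (8 ℕ.* m) ⊛ φ (8 ℕ.* m) ≋ K 1ℤ ⊹ K (+ 4) ⊛ X₄ m
φ²-divisors m h = ⊖-zero (dilation-zero 2 0 0 0 δ (λ _ → K 1ℤ) (λ _ → K (+ 2)) (s≤s (s≤s z≤n)) refl
  (λ m h → Lead-leads {1} ℕₚ.≤-refl (λ ()) (Lead-K 1ℤ)) (λ m h → λ ())
  (λ m h → Lead-vanish⁺ {m} {δ m} {0} (Lead-- (Lead-* (l m h) (l m h))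
    (Lead-+ (Lead-K 1ℤ) (Lead-* (Lead-K (+ 4)) (Lead-0 λ n< → Dv-vanish (8 ℕ.* m) (1≤k*m 7 h) _ (ℕₚ.<-≤-trans n< (m≤k*m 7 m)))))))
  step m h)
  where
  l : ∀ m → 1 ℕ.≤ m → Lead m (φ (8 ℕ.* m)) 1ℤ 0
  l m h = Lead-weaken (m≤k*m 7 m) (φ-lead (8 ℕ.* m) (1≤k*m 7 h))
  δ : ℕ → Ser
  δ m = φ (8 ℕ.* m) ⊛ φ (8 ℕ.* m) ⊖ (K 1ℤ ⊹ K (+ 4) ⊛ X₄ m)
  step : ∀ m → 1 ℕ.≤ m → K 1ℤ ⊛ δ m ≋ K (+ 2) ⊛ δ (2 ℕ.* m)
  step m h = begin
    K 1ℤ ⊛ δ m ≈⟨ solve 1 (λ x → con 1ℤ :* x := x) ≋-refl (δ m) ⟩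
    δ m ≈⟨ ⊹-cong (φ²-average (8 ℕ.* m) (1≤k*m 7 h)) (⊝-cong (⊹-cong ≋-refl (⊛-≋ ≋-refl (X₄-halve≋ m h)))) ⟩
    K (+ 2) ⊛ (φ (2 ℕ.* (8 ℕ.* m)) ⊛ φ (2 ℕ.* (8 ℕ.* m))) ⊖ φ⁻ (8 ℕ.* m) ⊛ φ⁻ (8 ℕ.* m) ⊖ (K 1ℤ ⊹ K (+ 4) ⊛ (K (+ 2) ⊛ X₄ (2 ℕ.* m) ⊖ R₄ m))
      ≈⟨ ⊹-cong (⊹-cong (⊛-≋ ≋-refl (⊛-≋ eq eq)) (⊝-cong (φ⁻²-divisors m h))) ≋-refl ⟩
    K (+ 2) ⊛ (φ (8 ℕ.* (2 ℕ.* m)) ⊛ φ (8 ℕ.* (2 ℕ.* m))) ⊖ (K 1ℤ ⊹ K (+ 4) ⊛ R₄ m) ⊖ (K 1ℤ ⊹ K (+ 4) ⊛ (K (+ 2) ⊛ X₄ (2 ℕ.* m) ⊖ R₄ m))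
      ≈⟨ solve 3 (λ f x r → con (+ 2) :* (f :* f) :- (con 1ℤ :+ con (+ 4) :* r) :- (con 1ℤ :+ con (+ 4) :* (con (+ 2) :* x :- r)) := con (+ 2) :* (f :* f :- (con 1ℤ :+ con (+ 4) :* x))) ≋-refl (φ (8 ℕ.* (2 ℕ.* m))) (X₄ (2 ℕ.* m)) (R₄ m) ⟩
    K (+ 2) ⊛ δ (2 ℕ.* m) ∎
    where
    open import Relation.Binary.Reasoning.Setoid serSetoid
    eq : φ (2 ℕ.* (8 ℕ.* m)) ≋ φ (8 ℕ.* (2 ℕ.* m))
    eq = reindex φ (trans (*-assoc′ 2 8 m) (sym (*-assoc′ 8 2 m)))

-- The part of `H 1` that belongs to one of the three nonzero parity classes of (x , y).
A₈ : Ser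
A₈ = θ 8 ⊛ φ 96 ⊹ φ 32 ⊛ θ 24

-- Multiplication by a cube root of unity permutes the three nonzero parity classes.
Hex-parity : ∀ n → H 1 n ≡ H 4 n + + 3 * A₈ n
Hex-parity n = trans (gen-cong S {v = λ (x , y) → ev x * ev y + (od x * ev y + (ev x * od y + od x * od y))}
    (λ (x , y) → decide (cst 1ℤ) (ap tev v₀ :*: ap tev v₁ :+: (ap tod v₀ :*: ap tev v₁ :+: (ap tev v₀ :*: ap tod v₁ :+: ap tod v₀ :*: ap tod v₁))) refl (x ∷ y ∷ [])) n)
  (trans (gen-+ S (λ (x , y) → ev x * ev y) (λ (x , y) → od x * ev y + (ev x * od y + od x * od y)) n) (cong₂ _+_ doubled
    (trans (gen-+ S w (λ (x , y) → ev x * od y + od x * od y) n) (trans (cong₂ _+_ part (trans (gen-+ S (λ (x , y) → ev x * od y) (λ (x , y) → od x * od y) n)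
      (cong₂ _+_ (trans (sym swapped) part) (trans (sym rotated) part)))) (thrice (A₈ n))))))
  where
  S = Hex 1
  w : ℤ × ℤ → ℤ
  w (x , y) = od x * ev y
  thrice : ∀ x → x + (x + x) ≡ + 3 * x
  thrice = solve-∀
  doubled : gen S (λ (x , y) → ev x * ev y) n ≡ H 4 n
  doubled = trans (gen-param S (Hex 4) (λ (x , y) → ev x * ev y ℤ.≟ 1ℤ) (λ (x , y) → ev x * ev y) (λ (x , y) → + 2 * x , + 2 * y) (λ _ → tt)
      (λ {(x , y)} _ → cong₂ _*_ (ev-2* x) (ev-2* y)) (λ {(x , y)} _ → l x y)
      (λ {(x , y)} {(x' , y')} q → cong₂ _,_ (2*-inj x x' (,-injectiveˡ q)) (2*-inj y y' (,-injectiveʳ q)))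
      (λ {(x , y)} _ p → go x y p (even∨odd x) (even∨odd y))
      (λ {(x , y)} _ np → zero-one x y np (even∨odd x) (even∨odd y)) n)
    (gen-cong (Hex 4) (λ (x , y) → cong₂ _*_ (ev-2* x) (ev-2* y)) n)
    where
    l : ∀ x y → 1ℤ * (+ 8 * ((+ 2 * x) * (+ 2 * x) + (+ 2 * x) * (+ 2 * y) + (+ 2 * y) * (+ 2 * y))) ≡ + 4 * (+ 8 * (x * x + x * y + y * y))
    l = solve-∀
    go : ∀ x y → ev x * ev y ≡ 1ℤ → (∃[ k ] (+ 2 * k ≡ x)) ⊎ (∃[ k ] (odd k ≡ x)) → (∃[ k ] (+ 2 * k ≡ y)) ⊎ (∃[ k ] (odd k ≡ y)) →
      ∃[ i ] (⊤ × (+ 2 * proj₁ i , + 2 * proj₂ i) ≡ (x , y))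
    go x y p (inj₁ (i , q)) (inj₁ (j , r)) = (i , j) , tt , cong₂ _,_ q r
    go x y p (inj₂ (i , q)) _ = ⊥-elim (1≢0 (trans (sym p) (cong (_* ev y) (trans (cong ev (sym q)) (ev-odd i)))))
    go x y p (inj₁ _) (inj₂ (j , r)) = ⊥-elim (1≢0 (trans (sym p) (trans (cong (ev x *_) (trans (cong ev (sym r)) (ev-odd j))) (ℤₚ.*-zeroʳ (ev x)))))
    zero-one : ∀ x y → ¬ ev x * ev y ≡ 1ℤ → (∃[ k ] (+ 2 * k ≡ x)) ⊎ (∃[ k ] (odd k ≡ x)) → (∃[ k ] (+ 2 * k ≡ y)) ⊎ (∃[ k ] (odd k ≡ y)) → ev x * ev y ≡ 0ℤ
    zero-one x y np (inj₁ (i , q)) (inj₁ (j , r)) = ⊥-elim (np (cong₂ _*_ (trans (cong ev (sym q)) (ev-2* i)) (trans (cong ev (sym r)) (ev-2* j))))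
    zero-one x y np (inj₂ (i , q)) _ = cong (_* ev y) (trans (cong ev (sym q)) (ev-odd i))
    zero-one x y np (inj₁ _) (inj₂ (j , r)) = trans (cong (ev x *_) (trans (cong ev (sym r)) (ev-odd j))) (ℤₚ.*-zeroʳ (ev x))
  swapped : gen S w n ≡ gen S (λ (x , y) → ev x * od y) n
  swapped = gen-bij S S (λ (x , y) → y , x) id (λ {(x , y)} _ → l x y) (λ { _ _ refl → refl }) (λ {(x , y)} _ → (y , x) , tt , refl) (λ {(x , y)} _ → ℤₚ.*-comm (od x) (ev y)) n
    where
    l : ∀ x y → 1ℤ * (+ 8 * (y * y + y * x + x * x)) ≡ 1ℤ * (+ 8 * (x * x + x * y + y * y))
    l = solve-∀
  rotated : gen S w n ≡ gen S (λ (x , y) → od x * od y) n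
  rotated = gen-bij S S (λ (x , y) → x + y , - x) id (λ {(x , y)} _ → l x y)
    (λ {(x , y)} {(x' , y')} _ _ q → cong₂ _,_ (ℤₚ.neg-injective (,-injectiveʳ q)) (trans (sym (l₁ x y)) (trans (cong₂ _+_ (,-injectiveˡ q) (,-injectiveʳ q)) (l₁ x' y'))))
    (λ {(x , y)} _ → (- y , x + y) , tt , cong₂ _,_ (l₂ x y) (ℤₚ.neg-involutive y))
    (λ {(x , y)} _ → decide (ap tod v₀ :*: ap tev v₁) (ap tod (v₀ ⊞ v₁) :*: ap tod (neg v₀)) refl (x ∷ y ∷ [])) n
    where
    l : ∀ x y → 1ℤ * (+ 8 * ((x + y) * (x + y) + (x + y) * (- x) + (- x) * (- x))) ≡ 1ℤ * (+ 8 * (x * x + x * y + y * y))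
    l = solve-∀
    l₁ : ∀ x y → (x + y) + - x ≡ y
    l₁ = solve-∀
    l₂ : ∀ x y → - y + (x + y) ≡ x
    l₂ = solve-∀
  P? : Decidable {A = ℤ × ℤ} (λ (x , y) → od x * ev y ≡ 1ℤ)
  P? (x , y) = od x * ev y ℤ.≟ 1ℤ
  part : gen S w n ≡ A₈ n
  part = trans (gen-param S (T₁ ⊕ T₂) P? w f (λ _ → tt) (λ {i} _ → one i) (λ {i} _ → ee i) (λ {i} {i'} → inj i i')
      (λ {(x , y)} _ p → surj x y p (even∨odd x) (even∨odd y)) (λ {(x , y)} _ np → zer x y np (even∨odd x) (even∨odd y)) n)
    (trans (gen-cong (T₁ ⊕ T₂) one n) (trans (gen-⊕ T₁ T₂ (λ _ → 1ℤ) n)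
      (trans (cong₂ _+_ (gen-⊗ (Odd 8) (Sq 96) (λ _ → 1ℤ) (λ _ → 1ℤ) n) (gen-⊗ (Sq 32) (Odd 24) (λ _ → 1ℤ) (λ _ → 1ℤ) n)) (sym (⊹-def _ _ n)))))
    where
    T₁ = Odd 8 ⊗ Sq 96
    T₂ = Sq 32 ⊗ Odd 24
    -- With y = 2m the form is (x + m)² + 3m². As x is odd, exactly one of x + m and m is odd: the
    -- first on the left summand, the second on the right one.
    f : (ℤ × ℤ) ⊎ (ℤ × ℤ) → ℤ × ℤ
    f (inj₁ (i , j)) = odd (i - j) , + 2 * (+ 2 * j)
    f (inj₂ (i , j)) = odd (i - j - 1ℤ) , + 2 * odd j
    one : ∀ i → w (f i) ≡ 1ℤ
    one (inj₁ (i , j)) = cong₂ _*_ (decide (ap tod (+ 2 · (v₀ ⊟ v₁) ⊞ lit 1ℤ)) (cst 1ℤ) refl (i ∷ j ∷ [])) (ev-2* (+ 2 * j))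
    one (inj₂ (i , j)) = cong₂ _*_ (decide (ap tod (+ 2 · (v₀ ⊟ v₁ ⊟ lit 1ℤ) ⊞ lit 1ℤ)) (cst 1ℤ) refl (i ∷ j ∷ [])) (ev-2* (odd j))
    l₁ : ∀ i j → 1ℤ * (+ 8 * ((+ 2 * (i - j) + 1ℤ) * (+ 2 * (i - j) + 1ℤ) + (+ 2 * (i - j) + 1ℤ) * (+ 2 * (+ 2 * j)) + (+ 2 * (+ 2 * j)) * (+ 2 * (+ 2 * j)))) ≡ + 8 * ((+ 2 * i + 1ℤ) * (+ 2 * i + 1ℤ)) + + 96 * (j * j)
    l₁ = solve-∀
    l₂ : ∀ i j → 1ℤ * (+ 8 * ((+ 2 * (i - j - 1ℤ) + 1ℤ) * (+ 2 * (i - j - 1ℤ) + 1ℤ) + (+ 2 * (i - j - 1ℤ) + 1ℤ) * (+ 2 * (+ 2 * j + 1ℤ)) + (+ 2 * (+ 2 * j + 1ℤ)) * (+ 2 * (+ 2 * j + 1ℤ)))) ≡ + 32 * (i * i) + + 24 * ((+ 2 * j + 1ℤ) * (+ 2 * j + 1ℤ))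
    l₂ = solve-∀
    ee : ∀ i → e S (f i) ≡ e (T₁ ⊕ T₂) i
    ee (inj₁ (i , j)) = l₁ i j
    ee (inj₂ (i , j)) = l₂ i j
    oi : ∀ x y → odd x ≡ odd y → x ≡ y
    oi x y q = 2*-inj x y (trans (sym (m x)) (trans (cong (_- 1ℤ) q) (m y)))
      where
      m : ∀ x → + 2 * x + 1ℤ - 1ℤ ≡ + 2 * x
      m = solve-∀
    ad : ∀ i j → (i - j) + j ≡ i
    ad = solve-∀
    ad₁ : ∀ i j → (i - j - 1ℤ) + j + 1ℤ ≡ i
    ad₁ = solve-∀
    inj : ∀ i i' → f i ≡ f i' → i ≡ i'
    inj (inj₁ (i , j)) (inj₁ (i' , j')) q = cong inj₁ (cong₂ _,_ (trans (sym (ad i j)) (trans (cong₂ _+_ (oi (i - j) (i' - j') (,-injectiveˡ q)) j≡) (ad i' j'))) j≡)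
      where j≡ = 2*-inj j j' (2*-inj (+ 2 * j) (+ 2 * j') (,-injectiveʳ q))
    inj (inj₂ (i , j)) (inj₂ (i' , j')) q = cong inj₂ (cong₂ _,_ (trans (sym (ad₁ i j)) (trans (cong₂ (λ x y → x + y + 1ℤ) (oi (i - j - 1ℤ) (i' - j' - 1ℤ) (,-injectiveˡ q)) j≡) (ad₁ i' j'))) j≡)
      where j≡ = oi j j' (2*-inj (odd j) (odd j') (,-injectiveʳ q))
    inj (inj₁ (i , j)) (inj₂ (i' , j')) q = ⊥-elim (even≢odd j j' (2*-inj (+ 2 * j) (odd j') (,-injectiveʳ q)))
    inj (inj₂ (i , j)) (inj₁ (i' , j')) q = ⊥-elim (even≢odd j' j (sym (2*-inj (odd j) (+ 2 * j') (,-injectiveʳ q))))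
    od-odd : ∀ k → od (odd k) ≡ 1ℤ
    od-odd k = decide (ap tod (+ 2 · v₀ ⊞ lit 1ℤ)) (cst 1ℤ) refl (k ∷ [])
    od-2* : ∀ k → od (+ 2 * k) ≡ 0ℤ
    od-2* k = decide (ap tod (+ 2 · v₀)) (cst 0ℤ) refl (k ∷ [])
    surj₂ : ∀ k m → (∃[ j ] (+ 2 * j ≡ m)) ⊎ (∃[ j ] (odd j ≡ m)) → ∃[ i ] (R (T₁ ⊕ T₂) i × f i ≡ (odd k , + 2 * m))
    surj₂ k _ (inj₁ (j , refl)) = inj₁ (k + j , j) , (tt , tt) , cong (λ t → odd t , + 2 * (+ 2 * j)) (m k j)
      where
      m : ∀ k j → (k + j) - j ≡ k
      m = solve-∀
    surj₂ k _ (inj₂ (j , refl)) = inj₂ (k + j + 1ℤ , j) , (tt , tt) , cong (λ t → odd t , + 2 * odd j) (m k j)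
      where
      m : ∀ k j → (k + j + 1ℤ) - j - 1ℤ ≡ k
      m = solve-∀
    surj : ∀ x y → od x * ev y ≡ 1ℤ → (∃[ k ] (+ 2 * k ≡ x)) ⊎ (∃[ k ] (odd k ≡ x)) → (∃[ k ] (+ 2 * k ≡ y)) ⊎ (∃[ k ] (odd k ≡ y)) → ∃[ i ] (R (T₁ ⊕ T₂) i × f i ≡ (x , y))
    surj _ _ p (inj₂ (k , refl)) (inj₁ (m , refl)) = surj₂ k m (even∨odd m)
    surj _ y p (inj₁ (k , refl)) _ = ⊥-elim (1≢0 (trans (sym p) (cong (_* ev y) (od-2* k))))
    surj x _ p (inj₂ _) (inj₂ (m , refl)) = ⊥-elim (1≢0 (trans (sym p) (trans (cong (od x *_) (ev-odd m)) (ℤₚ.*-zeroʳ (od x)))))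
    zer : ∀ x y → ¬ od x * ev y ≡ 1ℤ → (∃[ k ] (+ 2 * k ≡ x)) ⊎ (∃[ k ] (odd k ≡ x)) → (∃[ k ] (+ 2 * k ≡ y)) ⊎ (∃[ k ] (odd k ≡ y)) → od x * ev y ≡ 0ℤ
    zer _ _ np (inj₂ (k , refl)) (inj₁ (m , refl)) = ⊥-elim (np (cong₂ _*_ (od-odd k) (ev-2* m)))
    zer _ y np (inj₁ (k , refl)) _ = cong (_* ev y) (od-2* k)
    zer x _ np (inj₂ _) (inj₂ (m , refl)) = trans (cong (od x *_) (ev-odd m)) (ℤₚ.*-zeroʳ (od x))

-- The quaternary coefficient

Cls-zero : ∀ l .{{_ : ℕ.NonZero l}} {r f n c j} → Cls (+ l) r f → + n ≡ c + + l * j → r %ℕ l ≢ c %ℕ l → f n ≡ 0ℤ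
Cls-zero l {r} {f} {n} {c} {j} cl q ne = [ (λ (k , p) → ⊥-elim (ne (trans (sym (%ℕ-periodic l r k)) (trans (cong (_%ℕ l) (trans (sym p) q)) (%ℕ-periodic l c j))))) , id ]′ (on cl n)
  where open Cls

opaque
  unfolding _⊹_ ⊝_

  A₈-divisors : A₈ ≋ K (+ 2) ⊛ (X₃ 1 ⊖ X₃ 4)
  A₈-divisors = mk λ n → trans (ℤₚ.*-cancelˡ-≡ (+ 3) _ _ (trans (l₁ (H 4 n) (A₈ n)) (trans (cong (_- H 4 n) (sym (Hex-parity n)))
      (trans (cong₂ _-_ (h 1 (s≤s z≤n) n) (h 4 (s≤s z≤n) n)) (l₂ (K 1ℤ n) (X₃ 1 n) (X₃ 4 n)))))) (sym (K-⊛ (+ 2) (X₃ 1 ⊖ X₃ 4) n))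
    where
    h : ∀ m → 1 ℕ.≤ m → ∀ n → H m n ≡ K 1ℤ n + + 6 * X₃ m n
    h m p n = trans (un (Hex-divisors m p) n) (cong (_+_ (K 1ℤ n)) (K-⊛ (+ 6) (X₃ m) n))
    l₁ : ∀ a b → + 3 * b ≡ (a + + 3 * b) - a
    l₁ = solve-∀
    l₂ : ∀ k a b → (k + + 6 * a) - (k + + 6 * b) ≡ + 3 * (+ 2 * (a + - b))
    l₂ = solve-∀

φ-cls : ∀ k → Cls (+ 64) 0ℤ (φ (64 ℕ.* suc k))
φ-cls k = Cls-gen {L = + 64} {r = 0ℤ} (Sq (64 ℕ.* suc k)) (λ _ → 1ℤ) λ {x} _ → inj₁ (+ suc k * (x * x) , trans (cong (_* (x * x)) (⟪⟫-* 63 (suc k) (s≤s z≤n))) (l (+ suc k) x))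
  where
  l : ∀ k x → (+ 64 * k) * (x * x) ≡ 0ℤ + + 64 * (k * (x * x))
  l = solve-∀

θ-cls : ∀ k → Cls (+ 64) (+ 8 * + suc k) (θ (8 ℕ.* suc k))
θ-cls k = Cls-gen {L = + 64} {r = + 8 * + suc k} (Odd (8 ℕ.* suc k)) (λ _ → 1ℤ) λ {x} _ → inj₁ (go x (even∨odd x))
  where
  l : ∀ k y → (+ 8 * k) * ((+ 2 * (+ 2 * y) + 1ℤ) * (+ 2 * (+ 2 * y) + 1ℤ)) ≡ + 8 * k + + 64 * (k * (y * (+ 2 * y + 1ℤ)))
  l = solve-∀
  l' : ∀ k y → (+ 8 * k) * ((+ 2 * (+ 2 * y + 1ℤ) + 1ℤ) * (+ 2 * (+ 2 * y + 1ℤ) + 1ℤ)) ≡ + 8 * k + + 64 * (k * ((y + 1ℤ) * (+ 2 * y + 1ℤ)))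
  l' = solve-∀
  go : ∀ x → (∃[ y ] (+ 2 * y ≡ x)) ⊎ (∃[ y ] (odd y ≡ x)) → ∃[ j ] (⟪ 8 ℕ.* suc k ⟫ * (odd x * odd x) ≡ + 8 * + suc k + + 64 * j)
  go _ (inj₁ (y , refl)) = + suc k * (y * (+ 2 * y + 1ℤ)) , trans (cong (_* (odd (+ 2 * y) * odd (+ 2 * y))) (⟪⟫-* 7 (suc k) (s≤s z≤n))) (l (+ suc k) y)
  go _ (inj₂ (y , refl)) = + suc k * ((y + 1ℤ) * (+ 2 * y + 1ℤ)) , trans (cong (_* (odd (odd y) * odd (odd y))) (⟪⟫-* 7 (suc k) (s≤s z≤n))) (l' (+ suc k) y)

-- Each φ is split until every factor has its exponents in one class modulo 64. The first group
-- collects the products of class 56 = 8 · 7; the nine products of the second group lie in the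
-- classes 8, 24 and 40.
product-expansion : (φ 16 ⊛ φ 16) ⊛ A₈ ≋
  (((θ 24 ⊛ θ 32) ⊛ (two (φ 64 ⊛ φ 64) ⊹ φ⁻ 64 ⊛ φ⁻ 64)) ⊹ θ 8 ⊛ θ 8 ⊛ θ 8 ⊛ θ 96) ⊹
  ((φ 64 ⊛ φ 64) ⊛ (θ 8 ⊛ φ 384) ⊹ (φ 64 ⊛ φ 64) ⊛ (θ 8 ⊛ θ 96) ⊹ (φ 64 ⊛ φ 64) ⊛ (φ 128 ⊛ θ 24) ⊹
   (θ 16 ⊛ θ 16) ⊛ (θ 8 ⊛ φ 384) ⊹ (θ 16 ⊛ θ 16) ⊛ (θ 8 ⊛ θ 96) ⊹ (θ 16 ⊛ θ 16) ⊛ (θ 32 ⊛ θ 24) ⊹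
   (θ 8 ⊛ θ 8) ⊛ (θ 8 ⊛ φ 384) ⊹ (θ 8 ⊛ θ 8) ⊛ (φ 128 ⊛ θ 24) ⊹ (θ 8 ⊛ θ 8) ⊛ (θ 32 ⊛ θ 24))
product-expansion = begin
  (φ 16 ⊛ φ 16) ⊛ (θ 8 ⊛ φ 96 ⊹ φ 32 ⊛ θ 24)
    ≈⟨ ⊛-≋ (≋-trans (mk (φ² 8 (s≤s z≤n))) (⊹-cong (mk (φ² 16 (s≤s z≤n))) ≋-refl)) (⊹-cong (⊛-≋ ≋-refl (mk (φ-split 96 (s≤s z≤n)))) (⊛-≋ (mk (φ-split 32 (s≤s z≤n))) ≋-refl)) ⟩
  ((φ 64 ⊛ φ 64 ⊹ θ 16 ⊛ θ 16) ⊹ θ 8 ⊛ θ 8) ⊛ (θ 8 ⊛ (φ 384 ⊹ θ 96) ⊹ (φ 128 ⊹ θ 32) ⊛ θ 24)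
    ≈⟨ solve 9 (λ a b c d f g h i j → (a :+ b :+ c) :* (d :* (f :+ g) :+ (h :+ i) :* j) :=
         ((j :* i) :* a :+ b :* (h :* j) :+ c :* d :* g) :+
         (a :* (d :* f) :+ a :* (d :* g) :+ a :* (h :* j) :+ b :* (d :* f) :+ b :* (d :* g) :+ b :* (i :* j) :+ c :* (d :* f) :+ c :* (h :* j) :+ c :* (i :* j)))
         ≋-refl (φ 64 ⊛ φ 64) (θ 16 ⊛ θ 16) (θ 8 ⊛ θ 8) (θ 8) (φ 384) (θ 96) (φ 128) (θ 32) (θ 24) ⟩
  ((θ 24 ⊛ θ 32) ⊛ (φ 64 ⊛ φ 64) ⊹ (θ 16 ⊛ θ 16) ⊛ (φ 128 ⊛ θ 24) ⊹ θ 8 ⊛ θ 8 ⊛ θ 8 ⊛ θ 96) ⊹ _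
    ≈⟨ ⊹-cong (⊹-cong (≋-trans (⊹-cong ≋-refl (⊛-≋ (mk (θ² 16 (s≤s z≤n))) ≋-refl)) main) ≋-refl) ≋-refl ⟩
  _ ∎
  where
  open import Relation.Binary.Reasoning.Setoid serSetoid
  -- θ(16)² has become 2 θ(32) φ(128), and 2 φ(128)² = φ(64)² + φ⁻(64)².
  main : (θ 24 ⊛ θ 32) ⊛ (φ 64 ⊛ φ 64) ⊹ two (θ 32 ⊛ φ 128) ⊛ (φ 128 ⊛ θ 24) ≋ (θ 24 ⊛ θ 32) ⊛ (two (φ 64 ⊛ φ 64) ⊹ φ⁻ 64 ⊛ φ⁻ 64)
  main = begin
    (θ 24 ⊛ θ 32) ⊛ (φ 64 ⊛ φ 64) ⊹ two (θ 32 ⊛ φ 128) ⊛ (φ 128 ⊛ θ 24)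
      ≈⟨ solve 4 (λ r s f x → (r :* s) :* f :+ (s :* x :+ s :* x) :* (x :* r) := (r :* s) :* (f :+ ((x :* x :+ s :* s) :+ (x :* x :- s :* s)))) ≋-refl (θ 24) (θ 32) (φ 64 ⊛ φ 64) (φ 128) ⟩
    (θ 24 ⊛ θ 32) ⊛ (φ 64 ⊛ φ 64 ⊹ ((φ 128 ⊛ φ 128 ⊹ θ 32 ⊛ θ 32) ⊹ (φ 128 ⊛ φ 128 ⊖ θ 32 ⊛ θ 32)))
      ≈⟨ ⊛-≋ ≋-refl (⊹-cong ≋-refl (⊹-cong (≋-sym (mk (φ² 32 (s≤s z≤n)))) (≋-sym (φ⁻² 32 (s≤s z≤n))))) ⟩
    (θ 24 ⊛ θ 32) ⊛ (φ 64 ⊛ φ 64 ⊹ (φ 64 ⊛ φ 64 ⊹ φ⁻ 64 ⊛ φ⁻ 64))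
      ≈⟨ solve 3 (λ t f g → t :* (f :+ (f :+ g)) := t :* ((f :+ f) :+ g)) ≋-refl (θ 24 ⊛ θ 32) (φ 64 ⊛ φ 64) (φ⁻ 64 ⊛ φ⁻ 64) ⟩
    (θ 24 ⊛ θ 32) ⊛ (two (φ 64 ⊛ φ 64) ⊹ φ⁻ 64 ⊛ φ⁻ 64) ∎

module _ (n : ℕ) (j : ℤ) (n≡ : + n ≡ + 56 + + 64 * j) where
  private
    Z : ∀ {r f} → Cls (+ 64) r f → r %ℕ 64 ≢ 56 → f n ≡ 0ℤ
    Z {r} {f} c = Cls-zero 64 {r} {f} {n} {+ 56} {j} c n≡

    f₀ = Cls-⊛ (φ-cls 0) (φ-cls 0)
    t₁₆ = Cls-⊛ (θ-cls 1) (θ-cls 1)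
    t₈ = Cls-⊛ (θ-cls 0) (θ-cls 0)
    a₁ = Cls-⊛ (θ-cls 0) (φ-cls 5)
    a₂ = Cls-⊛ (θ-cls 0) (θ-cls 11)
    a₃ = Cls-⊛ (φ-cls 1) (θ-cls 2)
    a₄ = Cls-⊛ (θ-cls 3) (θ-cls 2)

  opaque
    unfolding _⊹_ ⊝_

    coefficient-relation : ((φ 16 ⊛ φ 16) ⊛ A₈) n ≡ + 2 * (θ 8 ⊛ θ 8 ⊛ θ 8 ⊛ θ 96) n + + 3 * (θ 32 ⊛ J 24) n
    coefficient-relation = trans (un product-expansion n) (trans (cong₂ _+_ (cong (_+ T) (trans (un quaternary-relation n) (cong (_+_ T) (K-⊛ (+ 3) (θ 32 ⊛ J 24) n))))
        (+0 (+0 (+0 (+0 (+0 (+0 (+0 (+0 (Z (Cls-⊛ f₀ a₁) (λ ())) (Z (Cls-⊛ f₀ a₂) (λ ()))) (Z (Cls-⊛ f₀ a₃) (λ ())))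
          (Z (Cls-⊛ t₁₆ a₁) (λ ()))) (Z (Cls-⊛ t₁₆ a₂) (λ ()))) (Z (Cls-⊛ t₁₆ a₄) (λ ())))
          (Z (Cls-⊛ t₈ a₁) (λ ()))) (Z (Cls-⊛ t₈ a₃) (λ ()))) (Z (Cls-⊛ t₈ a₄) (λ ())))) (l T ((θ 32 ⊛ J 24) n)))
      where
      T : ℤ
      T = (θ 8 ⊛ θ 8 ⊛ θ 8 ⊛ θ 96) n
      +0 : ∀ {x y} → x ≡ 0ℤ → y ≡ 0ℤ → x + y ≡ 0ℤ
      +0 refl refl = refl
      l : ∀ t c → (t + + 3 * c) + t + 0ℤ ≡ + 2 * t + + 3 * c
      l = solve-∀

    divisor-side : ((φ 16 ⊛ φ 16) ⊛ A₈) n ≡ + 2 * X₃ 1 n + + 8 * (X₄ 2 ⊛ X₃ 1) n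
    divisor-side = trans (un expand n) (trans (cong₂ _+_ (cong₂ _+_ (K-⊛ (+ 2) (X₃ 1) n) (K-⊛ (+ 8) (X₄ 2 ⊛ X₃ 1) n)) (cong -_ vanishes)) (ℤₚ.+-identityʳ _))
      where
      P : Ser
      P = K (+ 2) ⊛ ((K 1ℤ ⊹ K (+ 4) ⊛ X₄ 2) ⊛ X₃ 4)
      expand : (φ 16 ⊛ φ 16) ⊛ A₈ ≋ K (+ 2) ⊛ X₃ 1 ⊹ K (+ 8) ⊛ (X₄ 2 ⊛ X₃ 1) ⊖ P
      expand = expansion
        where
        opaque
          expansion : (φ 16 ⊛ φ 16) ⊛ A₈ ≋ K (+ 2) ⊛ X₃ 1 ⊹ K (+ 8) ⊛ (X₄ 2 ⊛ X₃ 1) ⊖ P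
          expansion = ≋-trans (⊛-≋ (φ²-divisors 2 (s≤s z≤n)) A₈-divisors)
            (solve 3 (λ x d d' → (con 1ℤ :+ con (+ 4) :* x) :* (con (+ 2) :* (d :- d')) := con (+ 2) :* d :+ con (+ 8) :* (x :* d) :- con (+ 2) :* ((con 1ℤ :+ con (+ 4) :* x) :* d')) ≋-refl (X₄ 2) (X₃ 1) (X₃ 4))
      dv : ∀ k (w : ℤ × ℤ → ℤ) → Cls (+ 16) 0ℤ (gen (Dv (16 ℕ.* suc k)) w)
      dv k w = Cls-gen {L = + 16} {r = 0ℤ} (Dv (16 ℕ.* suc k)) w λ {(a , d)} _ → inj₁ (+ suc k * (a * d) , trans (cong (_* (a * d)) (⟪⟫-* 15 (suc k) (s≤s z≤n))) (l (+ suc k) (a * d)))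
        where
        l : ∀ k x → (+ 16 * k) * x ≡ 0ℤ + + 16 * (k * x)
        l = solve-∀
      -- All exponents of `P` are multiples of 16, whereas n ≡ 8 modulo 16.
      vanishes : P n ≡ 0ℤ
      vanishes = Cls-zero 16 {n = n} {+ 56} {+ 4 * j} (Cls-⊛ (Cls-K (+ 2)) (Cls-⊛ (Cls-⊹ (Cls-K 1ℤ) (Cls-⊛ (Cls-K (+ 4)) (dv 0 (λ (a , d) → χ₄ a)))) (dv 1 (λ (a , d) → χ₃ a))))
        (trans n≡ (cong (_+_ (+ 56)) (l j))) (λ ())
        where
        l : ∀ j → + 64 * j ≡ + 16 * (+ 4 * j)
        l = solve-∀

-- Liouville's identity

opaque
  unfolding gen

  gen-cong-at : (S : Sys I) {w v : I → ℤ} → ∀ n → (∀ {i} → R S i → e S i ≡ + n → w i ≡ v i) → gen S w n ≡ gen S v n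
  gen-cong-at S n h = ∑-cong (fib S n) (λ i∈ → let (r , q) = sound S i∈ in h r q)

  gen-scale : (S T : Sys I) (k : ℕ) → (∀ {i} → R S i → R T i) → (∀ {i} → R T i → R S i) →
    (∀ i → e T i ≡ + suc k * e S i) → ∀ w n → gen T w (suc k ℕ.* n) ≡ gen S w n
  gen-scale S T k st ts eq w n = ∑-bij {v = w} (unique T (suc k ℕ.* n)) (unique S n) id
    (λ {i} p → let (r , q) = sound T p in complete S (ts r) (ℤₚ.*-cancelˡ-≡ (+ suc k) (e S i) (+ n) (trans (sym (eq i)) (trans q (ℤₚ.pos-* (suc k) n)))))
    (λ _ _ q → q)
    (λ {i} p → let (r , q) = sound S p in i , complete T (st r) (trans (eq i) (trans (cong (+ suc k *_) q) (sym (ℤₚ.pos-* (suc k) n)))) , refl)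
    (λ _ → refl)

module Trisect (S : Sys I) (f g : I → ℤ) where
  LT GT EQ : Sys I
  LT = restrict (λ i → f i ℤ.<? g i) S
  GT = restrict (λ i → g i ℤ.<? f i) S
  EQ = restrict (λ i → f i ℤ.≟ g i) S

  trisect : ∀ w n → gen S w n ≡ gen LT w n + (gen EQ w n + gen GT w n)
  trisect w n = trans (gen-restrict (λ i → f i ℤ.<? g i) S w n) (cong (_+_ (gen LT w n))
    (trans (gen-restrict (λ i → f i ℤ.≟ g i) NL w n) (cong₂ _+_
      (gen-bij (restrict (λ i → f i ℤ.≟ g i) NL) EQ {w} {w} id (λ ((r , _) , q) → r , q) (λ _ → refl) (λ _ _ q → q)
        (λ {i} (r , q) → i , ((r , λ lt → ℤₚ.<-irrefl q lt) , q) , refl) (λ _ → refl) n)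
      (gen-bij (restrict (¬? ∘ (λ i → f i ℤ.≟ g i)) NL) GT {w} {w} id (λ {i} ((r , ≮) , ≢) → r , greater (f i) (g i) ≮ ≢) (λ _ → refl) (λ _ _ q → q)
        (λ {i} (r , gt) → i , ((r , ℤₚ.<-asym gt) , λ q → ℤₚ.<-irrefl (sym q) gt) , refl) (λ _ → refl) n))))
    where
    NL = restrict (¬? ∘ (λ i → f i ℤ.<? g i)) S
    greater : ∀ x y → ¬ (x ℤ.< y) → ¬ (x ≡ y) → y ℤ.< x
    greater x y ≮ ≢ with ℤₚ.<-cmp x y
    ... | tri< lt _ _ = ⊥-elim (≮ lt)
    ... | tri≈ _ eq _ = ⊥-elim (≢ eq)
    ... | tri> _ _ gt = gt

ℤ⁴ : Set
ℤ⁴ = (ℤ × ℤ) × (ℤ × ℤ)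

Ω : Sys ℤ⁴
Ω = Dv 1 ⊗ Dv 1

positive-diff : ∀ {x y} → x ℤ.< y → Positive (y - x)
positive-diff {x} {y} h = subst (ℤ._< y - x) (ℤₚ.+-inverseʳ x) (ℤₚ.+-monoˡ-< (- x) h)

positive-+ : ∀ {x y} → Positive x → Positive y → Positive (x + y)
positive-+ = ℤₚ.+-mono-<

<-+ : ∀ {x y z} → Positive z → x + z ≡ y → x ℤ.< y
<-+ {x} {y} {z} h q = subst₂ ℤ._<_ (ℤₚ.+-identityʳ x) q (ℤₚ.+-monoʳ-< x h)

module A∥D = Trisect Ω (λ ((a , b) , (c , d)) → a) (λ ((a , b) , (c , d)) → d)
module B∥C = Trisect Ω (λ ((a , b) , (c , d)) → b) (λ ((a , b) , (c , d)) → c)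

private
  quadruple : ∀ {a b c d a' b' c' d' : ℤ} → a ≡ a' → b ≡ b' → c ≡ c' → d ≡ d' → _≡_ {A = ℤ⁴} ((a , b) , (c , d)) ((a' , b') , (c' , d'))
  quadruple refl refl refl refl = refl

  l+- : ∀ a b → (a + b) - b ≡ a
  l+- = solve-∀
  l-+ : ∀ a b → (a - b) + b ≡ a
  l-+ = solve-∀

module Liouville (F : ℤ → ℤ → ℤ) (F-x : ∀ x y → F (- x) y ≡ F x y) (F-y : ∀ x y → F x (- y) ≡ F x y) (n : ℕ) where
  w₁ w₂ w₃ : ℤ⁴ → ℤ
  w₁ ((a , b) , (c , d)) = F (a - d) (b + c)
  w₂ ((a , b) , (c , d)) = F (a + d) (b - c)
  w₃ ((a , b) , (c , d)) = F a c

  swap : ℤ⁴ → ℤ⁴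
  swap ((a , b) , (c , d)) = (d , c) , (b , a)

  e-swap : ∀ a b c d → 1ℤ * (d * c) + 1ℤ * (b * a) ≡ 1ℤ * (a * b) + 1ℤ * (c * d)
  e-swap = solve-∀
  neg-diff : ∀ a d → d - a ≡ - (a - d)
  neg-diff = solve-∀

  -- The maps here are linear and preserve the norm, as in ab + cd = (a - d) b + (b + c) d. The
  -- order imposed on the source keeps the new entries positive, and positivity of the old ones
  -- becomes the order imposed on the target.
  i₁ : gen A∥D.GT w₁ n ≡ gen B∥C.LT w₃ n
  i₁ = gen-bij A∥D.GT B∥C.LT (λ ((a , b) , (c , d)) → (a - d , b) , (b + c , d))
    (λ {((a , b) , (c , d))} (((_ , pb) , (pc , pd)) , d<a) → ((positive-diff d<a , pb) , (positive-+ pb pc , pd)) , <-+ pc refl)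
    (λ {((a , b) , (c , d))} _ → l a b c d)
    (λ {((a , b) , (c , d))} {((a' , b') , (c' , d'))} _ _ q → inj a b c d a' b' c' d' q)
    (λ {((a , b) , (c , d))} (((pa , pb) , (pc , pd)) , b<c) → ((a + d , b) , (c - b , d)) , (((positive-+ pa pd , pb) , (positive-diff b<c , pd)) , <-+ pa (ℤₚ.+-comm d a)) , quadruple (l+- a d) refl (l' b c) refl)
    (λ _ → refl) n
    where
    l : ∀ a b c d → 1ℤ * ((a - d) * b) + 1ℤ * ((b + c) * d) ≡ 1ℤ * (a * b) + 1ℤ * (c * d)
    l = solve-∀
    l' : ∀ b c → b + (c - b) ≡ c
    l' = solve-∀
    inj : ∀ a b c d a' b' c' d' → _≡_ {A = ℤ⁴} ((a - d , b) , (b + c , d)) ((a' - d' , b') , (b' + c' , d')) → _≡_ {A = ℤ⁴} ((a , b) , (c , d)) ((a' , b') , (c' , d'))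
    inj a b c d a' b' c' d' q = quadruple (trans (sym (l-+ a d)) (trans (cong₂ _+_ (cong (proj₁ ∘ proj₁) q) d≡) (l-+ a' d'))) b≡ (trans (sym (l'' b c)) (trans (cong₂ _-_ (cong (proj₁ ∘ proj₂) q) b≡) (l'' b' c'))) d≡
      where
      b≡ = cong (proj₂ ∘ proj₁) q
      d≡ = cong (proj₂ ∘ proj₂) q
      l'' : ∀ b c → (b + c) - b ≡ c
      l'' = solve-∀

  i₂ : gen A∥D.LT w₁ n ≡ gen A∥D.GT w₁ n
  i₂ = gen-bij A∥D.LT A∥D.GT swap (λ (((pa , pb) , (pc , pd)) , lt) → ((pd , pc) , (pb , pa)) , lt) (λ {((a , b) , (c , d))} _ → e-swap a b c d)
    (λ { _ _ refl → refl }) (λ {i} (((pa , pb) , (pc , pd)) , lt) → swap i , (((pd , pc) , (pb , pa)) , lt) , refl)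
    (λ {((a , b) , (c , d))} _ → trans (sym (F-x (a - d) (b + c))) (cong₂ F (sym (neg-diff a d)) (ℤₚ.+-comm b c))) n

  i₃ : gen B∥C.GT w₂ n ≡ gen A∥D.GT w₃ n
  i₃ = gen-bij B∥C.GT A∥D.GT (λ ((a , b) , (c , d)) → (a + d , c) , (b - c , a))
    (λ {((a , b) , (c , d))} (((pa , pb) , (pc , pd)) , c<b) → ((positive-+ pa pd , pc) , (positive-diff c<b , pa)) , <-+ pd refl)
    (λ {((a , b) , (c , d))} _ → l a b c d)
    (λ {((a , b) , (c , d))} {((a' , b') , (c' , d'))} _ _ q → inj a b c d a' b' c' d' q)
    (λ {((a , b) , (c , d))} (((pa , pb) , (pc , pd)) , d<a) → ((d , c + b) , (b , a - d)) , (((pd , positive-+ pc pb) , (pb , positive-diff d<a)) , <-+ pc (ℤₚ.+-comm b c)) , quadruple (l' a d) refl (l+- c b) refl)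
    (λ _ → refl) n
    where
    l : ∀ a b c d → 1ℤ * ((a + d) * c) + 1ℤ * ((b - c) * a) ≡ 1ℤ * (a * b) + 1ℤ * (c * d)
    l = solve-∀
    l' : ∀ a d → d + (a - d) ≡ a
    l' = solve-∀
    l'' : ∀ a d → (a + d) - a ≡ d
    l'' = solve-∀
    inj : ∀ a b c d a' b' c' d' → _≡_ {A = ℤ⁴} ((a + d , c) , (b - c , a)) ((a' + d' , c') , (b' - c' , a')) → _≡_ {A = ℤ⁴} ((a , b) , (c , d)) ((a' , b') , (c' , d'))
    inj a b c d a' b' c' d' q = quadruple a≡ (trans (sym (l-+ b c)) (trans (cong₂ _+_ (cong (proj₁ ∘ proj₂) q) c≡) (l-+ b' c'))) c≡ (trans (sym (l'' a d)) (trans (cong₂ _-_ (cong (proj₁ ∘ proj₁) q) a≡) (l'' a' d')))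
      where
      c≡ = cong (proj₂ ∘ proj₁) q
      a≡ = cong (proj₂ ∘ proj₂) q

  i₄ : gen B∥C.LT w₂ n ≡ gen B∥C.GT w₂ n
  i₄ = gen-bij B∥C.LT B∥C.GT swap (λ (((pa , pb) , (pc , pd)) , lt) → ((pd , pc) , (pb , pa)) , lt) (λ {((a , b) , (c , d))} _ → e-swap a b c d)
    (λ { _ _ refl → refl }) (λ {i} (((pa , pb) , (pc , pd)) , lt) → swap i , (((pd , pc) , (pb , pa)) , lt) , refl)
    (λ {((a , b) , (c , d))} _ → trans (sym (F-y (a + d) (b - c))) (cong₂ F (ℤₚ.+-comm a d) (sym (neg-diff b c)))) n

  i₅ : gen B∥C.GT w₃ n ≡ gen A∥D.LT w₃ n
  i₅ = gen-bij B∥C.GT A∥D.LT (λ ((a , b) , (c , d)) → (a , b - c) , (c , d + a))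
    (λ {((a , b) , (c , d))} (((pa , pb) , (pc , pd)) , c<b) → ((pa , positive-diff c<b) , (pc , positive-+ pd pa)) , <-+ pd (ℤₚ.+-comm a d))
    (λ {((a , b) , (c , d))} _ → l a b c d)
    (λ {((a , b) , (c , d))} {((a' , b') , (c' , d'))} _ _ q → inj a b c d a' b' c' d' q)
    (λ {((a , b) , (c , d))} (((pa , pb) , (pc , pd)) , a<d) → ((a , b + c) , (c , d - a)) , (((pa , positive-+ pb pc) , (pc , positive-diff a<d)) , <-+ pb (ℤₚ.+-comm c b)) , quadruple refl (l+- b c) refl (l-+ d a))
    (λ _ → refl) n
    where
    l : ∀ a b c d → 1ℤ * (a * (b - c)) + 1ℤ * (c * (d + a)) ≡ 1ℤ * (a * b) + 1ℤ * (c * d)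
    l = solve-∀
    inj : ∀ a b c d a' b' c' d' → _≡_ {A = ℤ⁴} ((a , b - c) , (c , d + a)) ((a' , b' - c') , (c' , d' + a')) → _≡_ {A = ℤ⁴} ((a , b) , (c , d)) ((a' , b') , (c' , d'))
    inj a b c d a' b' c' d' q = quadruple a≡ (trans (sym (l-+ b c)) (trans (cong₂ _+_ (cong (proj₂ ∘ proj₁) q) c≡) (l-+ b' c'))) c≡ (trans (sym (l+- d a)) (trans (cong₂ _-_ (cong (proj₂ ∘ proj₂) q) a≡) (l+- d' a')))
      where
      a≡ = cong (proj₁ ∘ proj₁) q
      c≡ = cong (proj₁ ∘ proj₂) q

  -- Off the diagonals `w₁` contributes twice the sum of F(a, c) over b < c, and `w₂` twice that
  -- over d < a. Cutting the full sum of F(a, c) once by b against c and once by a against d, and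
  -- removing the parts equated by `i₅`, reduces the difference of these two to the diagonals.
  liouville : gen Ω w₁ n - gen Ω w₂ n ≡ + 2 * (gen A∥D.EQ w₃ n - gen B∥C.EQ w₃ n) + (gen A∥D.EQ w₁ n - gen B∥C.EQ w₂ n)
  liouville = trans (cong₂ _-_ (trans (A∥D.trisect w₁ n) (cong₂ (λ x y → x + (gen A∥D.EQ w₁ n + y)) (trans i₂ i₁) i₁))
                                (trans (B∥C.trisect w₂ n) (cong₂ (λ x y → x + (gen B∥C.EQ w₂ n + y)) (trans i₄ i₃) i₃)))
    (trans (l₁ (gen B∥C.LT w₃ n) (gen A∥D.EQ w₁ n) (gen A∥D.GT w₃ n) (gen B∥C.EQ w₂ n))
      (cong (λ t → + 2 * t + (gen A∥D.EQ w₁ n - gen B∥C.EQ w₂ n))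
        (l₂ (gen B∥C.LT w₃ n) (gen B∥C.EQ w₃ n) (gen A∥D.LT w₃ n) (gen A∥D.EQ w₃ n) (gen A∥D.GT w₃ n)
          (trans (cong (λ t → gen B∥C.LT w₃ n + (gen B∥C.EQ w₃ n + t)) (sym i₅)) (trans (sym (B∥C.trisect w₃ n)) (A∥D.trisect w₃ n))))))
    where
    l₁ : ∀ x p y q → (x + (p + x)) - (y + (q + y)) ≡ + 2 * (x - y) + (p - q)
    l₁ = solve-∀
    l₃ : ∀ x b z → x ≡ (x + (b + z)) - b - z
    l₃ = solve-∀
    l₄ : ∀ z a y b → (z + (a + y)) - b - z - y ≡ a - b
    l₄ = solve-∀
    l₂ : ∀ x b z a y → x + (b + z) ≡ z + (a + y) → x - y ≡ a - b
    l₂ x b z a y q = trans (cong (_- y) (trans (l₃ x b z) (cong (λ t → t - b - z) q))) (l₄ z a y b)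

-- The diagonal terms and two linear relations for odd n

slice : ℤ × ℤ → List ℤ⁴
slice (a , + suc k) = map (λ i → (a , + suc k - + suc i) , (+ suc i , a)) (upTo k)
slice _ = []

slice-unique : ∀ z → Unique (slice z)
slice-unique (a , + suc k) = Uniq.map⁺ (λ q → ℕₚ.suc-injective (ℤₚ.+-injective (cong (λ z → proj₁ (proj₂ z)) q))) (Uniq.upTo⁺ k)
slice-unique (a , + zero) = AllPairs.[]
slice-unique (a , -[1+ k ]) = AllPairs.[]

slice-∈ : ∀ z {x} → x ∈ slice z → Positive (proj₂ (proj₁ x)) × Positive (proj₁ (proj₂ x)) × proj₁ (proj₁ x) ≡ proj₂ (proj₂ x) × (proj₁ (proj₁ x) , proj₂ (proj₁ x) + proj₁ (proj₂ x)) ≡ z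
slice-∈ (a , + suc k) x∈ with ∈-map⁻ _ x∈
... | i , i∈ , refl = positive-diff {+ suc i} {+ suc k} (ℤ.+<+ (s≤s (∈-upTo⁻ i∈))) , ℤ.+<+ (s≤s z≤n) , refl , cong (a ,_) (l-+ (+ suc k) (+ suc i))

∈-slice : ∀ a b c → Positive b → Positive c → ((a , b) , (c , a)) ∈ slice (a , b + c)
∈-slice a (+ suc i) (+ suc j) _ _ = subst (_∈ slice (a , + suc i + + suc j)) (cong (λ x → (a , x) , (+ suc j , a)) (l+- (+ suc i) (+ suc j)))
  (∈-map⁺ (λ i' → (a , + suc (i ℕ.+ suc j) - + suc i') , (+ suc i' , a)) (∈-upTo⁺ (ℕₚ.≤-trans (ℕₚ.n<1+n j) (ℕₚ.m≤n+m (suc j) i))))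
∈-slice a (+ zero) c (ℤ.+<+ ()) _
∈-slice a (+ suc i) (+ zero) _ (ℤ.+<+ ())

-- For a = d the norm is a (b + c): a sum over divisors a with an inner sum over b + c = t.
diagonal : ∀ w n → gen A∥D.EQ w n ≡ gen (Dv 1) (λ z → ∑ (slice z) w) n
diagonal w n = trans (gen-def A∥D.EQ w n) (trans (∑-bij {ys = concatMap slice (fib T n)} {v = w} (unique A∥D.EQ n)
    (unique-concatMap slice (fib T n) (unique T n) slice-unique (λ {z} {z'} p q → trans (sym (proj₂ (proj₂ (proj₂ (slice-∈ z p))))) (proj₂ (proj₂ (proj₂ (slice-∈ z' q))))))
    id into (λ _ _ q → q) (λ {x} x∈ → x , out x∈ , refl) (λ _ → refl)) (trans (∑-concatMap slice (fib T n) w) (sym (gen-def T _ n))))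
  where
  T = Dv 1
  l : ∀ a b c → 1ℤ * (a * b) + 1ℤ * (c * a) ≡ 1ℤ * (a * (b + c))
  l = solve-∀
  into : ∀ {x} → x ∈ fib A∥D.EQ n → x ∈ concatMap slice (fib T n)
  into {(a , b) , (c , d)} x∈ = go (sound A∥D.EQ {(a , b) , (c , d)} {n} x∈)
    where
    go : (R Ω ((a , b) , (c , d)) × a ≡ d) × e Ω ((a , b) , (c , d)) ≡ + n → ((a , b) , (c , d)) ∈ concatMap slice (fib T n)
    go ((((pa , pb) , (pc , pd)) , refl) , q) = ∈-concatMap⁺ slice (Any.map (λ { refl → ∈-slice a b c pb pc }) (complete T {a , b + c} {n} (pa , positive-+ pb pc) (trans (sym (l a b c)) q)))
  out : ∀ {x} → x ∈ concatMap slice (fib T n) → x ∈ fib A∥D.EQ n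
  out {(a , b) , (c , d)} x∈ = let (z , z∈ , xz) = find (∈-concatMap⁻ slice {xs = fib T n} x∈) in go z z∈ (slice-∈ z xz)
    where
    go : ∀ z → z ∈ fib T n → Positive b × Positive c × a ≡ d × (a , b + c) ≡ z → ((a , b) , (c , d)) ∈ fib A∥D.EQ n
    go _ z∈ (pb , pc , refl , refl) = let ((pa , _) , q) = sound T {a , b + c} {n} z∈ in complete A∥D.EQ {(a , b) , (c , a)} {n} (((pa , pb) , (pc , pa)) , refl) (trans (l a b c) q)

transpose : ∀ w n → gen B∥C.EQ w n ≡ gen A∥D.EQ (λ ((a , b) , (c , d)) → w ((b , a) , (d , c))) n
transpose w = gen-bij B∥C.EQ A∥D.EQ {w} {λ ((a , b) , (c , d)) → w ((b , a) , (d , c))} (λ ((a , b) , (c , d)) → (b , a) , (d , c))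
  (λ (((pa , pb) , (pc , pd)) , q) → ((pb , pa) , (pd , pc)) , q) (λ {((a , b) , (c , d))} _ → l a b c d) (λ { _ _ refl → refl })
  (λ {((a , b) , (c , d))} (((pa , pb) , (pc , pd)) , q) → ((b , a) , (d , c)) , (((pb , pa) , (pd , pc)) , q) , refl) (λ _ → refl)
  where
  l : ∀ a b c d → 1ℤ * (b * a) + 1ℤ * (d * c) ≡ 1ℤ * (a * b) + 1ℤ * (c * d)
  l = solve-∀

sum-const : ∀ k (x : ℤ) → sumTo k (λ _ → x) ≡ + k * x
sum-const zero x = sym (ℤₚ.*-zeroˡ x)
sum-const (suc k) x = trans (cong (_+ x) (sum-const k x)) (l (+ k) x)
  where
  l : ∀ k x → k * x + x ≡ (1ℤ + k) * x
  l = solve-∀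

sumTo-*ˡ : ∀ k c f → sumTo k (λ i → c * f i) ≡ c * sumTo k f
sumTo-*ˡ zero c f = sym (ℤₚ.*-zeroʳ c)
sumTo-*ˡ (suc k) c f = trans (cong (_+ c * f k) (sumTo-*ˡ k c f)) (sym (ℤₚ.*-distribˡ-+ c (sumTo k f) (f k)))

module Odd-level (g G : ℤ → ℤ) (g-even : ∀ y → g (- y) ≡ g y) (g-0 : g 0ℤ ≡ 1ℤ) (g-od : ∀ y → g y ≡ ev y * g y)
  (partial : ∀ k → sumTo k (λ i → + 2 * g (+ suc i)) ≡ G (+ suc k)) (n : ℕ) (n-odd : od (+ n) ≡ 1ℤ) where

  F : ℤ → ℤ → ℤ
  F x y = χ₁₂ x * g y

  open Liouville F (λ x y → cong (_* g y) (decide (ap t₁₂ (neg v₀)) (ap t₁₂ v₀) refl (x ∷ []))) (λ x y → cong (χ₁₂ x *_) (g-even y)) n public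

  odd-product : ∀ a b c → 1ℤ * (a * b) + 1ℤ * (c * a) ≡ + n → ev a ≡ 0ℤ
  odd-product a b c q = trans (sym (ℤₚ.*-identityˡ (ev a))) (trans (cong (_* ev a) (trans (sym n-odd) (cong od (trans (sym q) (l a b c)))))
      (decide (ap tod (v₀ ⊠ v₁) :*: ap tev v₀) (cst 0ℤ) refl (a ∷ (b + c) ∷ [])))
    where
    l : ∀ a b c → 1ℤ * (a * b) + 1ℤ * (c * a) ≡ a * (b + c)
    l = solve-∀

  -- Two diagonal terms vanish: for a = d because χ₁₂(0) = 0, and for b = c because c divides the
  -- odd n while g lives on even numbers. The other two are slice sums, one of g and one of the
  -- constant g(0) = 1.
  evaluated : gen Ω w₁ n - gen Ω w₂ n ≡ gen (Dv 1) (λ (a , t) → χ₁₂ a * G t - χ₁₂ t * (t - 1ℤ)) n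
  evaluated = trans liouville (trans (cong₂ (λ x y → + 2 * x + y) (cong₂ _-_ (diagonal w₃ n) t₁) (cong₂ _-_ t₂ (trans (transpose w₂ n) (diagonal w₄ n))))
    (trans (l₁ (gen (Dv 1) (λ z → ∑ (slice z) w₃) n) (gen (Dv 1) (λ z → ∑ (slice z) w₄) n))
    (trans (cong (_+ - gen (Dv 1) (λ z → ∑ (slice z) w₄) n) (sym (gen-* (Dv 1) (+ 2) (λ z → ∑ (slice z) w₃) n)))
    (trans (cong (_+_ (gen (Dv 1) (λ z → + 2 * ∑ (slice z) w₃) n)) (sym (gen-neg (Dv 1) (λ z → ∑ (slice z) w₄) n)))
    (trans (sym (gen-+ (Dv 1) (λ z → + 2 * ∑ (slice z) w₃) (λ z → - ∑ (slice z) w₄) n))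
      (gen-cong-R (Dv 1) {λ z → + 2 * ∑ (slice z) w₃ + - ∑ (slice z) w₄} {λ (a , t) → χ₁₂ a * G t - χ₁₂ t * (t - 1ℤ)} (λ {z} (_ , p) → cong₂ (λ x y → x + - y) (val₃ z p) (val₄ z p)) n))))))
    where
    w₄ : ℤ⁴ → ℤ
    w₄ ((a , b) , (c , d)) = F (b + c) (a - d)
    l₁ : ∀ x y → + 2 * (x - 0ℤ) + (0ℤ - y) ≡ + 2 * x + - y
    l₁ = solve-∀
    t₁ : gen B∥C.EQ w₃ n ≡ 0ℤ
    t₁ = trans (transpose w₃ n) (trans (gen-cong-at A∥D.EQ {w = λ ((a , b) , (c , d)) → F b d} {v = λ _ → 0ℤ} n (λ {((a , b) , (c , d))} (_ , a≡d) q → vanish a b c d a≡d q)) (gen-0 A∥D.EQ {λ _ → 0ℤ} (λ _ → refl) n))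
      where
      vanish : ∀ a b c d → a ≡ d → 1ℤ * (a * b) + 1ℤ * (c * d) ≡ + n → F b d ≡ 0ℤ
      vanish a b c d refl q = trans (cong (χ₁₂ b *_) (trans (g-od a) (cong (_* g a) (odd-product a b c q)))) (ℤₚ.*-zeroʳ (χ₁₂ b))
    t₂ : gen A∥D.EQ w₁ n ≡ 0ℤ
    t₂ = gen-0 A∥D.EQ {w₁} (λ {((a , b) , (c , d))} (_ , a≡d) → cong (λ t → χ₁₂ t * g (b + c)) (trans (cong (_- d) a≡d) (ℤₚ.+-inverseʳ d))) n
    val₃ : ∀ z → Positive (proj₂ z) → + 2 * ∑ (slice z) w₃ ≡ χ₁₂ (proj₁ z) * G (proj₂ z)
    val₃ (a , + suc k) _ = trans (cong (+ 2 *_) (trans (∑-map _ (upTo k) w₃) (trans (∑-upTo k _) (sumTo-*ˡ k (χ₁₂ a) (λ i → g (+ suc i))))))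
      (trans (l (χ₁₂ a) (sumTo k (λ i → g (+ suc i)))) (cong (χ₁₂ a *_) (trans (sym (sumTo-*ˡ k (+ 2) (λ i → g (+ suc i)))) (partial k))))
      where
      l : ∀ x y → + 2 * (x * y) ≡ x * (+ 2 * y)
      l = solve-∀
    val₃ (a , + zero) (ℤ.+<+ ())
    val₄ : ∀ z → Positive (proj₂ z) → ∑ (slice z) w₄ ≡ χ₁₂ (proj₂ z) * (proj₂ z - 1ℤ)
    val₄ (a , + suc k) _ = trans (∑-map _ (upTo k) w₄) (trans (∑-upTo k _) (trans (sumTo-cong k (λ i →
        cong₂ (λ x y → χ₁₂ x * g y) (l-+ (+ suc k) (+ suc i)) (ℤₚ.+-inverseʳ a)))
      (trans (sum-const k (χ₁₂ (+ suc k) * g 0ℤ)) (trans (cong (λ t → + k * (χ₁₂ (+ suc k) * t)) g-0) (l (+ k) (χ₁₂ (+ suc k)))))))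
      where
      l : ∀ k x → k * (x * 1ℤ) ≡ x * ((1ℤ + k) - 1ℤ)
      l = solve-∀
    val₄ (a , + zero) (ℤ.+<+ ())

private
  -- Twice the partial sums of e₂ and of `g₃`. At odd t the first, and at t prime to 6 also the
  -- second, equals χ₄(t) - 1; this is why both choices of g lead to the same divisor sums in
  -- `right`.
  tG₁ tG₃ : List ℤ
  tG₁ = -[1+ 1 ] ∷ 0ℤ ∷ 0ℤ ∷ -[1+ 1 ] ∷ -[1+ 1 ] ∷ 0ℤ ∷ 0ℤ ∷ -[1+ 1 ] ∷ -[1+ 1 ] ∷ 0ℤ ∷ 0ℤ ∷ -[1+ 1 ] ∷ []
  tG₃ = -[1+ 1 ] ∷ 0ℤ ∷ 0ℤ ∷ 0ℤ ∷ 0ℤ ∷ 0ℤ ∷ 0ℤ ∷ -[1+ 1 ] ∷ -[1+ 1 ] ∷ -[1+ 1 ] ∷ -[1+ 1 ] ∷ -[1+ 1 ] ∷ []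

  G-periodic : ∀ t b → 0ℤ ≡ tab t (+ 12 + b) - tab t b
  G-periodic t b = sym (trans (cong (_- tab t b) (12+ t b)) (ℤₚ.+-inverseʳ (tab t b)))

  g₁ᵉ g₃ᵉ : ∀ {n} → Lin n → Exp n
  g₁ᵉ y = ap te y
  g₃ᵉ y = ap te y :*: ap td y

g₃ : ℤ → ℤ
g₃ y = e₂ y * d₃ y

partial₁ : ∀ k → sumTo k (λ i → + 2 * e₂ (+ suc i)) ≡ tab tG₁ (+ suc k)
partial₁ = periodic-sum (λ a b → + 2 * e₂ a) (tab tG₁) (λ _ _ → refl)
  (λ b → trans (decide (sumExp (λ j → cst (+ 2) :*: g₁ᵉ (lit j ⊞ v₀))) (cst 0ℤ) refl (b ∷ [])) (G-periodic tG₁ b)) refl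

partial₃ : ∀ k → sumTo k (λ i → + 2 * g₃ (+ suc i)) ≡ tab tG₃ (+ suc k)
partial₃ = periodic-sum (λ a b → + 2 * g₃ a) (tab tG₃) (λ _ _ → refl)
  (λ b → trans (decide (sumExp (λ j → cst (+ 2) :*: g₃ᵉ (lit j ⊞ v₀))) (cst 0ℤ) refl (b ∷ [])) (G-periodic tG₃ b)) refl

-- e₂ vanishes at odd numbers, and if b and d were both even, so would be ab + cd.
even-factors : ∀ a b c d → od (a * b + c * d) ≡ 1ℤ → e₂ b * e₂ d ≡ 0ℤ
even-factors a b c d h = trans (sym (ℤₚ.*-identityˡ (e₂ b * e₂ d))) (trans (cong (_* (e₂ b * e₂ d)) (trans (sym h)
    (trans (decide (ap tod (v₀ ⊞ v₁)) (ap tod v₀ :+: ap tod v₁ :-: cst (+ 2) :*: (ap tod v₀ :*: ap tod v₁)) refl (a * b ∷ c * d ∷ []))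
      (cong₂ (λ x y → x + y - + 2 * (x * y)) (odd-* a b) (odd-* c d)))))
  (trans (l (od a) (od b) (od c) (od d) (e₂ b) (e₂ d)) (cong₂ (λ x y → od a * x * e₂ d + od c * y * e₂ b - + 2 * (od a * od c * x * y)) (odd-e₂ b) (odd-e₂ d) ⟨trans⟩ l' (od a) (od c) (e₂ d) (e₂ b))))
  where
  _⟨trans⟩_ : ∀ {x y z : ℤ} → x ≡ y → y ≡ z → x ≡ z
  _⟨trans⟩_ = trans
  odd-* : ∀ a b → od (a * b) ≡ od a * od b
  odd-* a b = decide (ap tod (v₀ ⊠ v₁)) (ap tod v₀ :*: ap tod v₁) refl (a ∷ b ∷ [])
  odd-e₂ : ∀ a → od a * e₂ a ≡ 0ℤ
  odd-e₂ a = decide (ap tod v₀ :*: ap te v₀) (cst 0ℤ) refl (a ∷ [])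
  l : ∀ a b c d x y → (a * b + c * d - + 2 * ((a * b) * (c * d))) * (x * y) ≡ a * (b * x) * y + c * (d * y) * x - + 2 * (a * c * (b * x) * (d * y))
  l = solve-∀
  l' : ∀ a c x y → a * 0ℤ * x + c * 0ℤ * y - + 2 * (a * c * 0ℤ * 0ℤ) ≡ 0ℤ
  l' = solve-∀

-- Only odd c and even d matter. Then cd ≡ d modulo 4, and adding it to ab multiplies χ₄(ab) by
-- e₂(d).
χ₄-norm : ∀ a b c d → χ₄ (a * b + c * d) * (χ₄ c * ev d) ≡ (χ₄ a * e₂ d) * (χ₄ b * χ₄ c)
χ₄-norm a b c d = trans (cong (_* (χ₄ c * ev d)) (trans (decide (ap t₄ (v₀ ⊞ v₁)) (ap t₄ v₀ :*: ap te v₁ :+: ap t₄ v₁ :*: ap te v₀) refl (a * b ∷ c * d ∷ []))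
    (cong (λ t → t * e₂ (c * d) + χ₄ (c * d) * e₂ (a * b)) (decide (ap t₄ (v₀ ⊠ v₁)) (ap t₄ v₀ :*: ap t₄ v₁) refl (a ∷ b ∷ [])))))
  (trans (l (χ₄ a) (χ₄ b) (e₂ (c * d)) (χ₄ (c * d)) (e₂ (a * b)) (χ₄ c * ev d))
    (trans (cong₂ (λ x y → χ₄ a * χ₄ b * x + y * e₂ (a * b)) (decide (ap te (v₀ ⊠ v₁) :*: (ap t₄ v₀ :*: ap tev v₁)) (ap t₄ v₀ :*: ap te v₁) refl (c ∷ d ∷ []))
        (decide (ap t₄ (v₀ ⊠ v₁) :*: (ap t₄ v₀ :*: ap tev v₁)) (cst 0ℤ) refl (c ∷ d ∷ [])))
      (l' (χ₄ a) (χ₄ b) (χ₄ c) (e₂ d) (e₂ (a * b)))))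
  where
  l : ∀ a b x y z w → (a * b * x + y * z) * w ≡ a * b * (x * w) + (y * w) * z
  l = solve-∀
  l' : ∀ a b c d z → a * b * (c * d) + 0ℤ * z ≡ (a * d) * (b * c)
  l' = solve-∀

-- p and q stand for the parts of F (a - d) (b + c) and F (a + d) (b - c) modulo 3.
difference : ∀ a b c d p q → od (a * b + c * d) ≡ 1ℤ →
  p * (χ₄ (a - d) * e₂ (b + c)) - q * (χ₄ (a + d) * e₂ (b - c)) ≡
  - χ₄ (a * b + c * d) * ((χ₄ c * ev d) * (p + q)) + - χ₄ (a * b + c * d) * ((χ₄ b * ev a) * (q - p))
difference a b c d p q h = trans (cong₂ (λ x y → p * x - q * y)
    (cong₂ _*_ (decide (ap t₄ (v₀ ⊟ v₁)) (ap t₄ v₀ :*: ap te v₁ :-: ap t₄ v₁ :*: ap te v₀) refl (a ∷ d ∷ []))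
               (decide (ap te (v₀ ⊞ v₁)) (ap te v₀ :*: ap te v₁ :-: ap t₄ v₀ :*: ap t₄ v₁) refl (b ∷ c ∷ [])))
    (cong₂ _*_ (decide (ap t₄ (v₀ ⊞ v₁)) (ap t₄ v₀ :*: ap te v₁ :+: ap t₄ v₁ :*: ap te v₀) refl (a ∷ d ∷ []))
               (decide (ap te (v₀ ⊟ v₁)) (ap te v₀ :*: ap te v₁ :+: ap t₄ v₀ :*: ap t₄ v₁) refl (b ∷ c ∷ []))))
  (trans (l₁ p q (χ₄ a) (χ₄ b) (χ₄ c) (χ₄ d) (e₂ a) (e₂ b) (e₂ c) (e₂ d))
  (trans (cong₂ (λ x y → (p - q) * (χ₄ a * e₂ c) * x - (p + q) * (χ₄ d * e₂ b) * y - (p + q) * ((χ₄ a * e₂ d) * (χ₄ b * χ₄ c)) + (p - q) * ((χ₄ d * e₂ a) * (χ₄ c * χ₄ b)))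
      (even-factors a b c d h) (even-factors b a d c (trans (cong od (comm a b c d)) h)))
  (trans (cong₂ (λ x y → (p - q) * (χ₄ a * e₂ c) * 0ℤ - (p + q) * (χ₄ d * e₂ b) * 0ℤ - (p + q) * x + (p - q) * y)
      (sym (χ₄-norm a b c d)) (trans (sym (χ₄-norm d c b a)) (cong (λ t → χ₄ t * (χ₄ b * ev a)) (comm' a b c d))))
    (l₂ p q (χ₄ a * e₂ c) (χ₄ d * e₂ b) (χ₄ (a * b + c * d)) (χ₄ c * ev d) (χ₄ b * ev a)))))
  where
  comm : ∀ a b c d → b * a + d * c ≡ a * b + c * d
  comm = solve-∀
  comm' : ∀ a b c d → d * c + b * a ≡ a * b + c * d
  comm' = solve-∀
  l₁ : ∀ p q A B C D a b c d → p * ((A * d - D * a) * (b * c - B * C)) - q * ((A * d + D * a) * (b * c + B * C)) ≡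
    (p - q) * (A * c) * (b * d) - (p + q) * (D * b) * (a * c) - (p + q) * ((A * d) * (B * C)) + (p - q) * ((D * a) * (C * B))
  l₁ = solve-∀
  l₂ : ∀ p q x y n v w → (p - q) * x * 0ℤ - (p + q) * y * 0ℤ - (p + q) * (n * v) + (p - q) * (n * w) ≡ - n * (v * (p + q)) + - n * (w * (q - p))
  l₂ = solve-∀

-- `S₁` is the sum to be evaluated; `S₃`, its part with 3 | d, is the second unknown of the linear
-- system formed by `relation₁` and `relation₃`.
S₁ S₃ s₁ D₁₂ : Ser
S₁ = gen Ω (λ ((a , b) , (c , d)) → χ₃ a * (χ₄ c * ev d))
S₃ = gen Ω (λ ((a , b) , (c , d)) → χ₃ a * (χ₄ c * (ev d * d₃ d)))
s₁ = gen (Dv 1) (λ (a , t) → χ₃ a)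
D₁₂ = gen (Dv 1) (λ (a , t) → χ₁₂ t * t)

Ω-norm : ∀ {a b c d n} → 1ℤ * (a * b) + 1ℤ * (c * d) ≡ + n → a * b + c * d ≡ + n
Ω-norm {a} {b} {c} {d} q = trans (l a b c d) q
  where
  l : ∀ a b c d → a * b + c * d ≡ 1ℤ * (a * b) + 1ℤ * (c * d)
  l = solve-∀

gen-swap : ∀ (w : ℤ⁴ → ℤ) n → gen Ω w n ≡ gen Ω (λ ((a , b) , (c , d)) → w ((d , c) , (b , a))) n
gen-swap w = gen-bij Ω Ω {w} {λ ((a , b) , (c , d)) → w ((d , c) , (b , a))} (λ ((a , b) , (c , d)) → (d , c) , (b , a))
  (λ ((pa , pb) , (pc , pd)) → (pd , pc) , (pb , pa)) (λ {((a , b) , (c , d))} _ → l a b c d) (λ { _ _ refl → refl })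
  (λ {((a , b) , (c , d))} ((pa , pb) , (pc , pd)) → ((d , c) , (b , a)) , ((pd , pc) , (pb , pa)) , refl) (λ _ → refl)
  where
  l : ∀ a b c d → 1ℤ * (d * c) + 1ℤ * (b * a) ≡ 1ℤ * (a * b) + 1ℤ * (c * d)
  l = solve-∀

collect : ∀ n (ε : ℤ) (w₁ w₂ V : ℤ⁴ → ℤ) →
  (∀ a b c d → a * b + c * d ≡ + n → w₁ ((a , b) , (c , d)) - w₂ ((a , b) , (c , d)) ≡ ε * V ((a , b) , (c , d)) + ε * V ((d , c) , (b , a))) →
  gen Ω w₁ n - gen Ω w₂ n ≡ ε * (+ 2 * gen Ω V n)
collect n ε w₁ w₂ V h = trans (cong (_+_ (gen Ω w₁ n)) (sym (gen-neg Ω w₂ n))) (trans (sym (gen-+ Ω w₁ (λ i → - w₂ i) n))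
  (trans (gen-cong-at Ω {w = λ i → w₁ i + - w₂ i} {v = λ i → ε * V i + ε * V' i} n (λ {((a , b) , (c , d))} _ q → h a b c d (Ω-norm {a} {b} {c} {d} q)))
  (trans (gen-+ Ω (λ i → ε * V i) (λ i → ε * V' i) n) (trans (cong₂ _+_ (gen-* Ω ε V n) (trans (gen-* Ω ε V' n) (cong (ε *_) (sym (gen-swap V n))))) (l ε (gen Ω V n))))))
  where
  V' : ℤ⁴ → ℤ
  V' ((a , b) , (c , d)) = V ((d , c) , (b , a))
  l : ∀ e x → e * x + e * x ≡ e * (+ 2 * x)
  l = solve-∀

module Relations (n : ℕ) (n-odd : od (+ n) ≡ 1ℤ) where
  norm-odd : ∀ a b c d → a * b + c * d ≡ + n → od (a * b + c * d) ≡ 1ℤ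
  norm-odd a b c d q = trans (cong od q) n-odd

  χ₁₂-split : ∀ x → χ₁₂ x ≡ χ₃ x * χ₄ x
  χ₁₂-split x = decide (ap t₁₂ v₀) (ap t₃ v₀ :*: ap t₄ v₀) refl (x ∷ [])

  -- For a t = n one has χ₁₂(a) χ₄(t) = χ₄(n) χ₃(a), which produces s₁. The left-over χ₁₂(t) -
  -- χ₁₂(a) cancels on exchanging a and t.
  right : (G : ℤ → ℤ) → (∀ a t → a * t ≡ + n → χ₁₂ a * G t ≡ χ₁₂ a * (χ₄ t - 1ℤ)) →
    gen (Dv 1) (λ (a , t) → χ₁₂ a * G t - χ₁₂ t * (t - 1ℤ)) n ≡ χ₄ (+ n) * s₁ n - D₁₂ n
  right G h = trans (gen-cong-at (Dv 1) {v = λ (a , t) → (χ₄ (+ n) * χ₃ a + - (χ₁₂ t * t)) + (χ₁₂ t + - χ₁₂ a)} n (λ {(a , t)} _ q → point a t (trans (sym (ℤₚ.*-identityˡ (a * t))) q)))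
    (trans (gen-+ (Dv 1) (λ (a , t) → χ₄ (+ n) * χ₃ a + - (χ₁₂ t * t)) (λ (a , t) → χ₁₂ t + - χ₁₂ a) n)
    (trans (cong₂ _+_ (trans (gen-+ (Dv 1) (λ (a , t) → χ₄ (+ n) * χ₃ a) (λ (a , t) → - (χ₁₂ t * t)) n) (cong₂ _+_ (gen-* (Dv 1) (χ₄ (+ n)) (λ (a , t) → χ₃ a) n) (gen-neg (Dv 1) (λ (a , t) → χ₁₂ t * t) n)))
        (gen-anti (Dv 1) {λ (a , t) → χ₁₂ t + - χ₁₂ a} (λ (a , t) → t , a) (λ (p , q) → q , p) (λ {(a , t)} _ → cong (1ℤ *_) (ℤₚ.*-comm t a)) (λ _ → refl) (λ {(a , t)} _ → l (χ₁₂ a) (χ₁₂ t)) n))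
      (ℤₚ.+-identityʳ _)))
    where
    l : ∀ x y → y + - x ≡ - (x + - y)
    l = solve-∀
    l₁ : ∀ a s t → a * (s - 1ℤ) - t ≡ a * s - a - t
    l₁ = solve-∀
    l₂ : ∀ x a y t → x - a - y * (t - 1ℤ) ≡ (x + - (y * t)) + (y + - a)
    l₂ = solve-∀
    point : ∀ a t → a * t ≡ + n → χ₁₂ a * G t - χ₁₂ t * (t - 1ℤ) ≡ (χ₄ (+ n) * χ₃ a + - (χ₁₂ t * t)) + (χ₁₂ t + - χ₁₂ a)
    point a t q = trans (cong (_- χ₁₂ t * (t - 1ℤ)) (h a t q)) (trans (l₁ (χ₁₂ a) (χ₄ t) (χ₁₂ t * (t - 1ℤ)))
      (trans (cong (λ z → z - χ₁₂ a - χ₁₂ t * (t - 1ℤ)) (trans (decide (ap t₁₂ v₀ :*: ap t₄ v₁) (ap t₄ (v₀ ⊠ v₁) :*: ap t₃ v₀) refl (a ∷ t ∷ [])) (cong (λ z → χ₄ z * χ₃ a) q)))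
        (l₂ (χ₄ (+ n) * χ₃ a) (χ₁₂ a) (χ₁₂ t) t)))

  use-odd : ∀ {x y} a t → a * t ≡ + n → od (a * t) * x ≡ od (a * t) * y → x ≡ y
  use-odd {x} {y} a t q h = trans (sym (ℤₚ.*-identityˡ x)) (trans (cong (_* x) (sym o)) (trans h (trans (cong (_* y) o) (ℤₚ.*-identityˡ y))))
    where
    o : od (a * t) ≡ 1ℤ
    o = trans (cong od q) n-odd

  relation₁ : χ₄ (+ n) * s₁ n - D₁₂ n ≡ - χ₄ (+ n) * (+ 2 * (+ 3 * S₃ n - S₁ n))
  relation₁ = trans (sym (trans M.evaluated (right (tab tG₁) (λ a t q → use-odd a t q (decide (ap tod (v₀ ⊠ v₁) :*: (ap t₁₂ v₀ :*: ap tG₁ v₁)) (ap tod (v₀ ⊠ v₁) :*: (ap t₁₂ v₀ :*: (ap t₄ v₁ :-: cst 1ℤ))) refl (a ∷ t ∷ []))))))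
    (trans (collect n (- χ₄ (+ n)) M.w₁ M.w₂ V point) (cong (λ t → - χ₄ (+ n) * (+ 2 * t)) sumV))
    where
    module M = Odd-level e₂ (tab tG₁) (λ y → decide (ap te (neg v₀)) (ap te v₀) refl (y ∷ [])) refl (λ y → decide (ap te v₀) (ap tev v₀ :*: ap te v₀) refl (y ∷ [])) partial₁ n n-odd
    V : ℤ⁴ → ℤ
    V ((a , b) , (c , d)) = (χ₄ c * ev d) * (χ₃ a * (+ 3 * d₃ d - 1ℤ))
    l₁ : ∀ p x y → (p * x) * y ≡ p * (x * y)
    l₁ = solve-∀
    point : ∀ a b c d → a * b + c * d ≡ + n → M.w₁ ((a , b) , (c , d)) - M.w₂ ((a , b) , (c , d)) ≡ - χ₄ (+ n) * V ((a , b) , (c , d)) + - χ₄ (+ n) * V ((d , c) , (b , a))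
    point a b c d q = trans (cong₂ _-_ (trans (cong (_* e₂ (b + c)) (χ₁₂-split (a - d))) (l₁ (χ₃ (a - d)) (χ₄ (a - d)) (e₂ (b + c)))) (trans (cong (_* e₂ (b - c)) (χ₁₂-split (a + d))) (l₁ (χ₃ (a + d)) (χ₄ (a + d)) (e₂ (b - c)))))
      (trans (difference a b c d (χ₃ (a - d)) (χ₃ (a + d)) (norm-odd a b c d q))
      (trans (cong (λ z → - χ₄ z * ((χ₄ c * ev d) * (χ₃ (a - d) + χ₃ (a + d))) + - χ₄ z * ((χ₄ b * ev a) * (χ₃ (a + d) - χ₃ (a - d)))) q)
        (cong₂ (λ x y → - χ₄ (+ n) * ((χ₄ c * ev d) * x) + - χ₄ (+ n) * ((χ₄ b * ev a) * y))
          (decide (ap t₃ (v₀ ⊟ v₁) :+: ap t₃ (v₀ ⊞ v₁)) (ap t₃ v₀ :*: (cst (+ 3) :*: ap td v₁ :-: cst 1ℤ)) refl (a ∷ d ∷ []))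
          (decide (ap t₃ (v₀ ⊞ v₁) :-: ap t₃ (v₀ ⊟ v₁)) (ap t₃ v₁ :*: (cst (+ 3) :*: ap td v₀ :-: cst 1ℤ)) refl (a ∷ d ∷ [])))))
    sumV : gen Ω V n ≡ + 3 * S₃ n - S₁ n
    sumV = trans (gen-cong Ω {v = λ ((a , b) , (c , d)) → + 3 * (χ₃ a * (χ₄ c * (ev d * d₃ d))) + - (χ₃ a * (χ₄ c * ev d))} (λ ((a , b) , (c , d)) → l (χ₃ a) (χ₄ c) (ev d) (d₃ d)) n)
      (trans (gen-+ Ω (λ ((a , b) , (c , d)) → + 3 * (χ₃ a * (χ₄ c * (ev d * d₃ d)))) (λ ((a , b) , (c , d)) → - (χ₃ a * (χ₄ c * ev d))) n)
        (cong₂ _+_ (gen-* Ω (+ 3) (λ ((a , b) , (c , d)) → χ₃ a * (χ₄ c * (ev d * d₃ d))) n) (gen-neg Ω (λ ((a , b) , (c , d)) → χ₃ a * (χ₄ c * ev d)) n)))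
      where
      l : ∀ a c v d → (c * v) * (a * (+ 3 * d - 1ℤ)) ≡ + 3 * (a * (c * (v * d))) + - (a * (c * v))
      l = solve-∀

  module _ (n-3 : d₃ (+ n) ≡ 0ℤ) where

    -- Modulo 3, n ≡ b (a - d) if b ≡ -c, and n ≡ b (a + d) if b ≡ c. For b and c prime to 3 exactly
    -- one of these occurs; if just one of them is divisible by 3, neither does, and n excludes that
    -- both are.
    mod3-identity : ∀ a b c d → a * b + c * d ≡ + n → χ₃ (a - d) * d₃ (b + c) + χ₃ (a + d) * d₃ (b - c) ≡ χ₃ (+ n) * (χ₃ b * (1ℤ - d₃ c))
    mod3-identity a b c d q = subst (λ z → χ₃ (a - d) * d₃ (b + c) + χ₃ (a + d) * d₃ (b - c) ≡ χ₃ z * (χ₃ b * (1ℤ - d₃ c))) q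
      (use (decide ((cst 1ℤ :-: ap td (v₀ ⊠ v₁ ⊞ v₂ ⊠ v₃)) :*: (ap t₃ (v₀ ⊟ v₃) :*: ap td (v₁ ⊞ v₂) :+: ap t₃ (v₀ ⊞ v₃) :*: ap td (v₁ ⊟ v₂)))
                   ((cst 1ℤ :-: ap td (v₀ ⊠ v₁ ⊞ v₂ ⊠ v₃)) :*: (ap t₃ (v₀ ⊠ v₁ ⊞ v₂ ⊠ v₃) :*: (ap t₃ v₁ :*: (cst 1ℤ :-: ap td v₂)))) refl (a ∷ b ∷ c ∷ d ∷ [])))
      where
      o : 1ℤ - d₃ (a * b + c * d) ≡ 1ℤ
      o = trans (cong (λ z → 1ℤ - d₃ z) q) (cong (_-_ 1ℤ) n-3)
      use : ∀ {x y} → (1ℤ - d₃ (a * b + c * d)) * x ≡ (1ℤ - d₃ (a * b + c * d)) * y → x ≡ y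
      use {x} {y} h = trans (sym (ℤₚ.*-identityˡ x)) (trans (cong (_* x) (sym o)) (trans h (trans (cong (_* y) o) (ℤₚ.*-identityˡ y))))

    relation₃ : χ₄ (+ n) * s₁ n - D₁₂ n ≡ (- χ₄ (+ n) * χ₃ (+ n)) * (+ 2 * (S₁ n + S₃ n))
    relation₃ = trans (sym (trans M.evaluated (right (tab tG₃) (λ a t q → use₃ a t q (decide (p a t :*: (ap t₁₂ v₀ :*: ap tG₃ v₁)) (p a t :*: (ap t₁₂ v₀ :*: (ap t₄ v₁ :-: cst 1ℤ))) refl (a ∷ t ∷ []))))))
      (trans (collect n (- χ₄ (+ n) * χ₃ (+ n)) M.w₁ M.w₂ V point) (cong (λ t → (- χ₄ (+ n) * χ₃ (+ n)) * (+ 2 * t)) sumV))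
      where
      module M = Odd-level g₃ (tab tG₃) (λ y → decide (g₃ᵉ (neg v₀)) (g₃ᵉ v₀) refl (y ∷ [])) refl (λ y → decide (g₃ᵉ v₀) (ap tev v₀ :*: g₃ᵉ v₀) refl (y ∷ [])) partial₃ n n-odd
      p : ℤ → ℤ → Exp 2
      p a t = ap tod (v₀ ⊠ v₁) :*: (cst 1ℤ :-: ap td (v₀ ⊠ v₁))
      use₃ : ∀ {x y} a t → a * t ≡ + n → (od (a * t) * (1ℤ - d₃ (a * t))) * x ≡ (od (a * t) * (1ℤ - d₃ (a * t))) * y → x ≡ y
      use₃ {x} {y} a t q h = trans (sym (ℤₚ.*-identityˡ x)) (trans (cong (_* x) (sym o)) (trans h (trans (cong (_* y) o) (ℤₚ.*-identityˡ y))))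
        where
        o : od (a * t) * (1ℤ - d₃ (a * t)) ≡ 1ℤ
        o = cong₂ (λ x y → x * (1ℤ - y)) (trans (cong od q) n-odd) (trans (cong d₃ q) n-3)
      V : ℤ⁴ → ℤ
      V ((a , b) , (c , d)) = (χ₄ c * ev d) * (χ₃ b * (1ℤ - d₃ c))
      l₁ : ∀ p x y z → (p * x) * (y * z) ≡ (p * z) * (x * y)
      l₁ = solve-∀
      l₂ : ∀ n k v w x y → - n * (v * (k * x)) + - n * (w * (k * y)) ≡ (- n * k) * (v * x) + (- n * k) * (w * y)
      l₂ = solve-∀
      second : ∀ a b c d → a * b + c * d ≡ + n → χ₃ (a + d) * d₃ (b - c) - χ₃ (a - d) * d₃ (b + c) ≡ χ₃ (+ n) * (χ₃ c * (1ℤ - d₃ b))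
      second a b c d q = trans (trans (cong₂ _-_ (cong₂ _*_ (cong χ₃ (ℤₚ.+-comm a d)) (decide (ap td (v₀ ⊟ v₁)) (ap td (v₁ ⊟ v₀)) refl (b ∷ c ∷ [])))
          (cong₂ _*_ (decide (ap t₃ (v₀ ⊟ v₁)) (negᵉ (ap t₃ (v₁ ⊟ v₀))) refl (a ∷ d ∷ [])) (cong d₃ (ℤₚ.+-comm b c)))) (l (χ₃ (d + a)) (d₃ (c - b)) (χ₃ (d - a)) (d₃ (c + b))))
        (mod3-identity d c b a (trans (l' a b c d) q))
        where
        l : ∀ x y z w → x * y - (- z) * w ≡ z * w + x * y
        l = solve-∀
        l' : ∀ a b c d → d * c + b * a ≡ a * b + c * d
        l' = solve-∀
      point : ∀ a b c d → a * b + c * d ≡ + n → M.w₁ ((a , b) , (c , d)) - M.w₂ ((a , b) , (c , d)) ≡ (- χ₄ (+ n) * χ₃ (+ n)) * V ((a , b) , (c , d)) + (- χ₄ (+ n) * χ₃ (+ n)) * V ((d , c) , (b , a))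
      point a b c d q = trans (cong₂ _-_ (trans (cong (_* g₃ (b + c)) (χ₁₂-split (a - d))) (l₁ (χ₃ (a - d)) (χ₄ (a - d)) (e₂ (b + c)) (d₃ (b + c)))) (trans (cong (_* g₃ (b - c)) (χ₁₂-split (a + d))) (l₁ (χ₃ (a + d)) (χ₄ (a + d)) (e₂ (b - c)) (d₃ (b - c)))))
        (trans (difference a b c d (χ₃ (a - d) * d₃ (b + c)) (χ₃ (a + d) * d₃ (b - c)) (norm-odd a b c d q))
        (trans (cong (λ z → - χ₄ z * ((χ₄ c * ev d) * (χ₃ (a - d) * d₃ (b + c) + χ₃ (a + d) * d₃ (b - c))) + - χ₄ z * ((χ₄ b * ev a) * (χ₃ (a + d) * d₃ (b - c) - χ₃ (a - d) * d₃ (b + c)))) q)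
        (trans (cong₂ (λ x y → - χ₄ (+ n) * ((χ₄ c * ev d) * x) + - χ₄ (+ n) * ((χ₄ b * ev a) * y)) (mod3-identity a b c d q) (second a b c d q))
          (l₂ (χ₄ (+ n)) (χ₃ (+ n)) (χ₄ c * ev d) (χ₄ b * ev a) (χ₃ b * (1ℤ - d₃ c)) (χ₃ c * (1ℤ - d₃ b))))))
      T = Dv 1 ⊗ Dv 3
      w₃ : ℤ⁴ → ℤ
      w₃ ((a , b) , (c , d)) = (χ₃ b * (χ₄ c * ev d)) * d₃ c
      by-c : gen Ω w₃ n ≡ gen T (λ ((a , b) , (c , d)) → w₃ ((a , b) , (+ 3 * c , d))) n
      by-c = gen-param Ω T (3∣? (λ ((a , b) , (c , d)) → c)) w₃ (λ ((a , b) , (c , d)) → (a , b) , (+ 3 * c , d))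
        (λ (p , (pc , pd)) → p , (positive-multiple 2 pc , pd)) (λ {((a , b) , (c , d))} _ → d₃-3* c) (λ {((a , b) , (c , d))} _ → l a b c d)
        (λ {((a , b) , (c , d))} {((a' , b') , (c' , d'))} q → cong₂ _,_ (cong proj₁ q) (cong₂ _,_ (ℤₚ.*-cancelˡ-≡ (+ 3) c c' (cong (proj₁ ∘ proj₂) q)) (cong (proj₂ ∘ proj₂) q)))
        (λ {((a , b) , (c , d))} (p , (pc , pd)) h → let (k , s) = 3∣-witness c h in ((a , b) , (k , d)) , (p , (positive-factor 2 (subst Positive (sym s) pc) , pd)) , cong (λ z → (a , b) , (z , d)) s)
        (λ {((a , b) , (c , d))} _ h → trans (cong ((χ₃ b * (χ₄ c * ev d)) *_) (3∤-zero c h)) (ℤₚ.*-zeroʳ (χ₃ b * (χ₄ c * ev d)))) n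
        where
        l : ∀ a b c d → 1ℤ * (a * b) + 1ℤ * ((+ 3 * c) * d) ≡ 1ℤ * (a * b) + + 3 * (c * d)
        l = solve-∀
      w₄ : ℤ⁴ → ℤ
      w₄ ((a , b) , (c , d)) = χ₃ a * (χ₄ c * (ev d * d₃ d))
      by-d : S₃ n ≡ gen T (λ ((a , b) , (c , d)) → w₄ ((a , b) , (c , + 3 * d))) n
      by-d = gen-param Ω T (3∣? (λ ((a , b) , (c , d)) → d)) w₄ (λ ((a , b) , (c , d)) → (a , b) , (c , + 3 * d))
        (λ (p , (pc , pd)) → p , (pc , positive-multiple 2 pd)) (λ {((a , b) , (c , d))} _ → d₃-3* d) (λ {((a , b) , (c , d))} _ → l a b c d)
        (λ {((a , b) , (c , d))} {((a' , b') , (c' , d'))} q → cong₂ _,_ (cong proj₁ q) (cong₂ _,_ (cong (proj₁ ∘ proj₂) q) (ℤₚ.*-cancelˡ-≡ (+ 3) d d' (cong (proj₂ ∘ proj₂) q))))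
        (λ {((a , b) , (c , d))} (p , (pc , pd)) h → let (k , s) = 3∣-witness d h in ((a , b) , (c , k)) , (p , (pc , positive-factor 2 (subst Positive (sym s) pd))) , cong (λ z → (a , b) , (c , z)) s)
        (λ {((a , b) , (c , d))} _ h → trans (cong (λ z → χ₃ a * (χ₄ c * (ev d * z))) (3∤-zero d h)) (l' (χ₃ a) (χ₄ c) (ev d))) n
        where
        l : ∀ a b c d → 1ℤ * (a * b) + 1ℤ * (c * (+ 3 * d)) ≡ 1ℤ * (a * b) + + 3 * (c * d)
        l = solve-∀
        l' : ∀ x y z → x * (y * (z * 0ℤ)) ≡ 0ℤ
        l' = solve-∀
      flip-ab : (S : Sys (ℤ × ℤ)) (w : ℤ⁴ → ℤ) → gen (Dv 1 ⊗ S) w n ≡ gen (Dv 1 ⊗ S) (λ ((a , b) , z) → w ((b , a) , z)) n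
      flip-ab S w = gen-bij (Dv 1 ⊗ S) (Dv 1 ⊗ S) {w} {λ ((a , b) , z) → w ((b , a) , z)} (λ ((a , b) , z) → (b , a) , z) (λ ((p , q) , r) → (q , p) , r)
        (λ {((a , b) , z)} _ → cong (λ t → 1ℤ * t + e S z) (ℤₚ.*-comm b a)) (λ { _ _ refl → refl }) (λ {((a , b) , z)} ((p , q) , r) → ((b , a) , z) , ((q , p) , r) , refl) (λ _ → refl) n
      -- Moving a factor 3 from c to d costs the sign χ₄(3) = -1, so the subtracted terms with 3 | c
      -- contribute + S₃. Exchanging a and b turns χ₃(b) into χ₃(a).
      sumV : gen Ω V n ≡ S₁ n + S₃ n
      sumV = trans (gen-cong Ω {v = λ ((a , b) , (c , d)) → χ₃ b * (χ₄ c * ev d) + - w₃ ((a , b) , (c , d))} (λ ((a , b) , (c , d)) → l (χ₃ b) (χ₄ c * ev d) (d₃ c)) n)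
        (trans (gen-+ Ω (λ ((a , b) , (c , d)) → χ₃ b * (χ₄ c * ev d)) (λ i → - w₃ i) n) (cong₂ _+_ (flip-ab (Dv 1) (λ ((a , b) , (c , d)) → χ₃ b * (χ₄ c * ev d)))
          (trans (gen-neg Ω w₃ n) (trans (cong -_ by-c) (trans (sym (gen-neg T _ n)) (trans (gen-cong T {v = λ ((a , b) , (c , d)) → w₄ ((b , a) , (c , + 3 * d))} (λ ((a , b) , (c , d)) → pt b c d) n)
            (trans (flip-ab (Dv 3) (λ ((a , b) , (c , d)) → w₄ ((b , a) , (c , + 3 * d)))) (sym by-d))))))))
        where
        l : ∀ b v d → v * (b * (1ℤ - d)) ≡ b * v + - ((b * v) * d)
        l = solve-∀
        l'' : ∀ b c d → - ((b * (- c * d)) * 1ℤ) ≡ b * (c * (d * 1ℤ))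
        l'' = solve-∀
        pt : ∀ b c d → - ((χ₃ b * (χ₄ (+ 3 * c) * ev d)) * d₃ (+ 3 * c)) ≡ χ₃ b * (χ₄ c * (ev (+ 3 * d) * d₃ (+ 3 * d)))
        pt b c d = trans (cong₂ (λ x y → - ((χ₃ b * (x * ev d)) * y)) (decide (ap t₄ (+ 3 · v₀)) (negᵉ (ap t₄ v₀)) refl (c ∷ [])) (d₃-3* c))
          (trans (l'' (χ₃ b) (χ₄ c) (ev d)) (cong₂ (λ x y → χ₃ b * (χ₄ c * (x * y))) (decide (ap tev v₀) (ap tev (+ 3 · v₀)) refl (d ∷ [])) (sym (d₃-3* d))))

-- The passage from n to 3n and the closed formula

Dv-triple : (f : ℤ → ℤ) → (∀ a d → f a * d₃ (a * d) ≡ f a * d₃ d) → ∀ n → gen (Dv 1) (λ (a , d) → f a) (3 ℕ.* n) ≡ gen (Dv 1) (λ (a , d) → f a) n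
Dv-triple f h n = trans (gen-cong-at (Dv 1) {w = λ (a , d) → f a} {v = λ (a , d) → f a * d₃ d} (3 ℕ.* n) (λ {(a , d)} _ q → trans (sym (ℤₚ.*-identityʳ (f a))) (trans (cong (f a *_) (sym (div a d q))) (h a d))))
  (trans (Dv-multiples 2 1 (s≤s z≤n) (3∣? id) (λ (a , d) → f a * d₃ d) d₃-3* 3∣-witness (λ a d np → trans (cong (f a *_) (3∤-zero d np)) (ℤₚ.*-zeroʳ (f a))) (3 ℕ.* n))
  (trans (gen-cong (Dv 3) {v = λ (a , d) → f a} (λ (a , d) → trans (cong (f a *_) (d₃-3* d)) (ℤₚ.*-identityʳ (f a))) (3 ℕ.* n))
    (gen-scale (Dv 1) (Dv 3) 2 id id (λ (a , d) → l a d) (λ (a , d) → f a) n)))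
  where
  l : ∀ a d → + 3 * (a * d) ≡ + 3 * (1ℤ * (a * d))
  l = solve-∀
  div : ∀ a d → 1ℤ * (a * d) ≡ + (3 ℕ.* n) → d₃ (a * d) ≡ 1ℤ
  div a d q = trans (cong d₃ (trans (sym (ℤₚ.*-identityˡ (a * d))) (trans q (ℤₚ.pos-* 3 n)))) (d₃-3* (+ n))

s₁-triple : ∀ n → s₁ (3 ℕ.* n) ≡ s₁ n
s₁-triple = Dv-triple χ₃ (λ a d → decide (ap t₃ v₀ :*: ap td (v₀ ⊠ v₁)) (ap t₃ v₀ :*: ap td v₁) refl (a ∷ d ∷ []))

D₁₂-triple : ∀ n → D₁₂ (3 ℕ.* n) ≡ D₁₂ n
D₁₂-triple n = trans (Dv-swap 1 (λ (a , t) → χ₁₂ t * t) (3 ℕ.* n)) (trans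
  (Dv-triple (λ a → χ₁₂ a * a) (λ a d → trans (l₁ (χ₁₂ a) a (d₃ (a * d))) (trans (cong (_* a) (decide (ap t₁₂ v₀ :*: ap td (v₀ ⊠ v₁)) (ap t₁₂ v₀ :*: ap td v₁) refl (a ∷ d ∷ []))) (sym (l₁ (χ₁₂ a) a (d₃ d))))) n)
  (sym (Dv-swap 1 (λ (a , t) → χ₁₂ t * t) n)))
  where
  l₁ : ∀ x a d → (x * a) * d ≡ (x * d) * a
  l₁ = solve-∀

-- If 3 | d and the norm is divisible by 3, then 3 | ab. As χ₃(a) removes the a divisible by 3, b is
-- a multiple of 3, and both d and b can be divided by 3.
S₃-triple : ∀ n → S₃ (3 ℕ.* n) ≡ S₁ n
S₃-triple n = trans by-d (trans (gen-cong-at T {w = w'} {v = w₄} (3 ℕ.* n) (λ {((a , b) , (c , d))} _ q → point a b c d q)) (trans by-b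
    (gen-scale Ω (Dv 3 ⊗ Dv 3) 2 id id (λ ((a , b) , (c , d)) → l₃ a b c d) (λ ((a , b) , (c , d)) → χ₃ a * (χ₄ c * ev d)) n)))
  where
  T = Dv 1 ⊗ Dv 3
  w w' w₄ : ℤ⁴ → ℤ
  w ((a , b) , (c , d)) = χ₃ a * (χ₄ c * (ev d * d₃ d))
  w' ((a , b) , (c , d)) = w ((a , b) , (c , + 3 * d))
  w₄ ((a , b) , (c , d)) = (χ₃ a * (χ₄ c * ev d)) * d₃ b
  by-d : S₃ (3 ℕ.* n) ≡ gen T w' (3 ℕ.* n)
  by-d = gen-param Ω T (3∣? (λ ((a , b) , (c , d)) → d)) w (λ ((a , b) , (c , d)) → (a , b) , (c , + 3 * d))
    (λ (p , (pc , pd)) → p , (pc , positive-multiple 2 pd)) (λ {((a , b) , (c , d))} _ → d₃-3* d) (λ {((a , b) , (c , d))} _ → l a b c d)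
    (λ {((a , b) , (c , d))} {((a' , b') , (c' , d'))} q → cong₂ _,_ (cong proj₁ q) (cong₂ _,_ (cong (proj₁ ∘ proj₂) q) (ℤₚ.*-cancelˡ-≡ (+ 3) d d' (cong (proj₂ ∘ proj₂) q))))
    (λ {((a , b) , (c , d))} (p , (pc , pd)) h → let (k , s) = 3∣-witness d h in ((a , b) , (c , k)) , (p , (pc , positive-factor 2 (subst Positive (sym s) pd))) , cong (λ z → (a , b) , (c , z)) s)
    (λ {((a , b) , (c , d))} _ h → trans (cong (λ z → χ₃ a * (χ₄ c * (ev d * z))) (3∤-zero d h)) (l' (χ₃ a) (χ₄ c) (ev d))) (3 ℕ.* n)
    where
    l : ∀ a b c d → 1ℤ * (a * b) + 1ℤ * (c * (+ 3 * d)) ≡ 1ℤ * (a * b) + + 3 * (c * d)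
    l = solve-∀
    l' : ∀ x y z → x * (y * (z * 0ℤ)) ≡ 0ℤ
    l' = solve-∀
  point : ∀ a b c d → 1ℤ * (a * b) + + 3 * (c * d) ≡ + (3 ℕ.* n) → w' ((a , b) , (c , d)) ≡ w₄ ((a , b) , (c , d))
  point a b c d q = trans (cong₂ (λ x y → χ₃ a * (χ₄ c * (x * y))) (decide (ap tev (+ 3 · v₀)) (ap tev v₀) refl (d ∷ [])) (d₃-3* d))
    (trans (l₁ (χ₃ a) (χ₄ c * ev d) (χ₄ c) (ev d)) (trans (cong (λ z → χ₃ a * z * (χ₄ c * ev d)) (sym div))
      (trans (cong (_* (χ₄ c * ev d)) (decide (ap t₃ v₀ :*: ap td (v₀ ⊠ v₁)) (ap t₃ v₀ :*: ap td v₁) refl (a ∷ b ∷ []))) (l₂ (χ₃ a) (d₃ b) (χ₄ c * ev d)))))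
    where
    l₁ : ∀ a y c d → a * (c * (d * 1ℤ)) ≡ a * 1ℤ * (c * d)
    l₁ = solve-∀
    l₂ : ∀ a b y → a * b * y ≡ (a * y) * b
    l₂ = solve-∀
    l₄ : ∀ a b c d → a * b ≡ (1ℤ * (a * b) + + 3 * (c * d)) - + 3 * (c * d)
    l₄ = solve-∀
    l₅ : ∀ n c d → + 3 * n - + 3 * (c * d) ≡ + 3 * (n - c * d)
    l₅ = solve-∀
    div : d₃ (a * b) ≡ 1ℤ
    div = trans (cong d₃ (trans (l₄ a b c d) (trans (cong (_- + 3 * (c * d)) (trans q (ℤₚ.pos-* 3 n))) (l₅ (+ n) c d)))) (d₃-3* (+ n - c * d))
  by-b : gen T w₄ (3 ℕ.* n) ≡ gen (Dv 3 ⊗ Dv 3) (λ ((a , b) , (c , d)) → χ₃ a * (χ₄ c * ev d)) (3 ℕ.* n)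
  by-b = trans (gen-param T (Dv 3 ⊗ Dv 3) (3∣? (λ ((a , b) , (c , d)) → b)) w₄ (λ ((a , b) , (c , d)) → (a , + 3 * b) , (c , d))
    (λ ((pa , pb) , p) → (pa , positive-multiple 2 pb) , p) (λ {((a , b) , (c , d))} _ → d₃-3* b) (λ {((a , b) , (c , d))} _ → l a b c d)
    (λ {((a , b) , (c , d))} {((a' , b') , (c' , d'))} q → cong₂ _,_ (cong₂ _,_ (cong (proj₁ ∘ proj₁) q) (ℤₚ.*-cancelˡ-≡ (+ 3) b b' (cong (proj₂ ∘ proj₁) q))) (cong proj₂ q))
    (λ {((a , b) , (c , d))} ((pa , pb) , p) h → let (k , s) = 3∣-witness b h in ((a , k) , (c , d)) , ((pa , positive-factor 2 (subst Positive (sym s) pb)) , p) , cong (λ z → (a , z) , (c , d)) s)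
    (λ {((a , b) , (c , d))} _ h → trans (cong ((χ₃ a * (χ₄ c * ev d)) *_) (3∤-zero b h)) (ℤₚ.*-zeroʳ (χ₃ a * (χ₄ c * ev d)))) (3 ℕ.* n))
    (gen-cong (Dv 3 ⊗ Dv 3) (λ ((a , b) , (c , d)) → trans (cong ((χ₃ a * (χ₄ c * ev d)) *_) (d₃-3* b)) (ℤₚ.*-identityʳ (χ₃ a * (χ₄ c * ev d)))) (3 ℕ.* n))
    where
    l : ∀ a b c d → 1ℤ * (a * (+ 3 * b)) + + 3 * (c * d) ≡ + 3 * (a * b) + + 3 * (c * d)
    l = solve-∀
  l₃ : ∀ a b c d → + 3 * (a * b) + + 3 * (c * d) ≡ + 3 * (1ℤ * (a * b) + 1ℤ * (c * d))
  l₃ = solve-∀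

χ₃-s₁ : ∀ n → d₃ (+ n) ≡ 0ℤ → χ₃ (+ n) * s₁ n ≡ s₁ n
χ₃-s₁ n h = trans (sym (gen-* (Dv 1) (χ₃ (+ n)) (λ (a , t) → χ₃ a) n)) (trans
  (gen-cong-at (Dv 1) {w = λ (a , t) → χ₃ (+ n) * χ₃ a} {v = λ (a , t) → χ₃ t} n (λ {(a , t)} _ q → point a t (trans (sym (ℤₚ.*-identityˡ (a * t))) q)))
  (Dv-swap 1 (λ (a , t) → χ₃ t) n))
  where
  point : ∀ a t → a * t ≡ + n → χ₃ (+ n) * χ₃ a ≡ χ₃ t
  point a t q = trans (cong (λ z → χ₃ z * χ₃ a) (sym q)) (trans (sym (ℤₚ.*-identityˡ (χ₃ (a * t) * χ₃ a))) (trans (cong (_* (χ₃ (a * t) * χ₃ a)) (sym o))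
    (trans (decide ((cst 1ℤ :-: ap td (v₀ ⊠ v₁)) :*: (ap t₃ (v₀ ⊠ v₁) :*: ap t₃ v₀)) ((cst 1ℤ :-: ap td (v₀ ⊠ v₁)) :*: ap t₃ v₁) refl (a ∷ t ∷ []))
      (trans (cong (_* χ₃ t) o) (ℤₚ.*-identityˡ (χ₃ t))))))
    where
    o : 1ℤ - d₃ (a * t) ≡ 1ℤ
    o = trans (cong (λ z → 1ℤ - d₃ z) q) (cong (_-_ 1ℤ) h)

unit-cancel : ∀ (u x y : ℤ) → u * u ≡ 1ℤ → u * x ≡ y → x ≡ u * y
unit-cancel u x y h q = trans (sym (ℤₚ.*-identityˡ x)) (trans (cong (_* x) (sym h)) (trans (ℤₚ.*-assoc u u x) (cong (u *_) q)))

χ₄²-odd : ∀ x → od x ≡ 1ℤ → χ₄ x * χ₄ x ≡ 1ℤ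
χ₄²-odd x h = trans (decide (ap t₄ v₀ :*: ap t₄ v₀) (ap tod v₀) refl (x ∷ [])) h

-- Three times `r₃` minus `r₁` eliminates S₃ and leaves 2 s₁ = (3 χ₁₂(n) - χ₄(n)) D₁₂ - 8 S₁.
base : ∀ n → od (+ n) ≡ 1ℤ → d₃ (+ n) ≡ 0ℤ → + 2 * (+ 4 * S₁ n + s₁ n) ≡ (+ 3 * χ₁₂ (+ n) - χ₄ (+ n)) * D₁₂ n
base n no₂ no₃ = trans (final (S₁ n) (S₃ n) (s₁ n) r₁ r₃) (trans (l₀ (χ₄ (+ n)) (χ₃ (+ n)) (D₁₂ n)) (cong (λ z → (+ 3 * z - χ₄ (+ n)) * D₁₂ n) (decide (ap t₃ v₀ :*: ap t₄ v₀) (ap t₁₂ v₀) refl (+ n ∷ []))))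
  where
  module Lv = Relations n no₂
  l₀ : ∀ e x d → + 3 * (e * x * d) - e * d ≡ (+ 3 * (x * e) - e) * d
  l₀ = solve-∀
  ε² = χ₄²-odd (+ n) no₂
  x² : χ₃ (+ n) * χ₃ (+ n) ≡ 1ℤ
  x² = trans (decide (ap t₃ v₀ :*: ap t₃ v₀) (cst 1ℤ :-: ap td v₀) refl (+ n ∷ [])) (cong (_-_ 1ℤ) no₃)
  l₁ : ∀ e s d y → (e * s - d) ≡ - e * y → e * s ≡ d - e * y
  l₁ e s d y q = trans (l e s d) (trans (cong (_+ d) q) (l' e y d))
    where
    l : ∀ e s d → e * s ≡ (e * s - d) + d
    l = solve-∀
    l' : ∀ e y d → - e * y + d ≡ d - e * y
    l' = solve-∀
  l₂ : ∀ e d y → e * (d - e * y) ≡ e * d - (e * e) * y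
  l₂ = solve-∀
  r₁ : s₁ n ≡ χ₄ (+ n) * D₁₂ n - + 2 * (+ 3 * S₃ n - S₁ n)
  r₁ = trans (unit-cancel (χ₄ (+ n)) (s₁ n) (D₁₂ n - χ₄ (+ n) * (+ 2 * (+ 3 * S₃ n - S₁ n))) ε² (l₁ (χ₄ (+ n)) (s₁ n) (D₁₂ n) (+ 2 * (+ 3 * S₃ n - S₁ n)) Lv.relation₁))
    (trans (l₂ (χ₄ (+ n)) (D₁₂ n) (+ 2 * (+ 3 * S₃ n - S₁ n))) (trans (cong (λ z → χ₄ (+ n) * D₁₂ n - z * (+ 2 * (+ 3 * S₃ n - S₁ n))) ε²) (cong (_-_ (χ₄ (+ n) * D₁₂ n)) (ℤₚ.*-identityˡ (+ 2 * (+ 3 * S₃ n - S₁ n))))))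
  r₃ : s₁ n ≡ χ₄ (+ n) * χ₃ (+ n) * D₁₂ n - + 2 * (S₁ n + S₃ n)
  r₃ = trans (sym (χ₃-s₁ n no₃)) (trans (cong (χ₃ (+ n) *_) (trans (unit-cancel (χ₄ (+ n)) (s₁ n) (D₁₂ n - χ₄ (+ n) * (χ₃ (+ n) * (+ 2 * (S₁ n + S₃ n)))) ε² (l₁ (χ₄ (+ n)) (s₁ n) (D₁₂ n) (χ₃ (+ n) * (+ 2 * (S₁ n + S₃ n))) (trans (Lv.relation₃ no₃) (l₃ (χ₄ (+ n)) (χ₃ (+ n)) (+ 2 * (S₁ n + S₃ n))))))
        (l₂ (χ₄ (+ n)) (D₁₂ n) (χ₃ (+ n) * (+ 2 * (S₁ n + S₃ n))))))
    (trans (l₄ (χ₄ (+ n)) (χ₃ (+ n)) (D₁₂ n) (χ₄ (+ n) * χ₄ (+ n)) (+ 2 * (S₁ n + S₃ n))) (trans (cong₂ (λ a b → χ₄ (+ n) * χ₃ (+ n) * D₁₂ n - a * b * (+ 2 * (S₁ n + S₃ n))) ε² x²) (cong (_-_ (χ₄ (+ n) * χ₃ (+ n) * D₁₂ n)) (ℤₚ.*-identityˡ (+ 2 * (S₁ n + S₃ n)))))))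
    where
    l₃ : ∀ e x y → (- e * x) * y ≡ - e * (x * y)
    l₃ = solve-∀
    l₄ : ∀ e x d f y → x * (e * d - f * (x * y)) ≡ e * x * d - f * (x * x) * y
    l₄ = solve-∀
  final : ∀ S S' s → s ≡ χ₄ (+ n) * D₁₂ n - + 2 * (+ 3 * S' - S) → s ≡ χ₄ (+ n) * χ₃ (+ n) * D₁₂ n - + 2 * (S + S') →
    + 2 * (+ 4 * S + s) ≡ + 3 * (χ₄ (+ n) * χ₃ (+ n) * D₁₂ n) - χ₄ (+ n) * D₁₂ n
  final S S' s q q' = trans (l₅ S s) (trans (cong₂ (λ x y → + 8 * S + (+ 3 * x - y)) q' q) (l₆ S S' (χ₄ (+ n) * χ₃ (+ n) * D₁₂ n) (χ₄ (+ n) * D₁₂ n)))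
    where
    l₅ : ∀ S s → + 2 * (+ 4 * S + s) ≡ + 8 * S + (+ 3 * s - s)
    l₅ = solve-∀
    l₆ : ∀ S S' u v → + 8 * S + (+ 3 * (u - + 2 * (S + S')) - (v - + 2 * (+ 3 * S' - S))) ≡ + 3 * u - v
    l₆ = solve-∀

-- This is `relation₁` at 3n: there S₃ has become S₁(n), the values of s₁ and D₁₂ are those at n,
-- and χ₄ has changed sign.
step : ∀ n → od (+ n) ≡ 1ℤ → + 2 * (+ 4 * S₁ (3 ℕ.* n) + s₁ (3 ℕ.* n)) ≡ + 3 * (+ 2 * (+ 4 * S₁ n + s₁ n)) + + 4 * (χ₄ (+ n) * D₁₂ n)
step n o = trans (l₅ (S₁ (3 ℕ.* n)) (s₁ (3 ℕ.* n))) (trans (cong₂ (λ x y → + 4 * x + + 2 * y) r (s₁-triple n)) (l₆ (S₁ n) (s₁ n) (χ₄ (+ n) * D₁₂ n)))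
  where
  χ₄-triple : χ₄ (+ (3 ℕ.* n)) ≡ - χ₄ (+ n)
  χ₄-triple = trans (cong χ₄ (ℤₚ.pos-* 3 n)) (decide (ap t₄ (+ 3 · v₀)) (negᵉ (ap t₄ v₀)) refl (+ n ∷ []))
  o' : od (+ (3 ℕ.* n)) ≡ 1ℤ
  o' = trans (trans (cong od (ℤₚ.pos-* 3 n)) (decide (ap tod (+ 3 · v₀)) (ap tod v₀) refl (+ n ∷ []))) o
  module Lv = Relations (3 ℕ.* n) o'
  rel : - χ₄ (+ n) * s₁ n - D₁₂ n ≡ - (- χ₄ (+ n)) * (+ 2 * (+ 3 * S₁ n - S₁ (3 ℕ.* n)))
  rel = trans (cong₂ _-_ (cong₂ _*_ (sym χ₄-triple) (sym (s₁-triple n))) (sym (D₁₂-triple n))) (trans Lv.relation₁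
    (cong₂ (λ x y → - x * (+ 2 * (+ 3 * y - S₁ (3 ℕ.* n)))) χ₄-triple (S₃-triple n)))
  r : + 2 * S₁ (3 ℕ.* n) ≡ + 6 * S₁ n + s₁ n + χ₄ (+ n) * D₁₂ n
  r = solve-r (χ₄ (+ n)) (s₁ n) (D₁₂ n) (S₁ n) (S₁ (3 ℕ.* n)) (χ₄²-odd (+ n) o) rel
    where
    solve-r : ∀ e s d S S' → e * e ≡ 1ℤ → - e * s - d ≡ - (- e) * (+ 2 * (+ 3 * S - S')) → + 2 * S' ≡ + 6 * S + s + e * d
    solve-r e s d S S' h q = trans (sym (trans (l e s d S (+ 2 * (+ 3 * S - S')) h) (l' e s d S S')))
       (trans (cong (λ z → + 6 * S + s + e * d + (e * z - e * (- (- e) * (+ 2 * (+ 3 * S - S'))))) q) (l'' (+ 6 * S + s + e * d) (e * (- (- e) * (+ 2 * (+ 3 * S - S'))))))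
      where
      l : ∀ e s d S Y → e * e ≡ 1ℤ → + 6 * S + s + e * d + (e * (- e * s - d) - e * (- (- e) * Y)) ≡ + 6 * S + s + e * d + ((- (1ℤ * s) - e * d) - 1ℤ * Y)
      l e s d S Y h = trans (m e s d S Y) (cong (λ z → + 6 * S + s + e * d + ((- (z * s) - e * d) - z * Y)) h)
        where
        m : ∀ e s d S Y → + 6 * S + s + e * d + (e * (- e * s - d) - e * (- (- e) * Y)) ≡ + 6 * S + s + e * d + ((- ((e * e) * s) - e * d) - (e * e) * Y)
        m = solve-∀
      l' : ∀ e s d S S' → + 6 * S + s + e * d + ((- (1ℤ * s) - e * d) - 1ℤ * (+ 2 * (+ 3 * S - S'))) ≡ + 2 * S'
      l' = solve-∀
      l'' : ∀ x y → x + (y - y) ≡ x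
      l'' = solve-∀
  l₅ : ∀ S s → + 2 * (+ 4 * S + s) ≡ + 4 * (+ 2 * S) + + 2 * s
  l₅ = solve-∀
  l₆ : ∀ S s u → + 4 * (+ 6 * S + s + u) + + 2 * s ≡ + 3 * (+ 2 * (+ 4 * S + s)) + + 4 * u
  l₆ = solve-∀

odd-3^ : ∀ β n → od (+ n) ≡ 1ℤ → od (+ (3 ℕ.^ β ℕ.* n)) ≡ 1ℤ
odd-3^ zero n o = trans (cong (λ z → od (+ z)) (ℕₚ.*-identityˡ n)) o
odd-3^ (suc β) n o = trans (cong od (trans (cong +_ (ℕₚ.*-assoc 3 (3 ℕ.^ β) n)) (ℤₚ.pos-* 3 (3 ℕ.^ β ℕ.* n))))
  (trans (decide (ap tod (+ 3 · v₀)) (ap tod v₀) refl (+ (3 ℕ.^ β ℕ.* n) ∷ [])) (odd-3^ β n o))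

-- The recursion T(3N) = 3 T(N) + 4 χ₄(N) D₁₂ has the particular solution -χ₄(N) D₁₂, because χ₄(3N)
-- = -χ₄(N); the power of 3 is the homogeneous part.
divisor-formula : ∀ β n₁ → od (+ n₁) ≡ 1ℤ → d₃ (+ n₁) ≡ 0ℤ → let N = 3 ℕ.^ β ℕ.* n₁ in
  D₁₂ N ≡ D₁₂ n₁ × + 2 * (+ 4 * S₁ N + s₁ N) ≡ (+ (3 ℕ.^ suc β) * χ₁₂ (+ n₁) - χ₄ (+ N)) * D₁₂ n₁
divisor-formula zero n₁ o₂ o₃ = subst (λ N → D₁₂ N ≡ D₁₂ n₁ × + 2 * (+ 4 * S₁ N + s₁ N) ≡ (+ 3 * χ₁₂ (+ n₁) - χ₄ (+ N)) * D₁₂ n₁) (sym (ℕₚ.*-identityˡ n₁)) (refl , base n₁ o₂ o₃)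
divisor-formula (suc β) n₁ o₂ o₃ = subst (λ M → D₁₂ M ≡ D₁₂ n₁ × + 2 * (+ 4 * S₁ M + s₁ M) ≡ (+ (3 ℕ.* 3 ℕ.^ suc β) * χ₁₂ (+ n₁) - χ₄ (+ M)) * D₁₂ n₁) (sym (ℕₚ.*-assoc 3 (3 ℕ.^ β) n₁))
  (let (d , f) = divisor-formula β n₁ o₂ o₃; N = 3 ℕ.^ β ℕ.* n₁ in trans (D₁₂-triple N) d ,
    trans (step N (odd-3^ β n₁ o₂)) (trans (cong₂ (λ x y → + 3 * x + + 4 * (χ₄ (+ N) * y)) f d) (trans (l (+ (3 ℕ.^ suc β)) (χ₁₂ (+ n₁)) (χ₄ (+ N)) (D₁₂ n₁))
      (cong₂ (λ x y → (x * χ₁₂ (+ n₁) - y) * D₁₂ n₁) (sym (ℤₚ.pos-* 3 (3 ℕ.^ suc β))) (sym (trans (cong χ₄ (ℤₚ.pos-* 3 N)) (decide (ap t₄ (+ 3 · v₀)) (negᵉ (ap t₄ v₀)) refl (+ N ∷ []))))))))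
  where
  l : ∀ p x e d → + 3 * ((p * x - e) * d) + + 4 * (e * d) ≡ (+ 3 * p * x - - e) * d
  l = solve-∀

D-scale : ∀ n → X₃ 1 (8 ℕ.* n) ≡ s₁ n
D-scale = gen-scale (Dv 1) (Dv 8) 7 id id (λ (a , d) → l a d) (λ (a , d) → χ₃ a)
  where
  l : ∀ a d → + 8 * (a * d) ≡ + 8 * (1ℤ * (a * d))
  l = solve-∀

opaque
  unfolding _⊹_

  X₄D-scale : ∀ n → (X₄ 2 ⊛ X₃ 1) (8 ℕ.* n) ≡ S₁ n
  X₄D-scale n = trans (⊛-comm (X₄ 2) (X₃ 1) (8 ℕ.* n)) (trans (⊛-cong {f = X₃ 1} (λ _ → refl) X₄-even (8 ℕ.* n))
    (trans (sym (gen-⊗ (Dv 8) (Dv 8) (λ (a , d) → χ₃ a) (λ (a , d) → χ₄ a * ev d) (8 ℕ.* n)))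
      (gen-scale Ω (Dv 8 ⊗ Dv 8) 7 id id (λ ((a , b) , (c , d)) → l a b c d) (λ ((a , b) , (c , d)) → χ₃ a * (χ₄ c * ev d)) n)))
    where
    l : ∀ a b c d → + 8 * (a * b) + + 8 * (c * d) ≡ + 8 * (1ℤ * (a * b) + 1ℤ * (c * d))
    l = solve-∀
    X₄-even : X₄ 2 ≈ gen (Dv 8) (λ (a , d) → χ₄ a * ev d)
    X₄-even k = sym (trans (Dv-multiples 1 8 (s≤s z≤n) 2∣? (λ (a , d) → χ₄ a * ev d) ev-2* ev-witness (λ a d np → trans (cong (χ₄ a *_) (ev-zero d np)) (ℤₚ.*-zeroʳ (χ₄ a))) k)
      (gen-cong (Dv 16) {v = λ (a , d) → χ₄ a} (λ (a , d) → trans (cong (χ₄ a *_) (ev-2* d)) (ℤₚ.*-identityʳ (χ₄ a))) k))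

-- Residues modulo a prime

module Residues (p : ℕ) {{p≢0 : ℕ.NonZero p}} (p-prime : Prime p) where
  infix 4 _≃_
  -- Congruence modulo p with its quotient as data, so that congruences follow from ring identities
  -- by exhibiting the cofactor; `multiple` is the usual way.
  record _≃_ (x y : ℤ) : Set where
    constructor by
    field
      quot : ℤ
      equation : x ≡ y + quot * + p

  ≃-reflexive : ∀ {x y} → x ≡ y → x ≃ y
  ≃-reflexive {x} {y} q = by 0ℤ (trans q (sym (ℤₚ.+-identityʳ y)))

  ≃-trans : ∀ {x y z} → x ≃ y → y ≃ z → x ≃ z
  ≃-trans {x} {y} {z} (by k q) (by l r) = by (l + k) (trans q (trans (cong (_+ k * + p) r) (lem z l k (+ p))))
    where
    lem : ∀ z l k p → (z + l * p) + k * p ≡ z + (l + k) * p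
    lem = solve-∀

  ≃-sym : ∀ {x y} → x ≃ y → y ≃ x
  ≃-sym {x} {y} (by k q) = by (- k) (trans (lem y k (+ p)) (cong (_+ (- k) * + p) (sym q)))
    where
    lem : ∀ y k p → y ≡ (y + k * p) + (- k) * p
    lem = solve-∀

  ≃-* : ∀ {x y z w} → x ≃ y → z ≃ w → x * z ≃ y * w
  ≃-* {x} {y} {z} {w} (by k q) (by l r) = by (k * w + l * y + k * l * + p) (trans (cong₂ _*_ q r) (lem y w k l (+ p)))
    where
    lem : ∀ y w k l p → (y + k * p) * (w + l * p) ≡ y * w + (k * w + l * y + k * l * p) * p
    lem = solve-∀

  ≃-^ : ∀ {x y} n → x ≃ y → x ^ n ≃ y ^ n
  ≃-^ zero h = ≃-reflexive refl
  ≃-^ (suc n) h = ≃-* h (≃-^ n h)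

  multiple : ∀ {x y} z c → z ≃ 0ℤ → x ≡ y + c * z → x ≃ y
  multiple {x} {y} z c (by k q) r = by (c * k) (trans r (trans (cong (λ t → y + c * t) q) (lem y c k (+ p))))
    where
    lem : ∀ y c k p → y + c * (0ℤ + k * p) ≡ y + (c * k) * p
    lem = solve-∀

  difference-zero : ∀ {x y} → x ≃ y → x - y ≃ 0ℤ
  difference-zero {x} {y} (by k q) = by k (trans (cong (_- y) q) (lem y k (+ p)))
    where
    lem : ∀ y k p → (y + k * p) - y ≡ 0ℤ + k * p
    lem = solve-∀

  ∣⇒≃0 : ∀ x → p ∣ ∣ x ∣ → x ≃ 0ℤ
  ∣⇒≃0 (+ n) (divides q r) = by (+ q) (trans (cong +_ r) (trans (ℤₚ.pos-* q p) (sym (ℤₚ.+-identityˡ _))))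
  ∣⇒≃0 -[1+ n ] (divides q r) = by (- (+ q)) (trans (cong (λ t → - (+ t)) r) (trans (cong -_ (ℤₚ.pos-* q p)) (lem (+ q) (+ p))))
    where
    lem : ∀ q p → - (q * p) ≡ 0ℤ + (- q) * p
    lem = solve-∀

  ≃0⇒∣ : ∀ x → x ≃ 0ℤ → p ∣ ∣ x ∣
  ≃0⇒∣ x (by k q) = divides ∣ k ∣ (trans (cong ∣_∣ (trans q (ℤₚ.+-identityˡ (k * + p)))) (ℤₚ.abs-* k (+ p)))

  euclid : ∀ x y → x * y ≃ 0ℤ → x ≃ 0ℤ ⊎ y ≃ 0ℤ
  euclid x y h = [ (λ d → inj₁ (∣⇒≃0 x d)) , (λ d → inj₂ (∣⇒≃0 y d)) ]′
    (euclidsLemma ∣ x ∣ ∣ y ∣ p-prime (subst (p ∣_) (ℤₚ.abs-* x y) (≃0⇒∣ (x * y) h)))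

  residue-≃ : ∀ x → x ≃ + (x %ℕ p)
  residue-≃ x = by (x /ℕ p) (a≡a%ℕn+[a/ℕn]*n x p)

  ≃⇒≡ : ∀ {r s} → r ℕ.< p → s ℕ.< p → + r ≃ + s → r ≡ s
  ≃⇒≡ {r} {s} r< s< (by k q) = %-unique p 0ℤ k r< s< (trans (ℤₚ.+-identityʳ (+ r)) q)

  1≄0 : ¬ 1ℤ ≃ 0ℤ
  1≄0 h = ¬prime[1] (subst Prime (ℕ∣.∣1⇒≡1 (≃0⇒∣ 1ℤ h)) p-prime)

  inverse : ∀ x → ¬ x ≃ 0ℤ → ∃[ z ] (z * x ≃ 1ℤ)
  inverse x x≄0 = go (x %ℕ p) refl
    where
    go : ∀ r → r ≡ x %ℕ p → ∃[ z ] (z * x ≃ 1ℤ)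
    go zero q = ⊥-elim (x≄0 (≃-trans (residue-≃ x) (≃-reflexive (cong +_ (sym q)))))
    go (suc r) q = bez (coprime-Bézout (prime⇒coprime p-prime (subst (ℕ._< p) (sym q) (n%ℕd<d x p))))
      where
      x≃ : x ≃ + suc r
      x≃ = ≃-trans (residue-≃ x) (≃-reflexive (cong +_ (sym q)))
      negated : ∀ a b → 1ℤ + a ≡ b → - a ≡ 1ℤ + - 1ℤ * b
      negated a _ refl = lem a
        where
        lem : ∀ a → - a ≡ 1ℤ + - 1ℤ * (1ℤ + a)
        lem = solve-∀
      p≃0 : ∀ a → + (a ℕ.* p) ≃ 0ℤ
      p≃0 a = by (+ a) (trans (ℤₚ.pos-* a p) (sym (ℤₚ.+-identityˡ _)))
      bez : Bézout.Identity 1 p (suc r) → ∃[ z ] (z * x ≃ 1ℤ)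
      bez (Bézout.-+ a b eq) = + b , ≃-trans (≃-* (≃-reflexive {+ b} refl) x≃) (by (+ a) (trans (sym (ℤₚ.pos-* b (suc r))) (trans (cong +_ (sym eq)) (cong (_+_ 1ℤ) (ℤₚ.pos-* a p)))))
      bez (Bézout.+- a b eq) = - (+ b) , ≃-trans (≃-* (≃-reflexive { - (+ b)} refl) x≃)
        (multiple (+ (a ℕ.* p)) (- 1ℤ) (p≃0 a) (trans (sym (ℤₚ.neg-distribˡ-* (+ b) (+ suc r))) (negated (+ b * + suc r) (+ (a ℕ.* p)) (trans (cong (_+_ 1ℤ) (sym (ℤₚ.pos-* b (suc r)))) (cong +_ eq)))))

  positives : List ℕ
  positives = applyUpTo suc (ℕ.pred p)

  positive-bound : ∀ {i} → i ∈ positives → 1 ℕ.≤ i × i ℕ.< p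
  positive-bound i∈ with ∈-applyUpTo⁻ suc i∈
  ... | j , j< , refl = s≤s z≤n , subst (suc (suc j) ℕ.≤_) (ℕₚ.suc-pred p) (s≤s j<)

  ∈-positives : ∀ {i} → 1 ℕ.≤ i → i ℕ.< p → i ∈ positives
  ∈-positives {suc j} _ i< = ∈-applyUpTo⁺ suc (ℕₚ.≤-pred (subst (suc (suc j) ℕ.≤_) (sym (ℕₚ.suc-pred p)) i<))

  positive≄0 : ∀ {i} → i ∈ positives → ¬ + i ≃ 0ℤ
  positive≄0 i∈ h with positive-bound i∈
  ... | s≤s z≤n , i< = ℕₚ.<⇒≱ i< (ℕ∣.∣⇒≤ (≃0⇒∣ _ h))

  -- Multiplication by x permutes the residues from 1 to p - 1, its inverse being multiplication by
  -- z. Hence x^(p-1) times their product is congruent to that product, which is prime to p.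
  fermat : ∀ x → ¬ x ≃ 0ℤ → x ^ ℕ.pred p ≃ 1ℤ
  fermat x x≄0 = [ (λ h → multiple (x ^ ℕ.pred p - 1ℤ) 1ℤ h (l₁ (x ^ ℕ.pred p))) , (λ h → ⊥-elim (prod≄0 positives positive≄0 h)) ]′
    (euclid (x ^ ℕ.pred p - 1ℤ) (+ product positives) (≃-trans (≃-reflexive (l₂ (x ^ ℕ.pred p) (+ product positives)))
      (difference-zero (≃-trans (≃-reflexive (cong (λ n → x ^ n * + product positives) (sym (length-applyUpTo suc (ℕ.pred p))))) (≃-trans (≃-sym (prod-map positives)) (≃-reflexive (cong +_ permuted)))))))
    where
    l₁ : ∀ a → a ≡ 1ℤ + 1ℤ * (a - 1ℤ)
    l₁ = solve-∀
    l₂ : ∀ a b → (a - 1ℤ) * b ≡ a * b - b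
    l₂ = solve-∀
    z = proj₁ (inverse x x≄0)
    zx≃1 = proj₂ (inverse x x≄0)
    z≄0 : ¬ z ≃ 0ℤ
    z≄0 h = 1≄0 (≃-trans (≃-sym zx≃1) (≃-* {z} {0ℤ} {x} {x} h (≃-reflexive refl)))
    times : ℤ → ℕ → ℕ
    times a i = (a * + i) %ℕ p
    times-≃ : ∀ a i → + times a i ≃ a * + i
    times-≃ a i = ≃-sym (residue-≃ (a * + i))
    times-∈ : ∀ a → ¬ a ≃ 0ℤ → ∀ {i} → i ∈ positives → times a i ∈ positives
    times-∈ a a≄0 {i} i∈ = go (times a i) refl
      where
      go : ∀ r → r ≡ times a i → r ∈ positives
      go zero q = ⊥-elim ([ a≄0 , positive≄0 i∈ ]′ (euclid a (+ i) (≃-trans (≃-sym (times-≃ a i)) (≃-reflexive (cong +_ (sym q))))))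
      go (suc r) q = ∈-positives (s≤s z≤n) (subst (ℕ._< p) (sym q) (n%ℕd<d (a * + i) p))
    cancel : ∀ a b → b * a ≃ 1ℤ → ∀ {i} → i ∈ positives → times b (times a i) ≡ i
    cancel a b h {i} i∈ = ≃⇒≡ (n%ℕd<d (b * + times a i) p) (proj₂ (positive-bound i∈))
      (≃-trans (times-≃ b (times a i)) (≃-trans (≃-* (≃-reflexive {b} refl) (times-≃ a i)) (≃-trans (≃-reflexive (sym (ℤₚ.*-assoc b a (+ i))))
        (≃-trans (≃-* h (≃-reflexive {+ i} refl)) (≃-reflexive (ℤₚ.*-identityˡ (+ i)))))))
    permuted : product (map (times x) positives) ≡ product positives
    permuted = product-↭ (∼bag⇒↭ (unique∧set⇒bag
      (unique-map (times x) positives (λ i∈ j∈ q → trans (sym (cancel x z zx≃1 i∈)) (trans (cong (times z) q) (cancel x z zx≃1 j∈))) up) up (mk⇔ to from)))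
      where
      up : Unique positives
      up = Uniq.applyUpTo⁺₁ suc (ℕ.pred p) (λ i<j _ q → ℕₚ.<-irrefl (ℕₚ.suc-injective q) i<j)
      to : ∀ {i} → i ∈ map (times x) positives → i ∈ positives
      to i∈ with ∈-map⁻ (times x) i∈
      ... | j , j∈ , refl = times-∈ x x≄0 j∈
      from : ∀ {i} → i ∈ positives → i ∈ map (times x) positives
      from {i} i∈ = subst (_∈ map (times x) positives) (cancel z x (≃-trans (≃-reflexive (ℤₚ.*-comm x z)) zx≃1) i∈) (∈-map⁺ (times x) (times-∈ z z≄0 i∈))
    prod-map : ∀ xs → + product (map (times x) xs) ≃ x ^ length xs * + product xs
    prod-map [] = ≃-reflexive refl
    prod-map (i ∷ xs) = ≃-trans (≃-reflexive (ℤₚ.pos-* (times x i) (product (map (times x) xs)))) (≃-trans (≃-* (times-≃ x i) (prod-map xs))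
      (≃-reflexive (trans (l x (+ i) (x ^ length xs) (+ product xs)) (cong (x * x ^ length xs *_) (sym (ℤₚ.pos-* i (product xs)))))))
      where
      l : ∀ x i y z → (x * i) * (y * z) ≡ (x * y) * (i * z)
      l = solve-∀
    prod≄0 : ∀ xs → (∀ {i} → i ∈ xs → ¬ + i ≃ 0ℤ) → ¬ + product xs ≃ 0ℤ
    prod≄0 [] h q = 1≄0 q
    prod≄0 (i ∷ xs) h q = [ h (here refl) , prod≄0 xs (h ∘ there) ]′ (euclid (+ i) (+ product xs) (≃-trans (≃-reflexive (sym (ℤₚ.pos-* i (product xs)))) q))

  Root : ℤ → Set
  Root m = ∃[ y ] (y * y ≃ m)

  root-* : ∀ {m n} → Root m → Root n → Root (m * n)
  root-* {m} {n} (x , h) (y , h') = x * y , ≃-trans (≃-reflexive (l x y)) (≃-* h h')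
    where
    l : ∀ x y → (x * y) * (x * y) ≡ (x * x) * (y * y)
    l = solve-∀

  ≄0-small : ∀ m → 1 ℕ.≤ m → m ℕ.< p → ¬ + m ≃ 0ℤ
  ≄0-small (suc m) _ m<p h = ℕₚ.<⇒≱ m<p (ℕ∣.∣⇒≤ (≃0⇒∣ (+ suc m) h))

  -1-^ : ∀ k → (- 1ℤ) ^ suc (2 ℕ.* k) ≡ - 1ℤ
  -1-^ k = trans (cong (- 1ℤ *_) (trans (sym (ℤₚ.^-*-assoc (- 1ℤ) 2 k)) (ℤₚ.^-zeroˡ k))) refl

  -- Here p ≡ 3 modulo 4, so (p - 1)/2 is odd, and y² ≡ -1 would give y^(p-1) ≡ -1 against `fermat`.
  -1-nonresidue : ∀ k → p ≡ suc (2 ℕ.* suc (2 ℕ.* k)) → 2 ℕ.< p → ¬ Root (- 1ℤ)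
  -1-nonresidue k p≡ 2<p (y , h) = ≄0-small 2 (s≤s z≤n) 2<p (multiple (1ℤ - - 1ℤ) 1ℤ (difference-zero 1≃-1) refl)
    where
    y≄0 : ¬ y ≃ 0ℤ
    y≄0 q = 1≄0 (≃-* { - 1ℤ} {0ℤ} { - 1ℤ} { - 1ℤ} (≃-trans (≃-sym h) (≃-* {y} {0ℤ} q q)) (≃-reflexive { - 1ℤ} refl))
    1≃-1 : 1ℤ ≃ - 1ℤ
    1≃-1 = ≃-trans (≃-sym (fermat y y≄0)) (≃-trans (≃-reflexive (trans (cong (λ n → y ^ ℕ.pred n) p≡) (sym (ℤₚ.^-*-assoc y 2 (suc (2 ℕ.* k))))))
      (≃-trans (≃-^ (suc (2 ℕ.* k)) (≃-trans (≃-reflexive (cong (y *_) (ℤₚ.*-identityʳ y))) h)) (≃-reflexive (-1-^ k))))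

  ^-neg-odd : ∀ x k → (- x) ^ suc (2 ℕ.* k) ≡ - (x ^ suc (2 ℕ.* k))
  ^-neg-odd x k = trans (cong (- x *_) (trans (sym (ℤₚ.^-*-assoc (- x) 2 k)) (trans (cong (_^ k) (l x)) (ℤₚ.^-*-assoc x 2 k)))) (sym (ℤₚ.neg-distribˡ-* x (x ^ (2 ℕ.* k))))
    where
    l : ∀ x → - x * (- x * 1ℤ) ≡ x * (x * 1ℤ)
    l = solve-∀

  -- If y² ≡ -3 then u = 1 + y satisfies u³ ≡ -8, while p - 1 ≡ 1 modulo 3 makes the cube of u determine u.
  -3-nonresidue : ∀ j → p ≡ suc (suc (3 ℕ.* suc (2 ℕ.* j))) → ¬ Root (- + 3)
  -3-nonresidue j p≡ (y , h) = ≄0-small 3 (s≤s z≤n) (ℕₚ.≤-trans (ℕₚ.m≤m+n 4 1) 5≤p) 3≃0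
    where
    5≤p : 5 ℕ.≤ p
    5≤p = subst (5 ℕ.≤_) (sym p≡) (s≤s (s≤s (ℕₚ.m≤m*n 3 (suc (2 ℕ.* j)))))
    u = 1ℤ + y
    Q = (+ 8) ^ suc (2 ℕ.* j)
    expand : ∀ x → x ^ ℕ.pred p ≡ x * (x * (x * (x * 1ℤ))) ^ suc (2 ℕ.* j)
    expand x = trans (cong (λ n → x ^ ℕ.pred n) p≡) (cong (x *_) (sym (ℤₚ.^-*-assoc x 3 (suc (2 ℕ.* j)))))
    u³ : u * (u * (u * 1ℤ)) ≃ - + 8
    u³ = multiple (y * y - - + 3) (y + + 3) (difference-zero h) (l y)
      where
      l : ∀ y → (1ℤ + y) * ((1ℤ + y) * ((1ℤ + y) * 1ℤ)) ≡ - + 8 + (y + + 3) * (y * y - - + 3)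
      l = solve-∀
    2≄0 : ¬ + 2 ≃ 0ℤ
    2≄0 = ≄0-small 2 (s≤s z≤n) (ℕₚ.≤-trans (ℕₚ.m≤m+n 3 2) 5≤p)
    u≄0 : ¬ u ≃ 0ℤ
    u≄0 q = [ 2≄0 , (λ r → [ 2≄0 , 2≄0 ]′ (euclid (+ 2) (+ 2) r)) ]′ (euclid (+ 2) (+ 4) (≃-trans (multiple {+ 8} { - (u * (u * (u * 1ℤ)))} (u * (u * (u * 1ℤ)) - - + 8) 1ℤ (difference-zero u³) (l (u * (u * (u * 1ℤ)))))
      (multiple {y = 0ℤ} u (- (u * (u * 1ℤ))) q (l' u))))
      where
      l : ∀ c → + 8 ≡ - c + 1ℤ * (c - - + 8)
      l = solve-∀
      l' : ∀ u → - (u * (u * (u * 1ℤ))) ≡ 0ℤ + (- (u * (u * 1ℤ))) * u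
      l' = solve-∀
    uQ : u * - Q ≃ 1ℤ
    uQ = ≃-trans (≃-* {u} {u} (≃-reflexive refl) (≃-trans (≃-reflexive (sym (^-neg-odd (+ 8) j))) (≃-sym (≃-^ (suc (2 ℕ.* j)) u³)))) (≃-trans (≃-reflexive (sym (expand u))) (fermat u u≄0))
    2Q : + 2 * Q ≃ 1ℤ
    2Q = ≃-trans (≃-reflexive (sym (expand (+ 2)))) (fermat (+ 2) 2≄0)
    -2≃u : (u + + 2) * Q ≃ 0ℤ
    -2≃u = ≃-trans (multiple {(u + + 2) * Q} {1ℤ - u * - Q} (+ 2 * Q - 1ℤ) 1ℤ (difference-zero 2Q) (l u Q)) (difference-zero (≃-sym uQ))
      where
      l : ∀ u q → (u + + 2) * q ≡ (1ℤ - u * - q) + 1ℤ * (+ 2 * q - 1ℤ)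
      l = solve-∀
    Q≄0 : ¬ Q ≃ 0ℤ
    Q≄0 q = 1≄0 (≃-trans (≃-sym 2Q) (multiple Q (+ 2) q (sym (ℤₚ.+-identityˡ (+ 2 * Q)))))
    3≃0 : + 3 ≃ 0ℤ
    3≃0 = [ (λ q → [ ⊥-elim ∘ 2≄0 , (λ r → [ ⊥-elim ∘ 2≄0 , id ]′ (euclid (+ 2) (+ 3) r)) ]′ (euclid (+ 2) (+ 6)
        (≃-trans (multiple {+ 12} {y * y - - + 3} (u + + 2) (- (y - + 3)) q (l y)) (difference-zero h)))) , ⊥-elim ∘ Q≄0 ]′ (euclid (u + + 2) Q -2≃u)
      where
      l : ∀ y → + 12 ≡ (y * y - - + 3) + (- (y - + 3)) * ((1ℤ + y) + + 2)
      l = solve-∀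

  -- Let r = 3^((p+1)/4) and s = 3^((p-1)/2), so that r² = 3s and s² ≡ 1. If s ≡ 1, r is the root;
  -- if s ≡ -1, r would be a root of -3, which p ≡ 2 modulo 3 forbids.
  3-residue : ∀ k → p ≡ 11 ℕ.+ 12 ℕ.* k → Root (+ 3)
  3-residue k p≡ = [ (λ h → r , ≃-trans r² (multiple {y = + 3} (s - 1ℤ) (+ 3) h (l₁ s))) , (λ h → ⊥-elim (-3-nonresidue (suc (2 ℕ.* k)) (trans p≡ (m₁ k)) (r , ≃-trans r² (multiple {y = - + 3} (s - - 1ℤ) (+ 3) h (l₂ s))))) ]′
    (euclid (s - 1ℤ) (s - - 1ℤ) (≃-trans (≃-reflexive (l₃ s)) (difference-zero s²)))
    where
    r s : ℤ
    r = (+ 3) ^ (3 ℕ.+ 3 ℕ.* k)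
    s = (+ 3) ^ (5 ℕ.+ 6 ℕ.* k)
    m₁ : ∀ k → 11 ℕ.+ 12 ℕ.* k ≡ suc (suc (3 ℕ.* suc (2 ℕ.* suc (2 ℕ.* k))))
    m₁ = solveℕ
    m₂ : ∀ k → (3 ℕ.+ 3 ℕ.* k) ℕ.+ (3 ℕ.+ 3 ℕ.* k) ≡ suc (5 ℕ.+ 6 ℕ.* k)
    m₂ = solveℕ
    m₃ : ∀ k → (5 ℕ.+ 6 ℕ.* k) ℕ.+ (5 ℕ.+ 6 ℕ.* k) ≡ 10 ℕ.+ 12 ℕ.* k
    m₃ = solveℕ
    l₁ : ∀ s → + 3 * s ≡ + 3 + + 3 * (s - 1ℤ)
    l₁ = solve-∀
    l₂ : ∀ s → + 3 * s ≡ - + 3 + + 3 * (s - - 1ℤ)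
    l₂ = solve-∀
    l₃ : ∀ s → (s - 1ℤ) * (s - - 1ℤ) ≡ s * s - 1ℤ
    l₃ = solve-∀
    3≄0 : ¬ + 3 ≃ 0ℤ
    3≄0 = ≄0-small 3 (s≤s z≤n) (subst (4 ℕ.≤_) (sym p≡) (ℕₚ.m≤m+n 4 (7 ℕ.+ 12 ℕ.* k)))
    r² : r * r ≃ + 3 * s
    r² = ≃-reflexive (trans (sym (ℤₚ.^-distribˡ-+-* (+ 3) (3 ℕ.+ 3 ℕ.* k) (3 ℕ.+ 3 ℕ.* k))) (cong ((+ 3) ^_) (m₂ k)))
    s² : s * s ≃ 1ℤ
    s² = ≃-trans (≃-reflexive (trans (sym (ℤₚ.^-distribˡ-+-* (+ 3) (5 ℕ.+ 6 ℕ.* k) (5 ℕ.+ 6 ℕ.* k))) (trans (cong ((+ 3) ^_) (m₃ k)) (sym (cong (λ n → (+ 3) ^ ℕ.pred n) p≡)))))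
      (fermat (+ 3) 3≄0)

∑-ones : (xs : List I) {w : I → ℤ} → (∀ {x} → x ∈ xs → w x ≡ 1ℤ) → ∑ xs w ≡ + length xs
∑-ones [] h = refl
∑-ones (x ∷ xs) h = cong₂ _+_ (h (here refl)) (∑-ones xs (h ∘ there))

opaque
  unfolding gen

  gen-witness : (S : Sys I) {w : I → ℤ} → ∀ n → gen S w n ≢ 0ℤ → ∃[ i ] (e S i ≡ + n)
  gen-witness S {w} n ne = go (fib S n) (λ i∈ → proj₂ (sound S i∈)) ne
    where
    go : ∀ xs → (∀ {i} → i ∈ xs → e S i ≡ + n) → ∑ xs w ≢ 0ℤ → ∃[ i ] (e S i ≡ + n)
    go [] _ ne = ⊥-elim (ne refl)
    go (i ∷ _) s _ = i , s (here refl)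

  gen-positive : (S : Sys I) {w : I → ℤ} → ∀ n {i} → R S i → e S i ≡ + n → (∀ {i} → R S i → e S i ≡ + n → w i ≡ 1ℤ) → ∃[ k ] (gen S w n ≡ + suc k)
  gen-positive S {w} n r q h = go (fib S n) (complete S r q) (λ i∈ → let (r , q) = sound S i∈ in h r q)
    where
    go : ∀ xs {i} → i ∈ xs → (∀ {i} → i ∈ xs → w i ≡ 1ℤ) → ∃[ k ] (∑ xs w ≡ + suc k)
    go (x ∷ xs) _ h = length xs , ∑-ones (x ∷ xs) h

K-suc : ∀ c n → 1 ℕ.≤ n → K c n ≡ 0ℤ
K-suc c (suc n) _ = refl

module Representation (p : ℕ) {{p≢0 : ℕ.NonZero p}} (p-prime : Prime p) where
  open Residues p p-prime

  1≤p : 1 ℕ.≤ p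
  1≤p = ℕ.>-nonZero⁻¹ p

  prime-factors : ∀ {a d} → Positive a → Positive d → + 8 * (a * d) ≡ + (8 ℕ.* p) → a ≡ 1ℤ ⊎ a ≡ + p
  prime-factors {+ suc a} {+ suc d} _ _ q = [ (λ r → inj₁ (cong +_ r)) , (λ r → inj₂ (cong +_ r)) ]′ (prime⇒irreducible p-prime (divides (suc d)
    (ℤₚ.+-injective (trans (ℤₚ.*-cancelˡ-≡ (+ 8) (+ p) (+ suc a * + suc d) (trans (sym (ℤₚ.pos-* 8 p)) (sym q))) (trans (ℤₚ.*-comm (+ suc a) (+ suc d)) (sym (ℤₚ.pos-* (suc d) (suc a))))))))
  prime-factors {+ zero} (ℤ.+<+ ())
  prime-factors {+ suc a} {+ zero} _ (ℤ.+<+ ())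

  -- The only divisors are 1 and p, and χ is 1 at both. Positivity of the sum then forces a
  -- representation of p by the form concerned.
  character-sum : (χ : ℤ → ℤ) → χ 1ℤ ≡ 1ℤ → χ (+ p) ≡ 1ℤ → ∃[ k ] (gen (Dv 8) (λ (a , d) → χ a) (8 ℕ.* p) ≡ + suc k)
  character-sum χ χ1 χp = gen-positive (Dv 8) (8 ℕ.* p) {1ℤ , + p} (ℤ.+<+ (s≤s z≤n) , ℤ.+<+ 1≤p) (trans (cong (+ 8 *_) (ℤₚ.*-identityˡ (+ p))) (sym (ℤₚ.pos-* 8 p)))
    (λ {(a , d)} (pa , pd) q → [ (λ r → trans (cong χ r) χ1) , (λ r → trans (cong χ r) χp) ]′ (prime-factors {a} {d} pa pd q))

  -- If p divided y, it would divide x² and so x, and then p² would divide p.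
  indivisible : ∀ c x y → x * x + c * (x * y) + y * y ≡ + p → ¬ y ≃ 0ℤ
  indivisible c x y q (by k y≡) = go ([ id , id ]′ (euclid x x (by (1ℤ - c * x * k - k * y) (trans (l₁ (x * x) (c * (x * y)) (y * y)) (trans (cong₂ (λ u v → u - c * (x * v) - v * y) q y≡) (l₂ c x y k (+ p)))))))
    where
    l₁ : ∀ a b c → a ≡ (a + b + c) - b - c
    l₁ = solve-∀
    l₂ : ∀ c x y k p → p - c * (x * (0ℤ + k * p)) - (0ℤ + k * p) * y ≡ 0ℤ + (1ℤ - c * x * k - k * y) * p
    l₂ = solve-∀
    l₃ : ∀ c l k p → (0ℤ + l * p) * (0ℤ + l * p) + c * ((0ℤ + l * p) * (0ℤ + k * p)) + (0ℤ + k * p) * (0ℤ + k * p) ≡ (l * l * p + c * l * k * p + k * k * p) * p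
    l₃ = solve-∀
    l₄ : ∀ c l k p → l * l * p + c * l * k * p + k * k * p ≡ 0ℤ + (l * l + c * l * k + k * k) * p
    l₄ = solve-∀
    go : ¬ x ≃ 0ℤ
    go (by l x≡) = 1≄0 (by (l * l + c * l * k + k * k) (trans (ℤₚ.*-cancelʳ-≡ 1ℤ (l * l * + p + c * l * k * + p + k * k * + p) (+ p)
      (trans (ℤₚ.*-identityˡ (+ p)) (trans (sym q) (trans (cong₂ (λ u v → u * u + c * (u * v) + v * v) x≡ y≡) (l₃ c l k (+ p)))))) (l₄ c l k (+ p))))

  -- The root is t/y, with the inverse of y modulo p.
  root-of-ratio : ∀ t y m k → t * t + m * (y * y) ≡ k * + p → ¬ y ≃ 0ℤ → Root (- m)
  root-of-ratio t y m k q y≄0 = let (z , h) = inverse y y≄0 in t * z ,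
    ≃-trans (multiple {y = - m * ((z * y) * (z * y))} (k * + p) (z * z) (by k (sym (ℤₚ.+-identityˡ _))) (trans (l t z m y) (cong (λ u → - m * ((z * y) * (z * y)) + z * z * u) q)))
      (≃-trans (≃-* {x = - m} (≃-reflexive refl) (≃-* h h)) (≃-reflexive (ℤₚ.*-identityʳ (- m))))
    where
    l : ∀ t z m y → (t * z) * (t * z) ≡ - m * ((z * y) * (z * y)) + z * z * (t * t + m * (y * y))
    l = solve-∀

  1≤8p : 1 ℕ.≤ 8 ℕ.* p
  1≤8p = ℕₚ.≤-trans 1≤p (ℕₚ.m≤n*m p 8)

  opaque
    unfolding _⊹_

    two-squares : ∀ k → X₄ 1 (8 ℕ.* p) ≡ + suc k → ∃[ i ] (e (Sq 8 ⊗ Sq 8) i ≡ + (8 ℕ.* p))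
    two-squares k q = gen-witness (Sq 8 ⊗ Sq 8) {w = λ (i , j) → 1ℤ * 1ℤ} (8 ℕ.* p) (λ z → nonzero (trans (sym value) (trans (sym (gen-⊗ (Sq 8) (Sq 8) (λ _ → 1ℤ) (λ _ → 1ℤ) (8 ℕ.* p))) z)))
      where
      nonzero : + 4 * + suc k ≡ 0ℤ → ⊥
      nonzero ()
      value : (φ 8 ⊛ φ 8) (8 ℕ.* p) ≡ + 4 * + suc k
      value = trans (un (φ²-divisors 1 (s≤s z≤n)) (8 ℕ.* p)) (trans (cong₂ _+_ (K-suc 1ℤ (8 ℕ.* p) 1≤8p) (trans (K-⊛ (+ 4) (X₄ 1) (8 ℕ.* p)) (cong (+ 4 *_) q))) (ℤₚ.+-identityˡ (+ 4 * + suc k)))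

    hexagonal : ∀ k → X₃ 1 (8 ℕ.* p) ≡ + suc k → ∃[ i ] (e (Hex 1) i ≡ + (8 ℕ.* p))
    hexagonal k q = gen-witness (Hex 1) {w = λ _ → 1ℤ} (8 ℕ.* p) (λ z → nonzero (trans (sym value) z))
      where
      nonzero : + 6 * + suc k ≡ 0ℤ → ⊥
      nonzero ()
      value : H 1 (8 ℕ.* p) ≡ + 6 * + suc k
      value = trans (un (Hex-divisors 1 (s≤s z≤n)) (8 ℕ.* p)) (trans (cong₂ _+_ (K-suc 1ℤ (8 ℕ.* p) 1≤8p) (trans (K-⊛ (+ 6) (X₃ 1) (8 ℕ.* p)) (cong (+ 6 *_) q))) (ℤₚ.+-identityˡ (+ 6 * + suc k)))

  -1-residue : χ₄ (+ p) ≡ 1ℤ → Root (- 1ℤ)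
  -1-residue h = let (k , q) = character-sum χ₄ refl h; ((x , y) , r) = two-squares k q in root x y r
    where
    l₀ : ∀ x y → + 8 * (x * x + y * y) ≡ + 8 * (x * x) + + 8 * (y * y)
    l₀ = solve-∀
    l : ∀ x y → x * x + 0ℤ * (x * y) + y * y ≡ x * x + y * y
    l = solve-∀
    root : ∀ x y → + 8 * (x * x) + + 8 * (y * y) ≡ + (8 ℕ.* p) → Root (- 1ℤ)
    root x y r = root-of-ratio x y 1ℤ 1ℤ (trans (cong (_+_ (x * x)) (ℤₚ.*-identityˡ (y * y))) (trans p≡ (sym (ℤₚ.*-identityˡ (+ p))))) (indivisible 0ℤ x y (trans (l x y) p≡))
      where
      p≡ : x * x + y * y ≡ + p
      p≡ = ℤₚ.*-cancelˡ-≡ (+ 8) (x * x + y * y) (+ p) (trans (l₀ x y) (trans r (ℤₚ.pos-* 8 p)))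

  -3-residue : χ₃ (+ p) ≡ 1ℤ → Root (- + 3)
  -3-residue h = let (k , q) = character-sum χ₃ refl h; ((x , y) , r) = hexagonal k q in root x y r
    where
    l : ∀ x y → (+ 2 * x + y) * (+ 2 * x + y) + + 3 * (y * y) ≡ + 4 * (x * x + x * y + y * y)
    l = solve-∀
    root : ∀ x y → 1ℤ * (+ 8 * (x * x + x * y + y * y)) ≡ + (8 ℕ.* p) → Root (- + 3)
    root x y r = root-of-ratio (+ 2 * x + y) y (+ 3) (+ 4) (trans (l x y) (cong (+ 4 *_) p≡)) (indivisible 1ℤ x y (trans (cong (λ t → x * x + t + y * y) (ℤₚ.*-identityˡ (x * y))) p≡))
      where
      p≡ : x * x + x * y + y * y ≡ + p
      p≡ = ℤₚ.*-cancelˡ-≡ (+ 8) (x * x + x * y + y * y) (+ p) (trans (sym (ℤₚ.*-identityˡ (+ 8 * (x * x + x * y + y * y)))) (trans r (ℤₚ.pos-* 8 p)))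

-- The symbol (3/p) and the divisor sum of the statement

module Legendre (q : ℕ) (p-prime : Prime (suc (suc (suc q)))) where
  private
    p : ℕ
    p = suc (suc (suc q))
  open Residues p p-prime
  open Representation p p-prime

  mod-≃ : ∀ m → + m ≃ + (m ℕ.% p)
  mod-≃ m = by (+ (m ℕ./ p)) (trans (cong +_ (ℕd.m≡m%n+[m/n]*n m p)) (cong (_+_ (+ (m ℕ.% p))) (ℤₚ.pos-* (m ℕ./ p) p)))

  Square : Set
  Square = ∃[ x ] ((toℕ {p} x ℕ.* toℕ x) ℕ.% p ≡ 3 ℕ.% p)

  square⇒root : Square → Root (+ 3)
  square⇒root (x , h) = + toℕ x , ≃-trans (≃-reflexive (sym (ℤₚ.pos-* (toℕ x) (toℕ x)))) (≃-trans (mod-≃ (toℕ x ℕ.* toℕ x)) (≃-trans (≃-reflexive (cong +_ h)) (≃-sym (mod-≃ 3))))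

  root⇒square : Root (+ 3) → Square
  root⇒square (y , h) = fromℕ< r< , subst (λ r → (r ℕ.* r) ℕ.% p ≡ 3 ℕ.% p) (sym (toℕ-fromℕ< r<))
    (≃⇒≡ (ℕd.m%n<n (r ℕ.* r) p) (ℕd.m%n<n 3 p) (≃-trans (≃-sym (mod-≃ (r ℕ.* r))) (≃-trans (≃-reflexive (ℤₚ.pos-* r r)) (≃-trans (≃-* (≃-sym (residue-≃ y)) (≃-sym (residue-≃ y))) (≃-trans h (mod-≃ 3))))))
    where
    r = y %ℕ p
    r< : r ℕ.< p
    r< = n%ℕd<d y p

  legendre-residue : ¬ 3 ℕ.% p ≡ 0 → Root (+ 3) → legendre 3 p ≡ 1ℤ
  legendre-residue h r = cong₂ (λ a b → if a then 0ℤ else if b then 1ℤ else -1ℤ) (dec-false (3 ℕ.% p ℕ.≟ 0) h)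
    (dec-true (any? (λ (x : Fin p) → (toℕ x ℕ.* toℕ x) ℕ.% p ℕ.≟ 3 ℕ.% p)) (root⇒square r))

  legendre-nonresidue : ¬ 3 ℕ.% p ≡ 0 → ¬ Root (+ 3) → legendre 3 p ≡ -1ℤ
  legendre-nonresidue h r = cong₂ (λ a b → if a then 0ℤ else if b then 1ℤ else -1ℤ) (dec-false (3 ℕ.% p ℕ.≟ 0) h)
    (dec-false (any? (λ (x : Fin p) → (toℕ x ℕ.* toℕ x) ℕ.% p ℕ.≟ 3 ℕ.% p)) (r ∘ square⇒root))

  private k = p ℕ./ 12

  divisible-by-3 : 3 ∣ p → legendre 3 p ≡ 0ℤ
  divisible-by-3 h = [ (λ ()) , (λ r → subst (λ n → legendre 3 n ≡ 0ℤ) r refl) ]′ (prime⇒irreducible p-prime h)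

  root-/3 : ¬ + 3 ≃ 0ℤ → Root (- + 9) → Root (- 1ℤ)
  root-/3 h (y , s) = let (z , t) = inverse (+ 3) h in z * y , ≃-trans (≃-reflexive (l z y)) (≃-trans (≃-* {z * z} (≃-reflexive refl) s)
    (≃-trans (≃-reflexive (l' z)) (≃-* { - 1ℤ} (≃-reflexive refl) (≃-* t t))))
    where
    l : ∀ z y → (z * y) * (z * y) ≡ (z * z) * (y * y)
    l = solve-∀
    l' : ∀ z → (z * z) * - + 9 ≡ - 1ℤ * ((z * + 3) * (z * + 3))
    l' = solve-∀

  -- At 1 both -1 and -3 are squares. At 5 only -1 is and at 7 only -3 is, so a root of 3 would
  -- supply one for the other. At 11 `3-residue` applies, and in the classes 3 and 9 the prime is
  -- divisible by 3.
  by-residue : ∀ r → r ℕ.< 12 → p ℕ.% 12 ≡ r → at tod r ≡ 1ℤ → legendre 3 p ≡ at t₁₂ r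
  by-residue r r< h o = go r r< h (trans (ℕd.m≡m%n+[m/n]*n p 12) (cong (ℕ._+ k ℕ.* 12) h)) o
    where
    large : ∀ c → p ≡ suc (suc (suc (suc c))) → ¬ 3 ℕ.% p ≡ 0 × 3 ℕ.< p
    large c q = (λ z → λ≢ (trans (sym (ℕd.m<n⇒m%n≡m {n = p} {m = 3} 3<p)) z)) , 3<p
      where
      λ≢ : 3 ≡ 0 → ⊥
      λ≢ ()
      3<p : 3 ℕ.< p
      3<p = subst (4 ℕ.≤_) (sym q) (ℕₚ.m≤m+n 4 c)
    3≄0 : ∀ c → p ≡ suc (suc (suc (suc c))) → ¬ + 3 ≃ 0ℤ
    3≄0 c q = ≄0-small 3 (s≤s z≤n) (proj₂ (large c q))
    1+k*12 : ∀ k → suc (k ℕ.* 12) ≡ p → ∃[ c ] (p ≡ suc (suc (suc (suc c))))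
    1+k*12 (suc k) q = _ , sym q
    m₇ : ∀ k → 7 ℕ.+ k ℕ.* 12 ≡ suc (2 ℕ.* suc (2 ℕ.* suc (3 ℕ.* k)))
    m₇ = solveℕ
    m₅ : ∀ k → 5 ℕ.+ k ℕ.* 12 ≡ suc (suc (3 ℕ.* suc (2 ℕ.* (2 ℕ.* k))))
    m₅ = solveℕ
    m₃ : ∀ k → 3 ℕ.+ k ℕ.* 12 ≡ (1 ℕ.+ 4 ℕ.* k) ℕ.* 3
    m₃ = solveℕ
    m₉ : ∀ k → 9 ℕ.+ k ℕ.* 12 ≡ (3 ℕ.+ 4 ℕ.* k) ℕ.* 3
    m₉ = solveℕ
    go : ∀ r → r ℕ.< 12 → p ℕ.% 12 ≡ r → p ≡ r ℕ.+ k ℕ.* 12 → at tod r ≡ 1ℤ → legendre 3 p ≡ at t₁₂ r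
    go 1 _ h q _ = let (c , s) = 1+k*12 k (sym q) in legendre-residue (proj₁ (large c s)) (root-* {m = - 1ℤ} {n = - + 3} (-1-residue (cong (at t₄) h)) (-3-residue (cong (at t₃) h)))
    go 3 _ h q _ = divisible-by-3 (divides (1 ℕ.+ 4 ℕ.* k) (trans q (m₃ k)))
    go 5 _ h q _ = legendre-nonresidue (proj₁ (large _ q)) (λ s → -3-nonresidue (2 ℕ.* k) (trans q (m₅ k)) (root-* {m = - 1ℤ} {n = + 3} (-1-residue (cong (at t₄) h)) s))
    go 7 _ h q _ = legendre-nonresidue (proj₁ (large _ q)) (λ s → -1-nonresidue (suc (3 ℕ.* k)) (trans q (m₇ k)) (s≤s (s≤s (s≤s z≤n))) (root-/3 (3≄0 _ q) (root-* {m = + 3} {n = - + 3} s (-3-residue (cong (at t₃) h)))))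
    go 9 _ h q _ = divisible-by-3 (divides (3 ℕ.+ 4 ℕ.* k) (trans q (m₉ k)))
    go 11 _ h q _ = legendre-residue (proj₁ (large _ q)) (3-residue k (trans q (cong (11 ℕ.+_) (ℕₚ.*-comm k 12))))
    go (suc (suc (suc (suc (suc (suc (suc (suc (suc (suc (suc (suc _)))))))))))) (s≤s (s≤s (s≤s (s≤s (s≤s (s≤s (s≤s (s≤s (s≤s (s≤s (s≤s (s≤s ())))))))))))) _ _ _
    go 0 _ _ _ ()
    go 2 _ _ _ ()
    go 4 _ _ _ ()
    go 6 _ _ _ ()
    go 8 _ _ _ ()
    go 10 _ _ _ ()

legendre-3 : ∀ p → Prime p → od (+ p) ≡ 1ℤ → legendre 3 p ≡ χ₁₂ (+ p)
legendre-3 0 _ ()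
legendre-3 1 p-prime _ = ⊥-elim (¬prime[1] p-prime)
legendre-3 2 _ ()
legendre-3 p@(suc (suc (suc q))) p-prime o = Legendre.by-residue q p-prime (p ℕ.% 12) (ℕd.m%n<n p 12) refl o

od-factor : ∀ x y → od (x * y) ≡ 1ℤ → od x ≡ 1ℤ
od-factor x y h = trans (sym (ℤₚ.*-identityˡ (od x))) (trans (cong (_* od x) (sym h)) (trans (decide (ap tod (v₀ ⊠ v₁) :*: ap tod v₀) (ap tod (v₀ ⊠ v₁)) refl (x ∷ y ∷ [])) h))

legendre-product : ∀ ps → All Prime ps → od (+ product ps) ≡ 1ℤ → prodℤ (map (legendre 3) ps) ≡ χ₁₂ (+ product ps)
legendre-product [] _ _ = refl
legendre-product (p ∷ ps) (pp ∷ pps) o = trans (cong₂ _*_ (legendre-3 p pp (od-factor (+ p) (+ product ps) o')) (legendre-product ps pps (od-factor (+ product ps) (+ p) (trans (cong od (ℤₚ.*-comm (+ product ps) (+ p))) o'))))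
  (trans (decide (ap t₁₂ v₀ :*: ap t₁₂ v₁) (ap t₁₂ (v₀ ⊠ v₁)) refl (+ p ∷ + product ps ∷ [])) (cong χ₁₂ (sym (ℤₚ.pos-* p (product ps)))))
  where
  o' : od (+ p * + product ps) ≡ 1ℤ
  o' = trans (cong od (sym (ℤₚ.pos-* p (product ps)))) o

jacobi-3 : ∀ m → od (+ m) ≡ 1ℤ → jacobi 3 m ≡ χ₁₂ (+ m)
jacobi-3 zero ()
jacobi-3 (suc m) o = trans (legendre-product (factors F) (PrimeFactorisation.factorsPrime F) (trans (cong (λ n → od (+ n)) (sym F≡)) o)) (cong (λ n → χ₁₂ (+ n)) (sym F≡))
  where
  F = factorise (suc m)
  F≡ = PrimeFactorisation.isFactorisation F

sumℤ-map : (f : I → ℤ) (xs : List I) → sumℤ (map f xs) ≡ ∑ xs f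
sumℤ-map f [] = refl
sumℤ-map f (x ∷ xs) = cong (_+_ (f x)) (sumℤ-map f xs)

divisorSum-D₁₂ : ∀ n → od (+ suc n) ≡ 1ℤ → divisorSum (suc n) ≡ D₁₂ (suc n)
divisorSum-D₁₂ n o = trans (sumℤ-map (λ d → + d * jacobi 3 d) divisors) (trans (sym (∑-bij {w = λ (a , t) → χ₁₂ t * t} {v = λ d → + d * jacobi 3 d} (unique (Dv 1) N) (Uniq.filter⁺ (_∣? N) (Uniq.applyUpTo⁺₁ suc N (λ i<j _ q → ℕₚ.<-irrefl (ℕₚ.suc-injective q) i<j))) (∣_∣ ∘ proj₂)
    (λ {z} z∈ → into z (sound (Dv 1) z∈)) (λ {z} {z'} z∈ z∈' → inj z z' (sound (Dv 1) z∈) (sound (Dv 1) z∈')) surj (λ {z} z∈ → weight z (sound (Dv 1) z∈)))) (sym (gen-def (Dv 1) (λ (a , t) → χ₁₂ t * t) N)))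
  where
  N = suc n
  divisors = filter (_∣? N) (applyUpTo suc N)
  Fib : ℤ × ℤ → Set
  Fib (a , t) = (Positive a × Positive t) × 1ℤ * (a * t) ≡ + N
  value : ∀ a t → 1ℤ * (+ a * + t) ≡ + N → N ≡ a ℕ.* t
  value a t q = sym (ℤₚ.+-injective (trans (ℤₚ.pos-* a t) (trans (sym (ℤₚ.*-identityˡ (+ a * + t))) q)))
  into : ∀ z → Fib z → ∣ proj₂ z ∣ ∈ divisors
  into (+ suc a , + suc t) (_ , q) = ∈-filter⁺ (_∣? N) (∈-applyUpTo⁺ suc (ℕ∣.∣⇒≤ t∣N)) t∣N
    where
    t∣N : suc t ∣ N
    t∣N = divides (suc a) (value (suc a) (suc t) q)
  into (+ zero , _) ((ℤ.+<+ () , _) , _)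
  into (+ suc _ , + zero) ((_ , ℤ.+<+ ()) , _)
  inj : ∀ z z' → Fib z → Fib z' → ∣ proj₂ z ∣ ≡ ∣ proj₂ z' ∣ → z ≡ z'
  inj (+ suc a , + suc t) (+ suc a' , + suc t') (_ , q) (_ , q') refl =
    cong (λ x → + x , + suc t) (ℕₚ.*-cancelʳ-≡ (suc a) (suc a') (suc t) (trans (sym (value (suc a) (suc t) q)) (value (suc a') (suc t) q')))
  inj (+ zero , _) _ ((ℤ.+<+ () , _) , _)
  inj (+ suc _ , + zero) _ ((_ , ℤ.+<+ ()) , _)
  inj (+ suc _ , + suc _) (+ zero , _) _ ((ℤ.+<+ () , _) , _)
  inj (+ suc _ , + suc _) (+ suc _ , + zero) _ ((_ , ℤ.+<+ ()) , _)
  surj : ∀ {d} → d ∈ divisors → ∃[ z ] (z ∈ fib (Dv 1) N × ∣ proj₂ z ∣ ≡ d)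
  surj {d} d∈ with ∈-filter⁻ (_∣? N) {xs = applyUpTo suc N} d∈
  ... | d∈' , divides c r with ∈-applyUpTo⁻ suc d∈'
  ... | i , _ , refl = (+ c , + suc i) , complete (Dv 1) (positive c r , ℤ.+<+ (s≤s z≤n)) (trans (ℤₚ.*-identityˡ (+ c * + suc i)) (trans (sym (ℤₚ.pos-* c (suc i))) (cong +_ (sym r)))) , refl
    where
    positive : ∀ c → N ≡ c ℕ.* suc i → Positive (+ c)
    positive (suc c) _ = ℤ.+<+ (s≤s z≤n)
  weight : ∀ z → Fib z → χ₁₂ (proj₂ z) * proj₂ z ≡ + ∣ proj₂ z ∣ * jacobi 3 ∣ proj₂ z ∣
  weight (a , + suc t) (_ , q) = trans (ℤₚ.*-comm (χ₁₂ (+ suc t)) (+ suc t)) (cong (+ suc t *_) (sym (jacobi-3 (suc t) (od-factor (+ suc t) a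
    (trans (cong od (trans (ℤₚ.*-comm (+ suc t) a) (trans (sym (ℤₚ.*-identityˡ (a * + suc t))) q))) o)))))
  weight (_ , + zero) ((_ , ℤ.+<+ ()) , _)

-- Counting the solutions

-- Used for the exactness of the division by 2, in `tri` and again in the final formula.
halve : ∀ y → (+ 2 * y) /ℕ 2 ≡ y
halve y = go ((+ 2 * y) %ℕ 2) (n%ℕd<d (+ 2 * y) 2) ((+ 2 * y) /ℕ 2) (a≡a%ℕn+[a/ℕn]*n (+ 2 * y) 2)
  where
  go : ∀ r → r ℕ.< 2 → ∀ q → + 2 * y ≡ + r + q * + 2 → q ≡ y
  go 0 _ q h = 2*-inj q y (sym (trans h (l q)))
    where
    l : ∀ q → 0ℤ + q * + 2 ≡ + 2 * q
    l = solve-∀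
  go 1 _ q h = ⊥-elim (even≢odd y q (trans h (l q)))
    where
    l : ∀ q → 1ℤ + q * + 2 ≡ + 2 * q + 1ℤ
    l = solve-∀
  go (suc (suc _)) (s≤s (s≤s ())) _ _

two-tri : ∀ x → + 2 * tri x ≡ x * (x - 1ℤ)
two-tri x = go (even∨odd x)
  where
  l₁ : ∀ k → (+ 2 * k) * (+ 2 * k - 1ℤ) ≡ + 2 * (k * (+ 2 * k - 1ℤ))
  l₁ = solve-∀
  l₂ : ∀ k → (+ 2 * k + 1ℤ) * (+ 2 * k + 1ℤ - 1ℤ) ≡ + 2 * ((+ 2 * k + 1ℤ) * k)
  l₂ = solve-∀
  exact : ∀ y → x * (x - 1ℤ) ≡ + 2 * y → + 2 * tri x ≡ x * (x - 1ℤ)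
  exact y h = trans (cong (+ 2 *_) (trans (cong (_/ℕ 2) h) (halve y))) (sym h)
  go : (∃[ k ] (+ 2 * k ≡ x)) ⊎ (∃[ k ] (odd k ≡ x)) → + 2 * tri x ≡ x * (x - 1ℤ)
  go (inj₁ (k , q)) = exact (k * (+ 2 * k - 1ℤ)) (trans (cong (λ x → x * (x - 1ℤ)) (sym q)) (l₁ k))
  go (inj₂ (k , q)) = exact ((+ 2 * k + 1ℤ) * k) (trans (cong (λ x → x * (x - 1ℤ)) (sym q)) (l₂ k))

odd²-tri : ∀ x → odd (x - 1ℤ) * odd (x - 1ℤ) ≡ + 8 * tri x + 1ℤ
odd²-tri x = trans (l x) (trans (cong (λ t → + 4 * t + 1ℤ) (sym (two-tri x))) (l' (tri x)))
  where
  l : ∀ x → (+ 2 * (x - 1ℤ) + 1ℤ) * (+ 2 * (x - 1ℤ) + 1ℤ) ≡ + 4 * (x * (x - 1ℤ)) + 1ℤ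
  l = solve-∀
  l' : ∀ t → + 4 * (+ 2 * t) + 1ℤ ≡ + 8 * t + 1ℤ
  l' = solve-∀

lookup-injective : ∀ {A : Set} {xs : List A} → Unique xs → ∀ i j → List.lookup xs i ≡ List.lookup xs j → i ≡ j
lookup-injective {xs = x ∷ xs} _ zero zero _ = refl
lookup-injective {xs = x ∷ xs} (x∉ ∷ _) zero (suc j) q = ⊥-elim (All.lookup x∉ (∈-lookup {xs = xs} j) q)
lookup-injective {xs = x ∷ xs} (x∉ ∷ _) (suc i) zero q = ⊥-elim (All.lookup x∉ (∈-lookup {xs = xs} i) (sym q))
lookup-injective {xs = x ∷ xs} (_ ∷ u) (suc i) (suc j) q = cong suc (lookup-injective u i j q)

-- A bijection of carriers is enough because `P` is proof irrelevant; in the application it is an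
-- equation between integers. The position in `xs` is determined since nothing is repeated.
enumerate : ∀ {A B : Set} {P : B → Set} → (∀ {v} (p q : P v) → p ≡ q) → {xs : List A} → Unique xs → (f : A → B) (g : B → A) →
  (∀ x → g (f x) ≡ x) → (∀ v → f (g v) ≡ v) → (∀ {v} → P v → g v ∈ xs) → (∀ {x} → x ∈ xs → P (f x)) → Σ B P ↔ Fin (length xs)
enumerate {A} {B} {P} irr {xs} u f g gf fg into out = mk↔ₛ′ to from to-from from-to
  where
  to : Σ B P → Fin (length xs)
  to (v , p) = Any.index (into p)
  from : Fin (length xs) → Σ B P
  from i = f (List.lookup xs i) , out (∈-lookup {xs = xs} i)
  to-from : ∀ i → to (from i) ≡ i
  to-from i = lookup-injective u _ i (trans (sym (lookup-index (into (out (∈-lookup {xs = xs} i))))) (gf (List.lookup xs i)))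
  pair≡ : ∀ {v w} (p : P v) (q : P w) → v ≡ w → _≡_ {A = Σ B P} (v , p) (w , q)
  pair≡ p q refl = cong (_ ,_) (irr p q)
  from-to : ∀ z → from (to z) ≡ z
  from-to (v , p) = pair≡ _ p (trans (cong f (sym (lookup-index (into p)))) (fg v))

OddQuad : Sys (((ℤ × ℤ) × ℤ) × ℤ)
OddQuad = ((Odd 8 ⊗ Odd 8) ⊗ Odd 8) ⊗ Odd 96

private
  e-tri : ∀ x y z w → + 8 * (odd (x - 1ℤ) * odd (x - 1ℤ)) + + 8 * (odd (y - 1ℤ) * odd (y - 1ℤ)) + + 8 * (odd (z - 1ℤ) * odd (z - 1ℤ)) + + 96 * (odd (w - 1ℤ) * odd (w - 1ℤ)) ≡
    + 64 * (+ 1 * tri x + + 1 * tri y + + 1 * tri z + + 12 * tri w) + + 120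
  e-tri x y z w = trans (cong₂ _+_ (cong₂ _+_ (cong₂ (λ a b → + 8 * a + + 8 * b) (odd²-tri x) (odd²-tri y)) (cong (+ 8 *_) (odd²-tri z))) (cong (+ 96 *_) (odd²-tri w))) (l (tri x) (tri y) (tri z) (tri w))
    where
    l : ∀ x y z w → + 8 * (+ 8 * x + 1ℤ) + + 8 * (+ 8 * y + 1ℤ) + + 8 * (+ 8 * z + 1ℤ) + + 96 * (+ 8 * w + 1ℤ) ≡ + 64 * (+ 1 * x + + 1 * y + + 1 * z + + 12 * w) + + 120
    l = solve-∀

  +-1 : ∀ x → (x + 1ℤ) - 1ℤ ≡ x
  +-1 = solve-∀
  -1+ : ∀ x → (x - 1ℤ) + 1ℤ ≡ x
  -1+ = solve-∀

  level : ∀ n → + (8 ℕ.* (8 ℕ.* n ℕ.+ 15)) ≡ + 64 * + n + + 120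
  level n = trans (cong +_ (l n)) (cong (_+ + 120) (ℤₚ.pos-* 64 n))
    where
    l : ∀ n → 8 ℕ.* (8 ℕ.* n ℕ.+ 15) ≡ 64 ℕ.* n ℕ.+ 120
    l = solveℕ

-- With X = 2x - 1 and so on, the equation becomes X² + Y² + Z² + 12 W² = 8n + 15; the exponent is 8
-- times this, that is 64n + 120.
solutions : ∀ n → Sol 1 1 1 12 n ↔ Fin (length (fib OddQuad (8 ℕ.* (8 ℕ.* n ℕ.+ 15))))
solutions n = enumerate (Decidable⇒UIP.≡-irrelevant ℤ._≟_) (unique OddQuad m) f g gf fg
  (λ {(x , y , z , w)} → into x y z w)
  (λ {(((a , b) , c) , d)} i∈ → out a b c d (proj₂ (sound OddQuad {(((a , b) , c) , d)} {m} i∈)))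
  where
  m = 8 ℕ.* (8 ℕ.* n ℕ.+ 15)
  f : ((ℤ × ℤ) × ℤ) × ℤ → ℤ × ℤ × ℤ × ℤ
  f (((a , b) , c) , d) = a + 1ℤ , b + 1ℤ , c + 1ℤ , d + 1ℤ
  g : ℤ × ℤ × ℤ × ℤ → ((ℤ × ℤ) × ℤ) × ℤ
  g (x , y , z , w) = ((x - 1ℤ , y - 1ℤ) , z - 1ℤ) , w - 1ℤ
  gf : ∀ i → g (f i) ≡ i
  gf (((a , b) , c) , d) = cong₂ _,_ (cong₂ _,_ (cong₂ _,_ (+-1 a) (+-1 b)) (+-1 c)) (+-1 d)
  fg : ∀ v → f (g v) ≡ v
  fg (x , y , z , w) = cong₂ _,_ (-1+ x) (cong₂ _,_ (-1+ y) (cong₂ _,_ (-1+ z) (-1+ w)))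
  into : ∀ x y z w → + n ≡ + 1 * tri x + + 1 * tri y + + 1 * tri z + + 12 * tri w → g (x , y , z , w) ∈ fib OddQuad m
  into x y z w q = complete OddQuad {g (x , y , z , w)} {m} (((tt , tt) , tt) , tt) (trans (e-tri x y z w) (trans (cong (λ t → + 64 * t + + 120) (sym q)) (sym (level n))))
  out : ∀ a b c d → + 8 * (odd a * odd a) + + 8 * (odd b * odd b) + + 8 * (odd c * odd c) + + 96 * (odd d * odd d) ≡ + m →
    + n ≡ + 1 * tri (a + 1ℤ) + + 1 * tri (b + 1ℤ) + + 1 * tri (c + 1ℤ) + + 12 * tri (d + 1ℤ)
  out a b c d q = ℤₚ.*-cancelˡ-≡ (+ 64) (+ n) (+ 1 * tri (a + 1ℤ) + + 1 * tri (b + 1ℤ) + + 1 * tri (c + 1ℤ) + + 12 * tri (d + 1ℤ))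
    (cancel (+ 64 * + n) (+ 64 * (+ 1 * tri (a + 1ℤ) + + 1 * tri (b + 1ℤ) + + 1 * tri (c + 1ℤ) + + 12 * tri (d + 1ℤ)))
      (trans (sym (level n)) (trans (sym q) (trans (cong₂ _+_ (cong₂ _+_ (cong₂ (λ s t → + 8 * s + + 8 * t) (h a) (h b)) (cong (+ 8 *_) (h c))) (cong (+ 96 *_) (h d))) (e-tri (a + 1ℤ) (b + 1ℤ) (c + 1ℤ) (d + 1ℤ))))))
    where
    h : ∀ a → odd a * odd a ≡ odd (a + 1ℤ - 1ℤ) * odd (a + 1ℤ - 1ℤ)
    h a = cong (λ x → odd x * odd x) (sym (+-1 a))
    cancel : ∀ x y → x + + 120 ≡ y + + 120 → x ≡ y
    cancel x y q = trans (sym (l x)) (trans (cong (_- + 120) q) (l y))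
      where
      l : ∀ x → x + + 120 - + 120 ≡ x
      l = solve-∀

opaque
  unfolding gen

  theta-count : ∀ n → (θ 8 ⊛ θ 8 ⊛ θ 8 ⊛ θ 96) n ≡ + length (fib OddQuad n)
  theta-count n = trans (sym (trans (gen-⊗ ((Odd 8 ⊗ Odd 8) ⊗ Odd 8) (Odd 96) (λ ((i , j) , k) → (1ℤ * 1ℤ) * 1ℤ) (λ _ → 1ℤ) n)
      (⊛-cong {g = θ 96} (λ m → trans (gen-⊗ (Odd 8 ⊗ Odd 8) (Odd 8) (λ (i , j) → 1ℤ * 1ℤ) (λ _ → 1ℤ) m) (⊛-cong {g = θ 8} (λ m' → gen-⊗ (Odd 8) (Odd 8) (λ _ → 1ℤ) (λ _ → 1ℤ) m') (λ _ → refl) m)) (λ _ → refl) n)))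
    (∑-ones (fib OddQuad n) (λ _ → refl))

-- The sum over a² + 3b²

-- This is 4x + 1. Choosing among b and -b the one congruent to 1 modulo 4 absorbs the sign
-- (-1)^((b-1)/2) into the number itself.
quad : ℤ → ℤ
quad x = odd (+ 2 * x)

Quad : ℕ → Sys ℤ
Quad m = mkSys {R = λ _ → ⊤} (λ _ → yes tt) (λ x → ⟪ m ⟫ * (quad x * quad x)) range range-unique
  λ {x} _ → _ , trans (cong (⟪ m ⟫ *_) (sq-abs (quad x))) (sym (ℤₚ.pos-* (suc (ℕ.pred m)) _)) ,
    ∈-range (ℕₚ.≤-trans (subst (∣ x ∣ ℕ.≤_) (sym (ℤₚ.abs-* (+ 2) x)) (ℕₚ.m≤n*m ∣ x ∣ 2)) (ℕₚ.≤-trans (∣x∣≤∣odd∣ (+ 2 * x)) (n≤sm*n*n (ℕ.pred m) ∣ quad x ∣)))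

quad-pos : ∀ d → quad (+ d) ≡ + (1 ℕ.+ 4 ℕ.* d)
quad-pos d = trans (l (+ d)) (cong (_+_ 1ℤ) (sym (ℤₚ.pos-* 4 d)))
  where
  l : ∀ d → + 2 * (+ 2 * d) + 1ℤ ≡ 1ℤ + + 4 * d
  l = solve-∀

quad-neg : ∀ d → quad -[1+ d ] ≡ - + (3 ℕ.+ 4 ℕ.* d)
quad-neg d = trans (l (+ d)) (cong (λ t → - (+ 3 + t)) (sym (ℤₚ.pos-* 4 d)))
  where
  l : ∀ d → + 2 * (+ 2 * (- (1ℤ + d))) + 1ℤ ≡ - (+ 3 + + 4 * d)
  l = solve-∀

quad-inj : ∀ x y → quad x ≡ quad y → x ≡ y
quad-inj x y q = 2*-inj x y (2*-inj (+ 2 * x) (+ 2 * y) (trans (sym (l (+ 2 * x))) (trans (cong (_- 1ℤ) q) (l (+ 2 * y)))))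
  where
  l : ∀ x → + 2 * x + 1ℤ - 1ℤ ≡ + 2 * x
  l = solve-∀

χ₄-∣∣ : ∀ z → χ₄ z ≡ 1ℤ → z ≡ χ₄ (+ ∣ z ∣) * + ∣ z ∣
χ₄-∣∣ (+ n) h = sym (trans (cong (_* + n) h) (ℤₚ.*-identityˡ (+ n)))
χ₄-∣∣ -[1+ n ] h = sym (trans (cong (_* + suc n) (trans (χ₄-neg -[1+ n ]) (cong -_ h))) (ℤₚ.-1*i≡-i (+ suc n)))

quad-∣∣ : ∀ x → quad x ≡ χ₄ (+ ∣ quad x ∣) * + ∣ quad x ∣
quad-∣∣ x = χ₄-∣∣ (quad x) (decide (ap t₄ (+ 2 · (+ 2 · v₀) ⊞ lit 1ℤ)) (cst 1ℤ) refl (x ∷ []))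

∣quad∣-inj : ∀ x y → ∣ quad x ∣ ≡ ∣ quad y ∣ → x ≡ y
∣quad∣-inj x y q = quad-inj x y (trans (quad-∣∣ x) (trans (cong (λ n → χ₄ (+ n) * + n) q) (sym (quad-∣∣ y))))

even∨oddℕ : ∀ n → ∃[ k ] (n ≡ k ℕ.* 2 ⊎ n ≡ suc (k ℕ.* 2))
even∨oddℕ n = n ℕ./ 2 , go (n ℕ.% 2) (ℕd.m%n<n n 2) (ℕd.m≡m%n+[m/n]*n n 2)
  where
  go : ∀ r → r ℕ.< 2 → n ≡ r ℕ.+ (n ℕ./ 2) ℕ.* 2 → n ≡ (n ℕ./ 2) ℕ.* 2 ⊎ n ≡ suc ((n ℕ./ 2) ℕ.* 2)
  go 0 _ q = inj₁ q
  go 1 _ q = inj₂ q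
  go (suc (suc _)) (s≤s (s≤s ())) _

∣quad∣-odd : ∀ x → ∃[ c ] (∣ quad x ∣ ≡ suc (c ℕ.* 2))
∣quad∣-odd (+ d) = 2 ℕ.* d , trans (cong ∣_∣ (quad-pos d)) (l d)
  where
  l : ∀ d → 1 ℕ.+ 4 ℕ.* d ≡ suc ((2 ℕ.* d) ℕ.* 2)
  l = solveℕ
∣quad∣-odd -[1+ d ] = 1 ℕ.+ 2 ℕ.* d , trans (cong ∣_∣ (quad-neg d)) (l d)
  where
  l : ∀ d → 3 ℕ.+ 4 ℕ.* d ≡ suc ((1 ℕ.+ 2 ℕ.* d) ℕ.* 2)
  l = solveℕ

∣quad∣-surj : ∀ c → ∃[ x ] (∣ quad x ∣ ≡ suc (c ℕ.* 2))
∣quad∣-surj c with even∨oddℕ c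
... | d , inj₁ refl = + d , trans (cong ∣_∣ (quad-pos d)) (l d)
  where
  l : ∀ d → 1 ℕ.+ 4 ℕ.* d ≡ suc ((d ℕ.* 2) ℕ.* 2)
  l = solveℕ
... | d , inj₂ refl = -[1+ d ] , trans (cong ∣_∣ (quad-neg d)) (l d)
  where
  l : ∀ d → 3 ℕ.+ 4 ℕ.* d ≡ suc (suc (d ℕ.* 2) ℕ.* 2)
  l = solveℕ

sign-χ₄ : ∀ c → -1ℤ ^ c ≡ χ₄ (+ suc (c ℕ.* 2))
sign-χ₄ zero = refl
sign-χ₄ (suc c) = trans (cong (-1ℤ *_) (sign-χ₄ c)) (trans (ℤₚ.-1*i≡-i (χ₄ (+ suc (c ℕ.* 2)))) (decide (negᵉ (ap t₄ v₀)) (ap t₄ (lit (+ 2) ⊞ v₀)) refl (+ suc (c ℕ.* 2) ∷ [])))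

quad-weight : ∀ x → quad x ≡ -1ℤ ^ ((∣ quad x ∣ ℕ.∸ 1) ℕ./ 2) * + ∣ quad x ∣
quad-weight x = go ∣ quad x ∣ (∣quad∣-odd x) (quad-∣∣ x)
  where
  go : ∀ b → ∃[ c ] (b ≡ suc (c ℕ.* 2)) → quad x ≡ χ₄ (+ b) * + b → quad x ≡ -1ℤ ^ ((b ℕ.∸ 1) ℕ./ 2) * + b
  go _ (c , refl) q = trans q (cong (_* + suc (c ℕ.* 2)) (trans (sym (sign-χ₄ c)) (cong (-1ℤ ^_) (sym (ℕd.m*n/n≡m c 2)))))

pairs : ℕ → List (ℕ × ℕ)
pairs M = filter (λ (a , b) → (a ℕ.% 2 ℕ.≟ 1) ×-dec (a ℕ.* a ℕ.+ 3 ℕ.* (b ℕ.* b) ℕ.≟ M)) (cartesianProduct (applyUpTo suc M) (applyUpTo suc M))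

pairs-unique : ∀ M → Unique (pairs M)
pairs-unique M = Uniq.filter⁺ _ (Uniq.cartesianProduct⁺ u u)
  where
  u : Unique (applyUpTo suc M)
  u = Uniq.applyUpTo⁺₁ suc M (λ i<j _ q → ℕₚ.<-irrefl (ℕₚ.suc-injective q) i<j)

∈-pairs : ∀ M {a b} c d → a ≡ suc (c ℕ.* 2) → b ≡ suc (d ℕ.* 2) → a ℕ.* a ℕ.+ 3 ℕ.* (b ℕ.* b) ≡ M → (a , b) ∈ pairs M
∈-pairs M c d refl refl q = ∈-filter⁺ _ (∈-cartesianProduct⁺
    (∈-applyUpTo⁺ suc (subst (suc (c ℕ.* 2) ℕ.≤_) q (ℕₚ.≤-trans (n≤n*n (suc (c ℕ.* 2))) (ℕₚ.m≤m+n _ _))))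
    (∈-applyUpTo⁺ suc (subst (suc (d ℕ.* 2) ℕ.≤_) q (ℕₚ.≤-trans (n≤n*n (suc (d ℕ.* 2))) (ℕₚ.≤-trans (ℕₚ.m≤n*m _ 3) (ℕₚ.m≤n+m _ (suc (c ℕ.* 2) ℕ.* suc (c ℕ.* 2))))))))
  (ℕd.[m+kn]%n≡m%n 1 c 2 , q)

-- The filter requires only a to be odd; b is odd too, since a² + 3b² = 4N is even.
pairs-∈ : ∀ N {a b} → (a , b) ∈ pairs (4 ℕ.* N) → (∃[ c ] (a ≡ suc (c ℕ.* 2))) × (∃[ d ] (b ≡ suc (d ℕ.* 2))) × a ℕ.* a ℕ.+ 3 ℕ.* (b ℕ.* b) ≡ 4 ℕ.* N
pairs-∈ N {a} {b} ab∈ = let (_ , p , q) = ∈-filter⁻ _ {xs = cartesianProduct (applyUpTo suc (4 ℕ.* N)) (applyUpTo suc (4 ℕ.* N))} ab∈ in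
  (a ℕ./ 2 , a≡ p) , odd-b b (even∨oddℕ b) (a≡ p) q , q
  where
  a≡ : a ℕ.% 2 ≡ 1 → a ≡ suc ((a ℕ./ 2) ℕ.* 2)
  a≡ p = trans (ℕd.m≡m%n+[m/n]*n a 2) (cong (ℕ._+ (a ℕ./ 2) ℕ.* 2) p)
  mod2 : ∀ x y → x ℕ.* 2 ≡ suc (y ℕ.* 2) → ⊥
  mod2 x y q = 0≢1 (trans (sym (ℕd.[m+kn]%n≡m%n 0 x 2)) (trans (cong (ℕ._% 2) q) (ℕd.[m+kn]%n≡m%n 1 y 2)))
    where
    0≢1 : 0 ≡ 1 → ⊥
    0≢1 ()
  odd-b : ∀ b → ∃[ k ] (b ≡ k ℕ.* 2 ⊎ b ≡ suc (k ℕ.* 2)) → a ≡ suc ((a ℕ./ 2) ℕ.* 2) → a ℕ.* a ℕ.+ 3 ℕ.* (b ℕ.* b) ≡ 4 ℕ.* N → ∃[ d ] (b ≡ suc (d ℕ.* 2))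
  odd-b b (k , inj₂ r) _ _ = k , r
  odd-b b (k , inj₁ r) a≡ q = ⊥-elim (mod2 (2 ℕ.* N) (2 ℕ.* ((a ℕ./ 2) ℕ.* (a ℕ./ 2)) ℕ.+ 2 ℕ.* (a ℕ./ 2) ℕ.+ 6 ℕ.* (k ℕ.* k)) (trans (l₁ N) (trans (sym q) (trans (cong₂ (λ x y → x ℕ.* x ℕ.+ 3 ℕ.* (y ℕ.* y)) a≡ r) (l₂ (a ℕ./ 2) k)))))
    where
    l₁ : ∀ N → (2 ℕ.* N) ℕ.* 2 ≡ 4 ℕ.* N
    l₁ = solveℕ
    l₂ : ∀ c k → suc (c ℕ.* 2) ℕ.* suc (c ℕ.* 2) ℕ.+ 3 ℕ.* ((k ℕ.* 2) ℕ.* (k ℕ.* 2)) ≡ suc ((2 ℕ.* (c ℕ.* c) ℕ.+ 2 ℕ.* c ℕ.+ 6 ℕ.* (k ℕ.* k)) ℕ.* 2)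
    l₂ = solveℕ

PQ : Sys (ℤ × ℤ)
PQ = Quad 2 ⊗ Quad 6

-- Each odd a > 0 is |x| for exactly one x ≡ 1 modulo 4.
repSum-gen : ∀ N → repSum (4 ℕ.* N) ≡ gen PQ (λ (i , j) → quad j) (8 ℕ.* N)
repSum-gen N = trans (sumℤ-map weight (pairs (4 ℕ.* N))) (trans (sym (∑-bij {w = λ (i , j) → quad j} {v = weight} (unique PQ (8 ℕ.* N)) (pairs-unique (4 ℕ.* N)) f
    (λ {(i , j)} ij∈ → into i j (proj₂ (sound PQ {i , j} {8 ℕ.* N} ij∈))) (λ {(i , j)} {(i' , j')} _ _ q → cong₂ _,_ (∣quad∣-inj i i' (,-injectiveˡ q)) (∣quad∣-inj j j' (,-injectiveʳ q)))
    (λ {(a , b)} ab∈ → surj a b (pairs-∈ N ab∈)) (λ {(i , j)} _ → quad-weight j))) (sym (gen-def PQ _ (8 ℕ.* N))))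
  where
  weight : ℕ × ℕ → ℤ
  weight (a , b) = -1ℤ ^ ((b ℕ.∸ 1) ℕ./ 2) * + b
  f : ℤ × ℤ → ℕ × ℕ
  f (i , j) = ∣ quad i ∣ , ∣ quad j ∣
  ∣∣-form : ∀ a b → + 2 * + (a ℕ.* a ℕ.+ 3 ℕ.* (b ℕ.* b)) ≡ + 2 * + (a ℕ.* a) + + 6 * + (b ℕ.* b)
  ∣∣-form a b = trans (cong (λ t → + 2 * (+ (a ℕ.* a) + t)) (ℤₚ.pos-* 3 (b ℕ.* b))) (l (+ (a ℕ.* a)) (+ (b ℕ.* b)))
    where
    l : ∀ x y → + 2 * (x + + 3 * y) ≡ + 2 * x + + 6 * y
    l = solve-∀
  form : ∀ i j → + 2 * (quad i * quad i) + + 6 * (quad j * quad j) ≡ + 2 * + (∣ quad i ∣ ℕ.* ∣ quad i ∣ ℕ.+ 3 ℕ.* (∣ quad j ∣ ℕ.* ∣ quad j ∣))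
  form i j = trans (cong₂ (λ x y → + 2 * x + + 6 * y) (sq-abs (quad i)) (sq-abs (quad j))) (sym (∣∣-form ∣ quad i ∣ ∣ quad j ∣))
  8N : + (8 ℕ.* N) ≡ + 2 * + (4 ℕ.* N)
  8N = trans (cong +_ (ℕₚ.*-assoc 2 4 N)) (ℤₚ.pos-* 2 (4 ℕ.* N))
  into : ∀ i j → + 2 * (quad i * quad i) + + 6 * (quad j * quad j) ≡ + (8 ℕ.* N) → f (i , j) ∈ pairs (4 ℕ.* N)
  into i j q = ∈-pairs (4 ℕ.* N) (proj₁ (∣quad∣-odd i)) (proj₁ (∣quad∣-odd j)) (proj₂ (∣quad∣-odd i)) (proj₂ (∣quad∣-odd j))
    (ℤₚ.+-injective (ℤₚ.*-cancelˡ-≡ (+ 2) (+ (∣ quad i ∣ ℕ.* ∣ quad i ∣ ℕ.+ 3 ℕ.* (∣ quad j ∣ ℕ.* ∣ quad j ∣))) (+ (4 ℕ.* N)) (trans (sym (form i j)) (trans q 8N))))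
  surj : ∀ a b → (∃[ c ] (a ≡ suc (c ℕ.* 2))) × (∃[ d ] (b ≡ suc (d ℕ.* 2))) × a ℕ.* a ℕ.+ 3 ℕ.* (b ℕ.* b) ≡ 4 ℕ.* N → ∃[ z ] (z ∈ fib PQ (8 ℕ.* N) × f z ≡ (a , b))
  surj _ _ ((c , refl) , (d , refl) , q) = go (∣quad∣-surj c) (∣quad∣-surj d)
    where
    go : ∃[ i ] (∣ quad i ∣ ≡ suc (c ℕ.* 2)) → ∃[ j ] (∣ quad j ∣ ≡ suc (d ℕ.* 2)) → ∃[ z ] (z ∈ fib PQ (8 ℕ.* N) × f z ≡ (suc (c ℕ.* 2) , suc (d ℕ.* 2)))
    go (i , r) (j , s) = (i , j) , complete PQ {i , j} {8 ℕ.* N} (tt , tt) (trans (form i j) (trans (cong₂ (λ x y → + 2 * + (x ℕ.* x ℕ.+ 3 ℕ.* (y ℕ.* y))) r s) (trans (cong (λ t → + 2 * + t) q) (sym 8N)))) , cong₂ _,_ r s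

XY : Sys (ℤ × ℤ)
XY = Odd 32 ⊗ Quad 24

-- From a ≡ b ≡ 1 modulo 4 and a² + 3b² = 4N pass to A = b + B and B = (a - b)/4, so that A² + 3B² = N; as N ≡ 7 modulo 8,
-- A is 2 modulo 4 and B is 1 modulo 4.
change-form : ∀ n → let m = 8 ℕ.* (8 ℕ.* n ℕ.+ 15) in gen PQ (λ (i , j) → quad j) m ≡ gen XY (λ (x , y) → quad (x - y)) m
change-form n = trans (gen-def PQ _ m) (trans (sym (∑-bij {w = λ (x , y) → quad (x - y)} {v = λ (i , j) → quad j} (unique XY m) (unique PQ m) f
    (λ {(x , y)} z∈ → complete PQ {f (x , y)} {m} (tt , tt) (trans (l₀ x y) (proj₂ (sound XY {x , y} {m} z∈))))
    (λ {(x , y)} {(x' , y')} _ _ q → inj x y x' y' (,-injectiveˡ q) (,-injectiveʳ q))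
    (λ {(i , j)} z∈ → surj i j (proj₂ (sound PQ {i , j} {m} z∈))) (λ _ → refl))) (sym (gen-def XY _ m)))
  where
  m = 8 ℕ.* (8 ℕ.* n ℕ.+ 15)
  f : ℤ × ℤ → ℤ × ℤ
  f (x , y) = x + + 3 * y + 1ℤ , x - y
  l₀ : ∀ x y → + 2 * ((+ 2 * (+ 2 * (x + + 3 * y + 1ℤ)) + 1ℤ) * (+ 2 * (+ 2 * (x + + 3 * y + 1ℤ)) + 1ℤ)) + + 6 * ((+ 2 * (+ 2 * (x - y)) + 1ℤ) * (+ 2 * (+ 2 * (x - y)) + 1ℤ))
    ≡ + 32 * ((+ 2 * x + 1ℤ) * (+ 2 * x + 1ℤ)) + + 24 * ((+ 2 * (+ 2 * y) + 1ℤ) * (+ 2 * (+ 2 * y) + 1ℤ))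
  l₀ = solve-∀
  inj : ∀ x y x' y' → x + + 3 * y + 1ℤ ≡ x' + + 3 * y' + 1ℤ → x - y ≡ x' - y' → (x , y) ≡ (x' , y')
  inj x y x' y' q r = cong₂ _,_ (trans (sym (l' x y)) (trans (cong₂ _+_ r y≡) (l' x' y'))) y≡
    where
    l : ∀ x y → (x + + 3 * y + 1ℤ) - (x - y) - 1ℤ ≡ + 4 * y
    l = solve-∀
    l' : ∀ x y → x - y + y ≡ x
    l' = solve-∀
    y≡ : y ≡ y'
    y≡ = ℤₚ.*-cancelˡ-≡ (+ 4) y y' (trans (sym (l x y)) (trans (cong₂ (λ s t → s - t - 1ℤ) q r) (l x' y')))
  Parity : ℤ → Set
  Parity a = (∃[ k ] (+ 2 * k ≡ a)) ⊎ (∃[ k ] (odd k ≡ a))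
  8* : + m ≡ + 8 * (+ 8 * + n + + 15)
  8* = trans (ℤₚ.pos-* 8 (8 ℕ.* n ℕ.+ 15)) (cong (λ t → + 8 * (t + + 15)) (ℤₚ.pos-* 8 n))
  Form : ℤ → ℤ → Set
  Form a b = a * a + + 3 * (b * b) ≡ + 8 * + n + + 15
  n-odd : ∀ n → + 8 * n + + 15 ≡ + 2 * (+ 4 * n + + 7) + 1ℤ
  n-odd = solve-∀
  half-parity : ∀ a b → Parity a → Parity b → a * a + + 3 * (b * b) + + 3 * b ≡ + 2 * + n + + 3 → ∃[ x ] (odd x ≡ a)
  half-parity a b (inj₂ r) _ _ = r
  half-parity _ _ (inj₁ (c , refl)) (inj₁ (d , refl)) q = ⊥-elim (even≢odd (+ 2 * (c * c) + + 6 * (d * d) + + 3 * d) (+ n + 1ℤ) (trans (l c d) (trans q (l' (+ n)))))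
    where
    l : ∀ c d → + 2 * (+ 2 * (c * c) + + 6 * (d * d) + + 3 * d) ≡ (+ 2 * c) * (+ 2 * c) + + 3 * ((+ 2 * d) * (+ 2 * d)) + + 3 * (+ 2 * d)
    l = solve-∀
    l' : ∀ n → + 2 * n + + 3 ≡ + 2 * (n + 1ℤ) + 1ℤ
    l' = solve-∀
  half-parity _ _ (inj₁ (c , refl)) (inj₂ (d , refl)) q = ⊥-elim (even≢odd (+ 2 * (c * c) + + 6 * (d * d) + + 9 * d + + 3) (+ n + 1ℤ) (trans (l c d) (trans q (l' (+ n)))))
    where
    l : ∀ c d → + 2 * (+ 2 * (c * c) + + 6 * (d * d) + + 9 * d + + 3) ≡ (+ 2 * c) * (+ 2 * c) + + 3 * ((+ 2 * d + 1ℤ) * (+ 2 * d + 1ℤ)) + + 3 * (+ 2 * d + 1ℤ)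
    l = solve-∀
    l' : ∀ n → + 2 * n + + 3 ≡ + 2 * (n + 1ℤ) + 1ℤ
    l' = solve-∀
  parities : ∀ a b → Parity a → Parity b → Form a b → ∃[ x ] ∃[ k ] (+ 2 * odd x ≡ a × odd k ≡ b)
  parities _ _ (inj₁ (c , refl)) (inj₁ (d , refl)) q = ⊥-elim (even≢odd (+ 2 * (c * c) + + 6 * (d * d)) (+ 4 * + n + + 7) (trans (l c d) (trans q (n-odd (+ n)))))
    where
    l : ∀ c d → + 2 * (+ 2 * (c * c) + + 6 * (d * d)) ≡ (+ 2 * c) * (+ 2 * c) + + 3 * ((+ 2 * d) * (+ 2 * d))
    l = solve-∀
  parities _ _ (inj₂ (c , refl)) (inj₂ (d , refl)) q = ⊥-elim (even≢odd (+ 2 * (c * c) + + 2 * c + + 6 * (d * d) + + 6 * d + + 2) (+ 4 * + n + + 7) (trans (l c d) (trans q (n-odd (+ n)))))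
    where
    l : ∀ c d → + 2 * (+ 2 * (c * c) + + 2 * c + + 6 * (d * d) + + 6 * d + + 2) ≡ (+ 2 * c + 1ℤ) * (+ 2 * c + 1ℤ) + + 3 * ((+ 2 * d + 1ℤ) * (+ 2 * d + 1ℤ))
    l = solve-∀
  parities _ _ (inj₂ (c , refl)) (inj₁ (d , refl)) q = ⊥-elim (even≢odd (c * c + c + + 3 * (d * d)) (+ 2 * + n + + 3)
      (2*-inj (+ 2 * (c * c + c + + 3 * (d * d))) (odd (+ 2 * + n + + 3)) (trans (l c d) (trans (cong (_- 1ℤ) q) (l' (+ n))))))
    where
    l : ∀ c d → + 2 * (+ 2 * (c * c + c + + 3 * (d * d))) ≡ (+ 2 * c + 1ℤ) * (+ 2 * c + 1ℤ) + + 3 * ((+ 2 * d) * (+ 2 * d)) - 1ℤ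
    l = solve-∀
    l' : ∀ n → + 8 * n + + 15 - 1ℤ ≡ + 2 * (+ 2 * (+ 2 * n + + 3) + 1ℤ)
    l' = solve-∀
  parities _ _ (inj₁ (c , refl)) (inj₂ (d , refl)) q = let (x , r) = half-parity c d (even∨odd c) (even∨odd d)
                                                            (ℤₚ.*-cancelˡ-≡ (+ 4) (c * c + + 3 * (d * d) + + 3 * d) (+ 2 * + n + + 3) (trans (l c d) (trans (cong (_- + 3) q) (l' (+ n)))))
                                                        in x , d , cong (+ 2 *_) r , refl
    where
    l : ∀ c d → + 4 * (c * c + + 3 * (d * d) + + 3 * d) ≡ (+ 2 * c) * (+ 2 * c) + + 3 * ((+ 2 * d + 1ℤ) * (+ 2 * d + 1ℤ)) - + 3
    l = solve-∀
    l' : ∀ n → + 8 * n + + 15 - + 3 ≡ + 4 * (+ 2 * n + + 3)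
    l' = solve-∀
  surj : ∀ i j → + 2 * (quad i * quad i) + + 6 * (quad j * quad j) ≡ + m → ∃[ z ] (z ∈ fib XY m × f z ≡ (i , j))
  surj i j q = go (parities (+ 3 * j + i + 1ℤ) (i - j) (even∨odd (+ 3 * j + i + 1ℤ)) (even∨odd (i - j))
      (ℤₚ.*-cancelˡ-≡ (+ 8) ((+ 3 * j + i + 1ℤ) * (+ 3 * j + i + 1ℤ) + + 3 * ((i - j) * (i - j))) (+ 8 * + n + + 15) (trans (l i j) (trans q 8*))))
    where
    l : ∀ i j → + 8 * ((+ 3 * j + i + 1ℤ) * (+ 3 * j + i + 1ℤ) + + 3 * ((i - j) * (i - j))) ≡
      + 2 * ((+ 2 * (+ 2 * i) + 1ℤ) * (+ 2 * (+ 2 * i) + 1ℤ)) + + 6 * ((+ 2 * (+ 2 * j) + 1ℤ) * (+ 2 * (+ 2 * j) + 1ℤ))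
    l = solve-∀
    go : ∃[ x ] ∃[ k ] (+ 2 * odd x ≡ + 3 * j + i + 1ℤ × odd k ≡ i - j) → ∃[ z ] (z ∈ fib XY m × f z ≡ (i , j))
    go (x , k , r , s) = (x , x - j) , complete XY {x , x - j} {m} (tt , tt) (trans (sym (l₀ x (x - j))) (trans (cong₂ (λ a b → + 2 * (quad a * quad a) + + 6 * (quad b * quad b)) i≡ (j≡ x j)) q)) , cong₂ _,_ i≡ (j≡ x j)
      where
      j≡ : ∀ x j → x - (x - j) ≡ j
      j≡ = solve-∀
      l₁ : ∀ x j → x + + 3 * (x - j) + 1ℤ ≡ + 2 * (+ 2 * x + 1ℤ) - + 3 * j - 1ℤ
      l₁ = solve-∀
      l₂ : ∀ i j → + 3 * j + i + 1ℤ - + 3 * j - 1ℤ ≡ i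
      l₂ = solve-∀
      i≡ : x + + 3 * (x - j) + 1ℤ ≡ i
      i≡ = trans (l₁ x j) (trans (cong (λ t → t - + 3 * j - 1ℤ) r) (l₂ i j))

-- quad (x - y) is 2 odd x minus quad y, and odd x changes sign under x ↦ -1 - x.
drop-odd : ∀ n → gen XY (λ (x , y) → quad (x - y)) n ≡ - gen XY (λ (x , y) → quad y) n
drop-odd n = trans (gen-cong XY {v = λ (x , y) → + 2 * odd x + - quad y} (λ (x , y) → l x y) n) (trans (gen-+ XY (λ (x , y) → + 2 * odd x) (λ (x , y) → - quad y) n)
  (trans (cong₂ _+_ (gen-anti XY {λ (x , y) → + 2 * odd x} (λ (x , y) → - 1ℤ - x , y) id (λ {(x , y)} _ → cong (λ t → + 32 * t + + 24 * (quad y * quad y)) (l₁ x)) (λ {(x , y)} _ → cong (_, y) (l₂ x)) (λ {(x , y)} _ → l₃ x) n)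
    (gen-neg XY (λ (x , y) → quad y) n)) (ℤₚ.+-identityˡ _)))
  where
  l : ∀ x y → + 2 * (+ 2 * (x - y)) + 1ℤ ≡ + 2 * (+ 2 * x + 1ℤ) + - (+ 2 * (+ 2 * y) + 1ℤ)
  l = solve-∀
  l₁ : ∀ x → (+ 2 * (- 1ℤ - x) + 1ℤ) * (+ 2 * (- 1ℤ - x) + 1ℤ) ≡ (+ 2 * x + 1ℤ) * (+ 2 * x + 1ℤ)
  l₁ = solve-∀
  l₂ : ∀ x → - 1ℤ - (- 1ℤ - x) ≡ x
  l₂ = solve-∀
  l₃ : ∀ x → + 2 * (+ 2 * x + 1ℤ) ≡ - (+ 2 * (+ 2 * (- 1ℤ - x) + 1ℤ))
  l₃ = solve-∀

-- χ₄(v) v is even in v, so summing over all odd v doubles the sum over v ≡ 1 modulo 4, where the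
-- weight is v itself.
θJ-quad : ∀ n → (θ 32 ⊛ J 24) n ≡ + 2 * gen XY (λ (x , y) → quad y) n
θJ-quad n = trans (sym (gen-⊗ (Odd 32) (Odd 24) (λ _ → 1ℤ) (λ y → sgn y * odd y) n)) (trans
  (gen-decomp (Odd 32 ⊗ Odd 24) XY XY (λ (x , y) → 1ℤ * (sgn y * odd y)) (λ (x , y) → x , + 2 * y) (λ (x , y) → x , - 1ℤ - + 2 * y) id id (λ _ → refl)
    (λ {(x , y)} _ → cong (λ t → + 32 * (odd x * odd x) + + 24 * t) (l₁ y))
    (λ {(x , y)} {(x' , y')} q → cong₂ _,_ (,-injectiveˡ q) (2*-inj y y' (,-injectiveʳ q)))
    (λ {(x , y)} {(x' , y')} q → cong₂ _,_ (,-injectiveˡ q) (2*-inj y y' (ℤₚ.neg-injective (trans (sym (l₂ y)) (trans (cong (_+ 1ℤ) (,-injectiveʳ q)) (l₂ y'))))))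
    (λ {(x , y)} {(x' , y')} q → even≢odd y (- y' - 1ℤ) (trans (,-injectiveʳ q) (l₃ y')))
    (λ {(x , y)} _ → [ (λ (k , q) → inj₁ ((x , k) , (tt , tt) , cong (x ,_) q)) , (λ (k , q) → inj₂ ((x , - k - 1ℤ) , (tt , tt) , cong (x ,_) (trans (l₄ k) q))) ]′ (even∨odd y)) n)
  (trans (cong₂ _+_ (gen-cong XY {v = λ (x , y) → quad y} (λ (x , y) → trans (cong (λ s → 1ℤ * (s * quad y)) (decide (ap ts (+ 2 · v₀)) (cst 1ℤ) refl (y ∷ []))) (l₅ (quad y))) n)
      (gen-cong XY {v = λ (x , y) → quad y} (λ (x , y) → trans (cong (λ s → 1ℤ * (s * odd (- 1ℤ - + 2 * y))) (decide (ap ts (lit (- 1ℤ) ⊟ + 2 · v₀)) (cst -1ℤ) refl (y ∷ []))) (l₆ y)) n))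
    (l₇ (gen XY (λ (x , y) → quad y) n))))
  where
  l₁ : ∀ y → (+ 2 * (- 1ℤ - + 2 * y) + 1ℤ) * (+ 2 * (- 1ℤ - + 2 * y) + 1ℤ) ≡ (+ 2 * (+ 2 * y) + 1ℤ) * (+ 2 * (+ 2 * y) + 1ℤ)
  l₁ = solve-∀
  l₂ : ∀ y → - 1ℤ - + 2 * y + 1ℤ ≡ - (+ 2 * y)
  l₂ = solve-∀
  l₃ : ∀ y → - 1ℤ - + 2 * y ≡ + 2 * (- y - 1ℤ) + 1ℤ
  l₃ = solve-∀
  l₄ : ∀ k → - 1ℤ - + 2 * (- k - 1ℤ) ≡ + 2 * k + 1ℤ
  l₄ = solve-∀
  l₅ : ∀ x → 1ℤ * (1ℤ * x) ≡ x
  l₅ = solve-∀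
  l₆ : ∀ y → 1ℤ * (- 1ℤ * (+ 2 * (- 1ℤ - + 2 * y) + 1ℤ)) ≡ + 2 * (+ 2 * y) + 1ℤ
  l₆ = solve-∀
  l₇ : ∀ x → x + x ≡ + 2 * x
  l₇ = solve-∀

two-repSum : ∀ n → let N = 8 ℕ.* n ℕ.+ 15 in + 2 * repSum (4 ℕ.* N) ≡ - (θ 32 ⊛ J 24) (8 ℕ.* N)
two-repSum n = trans (cong (+ 2 *_) (trans (repSum-gen N) (trans (change-form n) (drop-odd (8 ℕ.* N))))) (trans (l (gen XY (λ (x , y) → quad y) (8 ℕ.* N))) (cong -_ (sym (θJ-quad (8 ℕ.* N)))))
  where
  N = 8 ℕ.* n ℕ.+ 15
  l : ∀ x → + 2 * - x ≡ - (+ 2 * x)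
  l = solve-∀

-- Assembling the formula

d₃-coprime : ∀ n → ¬ (3 ∣ n) → d₃ (+ n) ≡ 0ℤ
d₃-coprime n h = [ (λ (k , q) → ⊥-elim (h (divides ∣ k ∣ (trans (cong ∣_∣ (sym q)) (trans (ℤₚ.abs-* (+ 3) k) (ℕₚ.*-comm 3 ∣ k ∣)))))) , id ]′ (mod3 (+ n))

weighted-count : ∀ n → let m = 8 ℕ.* (8 ℕ.* n ℕ.+ 15) in
  + 2 * (θ 8 ⊛ θ 8 ⊛ θ 8 ⊛ θ 96) m + + 3 * (θ 32 ⊛ J 24) m ≡ + 2 * X₃ 1 m + + 8 * (X₄ 2 ⊛ X₃ 1) m
weighted-count n = trans (sym (coefficient-relation m (+ n + 1ℤ) m≡)) (divisor-side m (+ n + 1ℤ) m≡)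
  where
  m = 8 ℕ.* (8 ℕ.* n ℕ.+ 15)
  l : ∀ n → 8 ℕ.* (8 ℕ.* n ℕ.+ 15) ≡ 64 ℕ.* n ℕ.+ 120
  l = solveℕ
  l' : ∀ n → + 64 * n + + 120 ≡ + 56 + + 64 * (n + 1ℤ)
  l' = solve-∀
  m≡ : + m ≡ + 56 + + 64 * (+ n + 1ℤ)
  m≡ = trans (cong +_ (l n)) (trans (cong (_+ + 120) (ℤₚ.pos-* 64 n)) (l' (+ n)))

χ₄-level : ∀ n → χ₄ (+ (8 ℕ.* n ℕ.+ 15)) ≡ - 1ℤ
χ₄-level n = trans (cong (λ t → χ₄ (t + + 15)) (ℤₚ.pos-* 8 n)) (decide (ap t₄ (+ 8 · v₀ ⊞ lit (+ 15))) (cst (- 1ℤ)) refl (+ n ∷ []))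

od-level : ∀ n → od (+ (8 ℕ.* n ℕ.+ 15)) ≡ 1ℤ
od-level n = trans (cong (λ t → od (t + + 15)) (ℤₚ.pos-* 8 n)) (decide (ap tod (+ 8 · v₀ ⊞ lit (+ 15))) (cst 1ℤ) refl (+ n ∷ []))

-- Since 8n + 15 ≡ 3 modulo 4, the term -χ₄(N) of `divisor-formula` is the + 1 of the statement.
twice-count : ∀ n β n₁ → 1 ℕ.≤ n₁ → ¬ (3 ∣ n₁) → 8 ℕ.* n ℕ.+ 15 ≡ 3 ℕ.^ β ℕ.* n₁ →
  (+ (3 ℕ.^ suc β) * jacobi 3 n₁ + 1ℤ) * divisorSum n₁ ≡ + 2 * (+ length (fib OddQuad (8 ℕ.* (8 ℕ.* n ℕ.+ 15))) - + 3 * repSum (4 ℕ.* (8 ℕ.* n ℕ.+ 15)))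
twice-count n β (suc k) _ 3∤n₁ N≡ = trans (cong₂ (λ x y → (+ (3 ℕ.^ suc β) * x + 1ℤ) * y) (jacobi-3 (suc k) n₁-odd) (divisorSum-D₁₂ k n₁-odd))
  (trans (cong (λ x → (+ (3 ℕ.^ suc β) * χ₁₂ (+ suc k) + x) * D₁₂ (suc k)) (cong -_ (sym (trans (cong (λ t → χ₄ (+ t)) (sym N≡)) (χ₄-level n)))))
  (trans (sym (proj₂ (divisor-formula β (suc k) n₁-odd (d₃-coprime (suc k) 3∤n₁))))
  (trans (cong (λ t → + 2 * (+ 4 * S₁ t + s₁ t)) (sym N≡))
  (final (S₁ N) (s₁ N) (+ length (fib OddQuad (8 ℕ.* N))) ((θ 32 ⊛ J 24) (8 ℕ.* N)) (repSum (4 ℕ.* N))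
    (trans (cong (λ x → + 2 * x + + 3 * (θ 32 ⊛ J 24) (8 ℕ.* N)) (sym (theta-count (8 ℕ.* N)))) (trans (weighted-count n) (cong₂ (λ x y → + 2 * x + + 8 * y) (D-scale N) (X₄D-scale N))))
    (two-repSum n)))))
  where
  N = 8 ℕ.* n ℕ.+ 15
  n₁-odd : od (+ suc k) ≡ 1ℤ
  n₁-odd = od-factor (+ suc k) (+ (3 ℕ.^ β)) (trans (cong od (trans (ℤₚ.*-comm (+ suc k) (+ (3 ℕ.^ β))) (sym (ℤₚ.pos-* (3 ℕ.^ β) (suc k))))) (trans (cong (λ t → od (+ t)) (sym N≡)) (od-level n)))
  final : ∀ S s t j r → + 2 * t + + 3 * j ≡ + 2 * s + + 8 * S → + 2 * r ≡ - j → + 2 * (+ 4 * S + s) ≡ + 2 * (t - + 3 * r)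
  final S s t j r q h = trans (l₁ S s) (trans (sym q) (trans (l₂ t j) (trans (cong (λ x → + 2 * t - + 3 * x) (sym h)) (l₃ t r))))
    where
    l₁ : ∀ S s → + 2 * (+ 4 * S + s) ≡ + 2 * s + + 8 * S
    l₁ = solve-∀
    l₂ : ∀ t j → + 2 * t + + 3 * j ≡ + 2 * t - + 3 * (- j)
    l₂ = solve-∀
    l₃ : ∀ t r → + 2 * t - + 3 * (+ 2 * r) ≡ + 2 * (t - + 3 * r)
    l₃ = solve-∀

theorem4p5 : (n : ℕ) → 1 ℕ.≤ n → (β n₁ : ℕ) → 1 ℕ.≤ n₁ → ¬ (3 ∣ n₁) →
    8 ℕ.* n ℕ.+ 15 ≡ 3 ℕ.^ β ℕ.* n₁ →
    ∃[ k ] (tIs 1 1 1 12 n k ×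
    + k ≡ (((+ (3 ℕ.^ (suc β))) ℤ.* jacobi 3 n₁ ℤ.+ 1ℤ) ℤ.* divisorSum n₁) /ℕ 2
    ℤ.+ + 3 ℤ.* repSum (4 ℕ.* (8 ℕ.* n ℕ.+ 15)))
-- By `twice-count` the dividend is 2(t - 3r), so the integer division by 2 is exact.
theorem4p5 n _ β n₁ 1≤n₁ 3∤n₁ N≡ = t , solutions n , sym (trans (cong (_+ + 3 * r) (trans (cong (_/ℕ 2) (twice-count n β n₁ 1≤n₁ 3∤n₁ N≡)) (halve (+ t - + 3 * r)))) (l (+ t) (+ 3 * r)))
  where
  t = length (fib OddQuad (8 ℕ.* (8 ℕ.* n ℕ.+ 15)))
  r = repSum (4 ℕ.* (8 ℕ.* n ℕ.+ 15))
  l : ∀ t x → t - x + x ≡ t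
  l = solve-∀
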